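{- Let $d\ge 1$ be an integer and let $\Delta=\operatorname{conv}(v_1,\ldots,v_{2d})\subset\mathbb{R}^{2d-1}$ be a $(2d-1)$-dimensional lattice simplex (with respect to $\mathbb{Z}^{2d-1}$) all of whose codimension-$1$ facets are basic lattice simplices. Then the following statements are equivalent: (1) for all $k=1,\ldots,d-1$ there are no lattice points in the interior of $k\Delta$, i.e. $\mathrm{Int}(k\Delta)\cap\mathbb{Z}^{2d-1}=\emptyset$; (2) $\Delta\cong\Delta_1*\cdots*\Delta_d$ for some $1$-dimensional lattice simplices (lattice segments) $\Delta_1,\ldots,\Delta_d\subset\mathbb{R}^d$.
   Context: A $k$-dimensional lattice simplex $\operatorname{conv}(w_1,\ldots,w_{k+1})\subset\mathbb{R}^m$ (vertices in $\mathbb{Z}^m$, affinely independent) is called basic if $w_1-w_{k+1},\ldots,w_k-w_{k+1}$ is part of a lattice basis of $\mathbb{Z}^m$ (equivalently, it is mapped onto $\operatorname{conv}(0,e_1,\ldots,e_k)$ by an affine unimodular isomorphism of $\mathbb{R}^m$). Cayley polytope: for lattice polytopes $\Sigma_1,\ldots,\Sigma_r\subset\mathbb{R}^d$ ($r\le d$), $\Sigma_1*\cdots*\Sigma_r$ is the convex hull of $e_1\times\Sigma_1,\ldots,e_r\times\Sigma_r$ in $\mathbb{R}^{r+d}=\mathbb{R}^r\times\mathbb{R}^d$, where $e_i$ are the standard basis vectors of $\mathbb{R}^r$; it lies in the affine hyperplane $H=\{x\in\mathbb{R}^{r+d}:x_1+\cdots+x_r=1\}$, which carries the affine lattice $H\cap\mathbb{Z}^{r+d}$.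 Here $\Delta\cong P$ for $P\subset H$ (with $r=d$, so $H$ has dimension $2d-1$) means there is an affine isomorphism $\varphi:\mathbb{R}^{2d-1}\to H$ with $\varphi(\mathbb{Z}^{2d-1})=H\cap\mathbb{Z}^{2d}$ and $\varphi(\Delta)=P$. -}

module Defs where

open import Data.Nat using (ℕ; zero; suc; _+_)
open import Data.Fin using (Fin; zero; suc; inject₁; fromℕ; punchIn; _↑ˡ_)
open import Data.Fin.Properties using () renaming (_≟_ to _≟ᶠ_)
open import Data.Integer using (ℤ; +_) renaming (_+_ to _+ℤ_; _*_ to _*ℤ_; _-_ to _-ℤ_)
open import Data.Rational using (ℚ; 0ℚ; 1ℚ; _/_; _≤_; _<_) renaming (_+_ to _+ℚ_; _*_ to _*ℚ_)
open import Data.Vec.Functional using (_++_)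
open import Data.Product using (Σ; _×_; ∃)
open import Data.Bool using (if_then_else_)
open import Relation.Nullary using (¬_; does)
open import Relation.Binary.PropositionalEquality using (_≡_)
open import Function.Definitions using (Injective)

Pt : ℕ → Set
Pt m = Fin m → ℤ

QPt : ℕ → Set
QPt m = Fin m → ℚ

ℤ→ℚ : ℤ → ℚ
ℤ→ℚ z = z / 1

ℕ→ℚ : ℕ → ℚ
ℕ→ℚ k = (+ k) / 1

toQ : ∀ {m} → Pt m → QPt m
toQ x t = ℤ→ℚ (x t)

_≋ℤ_ : ∀ {m} → Pt m → Pt m → Set
x ≋ℤ y = ∀ t → x t ≡ y t

_≋ℚ_ : ∀ {m} → QPt m → QPt m → Set
x ≋ℚ y = ∀ t → x t ≡ y t

sumℤ : ∀ {n} → (Fin n → ℤ) → ℤ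
sumℤ {zero} f = + 0
sumℤ {suc n} f = f zero +ℤ sumℤ (λ i → f (suc i))

sumℚ : ∀ {n} → (Fin n → ℚ) → ℚ
sumℚ {zero} f = 0ℚ
sumℚ {suc n} f = f zero +ℚ sumℚ (λ i → f (suc i))

combℤ : ∀ {n m} → (Fin n → ℤ) → (Fin n → Pt m) → Pt m
combℤ a p t = sumℤ (λ i → a i *ℤ p i t)

combℚ : ∀ {n m} → (Fin n → ℚ) → (Fin n → QPt m) → QPt m
combℚ a p t = sumℚ (λ i → a i *ℚ p i t)

AffIndep : ∀ {n m} → (Fin n → Pt m) → Set
AffIndep {n} {m} p =
  (λs : Fin n → ℚ) → sumℚ λs ≡ 0ℚ → combℚ λs (λ i → toQ (p i)) ≋ℚ (λ _ → 0ℚ) →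
  ∀ i → λs i ≡ 0ℚ

IsLatticeBasis : ∀ {m} → (Fin m → Pt m) → Set
IsLatticeBasis {m} b =
  ((z : Pt m) → ∃ λ (a : Fin m → ℤ) → combℤ a b ≋ℤ z) ×
  ((a : Fin m → ℤ) → combℤ a b ≋ℤ (λ _ → + 0) → ∀ i → a i ≡ + 0)

PartOfLatticeBasis : ∀ {k m} → (Fin k → Pt m) → Set
PartOfLatticeBasis {k} {m} u =
  Σ (Fin m → Pt m) λ b → Σ (Fin k → Fin m) λ ι →
    Injective _≡_ _≡_ ι × IsLatticeBasis b × (∀ i → b (ι i) ≡ u i)

IsBasic : ∀ {k m} → (Fin (suc k) → Pt m) → Set
IsBasic {k} {m} w =
  AffIndep w ×
  PartOfLatticeBasis (λ (i : Fin k) → λ t → w (inject₁ i) t -ℤ w (fromℕ k) t)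

InConv : ∀ {N m} → (Fin N → QPt m) → QPt m → Set
InConv {N} {m} p x =
  Σ (Fin N → ℚ) λ λs → (∀ i → 0ℚ ≤ λs i) × sumℚ λs ≡ 1ℚ × combℚ λs p ≋ℚ x

-- x ∈ Int(k Δ) for the full-dimensional simplex Δ = conv(v_1,…,v_{m+1}) ⊂ ℝ^m:
-- x = k·y with y in the interior of Δ, i.e. with all barycentric coordinates > 0.
InIntMultiple : ∀ {m} → ℕ → (Fin (suc m) → Pt m) → Pt m → Set
InIntMultiple {m} k v x =
  Σ (Fin (suc m) → ℚ) λ λs → (∀ i → 0ℚ < λs i) × sumℚ λs ≡ 1ℚ ×
    ((λ t → ℕ→ℚ k *ℚ combℚ λs (λ i → toQ (v i)) t) ≋ℚ toQ x)

-- Affine maps ℝ^m → ℝ^M, x ↦ c + A x, with integral c and A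
-- (any affine map sending ℤ^m into ℤ^M has this form).
record AffMap (m M : ℕ) : Set where
  field
    c : Pt M
    A : Fin M → Fin m → ℤ

applyℤ : ∀ {m M} → AffMap m M → Pt m → Pt M
applyℤ φ x t = AffMap.c φ t +ℤ sumℤ (λ j → AffMap.A φ t j *ℤ x j)

applyℚ : ∀ {m M} → AffMap m M → QPt m → QPt M
applyℚ φ x t = ℤ→ℚ (AffMap.c φ t) +ℚ sumℚ (λ j → ℤ→ℚ (AffMap.A φ t j) *ℚ x j)

InH : ∀ r {d} → QPt (r + d) → Set
InH r {d} y = sumℚ (λ (i : Fin r) → y (i ↑ˡ d)) ≡ 1ℚ

IsLatticeIsoOntoH : ∀ m r d → AffMap m (r + d) → Set
IsLatticeIsoOntoH m r d φ =
  -- φ maps ℝ^m into H (checked on ℚ^m; affine, so equivalent)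
  ((x : QPt m) → InH r (applyℚ φ x)) ×
  -- φ is injective (hence, dim H = m being assumed, a bijection ℝ^m → H)
  ((x y : QPt m) → applyℚ φ x ≋ℚ applyℚ φ y → x ≋ℚ y) ×
  ((y : Pt (r + d)) → InH r (toQ y) → ∃ λ (x : Pt m) → applyℤ φ x ≋ℤ y)

unitVec : ∀ {r} → Fin r → Pt r
unitVec i t = if does (i ≟ᶠ t) then + 1 else + 0

-- vertex family of the Cayley polytope Δ_1 * ⋯ * Δ_r of segments
-- Δ_i = conv(a_i, b_i) ⊂ ℝ^d : points e_i × a_i and e_i × b_i in ℝ^{r+d}
cayleyVerts : ∀ {r d} → (Fin r → Pt d) → (Fin r → Pt d) → Fin (r + r) → Pt (r + d)
cayleyVerts a b = (λ i → unitVec i ++ a i) ++ (λ i → unitVec i ++ b i)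

seg : ∀ {d} → Pt d → Pt d → Fin 2 → Pt d
seg p q zero = p
seg p q (suc _) = q

MapsOnto : ∀ {m M N K} → AffMap m M → (Fin N → Pt m) → (Fin K → Pt M) → Set
MapsOnto {m} {M} φ v w =
  (y : QPt M) →
    (InConv (λ j → toQ (w j)) y → ∃ λ (x : QPt m) → InConv (λ i → toQ (v i)) x × applyℚ φ x ≋ℚ y) ×
    ((x : QPt m) → InConv (λ i → toQ (v i)) x → applyℚ φ x ≋ℚ y → InConv (λ j → toQ (w j)) y)

-- Statement (1): no lattice points in Int(kΔ) for k = 1, …, d-1  (here d = suc e)
NoInteriorPoints : ∀ e {m} → (Fin (suc m) → Pt m) → Set
NoInteriorPoints e {m} v =
  (k : ℕ) → 1 Data.Nat.≤ k → k Data.Nat.≤ e → (x : Pt m) → ¬ InIntMultiple k v x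

IsCayleyOfSegments : ∀ d {m} → (Fin (suc m) → Pt m) → Set
IsCayleyOfSegments d {m} v =
  Σ (Fin d → Pt d) λ a → Σ (Fin d → Pt d) λ b →
    (∀ i → AffIndep (seg (a i) (b i))) ×
    Σ (AffMap m (d + d)) λ φ →
      IsLatticeIsoOntoH m d d φ × MapsOnto φ v (cayleyVerts a b)

{-# OPTIONS --safe #-}
-- Since the facets are basic, ℤ^(2d-1) modulo the lattice of the vertices v₀, …, v₂ₑ₊₁ (e = d - 1) is cyclic of some
-- order n, generated by a vector Γ with nΓ = Σ aᵢ vᵢ, Σ aᵢ = 0 and all aᵢ units mod n.  For r ≢ 0 the numbers r aᵢ mod n
-- are the barycentric coordinates, scaled by n, of a lattice point in Int(kΔ), where kn is their sum; so (1), for r and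
-- for -r, says that Σ (r aᵢ mod n) = dn for every r ≢ 0.
--
-- The arithmetic heart is that such aᵢ fall into d pairs with aᵢ + aⱼ ≡ 0 (mod n); given the pairs, the sums of the
-- barycentric coordinates over the pairs are the first d coordinates of the isomorphism in (2).  For the pairing one
-- must show that the odd function h(m) = #{i : aᵢ m ≡ 1} - #{i : aᵢ m ≡ -1} vanishes; this is equivalent to L(1, χ) ≠ 0
-- for all odd characters χ.  The sums being constant, the finite Fourier transform (sawtooth to cotangent) gives
-- Σ_{m ≤ x} h(km)/m = O(1/x) for every k, i.e. the series Σ h(km)/m vanish.  Let χ₀ be the indicator of the units mod n
-- and E(N) = Σ h(km) h(km′) χ₀(a) χ₀(b), over all k mod n and all mam′b = N.  By Ingham's identity E(N) is a sum of
-- squares of divisor sums when N is prime to n, and E(D²) ≥ Σ h(k)²; hence the average of E grows unless h = 0, whereas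
-- the bounds above keep it small.
--
-- All analysis is done over ℚ: cos and sin are replaced by the real and imaginary parts of (1 + √-y)ᵐ, and the value
-- y = tan²(π/M) at which the imaginary part of the M-th power vanishes by a sequence of rational approximations.
--
-- For (2) ⇒ (1), the first d coordinates of the isomorphism are integral and positive on Int(kΔ) and add up to k.
module Submission where

open import Data.Empty using (⊥-elim)
open import Data.Nat.Base as ℕ using (ℕ; zero; suc; s≤s; z≤n; _∸_; _%_)
import Data.Nat.Properties as ℕ
import Data.Nat.Tactic.RingSolver as ℕ-Solver
open import Data.Product using (∃; ∃₂; _×_; _,_; proj₁; proj₂)
open import Data.Sum using (_⊎_; inj₁; inj₂; [_,_]′)
open import Function.Base using (_∘_)
open import Level using (0ℓ)
open import Relation.Binary.PropositionalEquality
  using (_≡_; _≢_; refl; sym; trans; cong; cong₂; subst; subst₂; module ≡-Reasoning)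
open import Relation.Nullary using (Dec; yes; no; ¬_)

module RangeSums where

  open import Algebra.Bundles using (CommutativeSemiring)
  open import Data.Fin.Base using (Fin; toℕ; fromℕ<)
  open import Data.Fin.Properties using (toℕ-fromℕ<; toℕ-injective; toℕ<n)
  open import Data.Fin.Permutation using (Permutation; permutation)

  module RangeSum {c ℓ} (R : CommutativeSemiring c ℓ) where
    open CommutativeSemiring R hiding (zero) renaming (refl to ≈-refl; sym to ≈-sym; trans to ≈-trans)
    open import Algebra.Properties.CommutativeMonoid.Sum +-commutativeMonoid using (sum; sum-permute; sum-cong-≋)
    open import Algebra.Properties.CommutativeSemigroup +-commutativeSemigroup using (interchange)
    open import Relation.Binary.Reasoning.Setoid setoid

    ∑ : ℕ → (ℕ → Carrier) → Carrier
    ∑ zero    f = 0#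
    ∑ (suc N) f = f zero + ∑ N (f ∘ suc)

    ∑≡sum : ∀ N f → ∑ N f ≡ sum {N} (f ∘ toℕ)
    ∑≡sum zero    f = refl
    ∑≡sum (suc N) f = cong (f zero +_) (∑≡sum N (f ∘ suc))

    ∑-cong : ∀ N {f g} → (∀ i → i ℕ.< N → f i ≈ g i) → ∑ N f ≈ ∑ N g
    ∑-cong zero    f≈g = ≈-refl
    ∑-cong (suc N) f≈g = +-cong (f≈g zero (s≤s z≤n)) (∑-cong N λ i i<N → f≈g (suc i) (s≤s i<N))

    ∑-cong′ : ∀ N {f g} → (∀ i → f i ≈ g i) → ∑ N f ≈ ∑ N g
    ∑-cong′ N f≈g = ∑-cong N λ i _ → f≈g i

    ∑-zero : ∀ N {f} → (∀ i → i ℕ.< N → f i ≈ 0#) → ∑ N f ≈ 0#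
    ∑-zero zero    f≈0 = ≈-refl
    ∑-zero (suc N) f≈0 =
      ≈-trans (+-cong (f≈0 zero (s≤s z≤n)) (∑-zero N λ i i<N → f≈0 (suc i) (s≤s i<N))) (+-identityˡ 0#)

    ∑-+ : ∀ N f g → ∑ N (λ i → f i + g i) ≈ ∑ N f + ∑ N g
    ∑-+ zero    f g = ≈-sym (+-identityˡ 0#)
    ∑-+ (suc N) f g = ≈-trans (+-congˡ (∑-+ N _ _)) (interchange _ _ _ _)

    ∑-swap : ∀ M N (f : ℕ → ℕ → Carrier) → ∑ M (λ i → ∑ N (f i)) ≈ ∑ N (λ j → ∑ M (λ i → f i j))
    ∑-swap zero    N f = ≈-sym (∑-zero N λ _ _ → ≈-refl)
    ∑-swap (suc M) N f = ≈-trans (+-congˡ (∑-swap M N (f ∘ suc))) (≈-sym (∑-+ N _ _))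

    ∑-*ˡ : ∀ N x f → x * ∑ N f ≈ ∑ N (λ i → x * f i)
    ∑-*ˡ zero    x f = zeroʳ x
    ∑-*ˡ (suc N) x f = ≈-trans (distribˡ x _ _) (+-congˡ (∑-*ˡ N x _))

    ∑-*ʳ : ∀ N x f → ∑ N f * x ≈ ∑ N (λ i → f i * x)
    ∑-*ʳ zero    x f = zeroˡ x
    ∑-*ʳ (suc N) x f = ≈-trans (distribʳ x _ _) (+-congˡ (∑-*ʳ N x _))

    ∑₂ : ℕ → (ℕ → ℕ → Carrier) → Carrier
    ∑₂ N f = ∑ N (λ i → ∑ N (f i))

    ∑₂-cong : ∀ N {f g : ℕ → ℕ → Carrier} → (∀ i j → i ℕ.< N → j ℕ.< N → f i j ≈ g i j) → ∑₂ N f ≈ ∑₂ N g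
    ∑₂-cong N f≈g = ∑-cong N λ i i<N → ∑-cong N λ j j<N → f≈g i j i<N j<N

    ∑₂-cong′ : ∀ N {f g : ℕ → ℕ → Carrier} → (∀ i j → f i j ≈ g i j) → ∑₂ N f ≈ ∑₂ N g
    ∑₂-cong′ N f≈g = ∑₂-cong N λ i j _ _ → f≈g i j

    ∑₂-zero : ∀ N {f : ℕ → ℕ → Carrier} → (∀ i j → f i j ≈ 0#) → ∑₂ N f ≈ 0#
    ∑₂-zero N f≈0 = ∑-zero N λ i _ → ∑-zero N λ j _ → f≈0 i j

    ∑₂-*ˡ : ∀ N x f → x * ∑₂ N f ≈ ∑₂ N (λ i j → x * f i j)
    ∑₂-*ˡ N x f = ≈-trans (∑-*ˡ N x _) (∑-cong′ N λ i → ∑-*ˡ N x (f i))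

    ∑₂-*ʳ : ∀ N x f → ∑₂ N f * x ≈ ∑₂ N (λ i j → f i j * x)
    ∑₂-*ʳ N x f = ≈-trans (∑-*ʳ N x _) (∑-cong′ N λ i → ∑-*ʳ N x (f i))

    ∑-*-∑ : ∀ N f g → ∑ N f * ∑ N g ≈ ∑₂ N (λ i j → f i * g j)
    ∑-*-∑ N f g = ≈-trans (∑-*ʳ N (∑ N g) f) (∑-cong′ N λ i → ∑-*ˡ N (f i) g)

    ∑-∑₂-swap : ∀ M N (f : ℕ → ℕ → ℕ → Carrier) → ∑ M (λ k → ∑₂ N (f k)) ≈ ∑₂ N (λ i j → ∑ M (λ k → f k i j))
    ∑-∑₂-swap M N f = ≈-trans (∑-swap M N _) (∑-cong′ N λ i → ∑-swap M N (λ k → f k i))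

    ∑₂-swap : ∀ M N (f : ℕ → ℕ → ℕ → ℕ → Carrier) →
              ∑₂ M (λ k l → ∑₂ N (f k l)) ≈ ∑₂ N (λ i j → ∑₂ M (λ k l → f k l i j))
    ∑₂-swap M N f = ≈-trans (∑-cong′ M λ k → ∑-∑₂-swap M N (f k)) (∑-∑₂-swap M N _)

    ∑₄ : ℕ → (ℕ → ℕ → ℕ → ℕ → Carrier) → Carrier
    ∑₄ N f = ∑₂ N (λ i j → ∑₂ N (f i j))

    ∑₄-cong′ : ∀ N {f g : ℕ → ℕ → ℕ → ℕ → Carrier} → (∀ i j k l → f i j k l ≈ g i j k l) → ∑₄ N f ≈ ∑₄ N g
    ∑₄-cong′ N f≈g = ∑₂-cong′ N λ i j → ∑₂-cong′ N (f≈g i j)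

    ∑₄-zero : ∀ N {f : ℕ → ℕ → ℕ → ℕ → Carrier} → (∀ i j k l → f i j k l ≈ 0#) → ∑₄ N f ≈ 0#
    ∑₄-zero N f≈0 = ∑₂-zero N λ i j → ∑₂-zero N (f≈0 i j)

    ∑₄-*ˡ : ∀ N x f → x * ∑₄ N f ≈ ∑₄ N (λ i j k l → x * f i j k l)
    ∑₄-*ˡ N x f = ≈-trans (∑₂-*ˡ N x _) (∑₂-cong′ N λ i j → ∑₂-*ˡ N x (f i j))

    ∑₂-*-∑₂ : ∀ N f g → ∑₂ N f * ∑₂ N g ≈ ∑₄ N (λ i j k l → f i j * g k l)
    ∑₂-*-∑₂ N f g = ≈-trans (∑₂-*ʳ N (∑₂ N g) f) (∑₂-cong′ N λ i j → ∑₂-*ˡ N (f i j) g)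

    ∑-∑₄-swap : ∀ M N (f : ℕ → ℕ → ℕ → ℕ → ℕ → Carrier) →
                ∑ M (λ h → ∑₄ N (f h)) ≈ ∑₄ N (λ i j k l → ∑ M (λ h → f h i j k l))
    ∑-∑₄-swap M N f = ≈-trans (∑-∑₂-swap M N _) (∑₂-cong′ N λ i j → ∑-∑₂-swap M N (λ h → f h i j))

    ∑-split : ∀ M N f → ∑ (M ℕ.+ N) f ≈ ∑ M f + ∑ N (λ i → f (M ℕ.+ i))
    ∑-split zero    N f = ≈-sym (+-identityˡ _)
    ∑-split (suc M) N f = ≈-trans (+-congˡ (∑-split M N (f ∘ suc))) (≈-sym (+-assoc _ _ _))

    ∑-last : ∀ N f → ∑ (suc N) f ≈ ∑ N f + f N
    ∑-last zero    f = ≈-trans (+-identityʳ _) (≈-sym (+-identityˡ _))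
    ∑-last (suc N) f = ≈-trans (+-congˡ (∑-last N (f ∘ suc))) (≈-sym (+-assoc _ _ _))

    ∑-reverse : ∀ N f → ∑ N f ≈ ∑ N (λ i → f (N ∸ suc i))
    ∑-reverse zero    f = ≈-refl
    ∑-reverse (suc N) f = ≈-trans (∑-last N f) (≈-trans (+-comm _ _) (+-congˡ (∑-reverse N f)))

    ∑-ends : ∀ M N f → ∑ (suc M ℕ.+ (N ℕ.+ M)) f ≈
             ∑ (suc M) f + (∑ N (λ i → f (suc M ℕ.+ i)) + ∑ M (λ i → f (suc M ℕ.+ (N ℕ.+ M) ∸ suc i)))
    ∑-ends M N f = ≈-trans (∑-split (suc M) (N ℕ.+ M) f) (+-congˡ (≈-trans (∑-split N M _) (+-congˡ
      (≈-trans (∑-reverse M _) (∑-cong M λ i i<M → reflexive (cong f (sym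
        (trans (ℕ.+-∸-assoc (suc M) (ℕ.m≤n⇒m≤o+n N i<M)) (cong (suc M ℕ.+_) (ℕ.+-∸-assoc N i<M))))))))))

    ∑-blocks : ∀ L n f → ∑ (L ℕ.* n) f ≈ ∑ L (λ l → ∑ n (λ r → f (l ℕ.* n ℕ.+ r)))
    ∑-blocks zero    n f = ≈-refl
    ∑-blocks (suc L) n f = begin
      ∑ (n ℕ.+ L ℕ.* n) f
        ≈⟨ ∑-split n (L ℕ.* n) f ⟩
      ∑ n f + ∑ (L ℕ.* n) (λ i → f (n ℕ.+ i))
        ≈⟨ +-congˡ (∑-blocks L n _) ⟩
      ∑ n f + ∑ L (λ l → ∑ n (λ r → f (n ℕ.+ (l ℕ.* n ℕ.+ r))))
        ≈⟨ +-congˡ (∑-cong′ L λ l → ∑-cong′ n λ r → reflexive (cong f (ℕ.+-assoc n (l ℕ.* n) r))) ⟨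
      ∑ n f + ∑ L (λ l → ∑ n (λ r → f (suc l ℕ.* n ℕ.+ r))) ∎

    ∑-single : ∀ N {f} i₀ → i₀ ℕ.< N → (∀ i → i ℕ.< N → i ≢ i₀ → f i ≈ 0#) → ∑ N f ≈ f i₀
    ∑-single (suc N) zero     _          f≈0 =
      ≈-trans (+-congˡ (∑-zero N λ i i<N → f≈0 (suc i) (s≤s i<N) λ ())) (+-identityʳ _)
    ∑-single (suc N) (suc i₀) (s≤s i₀<N) f≈0 =
      ≈-trans (+-cong (f≈0 zero (s≤s z≤n) λ ())
                      (∑-single N i₀ i₀<N λ i i<N i≢i₀ → f≈0 (suc i) (s≤s i<N) (i≢i₀ ∘ ℕ.suc-injective)))
              (+-identityˡ _)

    ∑-extend : ∀ {M N} f → M ℕ.≤ N → (∀ i → M ℕ.≤ i → f i ≈ 0#) → ∑ N f ≈ ∑ M f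
    ∑-extend {M} {N} f M≤N f≈0 = begin
      ∑ N f                                  ≡⟨ cong (λ k → ∑ k f) (ℕ.m+[n∸m]≡n M≤N) ⟨
      ∑ (M ℕ.+ (N ∸ M)) f                    ≈⟨ ∑-split M (N ∸ M) f ⟩
      ∑ M f + ∑ (N ∸ M) (λ i → f (M ℕ.+ i))  ≈⟨ +-congˡ (∑-zero (N ∸ M) λ i _ → f≈0 _ (ℕ.m≤m+n M i)) ⟩
      ∑ M f + 0#                             ≈⟨ +-identityʳ _ ⟩
      ∑ M f                                  ∎

    ∑-permute : ∀ N f (π π⁻¹ : ℕ → ℕ) →
                (∀ i → i ℕ.< N → π i ℕ.< N) → (∀ i → i ℕ.< N → π⁻¹ i ℕ.< N) →
                (∀ i → i ℕ.< N → π (π⁻¹ i) ≡ i) → (∀ i → i ℕ.< N → π⁻¹ (π i) ≡ i) →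
                ∑ N f ≈ ∑ N (f ∘ π)
    ∑-permute N f π π⁻¹ π< π⁻¹< ππ⁻¹ π⁻¹π = begin
      ∑ N f                   ≡⟨ ∑≡sum N f ⟩
      sum {N} (f ∘ toℕ)       ≈⟨ sum-permute (f ∘ toℕ) perm ⟩
      sum {N} (f ∘ toℕ ∘ to)  ≈⟨ sum-cong-≋ {N} (λ i → reflexive (cong f (toℕ-fromℕ< _))) ⟩
      sum {N} (f ∘ π ∘ toℕ)   ≡⟨ ∑≡sum N (f ∘ π) ⟨
      ∑ N (f ∘ π)             ∎
      where
      to from : Fin N → Fin N
      to   i = fromℕ< (π< (toℕ i) (toℕ<n i))
      from i = fromℕ< (π⁻¹< (toℕ i) (toℕ<n i))

      to-from : ∀ i → to (from i) ≡ i
      to-from i = toℕ-injective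
        (trans (toℕ-fromℕ< _) (trans (cong π (toℕ-fromℕ< _)) (ππ⁻¹ _ (toℕ<n i))))

      from-to : ∀ i → from (to i) ≡ i
      from-to i = toℕ-injective
        (trans (toℕ-fromℕ< _) (trans (cong π⁻¹ (toℕ-fromℕ< _)) (π⁻¹π _ (toℕ<n i))))

      perm : Permutation N N
      perm = permutation to from to-from from-to

  open RangeSum ℕ.+-*-commutativeSemiring public using () renaming (∑ to ∑ℕ; ∑-cong′ to ∑ℕ-cong)

module IntegersInRationals where

  open import Data.Integer.Base as ℤ using (ℤ; +_; -[1+_])
  import Data.Integer.Properties as ℤ
  open import Data.Rational
  open import Data.Rational.Properties
  open import Data.Rational.Unnormalised.Base as ℚᵘ using (mkℚᵘ; *≡*; *≤*)
  import Data.Rational.Unnormalised.Properties as ℚᵘ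
  open import Defs using (ℤ→ℚ; ℕ→ℚ)

  private
    toℚᵘ-ℤ→ℚ : ∀ i → toℚᵘ (ℤ→ℚ i) ℚᵘ.≃ mkℚᵘ i 0
    toℚᵘ-ℤ→ℚ i = toℚᵘ-fromℚᵘ (mkℚᵘ i 0)

  ℤ→ℚ-+ : ∀ i j → ℤ→ℚ (i ℤ.+ j) ≡ ℤ→ℚ i + ℤ→ℚ j
  ℤ→ℚ-+ i j = toℚᵘ-injective (begin-equality
    toℚᵘ (ℤ→ℚ (i ℤ.+ j))            ≃⟨ toℚᵘ-ℤ→ℚ (i ℤ.+ j) ⟩
    mkℚᵘ (i ℤ.+ j) 0                ≃⟨ *≡* (cong (ℤ._* + 1) (cong₂ ℤ._+_ (ℤ.*-identityʳ i) (ℤ.*-identityʳ j))) ⟨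
    mkℚᵘ i 0 ℚᵘ.+ mkℚᵘ j 0          ≃⟨ ℚᵘ.+-cong (toℚᵘ-ℤ→ℚ i) (toℚᵘ-ℤ→ℚ j) ⟨
    toℚᵘ (ℤ→ℚ i) ℚᵘ.+ toℚᵘ (ℤ→ℚ j)  ≃⟨ toℚᵘ-homo-+ (ℤ→ℚ i) (ℤ→ℚ j) ⟨
    toℚᵘ (ℤ→ℚ i + ℤ→ℚ j)            ∎)
    where open ℚᵘ.≤-Reasoning

  ℤ→ℚ-* : ∀ i j → ℤ→ℚ (i ℤ.* j) ≡ ℤ→ℚ i * ℤ→ℚ j
  ℤ→ℚ-* i j = toℚᵘ-injective (begin-equality
    toℚᵘ (ℤ→ℚ (i ℤ.* j))            ≃⟨ toℚᵘ-ℤ→ℚ (i ℤ.* j) ⟩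
    mkℚᵘ i 0 ℚᵘ.* mkℚᵘ j 0          ≃⟨ ℚᵘ.*-cong (toℚᵘ-ℤ→ℚ i) (toℚᵘ-ℤ→ℚ j) ⟨
    toℚᵘ (ℤ→ℚ i) ℚᵘ.* toℚᵘ (ℤ→ℚ j)  ≃⟨ toℚᵘ-homo-* (ℤ→ℚ i) (ℤ→ℚ j) ⟨
    toℚᵘ (ℤ→ℚ i * ℤ→ℚ j)            ∎)
    where open ℚᵘ.≤-Reasoning

  ℤ→ℚ-mono : ∀ {i j} → i ℤ.≤ j → ℤ→ℚ i ≤ ℤ→ℚ j
  ℤ→ℚ-mono {i} {j} i≤j = toℚᵘ-cancel-≤ (begin
    toℚᵘ (ℤ→ℚ i)  ≃⟨ toℚᵘ-ℤ→ℚ i ⟩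
    mkℚᵘ i 0      ≤⟨ *≤* (subst₂ ℤ._≤_ (sym (ℤ.*-identityʳ i)) (sym (ℤ.*-identityʳ j)) i≤j) ⟩
    mkℚᵘ j 0      ≃⟨ toℚᵘ-ℤ→ℚ j ⟨
    toℚᵘ (ℤ→ℚ j)  ∎)
    where open ℚᵘ.≤-Reasoning

  ℤ→ℚ-injective : ∀ {i j} → ℤ→ℚ i ≡ ℤ→ℚ j → i ≡ j
  ℤ→ℚ-injective {i} {j} eq
    with ℚᵘ.≃-trans (ℚᵘ.≃-sym (toℚᵘ-ℤ→ℚ i)) (ℚᵘ.≃-trans (toℚᵘ-cong eq) (toℚᵘ-ℤ→ℚ j))
  ... | *≡* i*1≡j*1 = trans (sym (ℤ.*-identityʳ i)) (trans i*1≡j*1 (ℤ.*-identityʳ j))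

  ℤ→ℚ>0 : ∀ n → 0ℚ < ℤ→ℚ (+ suc n)
  ℤ→ℚ>0 n = <-≤-trans (positive⁻¹ 1ℚ) (ℤ→ℚ-mono {+ 1} {+ suc n} (ℤ.+≤+ (s≤s z≤n)))

  ℤ→ℚ>0⇒≥1 : ∀ {i} → 0ℚ < ℤ→ℚ i → + 1 ℤ.≤ i
  ℤ→ℚ>0⇒≥1 {+ zero}    0<0 = ⊥-elim (<-irrefl refl 0<0)
  ℤ→ℚ>0⇒≥1 {+ suc i}   _   = ℤ.+≤+ (s≤s z≤n)
  ℤ→ℚ>0⇒≥1 { -[1+ i ]} 0<x = ⊥-elim (<-irrefl refl (<-≤-trans 0<x (ℤ→ℚ-mono { -[1+ i ]} {+ 0} ℤ.-≤+)))

  ↧p*p≡↥p : ∀ p → ℤ→ℚ (↧ p) * p ≡ ℤ→ℚ (↥ p)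
  ↧p*p≡↥p p@(mkℚ i d _) = toℚᵘ-injective (begin-equality
    toℚᵘ (ℤ→ℚ (+ suc d) * p)            ≃⟨ toℚᵘ-homo-* (ℤ→ℚ (+ suc d)) p ⟩
    toℚᵘ (ℤ→ℚ (+ suc d)) ℚᵘ.* mkℚᵘ i d  ≃⟨ ℚᵘ.*-congʳ (toℚᵘ-ℤ→ℚ (+ suc d)) ⟩
    mkℚᵘ (+ suc d) 0 ℚᵘ.* mkℚᵘ i d      ≃⟨ *≡* cross ⟩
    mkℚᵘ i 0                            ≃⟨ toℚᵘ-ℤ→ℚ i ⟨
    toℚᵘ (ℤ→ℚ i)                        ∎)
    where
    open ℚᵘ.≤-Reasoning
    cross : + suc d ℤ.* i ℤ.* + 1 ≡ i ℤ.* + (1 ℕ.* suc d)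
    cross = trans (ℤ.*-identityʳ _) (trans (ℤ.*-comm (+ suc d) i)
      (cong (λ k → i ℤ.* + k) (sym (ℕ.*-identityˡ (suc d)))))

  p≤∣↥p∣ : ∀ p → p ≤ ℕ→ℚ ℤ.∣ ↥ p ∣
  p≤∣↥p∣ p = toℚᵘ-cancel-≤ (ℚᵘ.≤-respʳ-≃ (ℚᵘ.≃-sym (toℚᵘ-ℤ→ℚ (+ ℤ.∣ ↥ p ∣))) (numerator-bound p))
    where
    i≤∣i∣ : ∀ i → i ℤ.≤ + ℤ.∣ i ∣
    i≤∣i∣ (+ n)    = ℤ.≤-refl
    i≤∣i∣ -[1+ n ] = ℤ.-≤+

    numerator-bound : ∀ p → toℚᵘ p ℚᵘ.≤ mkℚᵘ (+ ℤ.∣ ↥ p ∣) 0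
    numerator-bound (mkℚ i d _) = *≤* (begin
      i ℤ.* + 1              ≡⟨ ℤ.*-identityʳ i ⟩
      i                      ≤⟨ i≤∣i∣ i ⟩
      + ℤ.∣ i ∣              ≤⟨ ℤ.+≤+ (ℕ.m≤m*n ℤ.∣ i ∣ (suc d)) ⟩
      + (ℤ.∣ i ∣ ℕ.* suc d)  ≡⟨ ℤ.pos-* ℤ.∣ i ∣ (suc d) ⟩
      + ℤ.∣ i ∣ ℤ.* + suc d  ∎)
      where open ℤ.≤-Reasoning

module OrderedRationals where

  open import Algebra.Bundles using (CommutativeRing)
  open import Data.Integer.Base as ℤ using (+_)
  import Data.Integer.Properties as ℤ
  open import Data.Maybe.Base using (Maybe; just; nothing)
  open import Data.Rational public hiding (+-rawMonoid; *-rawMonoid)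
  open import Data.Rational.Properties public
  open import Tactic.RingSolver public using (solve-∀)
  import Tactic.RingSolver.Core.AlmostCommutativeRing as ACR
  open import Defs using (ℤ→ℚ; ℕ→ℚ)
  open IntegersInRationals

  open import Algebra.Properties.CommutativeSemiring.Exp
    (CommutativeRing.commutativeSemiring +-*-commutativeRing) public
    using (_^_; ^-homo-*; ^-assocʳ; ^-distrib-*)
  open import Algebra.Properties.CommutativeSemigroup
    (CommutativeRing.*-commutativeSemigroup +-*-commutativeRing) public
    using (interchange; x∙yz≈y∙xz; xy∙z≈y∙xz)

  private
    0≟ : (x : ℚ) → Maybe (0ℚ ≡ x)
    0≟ x with 0ℚ ≟ x
    ... | yes 0≡x = just 0≡x
    ... | no _    = nothing

  ringℚ : ACR.AlmostCommutativeRing 0ℓ 0ℓ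
  ringℚ = ACR.fromCommutativeRing +-*-commutativeRing 0≟

  2ℚ 4ℚ : ℚ
  2ℚ = 1ℚ + 1ℚ
  4ℚ = 2ℚ + 2ℚ

  x≡0⇒xy≡0 : ∀ {x} y → x ≡ 0ℚ → x * y ≡ 0ℚ
  x≡0⇒xy≡0 y refl = *-zeroˡ y

  y≡0⇒xy≡0 : ∀ x {y} → y ≡ 0ℚ → x * y ≡ 0ℚ
  y≡0⇒xy≡0 x refl = *-zeroʳ x

  0<1 : 0ℚ < 1ℚ
  0<1 = positive⁻¹ 1ℚ

  0≤1 : 0ℚ ≤ 1ℚ
  0≤1 = <⇒≤ 0<1

  0<2 : 0ℚ < 2ℚ
  0<2 = positive⁻¹ 2ℚ

  0≤2 : 0ℚ ≤ 2ℚ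
  0≤2 = <⇒≤ 0<2

  1≤2 : 1ℚ ≤ 2ℚ
  1≤2 = +-monoʳ-≤ 1ℚ 0≤1

  0<½ : 0ℚ < ½
  0<½ = positive⁻¹ ½

  0≤½ : 0ℚ ≤ ½
  0≤½ = <⇒≤ 0<½

  x≤y⇒0≤y-x : ∀ {x y} → x ≤ y → 0ℚ ≤ y - x
  x≤y⇒0≤y-x {x} {y} x≤y = subst (_≤ y - x) (+-inverseʳ x) (+-monoˡ-≤ (- x) x≤y)

  ≤-slack : ∀ {x y} e → 0ℚ ≤ e → x + e ≡ y → x ≤ y
  ≤-slack {x} e 0≤e refl = subst (_≤ x + e) (+-identityʳ x) (+-monoʳ-≤ x 0≤e)

  <-slack : ∀ {x y} e → 0ℚ < e → x + e ≡ y → x < y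
  <-slack {x} e 0<e refl = subst (_< x + e) (+-identityʳ x) (+-monoʳ-< x 0<e)

  <⇒≱ : ∀ {x y} → x < y → ¬ y ≤ x
  <⇒≱ x<y y≤x = <-irrefl refl (<-≤-trans x<y y≤x)

  0<⇒≢0 : ∀ {x} → 0ℚ < x → x ≢ 0ℚ
  0<⇒≢0 0<x refl = <-irrefl refl 0<x

  +≥0 : ∀ {x y} → 0ℚ ≤ x → 0ℚ ≤ y → 0ℚ ≤ x + y
  +≥0 = +-mono-≤

  *≥0 : ∀ {x y} → 0ℚ ≤ x → 0ℚ ≤ y → 0ℚ ≤ x * y
  *≥0 {x} {y} 0≤x 0≤y =
    nonNegative⁻¹ _ {{nonNeg*nonNeg⇒nonNeg x {{nonNegative 0≤x}} y {{nonNegative 0≤y}}}}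

  *>0 : ∀ {x y} → 0ℚ < x → 0ℚ < y → 0ℚ < x * y
  *>0 {x} {y} 0<x 0<y = positive⁻¹ _ {{pos*pos⇒pos x {{positive 0<x}} y {{positive 0<y}}}}

  *-monoˡ : ∀ {z x y} → 0ℚ ≤ z → x ≤ y → z * x ≤ z * y
  *-monoˡ {z} 0≤z = *-monoˡ-≤-nonNeg z {{nonNegative 0≤z}}

  *-monoʳ : ∀ {z x y} → 0ℚ ≤ z → x ≤ y → x * z ≤ y * z
  *-monoʳ {z} 0≤z = *-monoʳ-≤-nonNeg z {{nonNegative 0≤z}}

  *-mono : ∀ {x y x′ y′} → 0ℚ ≤ x → x ≤ x′ → 0ℚ ≤ y → y ≤ y′ → x * y ≤ x′ * y′
  *-mono 0≤x x≤x′ 0≤y y≤y′ = ≤-trans (*-monoʳ 0≤y x≤x′) (*-monoˡ (≤-trans 0≤x x≤x′) y≤y′)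

  1≤x⇒y≤x*y : ∀ {x y} → 1ℚ ≤ x → 0ℚ ≤ y → y ≤ x * y
  1≤x⇒y≤x*y {x} {y} 1≤x 0≤y = subst (_≤ x * y) (*-identityˡ y) (*-monoʳ 0≤y 1≤x)

  x≤1⇒x*y≤y : ∀ {x y} → x ≤ 1ℚ → 0ℚ ≤ y → x * y ≤ y
  x≤1⇒x*y≤y {x} {y} x≤1 0≤y = subst (x * y ≤_) (*-identityˡ y) (*-monoʳ 0≤y x≤1)

  *-cancelˡ-≤ : ∀ {z x y} → 0ℚ < z → z * x ≤ z * y → x ≤ y
  *-cancelˡ-≤ {z} 0<z = *-cancelˡ-≤-pos z {{positive 0<z}}

  *-cancelˡ-≡ : ∀ {z x y} → 0ℚ < z → z * x ≡ z * y → x ≡ y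
  *-cancelˡ-≡ 0<z eq =
    ≤-antisym (*-cancelˡ-≤ 0<z (≤-reflexive eq)) (*-cancelˡ-≤ 0<z (≤-reflexive (sym eq)))

  sq≥0 : ∀ x → 0ℚ ≤ x * x
  sq≥0 x with ≤-total 0ℚ x
  ... | inj₁ 0≤x = *≥0 0≤x 0≤x
  ... | inj₂ x≤0 = subst (0ℚ ≤_) (neg-sq x) (*≥0 (neg-antimono-≤ x≤0) (neg-antimono-≤ x≤0))
    where
    neg-sq : ∀ x → (- x) * (- x) ≡ x * x
    neg-sq = solve-∀ ringℚ

  ^>0 : ∀ {x} → 0ℚ < x → ∀ i → 0ℚ < x ^ i
  ^>0 0<x zero    = 0<1
  ^>0 0<x (suc i) = *>0 0<x (^>0 0<x i)

  ^≥0 : ∀ {x} → 0ℚ < x → ∀ i → 0ℚ ≤ x ^ i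
  ^≥0 0<x i = <⇒≤ (^>0 0<x i)

  ^≤1 : ∀ {x} → 0ℚ < x → x ≤ 1ℚ → ∀ i → x ^ i ≤ 1ℚ
  ^≤1 0<x x≤1 zero    = ≤-refl
  ^≤1 0<x x≤1 (suc i) = *-mono (<⇒≤ 0<x) x≤1 (^≥0 0<x i) (^≤1 0<x x≤1 i)

  ^≥1 : ∀ {x} → 1ℚ ≤ x → ∀ i → 1ℚ ≤ x ^ i
  ^≥1 1≤x zero    = ≤-refl
  ^≥1 1≤x (suc i) = *-mono 0≤1 1≤x 0≤1 (^≥1 1≤x i)

  1^ : ∀ i → 1ℚ ^ i ≡ 1ℚ
  1^ zero    = refl
  1^ (suc i) = trans (*-identityˡ (1ℚ ^ i)) (1^ i)

  ^-split : ∀ x {i j} → i ℕ.≤ j → x ^ i * x ^ (j ∸ i) ≡ x ^ j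
  ^-split x {i} {j} i≤j = trans (sym (^-homo-* x i (j ∸ i))) (cong (x ^_) (ℕ.m+[n∸m]≡n i≤j))

  ^-antimono : ∀ {x} → 0ℚ < x → x ≤ 1ℚ → ∀ {i j} → i ℕ.≤ j → x ^ j ≤ x ^ i
  ^-antimono {x} 0<x x≤1 {i} {j} i≤j = subst₂ _≤_ (^-split x i≤j) (*-identityʳ (x ^ i))
    (*-monoˡ (^≥0 0<x i) (^≤1 0<x x≤1 (j ∸ i)))

  ^-mono : ∀ {x} → 1ℚ ≤ x → ∀ {i j} → i ℕ.≤ j → x ^ i ≤ x ^ j
  ^-mono {x} 1≤x {i} {j} i≤j = subst₂ _≤_ (*-identityʳ (x ^ i)) (^-split x i≤j)
    (*-monoˡ (≤-trans 0≤1 (^≥1 1≤x i)) (^≥1 1≤x (j ∸ i)))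

  -- Sealed: otherwise unification tries to invert the normalisation of fractions.
  abstract
    ι : ℕ → ℚ
    ι = ℕ→ℚ

    ι≡ℕ→ℚ : ∀ n → ι n ≡ ℕ→ℚ n
    ι≡ℕ→ℚ n = refl

    ι-0 : ι 0 ≡ 0ℚ
    ι-0 = refl

    ι-1 : ι 1 ≡ 1ℚ
    ι-1 = refl

    ι-2 : ι 2 ≡ 2ℚ
    ι-2 = refl

    ι-4 : ι 4 ≡ 4ℚ
    ι-4 = refl

    ι-+ : ∀ m n → ι (m ℕ.+ n) ≡ ι m + ι n
    ι-+ m n = ℤ→ℚ-+ (+ m) (+ n)

    ι-* : ∀ m n → ι (m ℕ.* n) ≡ ι m * ι n
    ι-* m n = trans (cong ℤ→ℚ (ℤ.pos-* m n)) (ℤ→ℚ-* (+ m) (+ n))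

    ι-mono : ∀ {m n} → m ℕ.≤ n → ι m ≤ ι n
    ι-mono m≤n = ℤ→ℚ-mono (ℤ.+≤+ m≤n)

    archimedean : ∀ x → ∃ λ N → x ≤ ι N
    archimedean x = ℤ.∣ ↥ x ∣ , p≤∣↥p∣ x

  ι-suc : ∀ n → ι (suc n) ≡ 1ℚ + ι n
  ι-suc n = trans (ι-+ 1 n) (cong (_+ ι n) ι-1)

  ι-suc* : ∀ n x → ι (suc n) * x ≡ ι n * x + x
  ι-suc* n x = trans (cong (_* x) (ι-suc n)) (expand (ι n) x)
    where
    expand : ∀ i x → (1ℚ + i) * x ≡ i * x + x
    expand = solve-∀ ringℚ

  ι-0* : ∀ x → ι 0 * x ≡ 0ℚ
  ι-0* x = x≡0⇒xy≡0 x ι-0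

  ι-1* : ∀ x → ι 1 * x ≡ x
  ι-1* x = trans (cong (_* x) ι-1) (*-identityˡ x)

  ι-^ : ∀ m k → ι (m ℕ.^ k) ≡ ι m ^ k
  ι-^ m zero    = ι-1
  ι-^ m (suc k) = trans (ι-* m (m ℕ.^ k)) (cong (ι m *_) (ι-^ m k))

  ι≥0 : ∀ n → 0ℚ ≤ ι n
  ι≥0 n = subst (_≤ ι n) ι-0 (ι-mono z≤n)

  ι≥1 : ∀ n .{{_ : ℕ.NonZero n}} → 1ℚ ≤ ι n
  ι≥1 n = subst (_≤ ι n) ι-1 (ι-mono (ℕ.>-nonZero⁻¹ n))

  ι>0 : ∀ n .{{_ : ℕ.NonZero n}} → 0ℚ < ι n
  ι>0 n = <-≤-trans 0<1 (ι≥1 n)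

  -- Total, with the junk value inv 0 = 0.
  abstract
    inv : ℚ → ℚ
    inv x with x ≟ 0ℚ
    ... | yes _  = 0ℚ
    ... | no x≢0 = (1/ x) {{≢-nonZero x≢0}}

    *-inv : ∀ {x} → x ≢ 0ℚ → x * inv x ≡ 1ℚ
    *-inv {x} x≢0 with x ≟ 0ℚ
    ... | yes x≡0 = ⊥-elim (x≢0 x≡0)
    ... | no x≢0  = *-inverseʳ x {{≢-nonZero x≢0}}

  *-inv⁺ : ∀ {x} → 0ℚ < x → x * inv x ≡ 1ℚ
  *-inv⁺ 0<x = *-inv (0<⇒≢0 0<x)

  *-inv-cancelʳ : ∀ {x} → 0ℚ < x → ∀ y → y * (x * inv x) ≡ y
  *-inv-cancelʳ 0<x y = trans (cong (y *_) (*-inv⁺ 0<x)) (*-identityʳ y)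

  *-inv-*-cancel : ∀ {x} → 0ℚ < x → ∀ y → y * inv x * x ≡ y
  *-inv-*-cancel {x} 0<x y = trans (regroup y (inv x) x) (*-inv-cancelʳ 0<x y)
    where
    regroup : ∀ y i x → y * i * x ≡ y * (x * i)
    regroup = solve-∀ ringℚ

  inv>0 : ∀ {x} → 0ℚ < x → 0ℚ < inv x
  inv>0 {x} 0<x with 0ℚ <? inv x
  ... | yes 0<x⁻¹ = 0<x⁻¹
  ... | no  0≮x⁻¹ = ⊥-elim (<⇒≱ 0<1 (subst₂ _≤_ (*-inv⁺ 0<x) (*-zeroʳ x) (*-monoˡ (<⇒≤ 0<x) (≮⇒≥ 0≮x⁻¹))))

  inv≥0 : ∀ {x} → 0ℚ < x → 0ℚ ≤ inv x
  inv≥0 0<x = <⇒≤ (inv>0 0<x)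

  inv-unique : ∀ {x y} → 0ℚ < x → x * y ≡ 1ℚ → y ≡ inv x
  inv-unique 0<x xy≡1 = *-cancelˡ-≡ 0<x (trans xy≡1 (sym (*-inv⁺ 0<x)))

  inv-1 : inv 1ℚ ≡ 1ℚ
  inv-1 = sym (inv-unique {1ℚ} {1ℚ} 0<1 refl)

  inv-antimono : ∀ {x y} → 0ℚ < x → x ≤ y → inv y ≤ inv x
  inv-antimono {x} {y} 0<x x≤y = *-cancelˡ-≤ (*>0 0<x 0<y) (begin
    x * y * inv y    ≡⟨ *-assoc x y (inv y) ⟩
    x * (y * inv y)  ≡⟨ *-inv-cancelʳ 0<y x ⟩
    x                ≤⟨ x≤y ⟩
    y                ≡⟨ *-inv-cancelʳ 0<x y ⟨
    y * (x * inv x)  ≡⟨ regroup y x (inv x) ⟩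
    x * y * inv x    ∎)
    where
    open ≤-Reasoning
    0<y : 0ℚ < y
    0<y = <-≤-trans 0<x x≤y
    regroup : ∀ y x i → y * (x * i) ≡ x * y * i
    regroup = solve-∀ ringℚ

  1≤x⇒inv≤1 : ∀ {x} → 1ℚ ≤ x → inv x ≤ 1ℚ
  1≤x⇒inv≤1 {x} 1≤x = subst (inv x ≤_) inv-1 (inv-antimono 0<1 1≤x)

  x≤∣x∣ : ∀ x → x ≤ ∣ x ∣
  x≤∣x∣ x with ≤-total 0ℚ x
  ... | inj₁ 0≤x = ≤-reflexive (sym (0≤p⇒∣p∣≡p 0≤x))
  ... | inj₂ x≤0 = ≤-trans x≤0 (0≤∣p∣ x)

  -x≤∣x∣ : ∀ x → - x ≤ ∣ x ∣
  -x≤∣x∣ x = subst (- x ≤_) (∣-p∣≡∣p∣ x) (x≤∣x∣ (- x))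

  ∣x-y∣≡∣y-x∣ : ∀ x y → ∣ x - y ∣ ≡ ∣ y - x ∣
  ∣x-y∣≡∣y-x∣ x y = trans (sym (∣-p∣≡∣p∣ (x - y))) (cong ∣_∣ (flip x y))
    where
    flip : ∀ x y → - (x - y) ≡ y - x
    flip = solve-∀ ringℚ

  ∣x∣≤ : ∀ {x b} → x ≤ b → - x ≤ b → ∣ x ∣ ≤ b
  ∣x∣≤ {x} x≤b -x≤b with ∣p∣≡p∨∣p∣≡-p x
  ... | inj₁ eq = subst (_≤ _) (sym eq) x≤b
  ... | inj₂ eq = subst (_≤ _) (sym eq) -x≤b

  0≤x⇒∣x∣≤ : ∀ {x b} → 0ℚ ≤ x → x ≤ b → ∣ x ∣ ≤ b
  0≤x⇒∣x∣≤ 0≤x x≤b = subst (_≤ _) (sym (0≤p⇒∣p∣≡p 0≤x)) x≤b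

  ∣x+y∣≤ : ∀ {x y a b} → ∣ x ∣ ≤ a → ∣ y ∣ ≤ b → ∣ x + y ∣ ≤ a + b
  ∣x+y∣≤ {x} {y} ∣x∣≤a ∣y∣≤b = ≤-trans (∣p+q∣≤∣p∣+∣q∣ x y) (+-mono-≤ ∣x∣≤a ∣y∣≤b)

  ∣x-y∣≤ : ∀ {x y a b} → ∣ x ∣ ≤ a → ∣ y ∣ ≤ b → ∣ x - y ∣ ≤ a + b
  ∣x-y∣≤ {x} {y} ∣x∣≤a ∣y∣≤b = ≤-trans (∣p-q∣≤∣p∣+∣q∣ x y) (+-mono-≤ ∣x∣≤a ∣y∣≤b)

  ∣x*y∣≤ : ∀ {x y a b} → ∣ x ∣ ≤ a → ∣ y ∣ ≤ b → ∣ x * y ∣ ≤ a * b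
  ∣x*y∣≤ {x} {y} ∣x∣≤a ∣y∣≤b =
    subst (_≤ _) (sym (∣p*q∣≡∣p∣*∣q∣ x y)) (*-mono (0≤∣p∣ x) ∣x∣≤a (0≤∣p∣ y) ∣y∣≤b)

  ∣x∣≤∣c*x∣ : ∀ {c} x → 1ℚ ≤ c → ∣ x ∣ ≤ ∣ c * x ∣
  ∣x∣≤∣c*x∣ {c} x 1≤c = begin
    ∣ x ∣          ≤⟨ 1≤x⇒y≤x*y (≤-trans 1≤c (x≤∣x∣ c)) (0≤∣p∣ x) ⟩
    ∣ c ∣ * ∣ x ∣  ≡⟨ ∣p*q∣≡∣p∣*∣q∣ c x ⟨
    ∣ c * x ∣      ∎
    where open ≤-Reasoning

  ∣product-difference∣≤ : ∀ {a b c d e} → ∣ a - b ∣ ≤ e → ∣ c - d ∣ ≤ e → ∣ a ∣ ≤ 1ℚ → ∣ d ∣ ≤ 1ℚ →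
                          ∣ a * c - b * d ∣ ≤ e + e
  ∣product-difference∣≤ {a} {b} {c} {d} {e} ∣a-b∣≤e ∣c-d∣≤e ∣a∣≤1 ∣d∣≤1 = begin
    ∣ a * c - b * d ∣              ≡⟨ cong ∣_∣ (telescope a b c d) ⟩
    ∣ a * (c - d) + (a - b) * d ∣  ≤⟨ ∣x+y∣≤ (∣x*y∣≤ ∣a∣≤1 ∣c-d∣≤e) (∣x*y∣≤ ∣a-b∣≤e ∣d∣≤1) ⟩
    1ℚ * e + e * 1ℚ                ≡⟨ cong₂ _+_ (*-identityˡ e) (*-identityʳ e) ⟩
    e + e                          ∎
    where
    open ≤-Reasoning
    telescope : ∀ a b c d → a * c - b * d ≡ a * (c - d) + (a - b) * d
    telescope = solve-∀ ringℚ

  ι*-bounded⇒≤0 : ∀ {x} C → (∀ N → ι N * x ≤ C) → x ≤ 0ℚ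
  ι*-bounded⇒≤0 {x} C bounded with x ≤? 0ℚ
  ... | yes x≤0 = x≤0
  ... | no  x≰0 = ⊥-elim (<⇒≱ C<Nx (bounded (suc N)))
    where
    open ≤-Reasoning
    0<x : 0ℚ < x
    0<x = ≰⇒> x≰0
    N : ℕ
    N = proj₁ (archimedean (C * inv x))
    C<Nx : C < ι (suc N) * x
    C<Nx = begin-strict
      C              ≡⟨ *-inv-*-cancel 0<x C ⟨
      C * inv x * x  ≤⟨ *-monoʳ (<⇒≤ 0<x) (proj₂ (archimedean (C * inv x))) ⟩
      ι N * x        <⟨ <-slack x 0<x (sym (ι-suc* N x)) ⟩
      ι (suc N) * x  ∎

  ℕ-floor : ∀ x → 0ℚ ≤ x → ∃ λ J → ι J ≤ x × x < ι (suc J)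
  ℕ-floor x 0≤x with archimedean (x + 1ℚ)
  ... | N , x+1≤N = search N (<-≤-trans (<-slack 1ℚ 0<1 refl) x+1≤N)
    where
    search : ∀ N → x < ι N → ∃ λ J → ι J ≤ x × x < ι (suc J)
    search zero    x<0   = ⊥-elim (<⇒≱ x<0 (subst (_≤ x) (sym ι-0) 0≤x))
    search (suc N) x<1+N with ι N ≤? x
    ... | yes N≤x = N , N≤x , x<1+N
    ... | no  N≰x = search N (≰⇒> N≰x)

module RationalSums where

  open import Algebra.Bundles using (CommutativeRing)
  open import Relation.Nullary.Decidable using (_×-dec_)
  open OrderedRationals
  open RangeSums using (module RangeSum)
  open RangeSum (CommutativeRing.commutativeSemiring +-*-commutativeRing) public

  ∑-mono : ∀ N {f g} → (∀ i → i ℕ.< N → f i ≤ g i) → ∑ N f ≤ ∑ N g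
  ∑-mono zero    f≤g = ≤-refl
  ∑-mono (suc N) f≤g = +-mono-≤ (f≤g zero (s≤s z≤n)) (∑-mono N λ i i<N → f≤g (suc i) (s≤s i<N))

  ∑-nonNeg : ∀ N {f} → (∀ i → i ℕ.< N → 0ℚ ≤ f i) → 0ℚ ≤ ∑ N f
  ∑-nonNeg zero    f≥0 = ≤-refl
  ∑-nonNeg (suc N) f≥0 = +≥0 (f≥0 zero (s≤s z≤n)) (∑-nonNeg N λ i i<N → f≥0 (suc i) (s≤s i<N))

  term≤∑ : ∀ N {f} i₀ → i₀ ℕ.< N → (∀ i → i ℕ.< N → 0ℚ ≤ f i) → f i₀ ≤ ∑ N f
  term≤∑ (suc N) {f} zero     _          f≥0 =
    ≤-slack _ (∑-nonNeg N λ i i<N → f≥0 (suc i) (s≤s i<N)) refl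
  term≤∑ (suc N) {f} (suc i₀) (s≤s i₀<N) f≥0 = ≤-trans
    (term≤∑ N i₀ i₀<N λ i i<N → f≥0 (suc i) (s≤s i<N))
    (≤-slack (f zero) (f≥0 zero (s≤s z≤n)) (+-comm _ (f zero)))

  ∣∑∣≤∑ : ∀ N {f g} → (∀ i → i ℕ.< N → ∣ f i ∣ ≤ g i) → ∣ ∑ N f ∣ ≤ ∑ N g
  ∣∑∣≤∑ zero    ∣f∣≤g = ≤-refl
  ∣∑∣≤∑ (suc N) ∣f∣≤g = ∣x+y∣≤ (∣f∣≤g zero (s≤s z≤n)) (∣∑∣≤∑ N λ i i<N → ∣f∣≤g (suc i) (s≤s i<N))

  ∑-const : ∀ N x → ∑ N (λ _ → x) ≡ ι N * x
  ∑-const zero    x = sym (ι-0* x)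
  ∑-const (suc N) x = begin
    x + ∑ N (λ _ → x)  ≡⟨ cong (λ y → x + y) (∑-const N x) ⟩
    x + ι N * x        ≡⟨ +-comm x (ι N * x) ⟩
    ι N * x + x        ≡⟨ ι-suc* N x ⟨
    ι (suc N) * x      ∎
    where open ≡-Reasoning

  ∣∑∣≤const : ∀ N {f c} → (∀ i → i ℕ.< N → ∣ f i ∣ ≤ c) → ∣ ∑ N f ∣ ≤ ι N * c
  ∣∑∣≤const N {c = c} ∣f∣≤c = subst (_ ≤_) (∑-const N c) (∣∑∣≤∑ N ∣f∣≤c)

  ∑-neg : ∀ N f → ∑ N (λ i → - f i) ≡ - ∑ N f
  ∑-neg zero    f = refl
  ∑-neg (suc N) f = trans (cong (λ y → - f zero + y) (∑-neg N _)) (sym (neg-distrib-+ (f zero) _))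

  ∑-sub : ∀ N f g → ∑ N (λ i → f i - g i) ≡ ∑ N f - ∑ N g
  ∑-sub N f g = trans (∑-+ N f (λ i → - g i)) (cong (λ y → ∑ N f + y) (∑-neg N g))

  ∑₂-sub : ∀ N f g → ∑₂ N (λ i j → f i j - g i j) ≡ ∑₂ N f - ∑₂ N g
  ∑₂-sub N f g = trans (∑-cong′ N λ i → ∑-sub N (f i) (g i)) (∑-sub N _ _)

  ∑₄-sub : ∀ N f g → ∑₄ N (λ i j k l → f i j k l - g i j k l) ≡ ∑₄ N f - ∑₄ N g
  ∑₄-sub N f g = trans (∑₂-cong′ N λ i j → ∑₂-sub N (f i j) (g i j)) (∑₂-sub N _ _)

  ∣∑₂∣≤const : ∀ N {f c} → (∀ i j → ∣ f i j ∣ ≤ c) → ∣ ∑₂ N f ∣ ≤ ι N * (ι N * c)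
  ∣∑₂∣≤const N ∣f∣≤c = ∣∑∣≤const N λ i _ → ∣∑∣≤const N λ j _ → ∣f∣≤c i j

  ∣∑₄∣≤const : ∀ N {f c} → (∀ i j k l → ∣ f i j k l ∣ ≤ c) → ∣ ∑₄ N f ∣ ≤ ι N ^ 4 * c
  ∣∑₄∣≤const N {f} {c} ∣f∣≤c = subst (∣ ∑₄ N f ∣ ≤_) (fourth-power (ι N) c)
    (∣∑₂∣≤const N λ i j → ∣∑₂∣≤const N (∣f∣≤c i j))
    where
    fourth-power : ∀ x c → x * (x * (x * (x * c))) ≡ x * (x * (x * (x * 1ℚ))) * c
    fourth-power = solve-∀ ringℚ

  ∑-telescope : ∀ N (g : ℕ → ℚ) → ∑ N (λ i → g i - g (suc i)) ≡ g 0 - g N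
  ∑-telescope zero    g = sym (+-inverseʳ (g 0))
  ∑-telescope (suc N) g =
    trans (cong (λ y → g 0 - g 1 + y) (∑-telescope N (g ∘ suc))) (collapse (g 0) (g 1) (g (suc N)))
    where
    collapse : ∀ a b c → a - b + (b - c) ≡ a - c
    collapse = solve-∀ ringℚ

  harmonic : ℕ → ℚ
  harmonic N = ∑ N (λ i → inv (ι (suc i)))

  harmonic≥0 : ∀ N → 0ℚ ≤ harmonic N
  harmonic≥0 N = ∑-nonNeg N λ i _ → inv≥0 (ι>0 (suc i))

  ⟦_⟧ : ∀ {p} {P : Set p} → Dec P → ℚ
  ⟦ yes _ ⟧ = 1ℚ
  ⟦ no _  ⟧ = 0ℚ

  ⟦⟧-yes : ∀ {p} {P : Set p} (P? : Dec P) → P → ⟦ P? ⟧ ≡ 1ℚ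
  ⟦⟧-yes (yes _) _ = refl
  ⟦⟧-yes (no ¬p) p = ⊥-elim (¬p p)

  ⟦⟧-no : ∀ {p} {P : Set p} (P? : Dec P) → ¬ P → ⟦ P? ⟧ ≡ 0ℚ
  ⟦⟧-no (yes p) ¬p = ⊥-elim (¬p p)
  ⟦⟧-no (no _)  _  = refl

  ⟦⟧-cong : ∀ {p q} {P : Set p} {Q : Set q} (P? : Dec P) (Q? : Dec Q) → (P → Q) → (Q → P) → ⟦ P? ⟧ ≡ ⟦ Q? ⟧
  ⟦⟧-cong (yes p) Q? P⇒Q _   = sym (⟦⟧-yes Q? (P⇒Q p))
  ⟦⟧-cong (no ¬p) Q? _   Q⇒P = sym (⟦⟧-no Q? (¬p ∘ Q⇒P))

  ⟦⟧-× : ∀ {p q} {P : Set p} {Q : Set q} (P? : Dec P) (Q? : Dec Q) → ⟦ P? ×-dec Q? ⟧ ≡ ⟦ P? ⟧ * ⟦ Q? ⟧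
  ⟦⟧-× (yes _) (yes _) = refl
  ⟦⟧-× (yes _) (no _)  = refl
  ⟦⟧-× (no _)  Q?      = sym (*-zeroˡ ⟦ Q? ⟧)

  ⟦⟧≥0 : ∀ {p} {P : Set p} (P? : Dec P) → 0ℚ ≤ ⟦ P? ⟧
  ⟦⟧≥0 (yes _) = 0≤1
  ⟦⟧≥0 (no _)  = ≤-refl

  ⟦⟧≤1 : ∀ {p} {P : Set p} (P? : Dec P) → ⟦ P? ⟧ ≤ 1ℚ
  ⟦⟧≤1 (yes _) = ≤-refl
  ⟦⟧≤1 (no _)  = 0≤1

  ∣⟦⟧∣≤1 : ∀ {p} {P : Set p} (P? : Dec P) → ∣ ⟦ P? ⟧ ∣ ≤ 1ℚ
  ∣⟦⟧∣≤1 P? = 0≤x⇒∣x∣≤ (⟦⟧≥0 P?) (⟦⟧≤1 P?)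

  ⟦⟧-yes* : ∀ {p} {P : Set p} (P? : Dec P) x → P → ⟦ P? ⟧ * x ≡ x
  ⟦⟧-yes* P? x p = trans (cong (_* x) (⟦⟧-yes P? p)) (*-identityˡ x)

  ⟦⟧-no* : ∀ {p} {P : Set p} (P? : Dec P) x → ¬ P → ⟦ P? ⟧ * x ≡ 0ℚ
  ⟦⟧-no* P? x ¬p = x≡0⇒xy≡0 x (⟦⟧-no P? ¬p)

  ⟦⟧*-cong : ∀ {p} {P : Set p} (P? : Dec P) {x y} → (P → x ≡ y) → ⟦ P? ⟧ * x ≡ ⟦ P? ⟧ * y
  ⟦⟧*-cong (yes p)         P⇒x≡y = cong (1ℚ *_) (P⇒x≡y p)
  ⟦⟧*-cong (no _)  {x} {y} _     = trans (*-zeroˡ x) (sym (*-zeroˡ y))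

  ∑-select : ∀ N (f : ℕ → ℚ) k → (N ℕ.≤ k → f k ≡ 0ℚ) → ∑ N (λ i → ⟦ i ℕ.≟ k ⟧ * f i) ≡ f k
  ∑-select N f k f≡0 with k ℕ.<? N
  ... | yes k<N = trans (∑-single N k k<N λ i _ i≢k → ⟦⟧-no* (i ℕ.≟ k) (f i) i≢k) (⟦⟧-yes* (k ℕ.≟ k) (f k) refl)
  ... | no  k≮N = trans
    (∑-zero N λ i i<N → ⟦⟧-no* (i ℕ.≟ k) (f i) λ i≡k → k≮N (subst (ℕ._< N) i≡k i<N))
    (sym (f≡0 (ℕ.≮⇒≥ k≮N)))

  ∑-increasing≤∑ : ∀ N (f : ℕ → ℚ) (s : ℕ → ℕ) M → (∀ i → i ℕ.< N → 0ℚ ≤ f i) →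
                   (∀ {i j} → i ℕ.< j → s i ℕ.< s j) → (∀ j → j ℕ.< M → s j ℕ.< N) →
                   ∑ M (f ∘ s) ≤ ∑ N f
  ∑-increasing≤∑ N f s M f≥0 s-increasing s<N = begin
    ∑ M (f ∘ s)
      ≡⟨ ∑-cong M (λ j j<M → ∑-select N f (s j) λ N≤sj → ⊥-elim (ℕ.<⇒≱ (s<N j j<M) N≤sj)) ⟨
    ∑ M (λ j → ∑ N (λ i → ⟦ i ℕ.≟ s j ⟧ * f i))
      ≡⟨ ∑-swap M N _ ⟩
    ∑ N (λ i → ∑ M (λ j → ⟦ i ℕ.≟ s j ⟧ * f i))
      ≡⟨ ∑-cong′ N (λ i → ∑-*ʳ M (f i) _) ⟨
    ∑ N (λ i → ∑ M (λ j → ⟦ i ℕ.≟ s j ⟧) * f i)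
      ≤⟨ ∑-mono N (λ i i<N → x≤1⇒x*y≤y (hits≤1 M i) (f≥0 i i<N)) ⟩
    ∑ N f ∎
    where
    open ≤-Reasoning
    hits≤1 : ∀ M i → ∑ M (λ j → ⟦ i ℕ.≟ s j ⟧) ≤ 1ℚ
    hits≤1 zero    i = 0≤1
    hits≤1 (suc M) i with i ℕ.≟ s M
    ... | yes refl = ≤-reflexive (trans
      (∑-single (suc M) M ℕ.≤-refl λ { j (s≤s j≤M) j≢M → ⟦⟧-no (s M ℕ.≟ s j) λ sM≡sj →
        ℕ.<-irrefl (sym sM≡sj) (s-increasing (ℕ.≤∧≢⇒< j≤M j≢M)) })
      (⟦⟧-yes (s M ℕ.≟ s M) refl))
    ... | no i≢sM = begin
      ∑ (suc M) (λ j → ⟦ i ℕ.≟ s j ⟧)            ≡⟨ ∑-last M _ ⟩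
      ∑ M (λ j → ⟦ i ℕ.≟ s j ⟧) + ⟦ i ℕ.≟ s M ⟧  ≡⟨ cong (λ y → ∑ M _ + y) (⟦⟧-no (i ℕ.≟ s M) i≢sM) ⟩
      ∑ M (λ j → ⟦ i ℕ.≟ s j ⟧) + 0ℚ             ≡⟨ +-identityʳ _ ⟩
      ∑ M (λ j → ⟦ i ℕ.≟ s j ⟧)                  ≤⟨ hits≤1 M i ⟩
      1ℚ                                         ∎

  summation-by-parts : ∀ N (f g : ℕ → ℚ) →
    ∑ (suc N) (λ i → f i * g i) ≡ ∑ (suc N) f * g N + ∑ N (λ i → ∑ (suc i) f * (g i - g (suc i)))
  summation-by-parts zero    f g = base (f 0) (g 0)
    where
    base : ∀ x y → x * y + 0ℚ ≡ (x + 0ℚ) * y + 0ℚ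
    base = solve-∀ ringℚ
  summation-by-parts (suc N) f g = begin
    ∑ (suc (suc N)) (λ i → f i * g i)
      ≡⟨ ∑-last (suc N) (λ i → f i * g i) ⟩
    ∑ (suc N) (λ i → f i * g i) + f (suc N) * g (suc N)
      ≡⟨ cong (_+ f (suc N) * g (suc N)) (summation-by-parts N f g) ⟩
    F * g N + S + f (suc N) * g (suc N)
      ≡⟨ append F (g N) S (f (suc N)) (g (suc N)) ⟩
    (F + f (suc N)) * g (suc N) + (S + F * (g N - g (suc N)))
      ≡⟨ cong₂ (λ u v → u * g (suc N) + v) (∑-last (suc N) f)
           (∑-last N (λ i → ∑ (suc i) f * (g i - g (suc i)))) ⟨
    ∑ (suc (suc N)) f * g (suc N) + ∑ (suc N) (λ i → ∑ (suc i) f * (g i - g (suc i))) ∎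
    where
    open ≡-Reasoning
    F S : ℚ
    F = ∑ (suc N) f
    S = ∑ N (λ i → ∑ (suc i) f * (g i - g (suc i)))
    append : ∀ F g S f g′ → F * g + S + f * g′ ≡ (F + f) * g′ + (S + F * (g - g′))
    append = solve-∀ ringℚ

  ∣∑∣≤-by-parts : ∀ N (f g v : ℕ → ℚ) C → 0ℚ ≤ C → (∀ i → ∣ ∑ i f ∣ ≤ C) →
                  (∀ i → i ℕ.< N → ∣ g i - g (suc i) ∣ ≤ v i) →
                  ∣ ∑ (suc N) (λ i → f i * g i) ∣ ≤ C * (∣ g N ∣ + ∑ N v)
  ∣∑∣≤-by-parts N f g v C 0≤C partial≤C variation≤v = begin
    ∣ ∑ (suc N) (λ i → f i * g i) ∣
      ≡⟨ cong ∣_∣ (summation-by-parts N f g) ⟩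
    ∣ ∑ (suc N) f * g N + ∑ N (λ i → ∑ (suc i) f * (g i - g (suc i))) ∣
      ≤⟨ ∣x+y∣≤ (∣x*y∣≤ (partial≤C (suc N)) ≤-refl)
           (∣∑∣≤∑ N λ i i<N → ∣x*y∣≤ (partial≤C (suc i)) (variation≤v i i<N)) ⟩
    C * ∣ g N ∣ + ∑ N (λ i → C * v i)
      ≡⟨ cong (λ y → C * ∣ g N ∣ + y) (∑-*ˡ N C v) ⟨
    C * ∣ g N ∣ + C * ∑ N v
      ≡⟨ *-distribˡ-+ C _ _ ⟨
    C * (∣ g N ∣ + ∑ N v) ∎
    where open ≤-Reasoning

module Congruences where

  open import Data.Nat.Coprimality using (Coprime; coprime-Bézout; coprime-divisor)
  open import Data.Nat.Divisibility
  open import Data.Nat.DivMod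
    using (m%n%n≡m%n; %-distribˡ-+; %-distribˡ-*; [m+kn]%n≡m%n; m*n%n≡0; m<n⇒m%n≡m; n%n≡0)
  open import Data.Nat.GCD using (module Bézout)
  open ≡-Reasoning

  coprime-* : ∀ {a b n} → Coprime a n → Coprime b n → Coprime (a ℕ.* b) n
  coprime-* {a} {b} a⊥n b⊥n {d} (d∣ab , d∣n) =
    b⊥n (coprime-divisor {d} {a} {b} (λ (e∣d , e∣a) → a⊥n (e∣a , ∣-trans e∣d d∣n)) d∣ab , d∣n)

  ∣-coprime : ∀ {d a n} → d ∣ a → Coprime a n → Coprime d n
  ∣-coprime d∣a a⊥n (e∣d , e∣n) = a⊥n (∣-trans e∣d d∣a , e∣n)

  infix 4 _≡_mod_

  _≡_mod_ : ℕ → ℕ → (n : ℕ) .{{_ : ℕ.NonZero n}} → Set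
  a ≡ b mod n = a % n ≡ b % n

  module _ (n : ℕ) .{{_ : ℕ.NonZero n}} where

    0%n≡0 : 0 % n ≡ 0
    0%n≡0 = m<n⇒m%n≡m (ℕ.>-nonZero⁻¹ n)

    %-mod : ∀ a → a % n ≡ a mod n
    %-mod a = m%n%n≡m%n a n

    +-mod : ∀ {a b c d} → a ≡ b mod n → c ≡ d mod n → a ℕ.+ c ≡ b ℕ.+ d mod n
    +-mod {a} {b} {c} {d} a≡b c≡d = begin
      (a ℕ.+ c) % n          ≡⟨ %-distribˡ-+ a c n ⟩
      (a % n ℕ.+ c % n) % n  ≡⟨ cong₂ (λ x y → (x ℕ.+ y) % n) a≡b c≡d ⟩
      (b % n ℕ.+ d % n) % n  ≡⟨ %-distribˡ-+ b d n ⟨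
      (b ℕ.+ d) % n          ∎

    +-modˡ : ∀ c {a b} → a ≡ b mod n → c ℕ.+ a ≡ c ℕ.+ b mod n
    +-modˡ c {a} {b} a≡b = +-mod {c} {c} {a} {b} refl a≡b

    +-modʳ : ∀ c {a b} → a ≡ b mod n → a ℕ.+ c ≡ b ℕ.+ c mod n
    +-modʳ c {a} {b} a≡b = +-mod {a} {b} {c} {c} a≡b refl

    *-mod : ∀ {a b c d} → a ≡ b mod n → c ≡ d mod n → a ℕ.* c ≡ b ℕ.* d mod n
    *-mod {a} {b} {c} {d} a≡b c≡d = begin
      (a ℕ.* c) % n            ≡⟨ %-distribˡ-* a c n ⟩
      (a % n ℕ.* (c % n)) % n  ≡⟨ cong₂ (λ x y → (x ℕ.* y) % n) a≡b c≡d ⟩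
      (b % n ℕ.* (d % n)) % n  ≡⟨ %-distribˡ-* b d n ⟨
      (b ℕ.* d) % n            ∎

    *-modˡ : ∀ c {a b} → a ≡ b mod n → c ℕ.* a ≡ c ℕ.* b mod n
    *-modˡ c {a} {b} a≡b = *-mod {c} {c} {a} {b} refl a≡b

    *-modʳ : ∀ c {a b} → a ≡ b mod n → a ℕ.* c ≡ b ℕ.* c mod n
    *-modʳ c {a} {b} a≡b = *-mod {a} {b} {c} {c} a≡b refl

    *-zero-mod : ∀ c {a} → a % n ≡ 0 → (c ℕ.* a) % n ≡ 0
    *-zero-mod c {a} a≡0 = begin
      (c ℕ.* a) % n  ≡⟨ *-modˡ c {a} {0} (trans a≡0 (sym 0%n≡0)) ⟩
      (c ℕ.* 0) % n  ≡⟨ cong (_% n) (ℕ.*-zeroʳ c) ⟩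
      0 % n          ≡⟨ 0%n≡0 ⟩
      0              ∎

    -- ℕ.pred n plays the role of -1.
    pred*+-mod : ∀ a → (ℕ.pred n ℕ.* a ℕ.+ a) % n ≡ 0
    pred*+-mod a = begin
      (ℕ.pred n ℕ.* a ℕ.+ a) % n  ≡⟨ cong (_% n) (ℕ.+-comm (ℕ.pred n ℕ.* a) a) ⟩
      (suc (ℕ.pred n) ℕ.* a) % n  ≡⟨ cong (λ m → (m ℕ.* a) % n) (ℕ.suc-pred n) ⟩
      (n ℕ.* a) % n               ≡⟨ cong (_% n) (ℕ.*-comm n a) ⟩
      (a ℕ.* n) % n               ≡⟨ m*n%n≡0 a n ⟩
      0                           ∎

    +-cancelʳ-mod : ∀ c {a b} → a ℕ.+ c ≡ b ℕ.+ c mod n → a ≡ b mod n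
    +-cancelʳ-mod c {a} {b} a+c≡b+c = begin
      a % n                 ≡⟨ drop a ⟨
      (a ℕ.+ c ℕ.+ c⁻) % n  ≡⟨ +-modʳ c⁻ {a ℕ.+ c} {b ℕ.+ c} a+c≡b+c ⟩
      (b ℕ.+ c ℕ.+ c⁻) % n  ≡⟨ drop b ⟩
      b % n                 ∎
      where
      c⁻ : ℕ
      c⁻ = ℕ.pred n ℕ.* c
      drop : ∀ x → (x ℕ.+ c ℕ.+ c⁻) % n ≡ x % n
      drop x = begin
        (x ℕ.+ c ℕ.+ c⁻) % n    ≡⟨ cong (_% n) (trans (ℕ.+-assoc x c c⁻) (cong (x ℕ.+_) (ℕ.+-comm c c⁻))) ⟩
        (x ℕ.+ (c⁻ ℕ.+ c)) % n  ≡⟨ +-modˡ x {c⁻ ℕ.+ c} {0} (trans (pred*+-mod c) (sym 0%n≡0)) ⟩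
        (x ℕ.+ 0) % n           ≡⟨ cong (_% n) (ℕ.+-identityʳ x) ⟩
        x % n                   ∎

    complement⇒ : ∀ m {a} → 0 ℕ.< a → a ℕ.< n → (m ℕ.+ a) % n ≡ 0 → m % n ≡ n ∸ a
    complement⇒ m {a} 0<a a<n m+a≡0 = begin
      m % n
        ≡⟨ +-cancelʳ-mod a {m} {n ∸ a} (trans m+a≡0 (sym (trans (cong (_% n) (ℕ.m∸n+n≡m (ℕ.<⇒≤ a<n))) (n%n≡0 n)))) ⟩
      (n ∸ a) % n  ≡⟨ m<n⇒m%n≡m (ℕ.∸-monoʳ-< 0<a (ℕ.<⇒≤ a<n)) ⟩
      n ∸ a        ∎

    complement⇐ : ∀ m {a} → a ℕ.< n → m % n ≡ n ∸ a → (m ℕ.+ a) % n ≡ 0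
    complement⇐ m {a} a<n m≡n∸a = begin
      (m ℕ.+ a) % n      ≡⟨ +-modʳ a (%-mod m) ⟨
      (m % n ℕ.+ a) % n  ≡⟨ cong (λ x → (x ℕ.+ a) % n) m≡n∸a ⟩
      (n ∸ a ℕ.+ a) % n  ≡⟨ cong (_% n) (ℕ.m∸n+n≡m (ℕ.<⇒≤ a<n)) ⟩
      n % n              ≡⟨ n%n≡0 n ⟩
      0                  ∎

    opposites-unique : ∀ m a b → a ℕ.< n → (m ℕ.+ b) % n ≡ 0 → (m ℕ.+ a) % n ≡ 0 → b % n ≡ a
    opposites-unique m a b a<n m+b≡0 m+a≡0 = trans
      (+-cancelʳ-mod m {b} {a} (trans (flip b m+b≡0) (sym (flip a m+a≡0)))) (m<n⇒m%n≡m a<n)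
      where
      flip : ∀ x → (m ℕ.+ x) % n ≡ 0 → (x ℕ.+ m) % n ≡ 0
      flip x = trans (cong (_% n) (ℕ.+-comm x m))

    inverse-cancelˡ : ∀ {g h} m → g ℕ.* h ≡ 1 mod n → g ℕ.* (h ℕ.* m) ≡ m mod n
    inverse-cancelˡ {g} {h} m gh≡1 = begin
      (g ℕ.* (h ℕ.* m)) % n  ≡⟨ cong (_% n) (ℕ.*-assoc g h m) ⟨
      (g ℕ.* h ℕ.* m) % n    ≡⟨ *-modʳ m {g ℕ.* h} {1} gh≡1 ⟩
      (1 ℕ.* m) % n          ≡⟨ cong (_% n) (ℕ.*-identityˡ m) ⟩
      m % n                  ∎

    inverse-comm : ∀ g h → g ℕ.* h ≡ 1 mod n → h ℕ.* g ≡ 1 mod n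
    inverse-comm g h = trans (cong (_% n) (ℕ.*-comm h g))

    inverse-scale : ∀ {g h} → g ℕ.* h ≡ 1 mod n → ∀ k → k ℕ.< n → ((k ℕ.* g % n) ℕ.* h) % n ≡ k
    inverse-scale {g} {h} gh≡1 k k<n = begin
      ((k ℕ.* g % n) ℕ.* h) % n ≡⟨ *-modʳ h (%-mod (k ℕ.* g)) ⟩
      (k ℕ.* g ℕ.* h) % n    ≡⟨ cong (_% n) (ℕ.*-assoc k g h) ⟩
      (k ℕ.* (g ℕ.* h)) % n  ≡⟨ *-modˡ k {g ℕ.* h} {1} gh≡1 ⟩
      (k ℕ.* 1) % n          ≡⟨ cong (_% n) (ℕ.*-identityʳ k) ⟩
      k % n                  ≡⟨ m<n⇒m%n≡m k<n ⟩
      k                      ∎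

    neg-inverse : ∀ a b → b ℕ.≤ n → a ℕ.* b ≡ 1 mod n → ℕ.pred n ℕ.* a ℕ.* (n ∸ b) ≡ 1 mod n
    neg-inverse a b b≤n ab≡1 = trans (+-cancelʳ-mod (a⁻ ℕ.* b) {a⁻ ℕ.* (n ∸ b)} {a ℕ.* b} (begin
      (a⁻ ℕ.* (n ∸ b) ℕ.+ a⁻ ℕ.* b) % n         ≡⟨ cong (_% n) (ℕ.*-distribˡ-+ a⁻ (n ∸ b) b) ⟨
      (a⁻ ℕ.* (n ∸ b ℕ.+ b)) % n                ≡⟨ cong (λ x → (a⁻ ℕ.* x) % n) (ℕ.m∸n+n≡m b≤n) ⟩
      (a⁻ ℕ.* n) % n                            ≡⟨ m*n%n≡0 a⁻ n ⟩
      0                                         ≡⟨ pred*+-mod (a ℕ.* b) ⟨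
      (ℕ.pred n ℕ.* (a ℕ.* b) ℕ.+ a ℕ.* b) % n  ≡⟨ cong (_% n) (ℕ.+-comm (ℕ.pred n ℕ.* (a ℕ.* b)) (a ℕ.* b)) ⟩
      (a ℕ.* b ℕ.+ ℕ.pred n ℕ.* (a ℕ.* b)) % n  ≡⟨ cong (λ x → (a ℕ.* b ℕ.+ x) % n) (ℕ.*-assoc (ℕ.pred n) a b) ⟨
      (a ℕ.* b ℕ.+ a⁻ ℕ.* b) % n                ∎)) ab≡1
      where
      a⁻ : ℕ
      a⁻ = ℕ.pred n ℕ.* a

    coprime⇒invertible : ∀ {g} → Coprime g n → ∃ λ h → g ℕ.* h ≡ 1 mod n
    coprime⇒invertible {g} g⊥n with coprime-Bézout g⊥n
    ... | Bézout.+- x y 1+yn≡xg = x , (begin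
      (g ℕ.* x) % n        ≡⟨ cong (_% n) (trans (ℕ.*-comm g x) (sym 1+yn≡xg)) ⟩
      (1 ℕ.+ y ℕ.* n) % n  ≡⟨ [m+kn]%n≡m%n 1 y n ⟩
      1 % n                ∎)
    ... | Bézout.-+ x y 1+xg≡yn = ℕ.pred n ℕ.* x , +-cancelʳ-mod (x ℕ.* g) {g ℕ.* (ℕ.pred n ℕ.* x)} {1} (begin
      (g ℕ.* (ℕ.pred n ℕ.* x) ℕ.+ x ℕ.* g) % n  ≡⟨ cong (_% n) (regroup g (ℕ.pred n) x) ⟩
      (ℕ.pred n ℕ.* (x ℕ.* g) ℕ.+ x ℕ.* g) % n  ≡⟨ pred*+-mod (x ℕ.* g) ⟩
      0                                         ≡⟨ m*n%n≡0 y n ⟨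
      (y ℕ.* n) % n                             ≡⟨ cong (_% n) 1+xg≡yn ⟨
      (1 ℕ.+ x ℕ.* g) % n                       ∎)
      where
      regroup : ∀ g p x → g ℕ.* (p ℕ.* x) ℕ.+ x ℕ.* g ≡ p ℕ.* (x ℕ.* g) ℕ.+ x ℕ.* g
      regroup = ℕ-Solver.solve-∀

    invertible⇒coprime : ∀ {g h} → g ℕ.* h ≡ 1 mod n → Coprime g n
    invertible⇒coprime {g} {h} gh≡1 {d} (d∣g , d∣n) =
      ∣1⇒≡1 (∣n∣m%n⇒∣m d∣n (subst (d ∣_) gh≡1 (%-presˡ-∣ (∣m⇒∣m*n h d∣g) d∣n)))

    record Inverses (a a⁻¹ : ℕ → ℕ) : Set where
      field
        inverse : ∀ i → a i ℕ.* a⁻¹ i ≡ 1 mod n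
        0<a⁻¹   : ∀ i → 0 ℕ.< a⁻¹ i
        a⁻¹<n   : ∀ i → a⁻¹ i ℕ.< n

    negate : (ℕ → ℕ) → ℕ → ℕ
    negate a i = ℕ.pred n ℕ.* a i

    negate-inverses : ∀ {a a⁻¹} → Inverses a a⁻¹ → Inverses (negate a) (λ i → n ∸ a⁻¹ i)
    negate-inverses {a} {a⁻¹} inverses = record
      { inverse = λ i → neg-inverse (a i) (a⁻¹ i) (ℕ.<⇒≤ (a⁻¹<n i)) (inverse i)
      ; 0<a⁻¹   = λ i → ℕ.m<n⇒0<n∸m (a⁻¹<n i)
      ; a⁻¹<n   = λ i → ℕ.∸-monoʳ-< (0<a⁻¹ i) (ℕ.<⇒≤ (a⁻¹<n i)) }
      where open Inverses inverses

    residueSum : ℕ → (ℕ → ℕ) → ℕ → ℕ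
    residueSum N a r = RangeSums.∑ℕ N (λ i → r ℕ.* a i % n)

module ResidueSums where

  open import Data.Nat.Coprimality using (Coprime)
  open import Data.Nat.DivMod using (m%n<n; [m+kn]%n≡m%n; m<n⇒m%n≡m)
  open import Data.Rational using (ℚ; _*_)
  open RationalSums
  open Congruences
  open ≡-Reasoning

  ∑-rescale : ∀ n .{{_ : ℕ.NonZero n}} {g} → Coprime g n → (f : ℕ → ℚ) → (∀ a b → a ≡ b mod n → f a ≡ f b) →
              ∑ n (λ k → f (k ℕ.* g)) ≡ ∑ n f
  ∑-rescale n {g} g⊥n f f-periodic with coprime⇒invertible n g⊥n
  ... | h , gh≡1 = begin
    ∑ n (λ k → f (k ℕ.* g))      ≡⟨ ∑-cong′ n (λ k → f-periodic _ _ (%-mod n (k ℕ.* g))) ⟨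
    ∑ n (λ k → f (k ℕ.* g % n))  ≡⟨ ∑-permute n f (λ k → k ℕ.* g % n) (λ k → k ℕ.* h % n)
                                        (λ k _ → m%n<n (k ℕ.* g) n) (λ k _ → m%n<n (k ℕ.* h) n)
                                        (inverse-scale n {h} {g} (inverse-comm n g h gh≡1))
                                        (inverse-scale n gh≡1) ⟨
    ∑ n f                        ∎

  ∑-residue : ∀ n .{{_ : ℕ.NonZero n}} L a (f : ℕ → ℚ) → a ℕ.< n →
              ∑ (n ℕ.* L) (λ m → ⟦ m % n ℕ.≟ a ⟧ * f m) ≡ ∑ L (λ l → f (l ℕ.* n ℕ.+ a))
  ∑-residue n L a f a<n = begin
    ∑ (n ℕ.* L) F                              ≡⟨ cong (λ M → ∑ M F) (ℕ.*-comm n L) ⟩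
    ∑ (L ℕ.* n) F                              ≡⟨ ∑-blocks L n F ⟩
    ∑ L (λ l → ∑ n (λ r → F (l ℕ.* n ℕ.+ r)))  ≡⟨ ∑-cong′ L pick ⟩
    ∑ L (λ l → f (l ℕ.* n ℕ.+ a))              ∎
    where
    F : ℕ → ℚ
    F m = ⟦ m % n ℕ.≟ a ⟧ * f m
    block-residue : ∀ l r → r ℕ.< n → (l ℕ.* n ℕ.+ r) % n ≡ r
    block-residue l r r<n =
      trans (cong (_% n) (ℕ.+-comm (l ℕ.* n) r)) (trans ([m+kn]%n≡m%n r l n) (m<n⇒m%n≡m r<n))
    pick : ∀ l → ∑ n (λ r → F (l ℕ.* n ℕ.+ r)) ≡ f (l ℕ.* n ℕ.+ a)
    pick l = trans
      (∑-single n a a<n λ r r<n r≢a → ⟦⟧-no* ((l ℕ.* n ℕ.+ r) % n ℕ.≟ a) (f (l ℕ.* n ℕ.+ r)) λ e →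
        r≢a (trans (sym (block-residue l r r<n)) e))
      (⟦⟧-yes* ((l ℕ.* n ℕ.+ a) % n ℕ.≟ a) (f (l ℕ.* n ℕ.+ a)) (block-residue l a a<n))

module PairsByGcd where

  open import Data.Nat.Coprimality as Coprimality
    using (Coprime; coprime?; coprime⇒gcd≡1; gcd≡1⇒coprime; coprime-divisor)
  open import Data.Nat.Divisibility
  open import Data.Nat.GCD
  open import Relation.Nullary.Decidable using (_×-dec_)
  open OrderedRationals
  open RationalSums

  coprime-product-∣ : ∀ {k u v N} → Coprime u v → k ℕ.* u ∣ N → k ℕ.* v ∣ N → k ℕ.* u ℕ.* v ∣ N
  coprime-product-∣ {zero}          _   0∣N             _    = 0∣N
  coprime-product-∣ {k@(suc _)} {u} {v} {N} u⊥v (divides q N≡q*ku) kv∣N =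
    subst (k ℕ.* u ℕ.* v ∣_) (sym N≡ku*q) (*-monoʳ-∣ (k ℕ.* u) v∣q)
    where
    N≡ku*q : N ≡ k ℕ.* u ℕ.* q
    N≡ku*q = trans N≡q*ku (ℕ.*-comm q (k ℕ.* u))
    v∣uq : v ∣ u ℕ.* q
    v∣uq = *-cancelˡ-∣ k (subst (k ℕ.* v ∣_) (trans N≡ku*q (ℕ.*-assoc k u q)) kv∣N)
    v∣q : v ∣ q
    v∣q = coprime-divisor (Coprimality.sym u⊥v) v∣uq

  gcd-unique : ∀ {m m′ g u v} → Coprime u v → m ≡ g ℕ.* u → m′ ≡ g ℕ.* v → g ≡ gcd m m′
  gcd-unique {g = g} {u} {v} u⊥v refl refl = begin
    g                        ≡⟨ ℕ.*-identityʳ g ⟨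
    g ℕ.* 1                  ≡⟨ cong (g ℕ.*_) (coprime⇒gcd≡1 u⊥v) ⟨
    g ℕ.* gcd u v            ≡⟨ c*gcd[m,n]≡gcd[cm,cn] g u v ⟩
    gcd (g ℕ.* u) (g ℕ.* v)  ∎
    where open ≡-Reasoning

  gcd-cofactors : ∀ m m′ .{{_ : ℕ.NonZero (gcd m m′)}} →
                  ∃₂ λ u v → Coprime u v × m ≡ gcd m m′ ℕ.* u × m′ ≡ gcd m m′ ℕ.* v
  gcd-cofactors m m′ = u , v , gcd≡1⇒coprime gcd[u,v]≡1 , m≡gu , m′≡gv
    where
    open ≡-Reasoning
    g u v : ℕ
    g = gcd m m′
    u = quotient (gcd[m,n]∣m m m′)
    v = quotient (gcd[m,n]∣n m m′)
    m≡gu : m ≡ g ℕ.* u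
    m≡gu = m∣n⇒n≡m*quotient (gcd[m,n]∣m m m′)
    m′≡gv : m′ ≡ g ℕ.* v
    m′≡gv = m∣n⇒n≡m*quotient (gcd[m,n]∣n m m′)
    gcd[u,v]≡1 : gcd u v ≡ 1
    gcd[u,v]≡1 = ℕ.*-cancelˡ-≡ (gcd u v) 1 g (begin
      g ℕ.* gcd u v            ≡⟨ c*gcd[m,n]≡gcd[cm,cn] g u v ⟩
      gcd (g ℕ.* u) (g ℕ.* v)  ≡⟨ cong₂ gcd m≡gu m′≡gv ⟨
      g                        ≡⟨ ℕ.*-identityʳ g ⟨
      g ℕ.* 1                  ∎)

  module _ (Z : ℕ) where

    private
      Decomposition : (m m′ g u v : ℕ) → Set
      Decomposition m m′ g u v = Coprime u v × m ≡ g ℕ.* u × m′ ≡ g ℕ.* v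

      decomposition? : ∀ m m′ g u v → Dec (Decomposition m m′ g u v)
      decomposition? m m′ g u v = coprime? u v ×-dec (m ℕ.≟ g ℕ.* u ×-dec m′ ℕ.≟ g ℕ.* v)

      factor<Z : ∀ {d m} → 0 ℕ.< m → m ℕ.< Z → d ∣ m → d ℕ.< Z
      factor<Z 0<m m<Z d∣m = ℕ.≤-<-trans (∣⇒≤ {{ℕ.>-nonZero 0<m}} d∣m) m<Z

      decomposition-count : ∀ m m′ → 0 ℕ.< m → m ℕ.< Z → 0 ℕ.< m′ → m′ ℕ.< Z →
                            ∑ Z (λ g → ∑₂ Z (λ u v → ⟦ decomposition? m m′ g u v ⟧)) ≡ 1ℚ
      decomposition-count m m′ 0<m m<Z 0<m′ m′<Z
        with gcd-cofactors m m′ {{ℕ.≢-nonZero (gcd[m,n]≢0 m m′ (inj₁ (ℕ.>⇒≢ 0<m)))}}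
      ... | u , v , u⊥v , m≡gu , m′≡gv = begin
        ∑ Z (λ g′ → ∑₂ Z (λ u′ v′ → ⟦ decomposition? m m′ g′ u′ v′ ⟧))
          ≡⟨ ∑-single Z g (factor<Z 0<m m<Z (gcd[m,n]∣m m m′)) (λ g′ _ g′≢g → ∑₂-zero Z λ u′ v′ →
               ⟦⟧-no (decomposition? m m′ g′ u′ v′) λ (c , p , q) → g′≢g (gcd-unique {m} {m′} {g′} {u′} {v′} c p q)) ⟩
        ∑₂ Z (λ u′ v′ → ⟦ decomposition? m m′ g u′ v′ ⟧)
          ≡⟨ ∑-single Z u (factor<Z 0<m m<Z (divides g m≡gu)) (λ u′ _ u′≢u → ∑-zero Z λ v′ _ →
               ⟦⟧-no (decomposition? m m′ g u′ v′) λ (_ , p , _) → u′≢u (ℕ.*-cancelˡ-≡ u′ u g (trans (sym p) m≡gu))) ⟩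
        ∑ Z (λ v′ → ⟦ decomposition? m m′ g u v′ ⟧)
          ≡⟨ ∑-single Z v (factor<Z 0<m′ m′<Z (divides g m′≡gv)) (λ v′ _ v′≢v →
               ⟦⟧-no (decomposition? m m′ g u v′) λ (_ , _ , q) → v′≢v (ℕ.*-cancelˡ-≡ v′ v g (trans (sym q) m′≡gv))) ⟩
        ⟦ decomposition? m m′ g u v ⟧
          ≡⟨ ⟦⟧-yes (decomposition? m m′ g u v) (u⊥v , m≡gu , m′≡gv) ⟩
        1ℚ ∎
        where
        open ≡-Reasoning
        g : ℕ
        g = gcd m m′
        instance
          g≢0 : ℕ.NonZero g
          g≢0 = ℕ.≢-nonZero (gcd[m,n]≢0 m m′ (inj₁ (ℕ.>⇒≢ 0<m)))

    SupportedBelow : (ℕ → ℕ → ℚ) → Set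
    SupportedBelow Φ = ∀ m m′ → ¬ ((0 ℕ.< m × m ℕ.< Z) × (0 ℕ.< m′ × m′ ℕ.< Z)) → Φ m m′ ≡ 0ℚ

    module _ (Φ : ℕ → ℕ → ℚ) (Φ-support : SupportedBelow Φ) where

      private
        weighted : ∀ m m′ → m ℕ.< Z → m′ ℕ.< Z →
                   ∑ Z (λ g → ∑₂ Z (λ u v → ⟦ decomposition? m m′ g u v ⟧ * Φ m m′)) ≡ Φ m m′
        weighted m m′ m<Z m′<Z with 0 ℕ.<? m ×-dec 0 ℕ.<? m′
        ... | yes (0<m , 0<m′) = begin
          ∑ Z (λ g → ∑₂ Z (λ u v → ⟦ decomposition? m m′ g u v ⟧ * Φ m m′))
            ≡⟨ trans (∑-*ʳ Z (Φ m m′) _) (∑-cong′ Z λ g → ∑₂-*ʳ Z (Φ m m′) _) ⟨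
          ∑ Z (λ g → ∑₂ Z (λ u v → ⟦ decomposition? m m′ g u v ⟧)) * Φ m m′
            ≡⟨ cong (_* Φ m m′) (decomposition-count m m′ 0<m m<Z 0<m′ m′<Z) ⟩
          1ℚ * Φ m m′
            ≡⟨ *-identityˡ (Φ m m′) ⟩
          Φ m m′ ∎
          where open ≡-Reasoning
        ... | no ¬0<m,m′ = trans
          (∑-zero Z λ g _ → ∑₂-zero Z λ u v → y≡0⇒xy≡0 ⟦ decomposition? m m′ g u v ⟧ Φ≡0)
          (sym Φ≡0)
          where
          Φ≡0 : Φ m m′ ≡ 0ℚ
          Φ≡0 = Φ-support m m′ λ ((0<m , _) , (0<m′ , _)) → ¬0<m,m′ (0<m , 0<m′)

        collapse : ∀ g u v → ∑₂ Z (λ m m′ → ⟦ decomposition? m m′ g u v ⟧ * Φ m m′) ≡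
                             ⟦ coprime? u v ⟧ * Φ (g ℕ.* u) (g ℕ.* v)
        collapse g u v = begin
          ∑₂ Z (λ m m′ → ⟦ decomposition? m m′ g u v ⟧ * Φ m m′)
            ≡⟨ ∑₂-cong′ Z factor ⟩
          ∑₂ Z (λ m m′ → c * (⟦ m ℕ.≟ g ℕ.* u ⟧ * (⟦ m′ ℕ.≟ g ℕ.* v ⟧ * Φ m m′)))
            ≡⟨ ∑₂-*ˡ Z c _ ⟨
          c * ∑₂ Z (λ m m′ → ⟦ m ℕ.≟ g ℕ.* u ⟧ * (⟦ m′ ℕ.≟ g ℕ.* v ⟧ * Φ m m′))
            ≡⟨ cong (c *_) (∑-cong′ Z λ m → trans (sym (∑-*ˡ Z ⟦ m ℕ.≟ g ℕ.* u ⟧ _))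
                 (cong (⟦ m ℕ.≟ g ℕ.* u ⟧ *_) (∑-select Z (Φ m) (g ℕ.* v) λ Z≤gv →
                   Φ-support m (g ℕ.* v) λ (_ , _ , gv<Z) → ℕ.<⇒≱ gv<Z Z≤gv))) ⟩
          c * ∑ Z (λ m → ⟦ m ℕ.≟ g ℕ.* u ⟧ * Φ m (g ℕ.* v))
            ≡⟨ cong (c *_) (∑-select Z (λ m → Φ m (g ℕ.* v)) (g ℕ.* u) λ Z≤gu →
                 Φ-support (g ℕ.* u) (g ℕ.* v) λ ((_ , gu<Z) , _) → ℕ.<⇒≱ gu<Z Z≤gu) ⟩
          c * Φ (g ℕ.* u) (g ℕ.* v) ∎
          where
          open ≡-Reasoning
          c : ℚ
          c = ⟦ coprime? u v ⟧
          regroup : ∀ c p q φ → c * (p * q) * φ ≡ c * (p * (q * φ))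
          regroup = solve-∀ ringℚ
          factor : ∀ m m′ → ⟦ decomposition? m m′ g u v ⟧ * Φ m m′ ≡
                            c * (⟦ m ℕ.≟ g ℕ.* u ⟧ * (⟦ m′ ℕ.≟ g ℕ.* v ⟧ * Φ m m′))
          factor m m′ = trans
            (cong (_* Φ m m′) (trans (⟦⟧-× (coprime? u v) (m ℕ.≟ g ℕ.* u ×-dec m′ ℕ.≟ g ℕ.* v))
                                     (cong (c *_) (⟦⟧-× (m ℕ.≟ g ℕ.* u) (m′ ℕ.≟ g ℕ.* v)))))
            (regroup c ⟦ m ℕ.≟ g ℕ.* u ⟧ ⟦ m′ ℕ.≟ g ℕ.* v ⟧ (Φ m m′))

      ∑-by-gcd : ∑₂ Z Φ ≡ ∑ Z (λ g → ∑₂ Z (λ u v → ⟦ coprime? u v ⟧ * Φ (g ℕ.* u) (g ℕ.* v)))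
      ∑-by-gcd = begin
        ∑₂ Z Φ
          ≡⟨ ∑₂-cong Z weighted ⟨
        ∑₂ Z (λ m m′ → ∑ Z (λ g → ∑₂ Z (λ u v → ⟦ decomposition? m m′ g u v ⟧ * Φ m m′)))
          ≡⟨ ∑-∑₂-swap Z Z _ ⟨
        ∑ Z (λ g → ∑₂ Z (λ m m′ → ∑₂ Z (λ u v → ⟦ decomposition? m m′ g u v ⟧ * Φ m m′)))
          ≡⟨ ∑-cong′ Z (λ g → ∑₂-swap Z Z _) ⟩
        ∑ Z (λ g → ∑₂ Z (λ u v → ∑₂ Z (λ m m′ → ⟦ decomposition? m m′ g u v ⟧ * Φ m m′)))
          ≡⟨ ∑-cong′ Z (λ g → ∑₂-cong′ Z (collapse g)) ⟩
        ∑ Z (λ g → ∑₂ Z (λ u v → ⟦ coprime? u v ⟧ * Φ (g ℕ.* u) (g ℕ.* v))) ∎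
        where open ≡-Reasoning

module InghamIdentity where

  open import Data.Nat.Coprimality using (Coprime; coprime?; 0-coprimeTo-m⇒m≡1)
  open import Data.Nat.Divisibility
  open import Function.Bundles using (_⇔_; mk⇔; module Equivalence)
  open import Relation.Nullary.Decidable using (_×-dec_)
  open OrderedRationals hiding (∣_∣)
  open RationalSums
  open Congruences
  open ResidueSums
  open PairsByGcd

  record SupportedOnUnits (n : ℕ) {{_ : ℕ.NonZero n}} (h : ℕ → ℚ) : Set where
    field
      periodic : ∀ a b → a ≡ b mod n → h a ≡ h b
      support  : ∀ m → ¬ Coprime m n → h m ≡ 0ℚ

  module Gram (n : ℕ) {{_ : ℕ.NonZero n}} (1<n : 1 ℕ.< n) (h : ℕ → ℚ) (h-units : SupportedOnUnits n h) where

    open SupportedOnUnits h-units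

    gram : ℕ → ℕ → ℚ
    gram m m′ = ∑ n (λ k → h (k ℕ.* m) * h (k ℕ.* m′))

    h-zero : ∀ k m → ¬ Coprime m n → h (k ℕ.* m) ≡ 0ℚ
    h-zero k m m⊥̸n = support (k ℕ.* m) λ km⊥n → m⊥̸n (∣-coprime (n∣m*n k) km⊥n)

    gram-support : ∀ m m′ → ¬ (Coprime m n × Coprime m′ n) → gram m m′ ≡ 0ℚ
    gram-support m m′ ¬⊥n with coprime? m n
    ... | no  m⊥̸n = ∑-zero n λ k _ → x≡0⇒xy≡0 (h (k ℕ.* m′)) (h-zero k m m⊥̸n)
    ... | yes m⊥n = ∑-zero n λ k _ → y≡0⇒xy≡0 (h (k ℕ.* m)) (h-zero k m′ λ m′⊥n → ¬⊥n (m⊥n , m′⊥n))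

    0-not-coprime : ¬ Coprime 0 n
    0-not-coprime 0⊥n = ℕ.<⇒≢ 1<n (sym (0-coprimeTo-m⇒m≡1 0⊥n))

    gram-scale : ∀ {g} → Coprime g n → ∀ u v → gram (g ℕ.* u) (g ℕ.* v) ≡ gram u v
    gram-scale {g} g⊥n u v = trans
      (∑-cong′ n λ k → cong₂ (λ a b → h a * h b) (sym (ℕ.*-assoc k g u)) (sym (ℕ.*-assoc k g v)))
      (∑-rescale n g⊥n (λ k → h (k ℕ.* u) * h (k ℕ.* v)) λ a b a≡b →
        cong₂ _*_ (periodic _ _ (*-modʳ n u {a} {b} a≡b)) (periodic _ _ (*-modʳ n v {a} {b} a≡b)))

    gram-diagonal≥0 : 0ℚ ≤ gram 1 1
    gram-diagonal≥0 = ∑-nonNeg n λ k _ → sq≥0 (h (k ℕ.* 1))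

    gram-quadratic : ∀ Z (w : ℕ → ℚ) →
      ∑₂ Z (λ x y → w x * w y * gram x y) ≡
      ∑ n (λ k → ∑ Z (λ x → w x * h (k ℕ.* x)) * ∑ Z (λ x → w x * h (k ℕ.* x)))
    gram-quadratic Z w = begin
      ∑₂ Z (λ x y → w x * w y * gram x y)
        ≡⟨ ∑₂-cong′ Z (λ x y → ∑-*ˡ n (w x * w y) _) ⟩
      ∑₂ Z (λ x y → ∑ n (λ k → w x * w y * (h (k ℕ.* x) * h (k ℕ.* y))))
        ≡⟨ ∑-∑₂-swap n Z _ ⟨
      ∑ n (λ k → ∑₂ Z (λ x y → w x * w y * (h (k ℕ.* x) * h (k ℕ.* y))))
        ≡⟨ ∑-cong′ n (λ k → ∑₂-cong′ Z λ x y → interchange (w x) (w y) (h (k ℕ.* x)) (h (k ℕ.* y))) ⟩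
      ∑ n (λ k → ∑₂ Z (λ x y → w x * h (k ℕ.* x) * (w y * h (k ℕ.* y))))
        ≡⟨ ∑-cong′ n (λ k → ∑-*-∑ Z (λ x → w x * h (k ℕ.* x)) (λ x → w x * h (k ℕ.* x))) ⟨
      ∑ n (λ k → ∑ Z (λ x → w x * h (k ℕ.* x)) * ∑ Z (λ x → w x * h (k ℕ.* x))) ∎
      where
      open ≡-Reasoning

    module _ (Z N : ℕ) {{_ : ℕ.NonZero N}} (N<Z : N ℕ.< Z) (N⊥n : Coprime N n) where

      inghamSum : ℚ
      inghamSum = ∑₂ Z λ m m′ → ∑ Z (λ a → ⟦ m ℕ.* m′ ℕ.* a ∣? N ⟧) * gram m m′

      levelSum : ℕ → ℚ
      levelSum d = ∑₂ Z λ x y → ⟦ d ℕ.* d ℕ.* x ∣? N ⟧ * ⟦ d ℕ.* d ℕ.* y ∣? N ⟧ * gram x y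

      levelSum≥0 : ∀ d → 0ℚ ≤ levelSum d
      levelSum≥0 d = subst (0ℚ ≤_) (sym (gram-quadratic Z λ x → ⟦ d ℕ.* d ℕ.* x ∣? N ⟧))
        (∑-nonNeg n λ k _ → sq≥0 (∑ Z (λ x → ⟦ d ℕ.* d ℕ.* x ∣? N ⟧ * h (k ℕ.* x))))

      private
        divisor<Z : ∀ {m} → m ∣ N → m ℕ.< Z
        divisor<Z m∣N = ℕ.≤-<-trans (∣⇒≤ m∣N) N<Z

        gram-zero : ∀ {x} y → ¬ (0 ℕ.< x × 0 ℕ.< y) → gram x y ≡ 0ℚ
        gram-zero {zero}  y       _    = gram-support 0 y λ (0⊥n , _) → 0-not-coprime 0⊥n
        gram-zero {suc x} zero    _    = gram-support (suc x) 0 λ (_ , 0⊥n) → 0-not-coprime 0⊥n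
        gram-zero {suc x} (suc y) ¬0<  = ⊥-elim (¬0< (s≤s z≤n , s≤s z≤n))

        supportedBelow : ∀ (c : ℕ → ℕ → ℚ) → (∀ x y → ¬ (x ℕ.< Z × y ℕ.< Z) → c x y ≡ 0ℚ) →
                         SupportedBelow Z (λ x y → c x y * gram x y)
        supportedBelow c c≡0 x y ¬range with x ℕ.<? Z ×-dec y ℕ.<? Z
        ... | no  ¬<Z         = x≡0⇒xy≡0 (gram x y) (c≡0 x y ¬<Z)
        ... | yes (x<Z , y<Z) = y≡0⇒xy≡0 (c x y) (gram-zero y λ (0<x , 0<y) → ¬range ((0<x , x<Z) , (0<y , y<Z)))

        -- For coprime u and v, with m = gu and m′ = gv on the left, x = au and y = av on the right.
        divisibility-exchange : ∀ g {u v} a → Coprime u v →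
          (g ℕ.* u ℕ.* (g ℕ.* v) ℕ.* a ∣ N) ⇔ (g ℕ.* g ℕ.* (a ℕ.* u) ∣ N × g ℕ.* g ℕ.* (a ℕ.* v) ∣ N)
        divisibility-exchange g {u} {v} a u⊥v = mk⇔
          (λ d → m*n∣⇒m∣ (g ℕ.* g ℕ.* (a ℕ.* u)) v (subst (_∣ N) (split-u g u v a) d) ,
                 m*n∣⇒m∣ (g ℕ.* g ℕ.* (a ℕ.* v)) u (subst (_∣ N) (split-v g u v a) d))
          (λ (p , q) → subst (_∣ N) (merge g u v a) (coprime-product-∣ {g ℕ.* g ℕ.* a} {u} {v} u⊥v
            (subst (_∣ N) (sym (ℕ.*-assoc (g ℕ.* g) a u)) p) (subst (_∣ N) (sym (ℕ.*-assoc (g ℕ.* g) a v)) q)))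
          where
          split-u : ∀ g u v a → g ℕ.* u ℕ.* (g ℕ.* v) ℕ.* a ≡ g ℕ.* g ℕ.* (a ℕ.* u) ℕ.* v
          split-u = ℕ-Solver.solve-∀
          split-v : ∀ g u v a → g ℕ.* u ℕ.* (g ℕ.* v) ℕ.* a ≡ g ℕ.* g ℕ.* (a ℕ.* v) ℕ.* u
          split-v = ℕ-Solver.solve-∀
          merge : ∀ g u v a → g ℕ.* g ℕ.* a ℕ.* u ℕ.* v ≡ g ℕ.* u ℕ.* (g ℕ.* v) ℕ.* a
          merge = ℕ-Solver.solve-∀

        summand : (g a u v : ℕ) → ℚ
        summand g a u v = ⟦ coprime? u v ⟧ *
          (⟦ g ℕ.* g ℕ.* (a ℕ.* u) ∣? N ⟧ * ⟦ g ℕ.* g ℕ.* (a ℕ.* v) ∣? N ⟧ * gram (a ℕ.* u) (a ℕ.* v))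

        exchange : ∀ g u v a → ⟦ coprime? u v ⟧ *
          (⟦ g ℕ.* u ℕ.* (g ℕ.* v) ℕ.* a ∣? N ⟧ * gram (g ℕ.* u) (g ℕ.* v)) ≡ summand g a u v
        exchange g u v a = ⟦⟧*-cong (coprime? u v) λ u⊥v → let open Equivalence (divisibility-exchange g a u⊥v) in begin
          ⟦ guva∣?N ⟧ * gram (g ℕ.* u) (g ℕ.* v)
            ≡⟨ ⟦⟧*-cong guva∣?N (λ d → trans (gram-scale (∣-coprime (g∣ d) N⊥n) u v)
                                             (sym (gram-scale (∣-coprime (a∣ d) N⊥n) u v))) ⟩
          ⟦ guva∣?N ⟧ * gram (a ℕ.* u) (a ℕ.* v)
            ≡⟨ cong (_* gram (a ℕ.* u) (a ℕ.* v))
                 (trans (⟦⟧-cong guva∣?N (ggau∣?N ×-dec ggav∣?N) to from) (⟦⟧-× ggau∣?N ggav∣?N)) ⟩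
          ⟦ ggau∣?N ⟧ * ⟦ ggav∣?N ⟧ * gram (a ℕ.* u) (a ℕ.* v) ∎
          where
          open ≡-Reasoning
          guva∣?N : Dec (g ℕ.* u ℕ.* (g ℕ.* v) ℕ.* a ∣ N)
          guva∣?N = g ℕ.* u ℕ.* (g ℕ.* v) ℕ.* a ∣? N
          ggau∣?N : Dec (g ℕ.* g ℕ.* (a ℕ.* u) ∣ N)
          ggau∣?N = g ℕ.* g ℕ.* (a ℕ.* u) ∣? N
          ggav∣?N : Dec (g ℕ.* g ℕ.* (a ℕ.* v) ∣ N)
          ggav∣?N = g ℕ.* g ℕ.* (a ℕ.* v) ∣? N
          g∣ : g ℕ.* u ℕ.* (g ℕ.* v) ℕ.* a ∣ N → g ∣ N
          g∣ d = m*n∣⇒m∣ g u (m*n∣⇒m∣ (g ℕ.* u) (g ℕ.* v) (m*n∣⇒m∣ (g ℕ.* u ℕ.* (g ℕ.* v)) a d))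
          a∣ : g ℕ.* u ℕ.* (g ℕ.* v) ℕ.* a ∣ N → a ∣ N
          a∣ = m*n∣⇒n∣ (g ℕ.* u ℕ.* (g ℕ.* v)) a

      -- Both sides sum gram u v over coprime u, v and all g, a with g²auv ∣ N.
      ingham-identity : inghamSum ≡ ∑ Z levelSum
      ingham-identity = begin
        inghamSum
          ≡⟨ ∑-by-gcd Z _ (supportedBelow (λ m m′ → ∑ Z (λ a → ⟦ m ℕ.* m′ ℕ.* a ∣? N ⟧)) λ m m′ ¬<Z →
               ∑-zero Z λ a _ → ⟦⟧-no (m ℕ.* m′ ℕ.* a ∣? N) λ d → let mm′∣N = m*n∣⇒m∣ (m ℕ.* m′) a d in
                 ¬<Z (divisor<Z (m*n∣⇒m∣ m m′ mm′∣N) , divisor<Z (m*n∣⇒n∣ m m′ mm′∣N))) ⟩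
        ∑ Z (λ g → ∑₂ Z (λ u v → ⟦ coprime? u v ⟧ *
          (∑ Z (λ a → ⟦ g ℕ.* u ℕ.* (g ℕ.* v) ℕ.* a ∣? N ⟧) * gram (g ℕ.* u) (g ℕ.* v))))
          ≡⟨ ∑-cong′ Z (λ g → ∑₂-cong′ Z λ u v → trans (cong (⟦ coprime? u v ⟧ *_) (∑-*ʳ Z _ _))
               (trans (∑-*ˡ Z ⟦ coprime? u v ⟧ _) (∑-cong′ Z (exchange g u v)))) ⟩
        ∑ Z (λ g → ∑₂ Z (λ u v → ∑ Z (λ a → summand g a u v)))
          ≡⟨ ∑-cong′ Z (λ g → ∑-∑₂-swap Z Z (summand g)) ⟨
        ∑ Z (λ g → ∑ Z (λ a → ∑₂ Z (summand g a)))
          ≡⟨ ∑-cong′ Z (λ d → ∑-by-gcd Z _ (supportedBelow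
               (λ x y → ⟦ d ℕ.* d ℕ.* x ∣? N ⟧ * ⟦ d ℕ.* d ℕ.* y ∣? N ⟧) (outside d))) ⟨
        ∑ Z levelSum ∎
        where
        open ≡-Reasoning
        outside : ∀ d x y → ¬ (x ℕ.< Z × y ℕ.< Z) → ⟦ d ℕ.* d ℕ.* x ∣? N ⟧ * ⟦ d ℕ.* d ℕ.* y ∣? N ⟧ ≡ 0ℚ
        outside d x y ¬<Z = trans (sym (⟦⟧-× (d ℕ.* d ℕ.* x ∣? N) (d ℕ.* d ℕ.* y ∣? N)))
          (⟦⟧-no (d ℕ.* d ℕ.* x ∣? N ×-dec d ℕ.* d ℕ.* y ∣? N) λ (p , q) →
            ¬<Z (divisor<Z (m*n∣⇒n∣ (d ℕ.* d) x p) , divisor<Z (m*n∣⇒n∣ (d ℕ.* d) y q)))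

      inghamSum≥0 : 0ℚ ≤ inghamSum
      inghamSum≥0 = subst (0ℚ ≤_) (sym ingham-identity) (∑-nonNeg Z λ d _ → levelSum≥0 d)

      levelSum-root : ∀ D → D ℕ.* D ≡ N → levelSum D ≡ gram 1 1
      levelSum-root D D²≡N = trans (gram-quadratic Z λ x → ⟦ D ℕ.* D ℕ.* x ∣? N ⟧)
        (∑-cong′ n λ k → cong₂ _*_ (only-one k) (only-one k))
        where
        D²x∣N⇒x≡1 : ∀ x → D ℕ.* D ℕ.* x ∣ N → x ≡ 1
        D²x∣N⇒x≡1 x p = ∣1⇒≡1 (*-cancelˡ-∣ N
          (subst₂ _∣_ (cong (ℕ._* x) D²≡N) (sym (ℕ.*-identityʳ N)) p))
        D²∣N : D ℕ.* D ℕ.* 1 ∣ N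
        D²∣N = subst (_∣ N) (trans (sym D²≡N) (sym (ℕ.*-identityʳ (D ℕ.* D)))) ∣-refl
        only-one : ∀ k → ∑ Z (λ x → ⟦ D ℕ.* D ℕ.* x ∣? N ⟧ * h (k ℕ.* x)) ≡ h (k ℕ.* 1)
        only-one k = trans
          (∑-single Z 1 (ℕ.≤-<-trans (ℕ.>-nonZero⁻¹ N) N<Z) λ x _ x≢1 →
            ⟦⟧-no* (D ℕ.* D ℕ.* x ∣? N) (h (k ℕ.* x)) (x≢1 ∘ D²x∣N⇒x≡1 x))
          (⟦⟧-yes* (D ℕ.* D ℕ.* 1 ∣? N) (h (k ℕ.* 1)) D²∣N)

      inghamSum-square : ∀ D → D ℕ.* D ≡ N → gram 1 1 ≤ inghamSum
      inghamSum-square D D²≡N = begin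
        gram 1 1      ≡⟨ levelSum-root D D²≡N ⟨
        levelSum D    ≤⟨ term≤∑ Z D (divisor<Z (divides D (sym D²≡N))) (λ d _ → levelSum≥0 d) ⟩
        ∑ Z levelSum  ≡⟨ ingham-identity ⟨
        inghamSum     ∎
        where open ≤-Reasoning

module Sawtooth where

  open import Relation.Binary.Definitions using (Tri; tri<; tri≈; tri>)
  open OrderedRationals
  open RationalSums

  infix 8 _⁺

  _⁺ : ℚ → ℚ
  x ⁺ = 0ℚ ⊔ x

  0≤x⇒x⁺≡x : ∀ {x} → 0ℚ ≤ x → x ⁺ ≡ x
  0≤x⇒x⁺≡x = p≤q⇒p⊔q≡q

  x≤0⇒x⁺≡0 : ∀ {x} → x ≤ 0ℚ → x ⁺ ≡ 0ℚ
  x≤0⇒x⁺≡0 = p≥q⇒p⊔q≡p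

  x⁺≥0 : ∀ x → 0ℚ ≤ x ⁺
  x⁺≥0 x = p≤p⊔q 0ℚ x

  *-distribˡ-⁺ : ∀ {c} → 0ℚ ≤ c → ∀ x → c * x ⁺ ≡ (c * x) ⁺
  *-distribˡ-⁺ {c} 0≤c x =
    trans (*-distribˡ-⊔-nonNeg c {{nonNegative 0≤c}} 0ℚ x) (cong (_⊔ (c * x)) (*-zeroʳ c))

  -- For 0 ≤ Y ≤ Z this is θ(1 − θ), with θ the fractional part of Y.
  sawtooth : ℕ → ℚ → ℚ
  sawtooth Z Y = 2ℚ * ∑ Z (λ a → (Y - ι (suc a)) ⁺) - Y * Y + Y

  private
    2∑-arithmetic : ∀ Y J → 2ℚ * ∑ J (λ a → Y - ι (suc a)) ≡ ι J * (Y + Y - ι J - 1ℚ)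
    2∑-arithmetic Y zero    = sym (ι-0* (Y + Y - ι 0 - 1ℚ))
    2∑-arithmetic Y (suc J) = begin
      2ℚ * ∑ (suc J) f
        ≡⟨ trans (cong (2ℚ *_) (∑-last J f)) (*-distribˡ-+ 2ℚ (∑ J f) (f J)) ⟩
      2ℚ * ∑ J f + 2ℚ * f J
        ≡⟨ cong₂ _+_ (2∑-arithmetic Y J) (cong (λ z → 2ℚ * (Y - z)) (ι-suc J)) ⟩
      ι J * (Y + Y - ι J - 1ℚ) + 2ℚ * (Y - (1ℚ + ι J))
        ≡⟨ append (ι J) Y ⟩
      (1ℚ + ι J) * (Y + Y - (1ℚ + ι J) - 1ℚ)
        ≡⟨ cong (λ z → z * (Y + Y - z - 1ℚ)) (ι-suc J) ⟨
      ι (suc J) * (Y + Y - ι (suc J) - 1ℚ) ∎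
      where
      open ≡-Reasoning
      f : ℕ → ℚ
      f a = Y - ι (suc a)
      append : ∀ j y → j * (y + y - j - 1ℚ) + 2ℚ * (y - (1ℚ + j)) ≡ (1ℚ + j) * (y + y - (1ℚ + j) - 1ℚ)
      append = solve-∀ ringℚ

    1+j-y≡1-[y-j] : ∀ j y → 1ℚ + j - y ≡ 1ℚ - (y - j)
    1+j-y≡1-[y-j] = solve-∀ ringℚ

  sawtooth-floor : ∀ Z Y J → J ℕ.≤ Z → ι J ≤ Y → Y < ι (suc J) → sawtooth Z Y ≡ (Y - ι J) * (1ℚ - (Y - ι J))
  sawtooth-floor Z Y J J≤Z J≤Y Y<1+J = begin
    2ℚ * ∑ Z f - Y * Y + Y                      ≡⟨ cong (λ s → 2ℚ * s - Y * Y + Y) (∑-extend f J≤Z above) ⟩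
    2ℚ * ∑ J f - Y * Y + Y                      ≡⟨ cong (λ s → 2ℚ * s - Y * Y + Y) (∑-cong J below) ⟩
    2ℚ * ∑ J (λ a → Y - ι (suc a)) - Y * Y + Y  ≡⟨ cong (λ s → s - Y * Y + Y) (2∑-arithmetic Y J) ⟩
    ι J * (Y + Y - ι J - 1ℚ) - Y * Y + Y        ≡⟨ complete-square (ι J) Y ⟩
    (Y - ι J) * (1ℚ - (Y - ι J))                ∎
    where
    open ≡-Reasoning
    f : ℕ → ℚ
    f a = (Y - ι (suc a)) ⁺
    complete-square : ∀ j y → j * (y + y - j - 1ℚ) - y * y + y ≡ (y - j) * (1ℚ - (y - j))
    complete-square = solve-∀ ringℚ
    below : ∀ a → a ℕ.< J → f a ≡ Y - ι (suc a)
    below a a<J = 0≤x⇒x⁺≡x (x≤y⇒0≤y-x (≤-trans (ι-mono a<J) J≤Y))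
    above : ∀ a → J ℕ.≤ a → f a ≡ 0ℚ
    above a J≤a = x≤0⇒x⁺≡0 (subst (Y - ι (suc a) ≤_) (+-inverseʳ (ι (suc a)))
      (+-monoˡ-≤ (- ι (suc a)) (≤-trans (<⇒≤ Y<1+J) (ι-mono (s≤s J≤a)))))

  private
    parabola-Lipschitz : ∀ {g t t′} → t′ * t′ ≤ g + t * t → (1ℚ - t) * (1ℚ - t) ≤ g + (1ℚ - t′) * (1ℚ - t′) →
                         ∣ t * (1ℚ - t) - t′ * (1ℚ - t′) ∣ ≤ g + (t - t′)
    parabola-Lipschitz {g} {t} {t′} t′²≤ [1-t]²≤ = ∣x∣≤
      (≤-slack (g + t * t - t′ * t′) (x≤y⇒0≤y-x t′²≤) (upper g t t′))
      (≤-slack (g + (1ℚ - t′) * (1ℚ - t′) - (1ℚ - t) * (1ℚ - t)) (x≤y⇒0≤y-x [1-t]²≤) (lower g t t′))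
      where
      upper : ∀ g t u → t * (1ℚ - t) - u * (1ℚ - u) + (g + t * t - u * u) ≡ g + (t - u)
      upper = solve-∀ ringℚ
      lower : ∀ g t u → - (t * (1ℚ - t) - u * (1ℚ - u)) + (g + (1ℚ - u) * (1ℚ - u) - (1ℚ - t) * (1ℚ - t)) ≡
         g + (t - u)
      lower = solve-∀ ringℚ

    x²≤g+y² : ∀ {x g} y → 0ℚ ≤ x → x ≤ 1ℚ → 1ℚ ≤ g → x * x ≤ g + y * y
    x²≤g+y² {x} {g} y 0≤x x≤1 1≤g = begin
      x * x      ≤⟨ *-mono 0≤x x≤1 0≤x x≤1 ⟩
      1ℚ         ≤⟨ 1≤g ⟩
      g          ≤⟨ ≤-slack (y * y) (sq≥0 y) refl ⟩
      g + y * y  ∎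
      where open ≤-Reasoning

    x²≤0+y² : ∀ {x y} → 0ℚ ≤ x → x ≤ y → x * x ≤ 0ℚ + y * y
    x²≤0+y² {x} {y} 0≤x x≤y = subst (x * x ≤_) (sym (+-identityˡ (y * y))) (*-mono 0≤x x≤y 0≤x x≤y)

  module _ (Z : ℕ) where

    private
      record Floor (Y : ℚ) : Set where
        field
          J     : ℕ
          J≤Y   : ι J ≤ Y
          Y<1+J : Y < ι (suc J)
          value : sawtooth Z Y ≡ (Y - ι J) * (1ℚ - (Y - ι J))

        θ : ℚ
        θ = Y - ι J

        0≤θ : 0ℚ ≤ θ
        0≤θ = x≤y⇒0≤y-x J≤Y

        0≤1-θ : 0ℚ ≤ 1ℚ - θ
        0≤1-θ = subst (0ℚ ≤_) (trans (cong (_- Y) (ι-suc J)) (1+j-y≡1-[y-j] (ι J) Y)) (x≤y⇒0≤y-x (<⇒≤ Y<1+J))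

        θ≤1 : θ ≤ 1ℚ
        θ≤1 = ≤-slack (1ℚ - θ) 0≤1-θ (restore θ)
          where
          restore : ∀ t → t + (1ℚ - t) ≡ 1ℚ
          restore = solve-∀ ringℚ

        1-θ≤1 : 1ℚ - θ ≤ 1ℚ
        1-θ≤1 = ≤-slack θ 0≤θ (restore θ)
          where
          restore : ∀ t → 1ℚ - t + t ≡ 1ℚ
          restore = solve-∀ ringℚ

      floor-of : ∀ Y → 0ℚ ≤ Y → Y ≤ ι Z → Floor Y
      floor-of Y 0≤Y Y≤Z with ℕ-floor Y 0≤Y
      ... | J , J≤Y , Y<1+J = record { J = J ; J≤Y = J≤Y ; Y<1+J = Y<1+J ; value = sawtooth-floor Z Y J J≤Z J≤Y Y<1+J }
        where
        J≤Z : J ℕ.≤ Z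
        J≤Z = ℕ.≮⇒≥ λ Z<J → <⇒≱ (<-≤-trans (<-slack 1ℚ 0<1 (trans (+-comm (ι Z) 1ℚ) (sym (ι-suc Z)))) (ι-mono Z<J))
                                  (≤-trans J≤Y Y≤Z)

    sawtooth≥0 : ∀ Y → 0ℚ ≤ Y → Y ≤ ι Z → 0ℚ ≤ sawtooth Z Y
    sawtooth≥0 Y 0≤Y Y≤Z = subst (0ℚ ≤_) (sym value) (*≥0 0≤θ 0≤1-θ)
      where open Floor (floor-of Y 0≤Y Y≤Z)

    sawtooth≤id : ∀ Y → 0ℚ ≤ Y → Y ≤ ι Z → sawtooth Z Y ≤ Y
    sawtooth≤id Y 0≤Y Y≤Z = begin
      sawtooth Z Y  ≡⟨ value ⟩
      θ * (1ℚ - θ)  ≤⟨ ≤-slack (θ * θ + ι J) (+≥0 (sq≥0 θ) (ι≥0 J)) (restore (ι J) Y) ⟩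
      Y             ∎
      where
      open ≤-Reasoning
      open Floor (floor-of Y 0≤Y Y≤Z)
      restore : ∀ j y → (y - j) * (1ℚ - (y - j)) + ((y - j) * (y - j) + j) ≡ y
      restore = solve-∀ ringℚ

    sawtooth-Lipschitz : ∀ Y Y′ → 0ℚ ≤ Y′ → Y′ ≤ Y → Y ≤ ι Z → ∣ sawtooth Z Y - sawtooth Z Y′ ∣ ≤ Y - Y′
    sawtooth-Lipschitz Y Y′ 0≤Y′ Y′≤Y Y≤Z = begin
      ∣ sawtooth Z Y - sawtooth Z Y′ ∣           ≡⟨ cong₂ (λ a b → ∣ a - b ∣) F.value F′.value ⟩
      ∣ F.θ * (1ℚ - F.θ) - F′.θ * (1ℚ - F′.θ) ∣  ≤⟨ by-floors (ℕ.<-cmp F′.J F.J) ⟩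
      (ι F.J - ι F′.J) + (F.θ - F′.θ)            ≡⟨ recombine Y Y′ (ι F.J) (ι F′.J) ⟩
      Y - Y′                                     ∎
      where
      open ≤-Reasoning
      module F  = Floor (floor-of Y (≤-trans 0≤Y′ Y′≤Y) Y≤Z)
      module F′ = Floor (floor-of Y′ 0≤Y′ (≤-trans Y′≤Y Y≤Z))
      recombine : ∀ y y′ j j′ → (j - j′) + ((y - j) - (y′ - j′)) ≡ y - y′
      recombine = solve-∀ ringℚ
      j-[1+i]≡[j-i]-1 : ∀ i j → 1ℚ + (j - (1ℚ + i)) ≡ j - i
      j-[1+i]≡[j-i]-1 = solve-∀ ringℚ
      by-floors : Tri (F′.J ℕ.< F.J) (F′.J ≡ F.J) (F.J ℕ.< F′.J) →
                  ∣ F.θ * (1ℚ - F.θ) - F′.θ * (1ℚ - F′.θ) ∣ ≤ (ι F.J - ι F′.J) + (F.θ - F′.θ)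
      by-floors (tri> _ _ J<J′) = ⊥-elim (<⇒≱ F.Y<1+J (≤-trans (ι-mono J<J′) (≤-trans F′.J≤Y Y′≤Y)))
      by-floors (tri≈ _ J′≡J _) = subst (λ g → ∣ F.θ * (1ℚ - F.θ) - F′.θ * (1ℚ - F′.θ) ∣ ≤ g + (F.θ - F′.θ))
        (sym same)
        (parabola-Lipschitz {0ℚ} {F.θ} {F′.θ} (x²≤0+y² F′.0≤θ θ′≤θ)
          (x²≤0+y² F.0≤1-θ (+-monoʳ-≤ 1ℚ (neg-antimono-≤ θ′≤θ))))
        where
        same : ι F.J - ι F′.J ≡ 0ℚ
        same = trans (cong (λ J → ι F.J - ι J) J′≡J) (+-inverseʳ (ι F.J))
        θ′≤θ : F′.θ ≤ F.θ
        θ′≤θ = subst (λ J → Y′ - ι J ≤ F.θ) (sym J′≡J) (+-monoˡ-≤ (- ι F.J) Y′≤Y)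
      by-floors (tri< J′<J _ _) = parabola-Lipschitz {ι F.J - ι F′.J} {F.θ} {F′.θ}
        (x²≤g+y² F.θ F′.0≤θ F′.θ≤1 1≤J-J′) (x²≤g+y² (1ℚ - F′.θ) F.0≤1-θ F.1-θ≤1 1≤J-J′)
        where
        1≤J-J′ : 1ℚ ≤ ι F.J - ι F′.J
        1≤J-J′ = ≤-slack (ι F.J - (1ℚ + ι F′.J)) (x≤y⇒0≤y-x (subst (_≤ ι F.J) (ι-suc F′.J) (ι-mono J′<J)))
          (j-[1+i]≡[j-i]-1 (ι F′.J) (ι F.J))

module SmoothedSums where

  open OrderedRationals
  open RationalSums
  open Sawtooth

  cutoff : ℚ → ℚ
  cutoff s = (1ℚ - s) ⁺

  cutoff≥0 : ∀ s → 0ℚ ≤ cutoff s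
  cutoff≥0 s = x⁺≥0 (1ℚ - s)

  cutoff≤1 : ∀ {s} → 0ℚ ≤ s → cutoff s ≤ 1ℚ
  cutoff≤1 {s} 0≤s = subst (cutoff s ≤_) (0≤x⇒x⁺≡x 0≤1)
    (⊔-monoʳ-≤ 0ℚ {1ℚ} {1ℚ - s} (≤-slack s 0≤s (restore s)))
    where
    restore : ∀ s → 1ℚ - s + s ≡ 1ℚ
    restore = solve-∀ ringℚ

  1≤s⇒cutoff≡0 : ∀ {s} → 1ℚ ≤ s → cutoff s ≡ 0ℚ
  1≤s⇒cutoff≡0 {s} 1≤s = x≤0⇒x⁺≡0 (subst (1ℚ - s ≤_) (+-inverseʳ s) (+-monoˡ-≤ (- s) 1≤s))

  s≤½⇒½≤cutoff : ∀ {s} → s ≤ ½ → ½ ≤ cutoff s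
  s≤½⇒½≤cutoff {s} s≤½ = ≤-trans (≤-slack (½ - s) (x≤y⇒0≤y-x s≤½) (restore s)) (p≤q⊔p 0ℚ (1ℚ - s))
    where
    restore : ∀ s → ½ + (½ - s) ≡ 1ℚ - s
    restore = solve-∀ ringℚ

  smoothingLoss : ℕ → ℚ
  smoothingLoss Z = 4ℚ + 2ℚ * harmonic (suc Z)

  smoothingLoss≥0 : ∀ Z → 0ℚ ≤ smoothingLoss Z
  smoothingLoss≥0 Z = +≥0 (+≥0 0≤2 0≤2) (*≥0 0≤2 (harmonic≥0 (suc Z)))

  module Smoothing (Z : ℕ) (z : ℚ) (0<z : 0ℚ < z) (1≤Zz : 1ℚ ≤ ι Z * z) where

    scale reach remainder cutoffSum : ℕ → ℚ
    scale m     = ι (suc m) * z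
    reach m     = inv (scale m)
    remainder m = scale m * sawtooth Z (reach m)
    cutoffSum m = ∑ Z (λ a → cutoff (ι (suc m) * ι (suc a) * z))

    private
      scale>0 : ∀ m → 0ℚ < scale m
      scale>0 m = *>0 (ι>0 (suc m)) 0<z

      scale-suc : ∀ m → scale (suc m) ≡ scale m + z
      scale-suc m = ι-suc* (suc m) z

      scale*reach≡1 : ∀ m → scale m * reach m ≡ 1ℚ
      scale*reach≡1 m = *-inv⁺ (scale>0 m)

      reach≥0 : ∀ m → 0ℚ ≤ reach m
      reach≥0 m = inv≥0 (scale>0 m)

      z*reach≡inv : ∀ m → z * reach m ≡ inv (ι (suc m))
      z*reach≡inv m = inv-unique (ι>0 (suc m)) (trans (sym (*-assoc (ι (suc m)) z (reach m))) (scale*reach≡1 m))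

      reach-antimono : ∀ m → reach (suc m) ≤ reach m
      reach-antimono m = inv-antimono (scale>0 m) (≤-slack z (<⇒≤ 0<z) (sym (scale-suc m)))

      reach≤Z : ∀ m → reach m ≤ ι Z
      reach≤Z m = *-cancelˡ-≤ (scale>0 m) (begin
        scale m * reach m  ≡⟨ scale*reach≡1 m ⟩
        1ℚ                 ≤⟨ 1≤Zz ⟩
        ι Z * z            ≤⟨ *-monoˡ (ι≥0 Z) (1≤x⇒y≤x*y (ι≥1 (suc m)) (<⇒≤ 0<z)) ⟩
        ι Z * scale m      ≡⟨ *-comm (ι Z) (scale m) ⟩
        scale m * ι Z      ∎)
        where open ≤-Reasoning

    2*cutoffSum : ∀ m → 2ℚ * cutoffSum m ≡ reach m - 1ℚ + remainder m
    2*cutoffSum m = begin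
      2ℚ * cutoffSum m                                ≡⟨ cong (2ℚ *_) (∑-cong′ Z term) ⟨
      2ℚ * ∑ Z (λ a → u * (Y - ι (suc a)) ⁺)          ≡⟨ cong (2ℚ *_) (∑-*ˡ Z u _) ⟨
      2ℚ * (u * S)                                    ≡⟨ insert-square u Y S ⟩
      Y * (u * Y) - u * Y + u * (2ℚ * S - Y * Y + Y)  ≡⟨ cong (λ o → Y * o - o + remainder m) (scale*reach≡1 m) ⟩
      Y * 1ℚ - 1ℚ + remainder m                       ≡⟨ cong (λ y → y - 1ℚ + remainder m) (*-identityʳ Y) ⟩
      Y - 1ℚ + remainder m                            ∎
      where
      open ≡-Reasoning
      u Y S : ℚ
      u = scale m
      Y = reach m
      S = ∑ Z (λ a → (Y - ι (suc a)) ⁺)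
      insert-square : ∀ u y s → 2ℚ * (u * s) ≡ y * (u * y) - u * y + u * (2ℚ * s - y * y + y)
      insert-square = solve-∀ ringℚ
      distribute : ∀ i z y a → i * z * (y - a) ≡ i * z * y - i * a * z
      distribute = solve-∀ ringℚ
      term : ∀ a → u * (Y - ι (suc a)) ⁺ ≡ cutoff (ι (suc m) * ι (suc a) * z)
      term a = trans (*-distribˡ-⁺ (<⇒≤ (scale>0 m)) (Y - ι (suc a))) (cong _⁺ (trans
        (distribute (ι (suc m)) z Y (ι (suc a)))
        (cong (_- ι (suc m) * ι (suc a) * z) (scale*reach≡1 m))))

    remainder≥0 : ∀ m → 0ℚ ≤ remainder m
    remainder≥0 m = *≥0 (<⇒≤ (scale>0 m)) (sawtooth≥0 Z (reach m) (reach≥0 m) (reach≤Z m))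

    remainder≤1 : ∀ m → remainder m ≤ 1ℚ
    remainder≤1 m = subst (remainder m ≤_) (scale*reach≡1 m)
      (*-monoˡ (<⇒≤ (scale>0 m)) (sawtooth≤id Z (reach m) (reach≥0 m) (reach≤Z m)))

    remainder-variation : ∀ m → ∣ remainder m - remainder (suc m) ∣ ≤ 2ℚ * inv (ι (suc (suc m)))
    remainder-variation m = begin
      ∣ u * T₁ - scale (suc m) * T₂ ∣  ≡⟨ cong (λ s → ∣ u * T₁ - s * T₂ ∣) (scale-suc m) ⟩
      ∣ u * T₁ - (u + z) * T₂ ∣        ≡⟨ cong ∣_∣ (split u z T₁ T₂) ⟩
      ∣ u * (T₁ - T₂) - z * T₂ ∣       ≤⟨ ∣x-y∣≤ (∣x*y∣≤ (0≤x⇒∣x∣≤ (<⇒≤ (scale>0 m)) ≤-refl) T-Lipschitz)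
                                                      (∣x*y∣≤ (0≤x⇒∣x∣≤ (<⇒≤ 0<z) ≤-refl) (0≤x⇒∣x∣≤ T₂≥0 T₂≤Y₂)) ⟩
      u * (Y₁ - Y₂) + z * Y₂           ≡⟨ regroup u z Y₁ Y₂ ⟩
      u * Y₁ - (u + z) * Y₂ + 2ℚ * (z * Y₂) ≡⟨ cong (λ s → u * Y₁ - s * Y₂ + 2ℚ * (z * Y₂)) (scale-suc m) ⟨
      u * Y₁ - scale (suc m) * Y₂ + 2ℚ * (z * Y₂)
        ≡⟨ cong₂ (λ a b → a - b + 2ℚ * (z * Y₂)) (scale*reach≡1 m) (scale*reach≡1 (suc m)) ⟩
      1ℚ - 1ℚ + 2ℚ * (z * Y₂)          ≡⟨ +-identityˡ (2ℚ * (z * Y₂)) ⟩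
      2ℚ * (z * Y₂)                    ≡⟨ cong (2ℚ *_) (z*reach≡inv (suc m)) ⟩
      2ℚ * inv (ι (suc (suc m)))       ∎
      where
      open ≤-Reasoning
      u Y₁ Y₂ T₁ T₂ : ℚ
      u  = scale m
      Y₁ = reach m
      Y₂ = reach (suc m)
      T₁ = sawtooth Z Y₁
      T₂ = sawtooth Z Y₂
      T₂≥0 : 0ℚ ≤ T₂
      T₂≥0 = sawtooth≥0 Z Y₂ (reach≥0 (suc m)) (reach≤Z (suc m))
      T₂≤Y₂ : T₂ ≤ Y₂
      T₂≤Y₂ = sawtooth≤id Z Y₂ (reach≥0 (suc m)) (reach≤Z (suc m))
      T-Lipschitz : ∣ T₁ - T₂ ∣ ≤ Y₁ - Y₂
      T-Lipschitz = sawtooth-Lipschitz Z Y₁ Y₂ (reach≥0 (suc m)) (reach-antimono m) (reach≤Z m)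
      split : ∀ u z s t → u * s - (u + z) * t ≡ u * (s - t) - z * t
      split = solve-∀ ringℚ
      regroup : ∀ u z s t → u * (s - t) + z * t ≡ u * s - (u + z) * t + 2ℚ * (z * t)
      regroup = solve-∀ ringℚ

    module _ (f : ℕ → ℚ) (C : ℚ) (0≤C : 0ℚ ≤ C) (∑f≤C : ∀ i → ∣ ∑ i f ∣ ≤ C)
      (∑f/m≤C/Z : ι Z * ∣ ∑ Z (λ m → f m * inv (ι (suc m))) ∣ ≤ C) where

      private
        main-term-bound : ∣ ∑ Z (λ m → f m * reach m) ∣ ≤ C
        main-term-bound = begin
          ∣ ∑ Z (λ m → f m * reach m) ∣  ≡⟨ cong ∣_∣ (trans (∑-cong′ Z factor) (sym (∑-*ˡ Z (inv z) _))) ⟩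
          ∣ inv z * S ∣                  ≡⟨ ∣p*q∣≡∣p∣*∣q∣ (inv z) S ⟩
          ∣ inv z ∣ * ∣ S ∣              ≤⟨ *-monoʳ (0≤∣p∣ S) (0≤x⇒∣x∣≤ (inv≥0 0<z) inv≤Z) ⟩
          ι Z * ∣ S ∣                    ≤⟨ ∑f/m≤C/Z ⟩
          C                              ∎
          where
          open ≤-Reasoning
          S : ℚ
          S = ∑ Z (λ m → f m * inv (ι (suc m)))
          inv≤Z : inv z ≤ ι Z
          inv≤Z = *-cancelˡ-≤ 0<z (subst₂ _≤_ (sym (*-inv⁺ 0<z)) (*-comm (ι Z) z) 1≤Zz)
          regroup : ∀ f y z i → f * y * (z * i) ≡ i * (f * (z * y))
          regroup = solve-∀ ringℚ
          factor : ∀ m → f m * reach m ≡ inv z * (f m * inv (ι (suc m)))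
          factor m = begin-equality
            f m * reach m                    ≡⟨ *-inv-cancelʳ 0<z (f m * reach m) ⟨
            f m * reach m * (z * inv z)      ≡⟨ regroup (f m) (reach m) z (inv z) ⟩
            inv z * (f m * (z * reach m))    ≡⟨ cong (λ y → inv z * (f m * y)) (z*reach≡inv m) ⟩
            inv z * (f m * inv (ι (suc m)))  ∎

        remainder-term-bound : ∣ ∑ Z (λ m → f m * remainder m) ∣ ≤ C * (1ℚ + 2ℚ * harmonic (suc Z))
        remainder-term-bound = up-to Z refl
          where
          tail≤harmonic : ∀ N → ∑ N (λ i → inv (ι (suc (suc i)))) ≤ harmonic (suc (suc N))
          tail≤harmonic N = begin
            ∑ N (λ i → inv (ι (suc (suc i))))         ≤⟨ ≤-slack _ (inv≥0 (ι>0 1)) (+-comm _ (inv (ι 1))) ⟩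
            harmonic (suc N)                          ≤⟨ ≤-slack _ (inv≥0 (ι>0 (suc (suc N)))) refl ⟩
            harmonic (suc N) + inv (ι (suc (suc N)))  ≡⟨ ∑-last (suc N) (λ i → inv (ι (suc i))) ⟨
            harmonic (suc (suc N))                    ∎
            where open ≤-Reasoning

          up-to : ∀ N → N ≡ Z → ∣ ∑ N (λ m → f m * remainder m) ∣ ≤ C * (1ℚ + 2ℚ * harmonic (suc Z))
          up-to zero    refl = *≥0 0≤C (+≥0 0≤1 (*≥0 0≤2 (harmonic≥0 (suc Z))))
          up-to (suc N) refl = begin
            ∣ ∑ (suc N) (λ m → f m * remainder m) ∣
              ≤⟨ ∣∑∣≤-by-parts N f remainder _ C 0≤C ∑f≤C (λ i _ → remainder-variation i) ⟩
            C * (∣ remainder N ∣ + ∑ N (λ i → 2ℚ * inv (ι (suc (suc i)))))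
              ≤⟨ *-monoˡ 0≤C (+-mono-≤ (0≤x⇒∣x∣≤ (remainder≥0 N) (remainder≤1 N))
                   (subst (_≤ 2ℚ * harmonic (suc Z)) (∑-*ˡ N 2ℚ _) (*-monoˡ 0≤2 (tail≤harmonic N)))) ⟩
            C * (1ℚ + 2ℚ * harmonic (suc Z)) ∎
            where open ≤-Reasoning

        2*smoothed-sum : 2ℚ * ∑ Z (λ m → f m * cutoffSum m) ≡
                         ∑ Z (λ m → f m * reach m) - ∑ Z f + ∑ Z (λ m → f m * remainder m)
        2*smoothed-sum = begin
          2ℚ * ∑ Z (λ m → f m * cutoffSum m)
            ≡⟨ ∑-*ˡ Z 2ℚ _ ⟩
          ∑ Z (λ m → 2ℚ * (f m * cutoffSum m))
            ≡⟨ ∑-cong′ Z (λ m → trans (commute (f m) (cutoffSum m)) (trans (cong (f m *_) (2*cutoffSum m))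
                                      (distribute (f m) (reach m) (remainder m)))) ⟩
          ∑ Z (λ m → f m * reach m - f m + f m * remainder m)
            ≡⟨ ∑-+ Z (λ m → f m * reach m - f m) (λ m → f m * remainder m) ⟩
          ∑ Z (λ m → f m * reach m - f m) + ∑ Z (λ m → f m * remainder m)
            ≡⟨ cong (_+ ∑ Z (λ m → f m * remainder m)) (∑-sub Z (λ m → f m * reach m) f) ⟩
          ∑ Z (λ m → f m * reach m) - ∑ Z f + ∑ Z (λ m → f m * remainder m) ∎
          where
          open ≡-Reasoning
          commute : ∀ f s → 2ℚ * (f * s) ≡ f * (2ℚ * s)
          commute = solve-∀ ringℚ
          distribute : ∀ f y r → f * (y - 1ℚ + r) ≡ f * y - f + f * r
          distribute = solve-∀ ringℚ

      -- The main term Σ f(m)/(mz) is small by the hypothesis on Σ f(m)/m; the remainder has bounded variation.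
      smoothed-sum-bound : ∣ ∑ Z (λ m → f m * cutoffSum m) ∣ ≤ C * smoothingLoss Z
      smoothed-sum-bound = begin
        ∣ S ∣
          ≤⟨ ∣x∣≤∣c*x∣ S 1≤2 ⟩
        ∣ 2ℚ * S ∣
          ≡⟨ cong ∣_∣ 2*smoothed-sum ⟩
        ∣ ∑ Z (λ m → f m * reach m) - ∑ Z f + ∑ Z (λ m → f m * remainder m) ∣
          ≤⟨ ∣x+y∣≤ (∣x-y∣≤ main-term-bound (∑f≤C Z)) remainder-term-bound ⟩
        C + C + C * (1ℚ + 2ℚ * harmonic (suc Z))
          ≤⟨ ≤-slack C 0≤C (collect C (2ℚ * harmonic (suc Z))) ⟩
        C * smoothingLoss Z ∎
        where
        open ≤-Reasoning
        S : ℚ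
        S = ∑ Z (λ m → f m * cutoffSum m)
        collect : ∀ c x → c + c + c * (1ℚ + x) + c ≡ c * (4ℚ + x)
        collect = solve-∀ ringℚ

module MöbiusInversion where

  open import Data.Nat.Coprimality using (coprime?; coprime⇒gcd≡1; gcd≡1⇒coprime)
  open import Data.Nat.Divisibility
  open import Data.Nat.GCD
  open import Relation.Nullary.Decidable using (_×-dec_)
  open OrderedRationals hiding (∣_∣)
  open RationalSums

  record IsMöbius (G : ℕ) (μ : ℕ → ℚ) : Set where
    field inversion : ∀ g → 0 ℕ.< g → g ℕ.≤ G → ∑ (suc G) (λ δ → ⟦ δ ∣? g ⟧ * μ δ) ≡ ⟦ g ℕ.≟ 1 ⟧

  open IsMöbius

  private
    override : (ℕ → ℚ) → ℕ → ℚ → ℕ → ℚ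
    override f k x i with i ℕ.≟ k
    ... | yes _ = x
    ... | no _  = f i

    override-same : ∀ f k x → override f k x k ≡ x
    override-same f k x with k ℕ.≟ k
    ... | yes _  = refl
    ... | no k≢k = ⊥-elim (k≢k refl)

    override-other : ∀ f k x i → i ℕ.< k → override f k x i ≡ f i
    override-other f k x i i<k with i ℕ.≟ k
    ... | yes refl = ⊥-elim (ℕ.<-irrefl refl i<k)
    ... | no _     = refl

  möbius : ∀ G → ∃ (IsMöbius G)
  möbius zero    = (λ _ → 0ℚ) , record { inversion = λ g 0<g g≤0 → ⊥-elim (ℕ.<⇒≱ 0<g g≤0) }
  möbius (suc G) = μ′ , record { inversion = inversion′ }
    where
    μ : ℕ → ℚ
    μ = proj₁ (möbius G)
    S : ℕ → ℚ
    S g = ∑ (suc G) (λ δ → ⟦ δ ∣? g ⟧ * μ δ)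
    x : ℚ
    x = ⟦ suc G ℕ.≟ 1 ⟧ - S (suc G)
    μ′ : ℕ → ℚ
    μ′ = override μ (suc G) x
    extend : ∀ g → ∑ (suc (suc G)) (λ δ → ⟦ δ ∣? g ⟧ * μ′ δ) ≡ S g + ⟦ suc G ∣? g ⟧ * x
    extend g = trans (∑-last (suc G) (λ δ → ⟦ δ ∣? g ⟧ * μ′ δ)) (cong₂ _+_
      (∑-cong (suc G) λ δ δ≤G → cong (⟦ δ ∣? g ⟧ *_) (override-other μ (suc G) x δ δ≤G))
      (cong (⟦ suc G ∣? g ⟧ *_) (override-same μ (suc G) x)))
    complete : ∀ s o → s + (o - s) ≡ o
    complete = solve-∀ ringℚ
    inversion′ : ∀ g → 0 ℕ.< g → g ℕ.≤ suc G → ∑ (suc (suc G)) (λ δ → ⟦ δ ∣? g ⟧ * μ′ δ) ≡ ⟦ g ℕ.≟ 1 ⟧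
    inversion′ g 0<g g≤1+G with ℕ.m≤n⇒m<n∨m≡n g≤1+G
    ... | inj₁ (s≤s g≤G) = trans (extend g) (trans
            (cong₂ _+_ (inversion (proj₂ (möbius G)) g 0<g g≤G)
              (⟦⟧-no* (suc G ∣? g) x λ 1+G∣g → ℕ.<⇒≱ (s≤s g≤G) (∣⇒≤ {{ℕ.>-nonZero 0<g}} 1+G∣g)))
            (+-identityʳ ⟦ g ℕ.≟ 1 ⟧))
    ... | inj₂ refl = trans (extend (suc G)) (trans
            (cong (S (suc G) +_) (⟦⟧-yes* (suc G ∣? suc G) x ∣-refl))
            (complete (S (suc G)) ⟦ suc G ℕ.≟ 1 ⟧))

  coprime-möbius : ∀ {n μ} .{{_ : ℕ.NonZero n}} → IsMöbius n μ → ∀ a →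
                   ⟦ coprime? a n ⟧ ≡ ∑ (suc n) (λ δ → ⟦ δ ∣? a ⟧ * (⟦ δ ∣? n ⟧ * μ δ))
  coprime-möbius {n} {μ} isMöbius a = begin
    ⟦ coprime? a n ⟧
      ≡⟨ ⟦⟧-cong (coprime? a n) (gcd a n ℕ.≟ 1) coprime⇒gcd≡1 gcd≡1⇒coprime ⟩
    ⟦ gcd a n ℕ.≟ 1 ⟧
      ≡⟨ inversion isMöbius (gcd a n) (ℕ.n≢0⇒n>0 (gcd[m,n]≢0 a n (inj₂ (ℕ.≢-nonZero⁻¹ n)))) (gcd[m,n]≤n a n) ⟨
    ∑ (suc n) (λ δ → ⟦ δ ∣? gcd a n ⟧ * μ δ)
      ≡⟨ ∑-cong′ (suc n) (λ δ → trans (cong (_* μ δ) (∣gcd δ)) (*-assoc ⟦ δ ∣? a ⟧ ⟦ δ ∣? n ⟧ (μ δ))) ⟩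
    ∑ (suc n) (λ δ → ⟦ δ ∣? a ⟧ * (⟦ δ ∣? n ⟧ * μ δ)) ∎
    where
    open ≡-Reasoning
    ∣gcd : ∀ δ → ⟦ δ ∣? gcd a n ⟧ ≡ ⟦ δ ∣? a ⟧ * ⟦ δ ∣? n ⟧
    ∣gcd δ = trans
      (⟦⟧-cong (δ ∣? gcd a n) (δ ∣? a ×-dec δ ∣? n)
        (λ d → ∣-trans d (gcd[m,n]∣m a n) , ∣-trans d (gcd[m,n]∣n a n)) λ (δ∣a , δ∣n) → gcd-greatest δ∣a δ∣n)
      (⟦⟧-× (δ ∣? a) (δ ∣? n))

  ∑-multiples : ∀ Z δ .{{_ : ℕ.NonZero δ}} (f : ℕ → ℚ) → (∀ j → Z ℕ.< j → f j ≡ 0ℚ) →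
                ∑ Z (λ a → ⟦ δ ∣? suc a ⟧ * f (suc a)) ≡ ∑ Z (λ b → f (δ ℕ.* suc b))
  ∑-multiples Z δ f f≡0 = begin
    ∑ Z (λ a → ⟦ δ ∣? suc a ⟧ * f (suc a))
      ≡⟨ ∑-cong Z (λ a a<Z → cong (_* f (suc a)) (cofactors a a<Z)) ⟨
    ∑ Z (λ a → ∑ Z (λ b → ⟦ suc a ℕ.≟ δ ℕ.* suc b ⟧) * f (suc a))
      ≡⟨ ∑-cong′ Z (λ a → ∑-*ʳ Z (f (suc a)) (λ b → ⟦ suc a ℕ.≟ δ ℕ.* suc b ⟧)) ⟩
    ∑ Z (λ a → ∑ Z (λ b → ⟦ suc a ℕ.≟ δ ℕ.* suc b ⟧ * f (suc a)))
      ≡⟨ ∑-swap Z Z _ ⟩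
    ∑ Z (λ b → ∑ Z (λ a → ⟦ suc a ℕ.≟ δ ℕ.* suc b ⟧ * f (suc a)))
      ≡⟨ ∑-cong′ Z (λ b → select (δ ℕ.* suc b) {{ℕ.m*n≢0 δ (suc b)}}) ⟩
    ∑ Z (λ b → f (δ ℕ.* suc b)) ∎
    where
    open ≡-Reasoning
    select : ∀ k .{{_ : ℕ.NonZero k}} → ∑ Z (λ a → ⟦ suc a ℕ.≟ k ⟧ * f (suc a)) ≡ f k
    select (suc k) = trans
      (∑-cong′ Z λ a → cong (_* f (suc a)) (⟦⟧-cong (suc a ℕ.≟ suc k) (a ℕ.≟ k) ℕ.suc-injective (cong suc)))
      (∑-select Z (f ∘ suc) k λ Z≤k → f≡0 (suc k) (s≤s Z≤k))
    cofactors : ∀ a → a ℕ.< Z → ∑ Z (λ b → ⟦ suc a ℕ.≟ δ ℕ.* suc b ⟧) ≡ ⟦ δ ∣? suc a ⟧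
    cofactors a a<Z with δ ∣? suc a
    ... | no δ∤1+a = ∑-zero Z λ b _ → ⟦⟧-no (suc a ℕ.≟ δ ℕ.* suc b) λ 1+a≡δb →
                       δ∤1+a (divides (suc b) (trans 1+a≡δb (ℕ.*-comm δ (suc b))))
    ... | yes (divides zero ())
    ... | yes (divides (suc b₀) 1+a≡b₀δ) = trans
      (∑-single Z b₀ b₀<Z λ b _ b≢b₀ → ⟦⟧-no (suc a ℕ.≟ δ ℕ.* suc b) λ 1+a≡δb →
        b≢b₀ (ℕ.suc-injective (ℕ.*-cancelˡ-≡ (suc b) (suc b₀) δ (trans (sym 1+a≡δb) 1+a≡δb₀))))
      (⟦⟧-yes (suc a ℕ.≟ δ ℕ.* suc b₀) 1+a≡δb₀)
      where
      1+a≡δb₀ : suc a ≡ δ ℕ.* suc b₀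
      1+a≡δb₀ = trans 1+a≡b₀δ (ℕ.*-comm (suc b₀) δ)
      b₀<Z : b₀ ℕ.< Z
      b₀<Z = ℕ.≤-trans (ℕ.m≤m*n (suc b₀) δ) (ℕ.≤-trans (ℕ.≤-reflexive (sym 1+a≡b₀δ)) a<Z)

module CoprimeSmoothing where

  open import Data.Nat.Coprimality using (coprime?)
  open import Data.Nat.Divisibility using (_∣?_; 0∣⇒≡0)
  open OrderedRationals
  open RationalSums
  open SmoothedSums
  open MöbiusInversion

  module _ (n : ℕ) {{_ : ℕ.NonZero n}} where

    private
      μ : ℕ → ℚ
      μ = proj₁ (möbius n)

    möbiusNorm : ℚ
    möbiusNorm = ∑ (suc n) (λ δ → ∣ μ δ ∣)

    möbiusNorm≥0 : 0ℚ ≤ möbiusNorm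
    möbiusNorm≥0 = ∑-nonNeg (suc n) λ δ _ → 0≤∣p∣ (μ δ)

    module _ (Z : ℕ) (z : ℚ) (0<z : 0ℚ < z) (1≤Zz : 1ℚ ≤ ι Z * z) where

      private
        weight : ℕ → ℕ → ℚ
        weight m a = cutoff (ι (suc m) * ι a * z)

        coefficient : ℕ → ℚ
        coefficient δ = ⟦ δ ∣? n ⟧ * μ δ

        multiplesSum : ℕ → ℕ → ℚ
        multiplesSum δ m = ∑ Z (λ a → ⟦ δ ∣? suc a ⟧ * weight m (suc a))

      coprimeCutoffSum : ℕ → ℚ
      coprimeCutoffSum m = ∑ Z (λ a → ⟦ coprime? (suc a) n ⟧ * cutoff (ι (suc m) * ι (suc a) * z))

      private
        coprimeCutoffSum-möbius : ∀ m → coprimeCutoffSum m ≡ ∑ (suc n) (λ δ → coefficient δ * multiplesSum δ m)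
        coprimeCutoffSum-möbius m = begin
          ∑ Z (λ a → ⟦ coprime? (suc a) n ⟧ * weight m (suc a))
            ≡⟨ ∑-cong′ Z (λ a → trans (cong (_* weight m (suc a)) (coprime-möbius (proj₂ (möbius n)) (suc a)))
                                      (∑-*ʳ (suc n) (weight m (suc a)) λ δ → ⟦ δ ∣? suc a ⟧ * coefficient δ)) ⟩
          ∑ Z (λ a → ∑ (suc n) (λ δ → ⟦ δ ∣? suc a ⟧ * coefficient δ * weight m (suc a)))
            ≡⟨ ∑-swap Z (suc n) (λ a δ → ⟦ δ ∣? suc a ⟧ * coefficient δ * weight m (suc a)) ⟩
          ∑ (suc n) (λ δ → ∑ Z (λ a → ⟦ δ ∣? suc a ⟧ * coefficient δ * weight m (suc a)))
            ≡⟨ ∑-cong′ (suc n) (λ δ → trans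
                 (∑-cong′ Z λ a → xy∙z≈y∙xz ⟦ δ ∣? suc a ⟧ (coefficient δ) (weight m (suc a)))
                 (sym (∑-*ˡ Z (coefficient δ) _))) ⟩
          ∑ (suc n) (λ δ → coefficient δ * multiplesSum δ m) ∎
          where open ≡-Reasoning

        multiplesSum-rescale : ∀ δ .{{_ : ℕ.NonZero δ}} m →
          multiplesSum δ m ≡ ∑ Z (λ b → cutoff (ι (suc m) * ι (suc b) * (ι δ * z)))
        multiplesSum-rescale δ m = trans (∑-multiples Z δ (weight m) beyond)
          (∑-cong′ Z λ b → cong cutoff (trans (cong (λ x → ι (suc m) * x * z) (ι-* δ (suc b)))
                                              (regroup (ι (suc m)) (ι δ) (ι (suc b)) z)))
          where
          open ≤-Reasoning
          regroup : ∀ m d b z → m * (d * b) * z ≡ m * b * (d * z)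
          regroup = solve-∀ ringℚ
          beyond : ∀ j → Z ℕ.< j → weight m j ≡ 0ℚ
          beyond j Z<j = 1≤s⇒cutoff≡0 (begin
            1ℚ                   ≤⟨ 1≤Zz ⟩
            ι Z * z
              ≤⟨ *-monoʳ (<⇒≤ 0<z) (≤-trans (ι-mono (ℕ.<⇒≤ Z<j)) (1≤x⇒y≤x*y (ι≥1 (suc m)) (ι≥0 j))) ⟩
            ι (suc m) * ι j * z  ∎)

      module _ (f : ℕ → ℚ) (C : ℚ) (0≤C : 0ℚ ≤ C) (∑f≤C : ∀ i → ∣ ∑ i f ∣ ≤ C)
        (∑f/m≤C/Z : ι Z * ∣ ∑ Z (λ m → f m * inv (ι (suc m))) ∣ ≤ C) where

        private
          bound : ℚ
          bound = C * smoothingLoss Z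

          multiples-bound : ∀ δ .{{_ : ℕ.NonZero δ}} → ∣ ∑ Z (λ m → f m * multiplesSum δ m) ∣ ≤ bound
          multiples-bound δ = subst (λ S → ∣ S ∣ ≤ bound)
            (∑-cong′ Z λ m → cong (f m *_) (sym (multiplesSum-rescale δ m)))
            (Smoothing.smoothed-sum-bound Z (ι δ * z) (*>0 (ι>0 δ) 0<z) 1≤Zδz f C 0≤C ∑f≤C ∑f/m≤C/Z)
            where
            1≤Zδz : 1ℚ ≤ ι Z * (ι δ * z)
            1≤Zδz = ≤-trans 1≤Zz (*-monoˡ (ι≥0 Z) (1≤x⇒y≤x*y (ι≥1 δ) (<⇒≤ 0<z)))

          term-bound : ∀ δ → ∣ coefficient δ * ∑ Z (λ m → f m * multiplesSum δ m) ∣ ≤ ∣ μ δ ∣ * bound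
          term-bound zero      = subst (λ x → ∣ x ∣ ≤ ∣ μ 0 ∣ * bound)
            (sym (x≡0⇒xy≡0 _ (⟦⟧-no* (0 ∣? n) (μ 0) λ 0∣n → ℕ.≢-nonZero⁻¹ n (0∣⇒≡0 0∣n))))
            (*≥0 (0≤∣p∣ (μ 0)) (*≥0 0≤C (smoothingLoss≥0 Z)))
          term-bound δ@(suc _) = ∣x*y∣≤ coefficient≤μ (multiples-bound δ)
            where
            coefficient≤μ : ∣ coefficient δ ∣ ≤ ∣ μ δ ∣
            coefficient≤μ = subst (∣ coefficient δ ∣ ≤_) (*-identityˡ ∣ μ δ ∣)
              (∣x*y∣≤ (∣⟦⟧∣≤1 (δ ∣? n)) ≤-refl)

        coprime-smoothed-sum-bound : ∣ ∑ Z (λ m → f m * coprimeCutoffSum m) ∣ ≤ möbiusNorm * (C * smoothingLoss Z)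
        coprime-smoothed-sum-bound = begin
          ∣ ∑ Z (λ m → f m * coprimeCutoffSum m) ∣
            ≡⟨ cong ∣_∣ (∑-cong′ Z λ m → trans (cong (f m *_) (coprimeCutoffSum-möbius m))
                 (∑-*ˡ (suc n) (f m) λ δ → coefficient δ * multiplesSum δ m)) ⟩
          ∣ ∑ Z (λ m → ∑ (suc n) (λ δ → f m * (coefficient δ * multiplesSum δ m))) ∣
            ≡⟨ cong ∣_∣ (∑-swap Z (suc n) λ m δ → f m * (coefficient δ * multiplesSum δ m)) ⟩
          ∣ ∑ (suc n) (λ δ → ∑ Z (λ m → f m * (coefficient δ * multiplesSum δ m))) ∣
            ≡⟨ cong ∣_∣ (∑-cong′ (suc n) λ δ → trans
                 (∑-cong′ Z λ m → x∙yz≈y∙xz (f m) (coefficient δ) (multiplesSum δ m))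
                   (sym (∑-*ˡ Z (coefficient δ) _))) ⟩
          ∣ ∑ (suc n) (λ δ → coefficient δ * ∑ Z (λ m → f m * multiplesSum δ m)) ∣
            ≤⟨ ∣∑∣≤∑ (suc n) (λ δ _ → term-bound δ) ⟩
          ∑ (suc n) (λ δ → ∣ μ δ ∣ * bound)
            ≡⟨ ∑-*ʳ (suc n) bound (λ δ → ∣ μ δ ∣) ⟨
          möbiusNorm * bound ∎
          where open ≤-Reasoning

module GeometricScales where

  open OrderedRationals
  open RationalSums
  open SmoothedSums

  cutoff-antimono : ∀ {s t} → s ≤ t → cutoff t ≤ cutoff s
  cutoff-antimono {s} {t} s≤t = ⊔-monoʳ-≤ 0ℚ {1ℚ - s} {1ℚ - t} (+-monoʳ-≤ 1ℚ (neg-antimono-≤ s≤t))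

  cutoff-dilate : ∀ {ρ η x} → 1ℚ ≤ ρ → ρ - 1ℚ ≤ η → 0ℚ ≤ x → ∣ cutoff (ρ * x) - cutoff x ∣ ≤ η
  cutoff-dilate {ρ} {η} {x} 1≤ρ ρ-1≤η 0≤x = begin
    ∣ cutoff (ρ * x) - cutoff x ∣  ≡⟨ ∣x-y∣≡∣y-x∣ (cutoff (ρ * x)) (cutoff x) ⟩
    ∣ cutoff x - cutoff (ρ * x) ∣  ≤⟨ 0≤x⇒∣x∣≤ (x≤y⇒0≤y-x (cutoff-antimono (1≤x⇒y≤x*y 1≤ρ 0≤x))) drop≤ρ-1 ⟩
    ρ - 1ℚ                         ≤⟨ ρ-1≤η ⟩
    η                              ∎
    where
    open ≤-Reasoning
    difference : ∀ r x v → 1ℚ - x - v + ((v - (1ℚ - r * x)) + (r - 1ℚ) * (1ℚ - x)) ≡ r - 1ℚ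
    difference = solve-∀ ringℚ
    drop≤ρ-1 : cutoff x - cutoff (ρ * x) ≤ ρ - 1ℚ
    drop≤ρ-1 with ≤-total 1ℚ x
    ... | inj₁ 1≤x = subst (_≤ ρ - 1ℚ)
      (sym (cong₂ _-_ (1≤s⇒cutoff≡0 1≤x) (1≤s⇒cutoff≡0 (≤-trans 1≤x (1≤x⇒y≤x*y 1≤ρ 0≤x))))) (x≤y⇒0≤y-x 1≤ρ)
    ... | inj₂ x≤1 = begin
      cutoff x - v  ≡⟨ cong (_- v) (Sawtooth.0≤x⇒x⁺≡x (x≤y⇒0≤y-x x≤1)) ⟩
      1ℚ - x - v    ≤⟨ ≤-slack ((v - (1ℚ - ρ * x)) + (ρ - 1ℚ) * (1ℚ - x))
                           (+≥0 (x≤y⇒0≤y-x (p≤q⊔p 0ℚ (1ℚ - ρ * x))) (*≥0 (x≤y⇒0≤y-x 1≤ρ) (x≤y⇒0≤y-x x≤1)))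
                           (difference ρ x v) ⟩
      ρ - 1ℚ        ∎
      where
      v : ℚ
      v = cutoff (ρ * x)

  module Scales (η : ℚ) (0<η : 0ℚ < η) where

    q p : ℚ
    q = 1ℚ + η
    p = inv q

    1≤q : 1ℚ ≤ q
    1≤q = ≤-slack η (<⇒≤ 0<η) refl

    0<q : 0ℚ < q
    0<q = <-≤-trans 0<1 1≤q

    0<p : 0ℚ < p
    0<p = inv>0 0<q

    p≤1 : p ≤ 1ℚ
    p≤1 = 1≤x⇒inv≤1 1≤q

    pq≡1 : p * q ≡ 1ℚ
    pq≡1 = trans (*-comm p q) (*-inv⁺ 0<q)

    window : ℕ → ℕ → ℚ
    window i M = cutoff (ι M * p ^ i)

    private
      ιp≥0 : ∀ i M → 0ℚ ≤ ι M * p ^ i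
      ιp≥0 i M = *≥0 (ι≥0 M) (^≥0 0<p i)

      ιp-antimono : ∀ M {i j} → i ℕ.≤ j → ι M * p ^ j ≤ ι M * p ^ i
      ιp-antimono M i≤j = *-monoˡ (ι≥0 M) (^-antimono 0<p p≤1 i≤j)

    window≥0 : ∀ i M → 0ℚ ≤ window i M
    window≥0 i M = cutoff≥0 (ι M * p ^ i)

    ∣window∣≤1 : ∀ i M → ∣ window i M ∣ ≤ 1ℚ
    ∣window∣≤1 i M = 0≤x⇒∣x∣≤ (window≥0 i M) (cutoff≤1 (ιp≥0 i M))

    coupled : ℕ → ℕ → ℕ → ℚ
    coupled I M M′ = ∑ (suc I) (λ i → window i M * window (I ∸ i) M′)

    merged : ℕ → ℕ → ℚ
    merged I = coupled I 1

    merged≥0 : ∀ I N → 0ℚ ≤ merged I N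
    merged≥0 I N = ∑-nonNeg (suc I) λ i _ → *≥0 (window≥0 i 1) (window≥0 (I ∸ i) N)

    merged-zero : ∀ I N → 1ℚ ≤ ι N * p ^ I → merged I N ≡ 0ℚ
    merged-zero I N 1≤Np^I = ∑-zero (suc I) λ i _ → y≡0⇒xy≡0 (window i 1)
      (1≤s⇒cutoff≡0 (≤-trans 1≤Np^I (ιp-antimono N (ℕ.m∸n≤m I i))))

    merged-lower-bound : ∀ J L N → p ^ J ≤ ½ → ι N * p ^ L ≤ ½ → ι J * (½ * ½) ≤ merged (J ℕ.+ (J ℕ.+ L)) N
    merged-lower-bound J L N p^J≤½ Np^L≤½ = begin
      ι J * (½ * ½)
        ≡⟨ ∑-const J (½ * ½) ⟨
      ∑ J (λ _ → ½ * ½)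
        ≤⟨ ∑-mono J (λ j j<J → *-mono 0≤½ (s≤½⇒½≤cutoff (first j)) 0≤½ (s≤½⇒½≤cutoff (second j j<J))) ⟩
      ∑ J (λ j → f (J ℕ.+ j))
        ≤⟨ ≤-slack _ (∑-nonNeg (suc L) λ j _ → f≥0 (J ℕ.+ (J ℕ.+ j))) refl ⟩
      ∑ J (λ j → f (J ℕ.+ j)) + ∑ (suc L) (λ j → f (J ℕ.+ (J ℕ.+ j)))
        ≡⟨ ∑-split J (suc L) (λ j → f (J ℕ.+ j)) ⟨
      ∑ (J ℕ.+ suc L) (λ j → f (J ℕ.+ j))
        ≤⟨ ≤-slack (∑ J f) (∑-nonNeg J λ j _ → f≥0 j) (+-comm _ (∑ J f)) ⟩
      ∑ J f + ∑ (J ℕ.+ suc L) (λ j → f (J ℕ.+ j))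
        ≡⟨ ∑-split J (J ℕ.+ suc L) f ⟨
      ∑ (J ℕ.+ (J ℕ.+ suc L)) f
        ≡⟨ cong (λ k → ∑ k f) (trans (cong (J ℕ.+_) (ℕ.+-suc J L)) (ℕ.+-suc J (J ℕ.+ L))) ⟩
      merged I N ∎
      where
      open ≤-Reasoning
      I : ℕ
      I = J ℕ.+ (J ℕ.+ L)
      f : ℕ → ℚ
      f i = window i 1 * window (I ∸ i) N
      f≥0 : ∀ i → 0ℚ ≤ f i
      f≥0 i = *≥0 (window≥0 i 1) (window≥0 (I ∸ i) N)
      first : ∀ j → ι 1 * p ^ (J ℕ.+ j) ≤ ½
      first j = begin
        ι 1 * p ^ (J ℕ.+ j)  ≡⟨ ι-1* (p ^ (J ℕ.+ j)) ⟩
        p ^ (J ℕ.+ j)        ≤⟨ ^-antimono 0<p p≤1 (ℕ.m≤m+n J j) ⟩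
        p ^ J                ≤⟨ p^J≤½ ⟩
        ½                    ∎
      L≤I-j : ∀ j → j ℕ.< J → L ℕ.≤ I ∸ (J ℕ.+ j)
      L≤I-j j j<J = ℕ.≤-trans (ℕ.≤-reflexive (sym (ℕ.m+n∸m≡n j L)))
        (ℕ.≤-trans (ℕ.∸-monoˡ-≤ j (ℕ.+-monoˡ-≤ L (ℕ.<⇒≤ j<J)))
          (ℕ.≤-reflexive (sym (ℕ.[m+n]∸[m+o]≡n∸o J (J ℕ.+ L) j))))
      second : ∀ j → j ℕ.< J → ι N * p ^ (I ∸ (J ℕ.+ j)) ≤ ½
      second j j<J = ≤-trans (ιp-antimono N (L≤I-j j j<J)) Np^L≤½

    private
      coupled-zero : ∀ I M M′ → 1ℚ ≤ ι M * p ^ I → coupled I M M′ ≡ 0ℚ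
      coupled-zero I M M′ 1≤Mp^I = ∑-zero (suc I) λ { i (s≤s i≤I) → x≡0⇒xy≡0 (window (I ∸ i) M′)
        (1≤s⇒cutoff≡0 (≤-trans 1≤Mp^I (ιp-antimono M i≤I))) }

      last-scale : ∀ M .{{_ : ℕ.NonZero M}} I → ι M * p ^ I < 1ℚ →
                   ∃₂ λ s L → s ℕ.+ L ≡ I × 1ℚ ≤ ι M * p ^ s × ι M * p ^ suc s < 1ℚ
      last-scale M zero    M<1 = ⊥-elim (<⇒≱ M<1 (subst (1ℚ ≤_) (sym (*-identityʳ (ι M))) (ι≥1 M)))
      last-scale M (suc I) Mp<1 with 1ℚ ≤? ι M * p ^ I
      ... | yes 1≤Mp^I = I , 1 , ℕ.+-comm I 1 , 1≤Mp^I , Mp<1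
      ... | no  1≰Mp^I with last-scale M I (≰⇒> 1≰Mp^I)
      ...   | s , L , s+L≡I , 1≤Mp^s , Mp^1+s<1 =
              s , suc L , trans (ℕ.+-suc s L) (cong suc s+L≡I) , 1≤Mp^s , Mp^1+s<1

      -- s is the last scale at which M is outside the window, so M p^s is within η of 1 and shifting
      -- all indices by s replaces the pair (M , M′) by (1 , M M′).
      module Shift (M M′ : ℕ) {{_ : ℕ.NonZero M}} {{_ : ℕ.NonZero M′}} (s L : ℕ)
        (1≤ρ : 1ℚ ≤ ι M * p ^ s) (Mp^1+s<1 : ι M * p ^ suc s < 1ℚ) where

        ρ : ℚ
        ρ = ι M * p ^ s

        ρ-1≤η : ρ - 1ℚ ≤ η
        ρ-1≤η = ≤-slack ((1ℚ - ι M * p ^ suc s) * q)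
          (*≥0 (x≤y⇒0≤y-x (<⇒≤ Mp^1+s<1)) (<⇒≤ 0<q)) (begin
          ρ - 1ℚ + (1ℚ - ι M * (p * p ^ s)) * q  ≡⟨ expand (ι M) (p ^ s) p η ⟩
          ρ - 1ℚ + (1ℚ + η - ρ * (p * q))        ≡⟨ cong (λ o → ρ - 1ℚ + (1ℚ + η - ρ * o)) pq≡1 ⟩
          ρ - 1ℚ + (1ℚ + η - ρ * 1ℚ)             ≡⟨ cancel ρ η ⟩
          η                                      ∎)
          where
          open ≡-Reasoning
          expand : ∀ m x p e → m * x - 1ℚ + (1ℚ - m * (p * x)) * (1ℚ + e) ≡
            m * x - 1ℚ + (1ℚ + e - m * x * (p * (1ℚ + e)))
          expand = solve-∀ ringℚ
          cancel : ∀ r e → r - 1ℚ + (1ℚ + e - r * 1ℚ) ≡ e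
          cancel = solve-∀ ringℚ

        coupledTerm mergedTerm : ℕ → ℚ
        coupledTerm j = window (s ℕ.+ j) M * window (L ∸ j) M′
        mergedTerm j  = window j 1 * window (s ℕ.+ (L ∸ j)) (M ℕ.* M′)

        coupled-tail : coupled (s ℕ.+ L) M M′ ≡ ∑ (suc L) coupledTerm
        coupled-tail = begin
          ∑ (suc (s ℕ.+ L)) f                    ≡⟨ cong (λ N → ∑ N f) (ℕ.+-suc s L) ⟨
          ∑ (s ℕ.+ suc L) f                      ≡⟨ ∑-split s (suc L) f ⟩
          ∑ s f + ∑ (suc L) (λ j → f (s ℕ.+ j))  ≡⟨ cong₂ _+_ (∑-zero s outside) (∑-cong′ (suc L) reindex) ⟩
          0ℚ + ∑ (suc L) coupledTerm             ≡⟨ +-identityˡ (∑ (suc L) coupledTerm) ⟩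
          ∑ (suc L) coupledTerm                  ∎
          where
          open ≡-Reasoning
          f : ℕ → ℚ
          f i = window i M * window (s ℕ.+ L ∸ i) M′
          outside : ∀ i → i ℕ.< s → f i ≡ 0ℚ
          outside i i<s = x≡0⇒xy≡0 (window (s ℕ.+ L ∸ i) M′)
            (1≤s⇒cutoff≡0 (≤-trans 1≤ρ (ιp-antimono M (ℕ.<⇒≤ i<s))))
          reindex : ∀ j → f (s ℕ.+ j) ≡ coupledTerm j
          reindex j = cong (λ k → window (s ℕ.+ j) M * window k M′) (ℕ.[m+n]∸[m+o]≡n∸o s L j)

        merged-head : merged (s ℕ.+ L) (M ℕ.* M′) ≡ ∑ (suc L) mergedTerm
        merged-head = begin
          ∑ (suc (s ℕ.+ L)) f                        ≡⟨ cong (λ N → ∑ (suc N) f) (ℕ.+-comm s L) ⟩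
          ∑ (suc L ℕ.+ s) f                          ≡⟨ ∑-split (suc L) s f ⟩
          ∑ (suc L) f + ∑ s (λ j → f (suc L ℕ.+ j))  ≡⟨ cong₂ _+_ (∑-cong (suc L) reindex) (∑-zero s outside) ⟩
          ∑ (suc L) mergedTerm + 0ℚ                  ≡⟨ +-identityʳ (∑ (suc L) mergedTerm) ⟩
          ∑ (suc L) mergedTerm                       ∎
          where
          open ≡-Reasoning
          f : ℕ → ℚ
          f j = window j 1 * window (s ℕ.+ L ∸ j) (M ℕ.* M′)
          reindex : ∀ j → j ℕ.< suc L → f j ≡ mergedTerm j
          reindex j (s≤s j≤L) = cong (λ k → window j 1 * window k (M ℕ.* M′)) (ℕ.+-∸-assoc s j≤L)
          index≤s : ∀ j → s ℕ.+ L ∸ (suc L ℕ.+ j) ℕ.≤ s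
          index≤s j = ℕ.≤-trans (ℕ.∸-monoʳ-≤ (s ℕ.+ L) (ℕ.≤-trans (ℕ.n≤1+n L) (ℕ.m≤m+n (suc L) j)))
            (ℕ.≤-reflexive (ℕ.m+n∸n≡m s L))
          outside : ∀ j → j ℕ.< s → f (suc L ℕ.+ j) ≡ 0ℚ
          outside j _ = y≡0⇒xy≡0 (window (suc L ℕ.+ j) 1) (1≤s⇒cutoff≡0 (≤-trans 1≤ρ
            (*-mono (ι≥0 M) (ι-mono (ℕ.m≤m*n M M′)) (^≥0 0<p s) (^-antimono 0<p p≤1 (index≤s j)))))

        terms-close : ∀ j → ∣ coupledTerm j - mergedTerm j ∣ ≤ η + η
        terms-close j = ∣product-difference∣≤ first second (∣window∣≤1 (s ℕ.+ j) M)
          (∣window∣≤1 (s ℕ.+ (L ∸ j)) (M ℕ.* M′))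
          where
          open ≡-Reasoning
          argument₁ : ρ * p ^ j ≡ ι M * p ^ (s ℕ.+ j)
          argument₁ = trans (*-assoc (ι M) (p ^ s) (p ^ j)) (cong (ι M *_) (sym (^-homo-* p s j)))
          first : ∣ window (s ℕ.+ j) M - window j 1 ∣ ≤ η
          first = subst₂ (λ x y → ∣ cutoff x - cutoff y ∣ ≤ η) argument₁ (sym (ι-1* (p ^ j)))
            (cutoff-dilate 1≤ρ ρ-1≤η (^≥0 0<p j))
          argument₂ : ρ * (ι M′ * p ^ (L ∸ j)) ≡ ι (M ℕ.* M′) * p ^ (s ℕ.+ (L ∸ j))
          argument₂ = begin
            ι M * p ^ s * (ι M′ * p ^ (L ∸ j))  ≡⟨ interchange (ι M) (p ^ s) (ι M′) (p ^ (L ∸ j)) ⟩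
            ι M * ι M′ * (p ^ s * p ^ (L ∸ j))  ≡⟨ cong₂ _*_ (ι-* M M′) (^-homo-* p s (L ∸ j)) ⟨
            ι (M ℕ.* M′) * p ^ (s ℕ.+ (L ∸ j))  ∎
          second : ∣ window (L ∸ j) M′ - window (s ℕ.+ (L ∸ j)) (M ℕ.* M′) ∣ ≤ η
          second = subst (_≤ η) (trans (∣x-y∣≡∣y-x∣ (cutoff (ρ * (ι M′ * p ^ (L ∸ j)))) (window (L ∸ j) M′))
                                       (cong (λ x → ∣ window (L ∸ j) M′ - cutoff x ∣) argument₂))
            (cutoff-dilate 1≤ρ ρ-1≤η (ιp≥0 (L ∸ j) M′))

    private
      η+η≥0 : 0ℚ ≤ η + η
      η+η≥0 = +≥0 (<⇒≤ 0<η) (<⇒≤ 0<η)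

    coupled≈merged : ∀ I M M′ {{_ : ℕ.NonZero M}} {{_ : ℕ.NonZero M′}} →
                     ∣ coupled I M M′ - merged I (M ℕ.* M′) ∣ ≤ ι (suc I) * (η + η)
    coupled≈merged I M M′ with 1ℚ ≤? ι M * p ^ I
    ... | yes 1≤Mp^I = subst (λ x → ∣ x ∣ ≤ ι (suc I) * (η + η))
      (sym (cong₂ _-_ (coupled-zero I M M′ 1≤Mp^I) (merged-zero I (M ℕ.* M′)
        (≤-trans 1≤Mp^I (*-monoʳ (^≥0 0<p I) (ι-mono (ℕ.m≤m*n M M′)))))))
      (*≥0 (ι≥0 (suc I)) η+η≥0)
    ... | no 1≰Mp^I with last-scale M I (≰⇒> 1≰Mp^I)
    ...   | s , L , refl , 1≤ρ , Mp^1+s<1 = begin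
      ∣ coupled (s ℕ.+ L) M M′ - merged (s ℕ.+ L) (M ℕ.* M′) ∣  ≡⟨ cong ∣_∣ (cong₂ _-_ coupled-tail merged-head) ⟩
      ∣ ∑ (suc L) coupledTerm - ∑ (suc L) mergedTerm ∣          ≡⟨ cong ∣_∣ (∑-sub (suc L) coupledTerm mergedTerm) ⟨
      ∣ ∑ (suc L) (λ j → coupledTerm j - mergedTerm j) ∣        ≤⟨ ∣∑∣≤const (suc L) (λ j _ → terms-close j) ⟩
      ι (suc L) * (η + η)                                       ≤⟨ *-monoʳ η+η≥0 (ι-mono (s≤s (ℕ.m≤n+m L s))) ⟩
      ι (suc (s ℕ.+ L)) * (η + η)                               ∎
      where
      open ≤-Reasoning
      open Shift M M′ s L 1≤ρ Mp^1+s<1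

module InghamMeans where

  open import Data.Nat.Coprimality using (Coprime; coprime?)
  open import Data.Nat.Divisibility
  open OrderedRationals
  open RationalSums
  open Congruences
  open InghamIdentity
  open SmoothedSums
  open CoprimeSmoothing
  open GeometricScales

  -- With this rate Σ h(km)/m = 0 for every k.
  record VanishingSeries (h : ℕ → ℚ) (C : ℚ) : Set where
    field
      C≥0            : 0ℚ ≤ C
      sums-bounded   : ∀ k x → ∣ ∑ x (λ m → h (k ℕ.* m)) ∣ ≤ C
      series-bounded : ∀ k x → ι x * ∣ ∑ x (λ m → h (k ℕ.* suc m) * inv (ι (suc m))) ∣ ≤ C

  module _ (n : ℕ) {{_ : ℕ.NonZero n}} (1<n : 1 ℕ.< n) (h : ℕ → ℚ) (h-units : SupportedOnUnits n h)
    (C : ℚ) (series : VanishingSeries h C) where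

    open Gram n 1<n h h-units
    open VanishingSeries series

    isUnit : ℕ → ℚ
    isUnit a = ⟦ coprime? a n ⟧

    private
      isUnit-0 : isUnit 0 ≡ 0ℚ
      isUnit-0 = ⟦⟧-no (coprime? 0 n) 0-not-coprime

    gramBound : ℚ
    gramBound = ι n * ((C + C) * (C + C))

    gramBound≥0 : 0ℚ ≤ gramBound
    gramBound≥0 = *≥0 (ι≥0 n) (sq≥0 (C + C))

    private
      ∣h∣≤2C : ∀ k m → ∣ h (k ℕ.* m) ∣ ≤ C + C
      ∣h∣≤2C k m = subst (λ x → ∣ x ∣ ≤ C + C)
        (trans (cong (_- ∑ m f) (∑-last m f)) (drop (∑ m f) (f m)))
        (∣x-y∣≤ (sums-bounded k (suc m)) (sums-bounded k m))
        where
        f : ℕ → ℚ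
        f m = h (k ℕ.* m)
        drop : ∀ x y → x + y - x ≡ y
        drop = solve-∀ ringℚ

      ∣gram∣≤gramBound : ∀ m m′ → ∣ gram m m′ ∣ ≤ gramBound
      ∣gram∣≤gramBound m m′ = ∣∑∣≤const n λ k _ → ∣x*y∣≤ (∣h∣≤2C k m) (∣h∣≤2C k m′)

    weight : ℕ → ℕ → ℕ → ℕ → ℚ
    weight m a m′ b = gram m m′ * (isUnit a * isUnit b)

    private
      ∣weight∣≤gramBound : ∀ m a m′ b → ∣ weight m a m′ b ∣ ≤ gramBound
      ∣weight∣≤gramBound m a m′ b = subst (∣ weight m a m′ b ∣ ≤_) (*-identityʳ gramBound)
        (∣x*y∣≤ (∣gram∣≤gramBound m m′) (∣x*y∣≤ (∣⟦⟧∣≤1 (coprime? a n)) (∣⟦⟧∣≤1 (coprime? b n))))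

      weight-zero : ∀ m a m′ b → ¬ Coprime (m ℕ.* a ℕ.* (m′ ℕ.* b)) n → weight m a m′ b ≡ 0ℚ
      weight-zero m a m′ b ¬⊥n with coprime? a n | coprime? b n
      ... | no _    | b⊥n?    = y≡0⇒xy≡0 (gram m m′) (*-zeroˡ ⟦ b⊥n? ⟧)
      ... | yes _   | no _    = *-zeroʳ (gram m m′)
      ... | yes a⊥n | yes b⊥n = x≡0⇒xy≡0 (1ℚ * 1ℚ) (gram-support m m′ λ (m⊥n , m′⊥n) →
        ¬⊥n (coprime-* {m ℕ.* a} {m′ ℕ.* b} (coprime-* {m} {a} m⊥n a⊥n) (coprime-* {m′} {b} m′⊥n b⊥n)))

    -- Z is kept as a variable so that sums of length Z do not unfold.
    module Means (η : ℚ) (0<η : 0ℚ < η) (Z Z-1 I : ℕ) (Z≡ : Z ≡ suc Z-1)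
      (Z-large : 1ℚ ≤ ι Z-1 * Scales.p η 0<η ^ I) where

      open Scales η 0<η

      scaleSum : ℕ → ℕ → ℚ
      scaleSum k i = ∑₂ Z λ m a → h (k ℕ.* m) * (isUnit a * window i (m ℕ.* a))

      scaleSumBound : ℚ
      scaleSumBound = möbiusNorm n * (C * smoothingLoss Z-1)

      private
        h-k0 : ∀ k → h (k ℕ.* 0) ≡ 0ℚ
        h-k0 k = h-zero k 0 0-not-coprime

        scaleSum-from-1 : ∀ k i → scaleSum k i ≡
          ∑ Z-1 (λ m → h (k ℕ.* suc m) * ∑ Z-1 (λ a → isUnit (suc a) * cutoff (ι (suc m) * ι (suc a) * p ^ i)))
        scaleSum-from-1 k i = begin
          scaleSum k i
            ≡⟨ cong (λ Z → ∑₂ Z λ m a → h (k ℕ.* m) * (isUnit a * window i (m ℕ.* a))) Z≡ ⟩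
          ∑ (suc Z-1) (λ a → h (k ℕ.* 0) * (isUnit a * window i 0)) +
          ∑ Z-1 (λ m → ∑ (suc Z-1) λ a → h (k ℕ.* suc m) * (isUnit a * window i (suc m ℕ.* a)))
            ≡⟨ cong₂ _+_ (∑-zero (suc Z-1) λ a _ → x≡0⇒xy≡0 (isUnit a * window i 0) (h-k0 k))
                 (∑-cong′ Z-1 λ m → trans
                   (sym (∑-*ˡ (suc Z-1) (h (k ℕ.* suc m)) λ a → isUnit a * window i (suc m ℕ.* a)))
                   (cong (h (k ℕ.* suc m) *_) (inner m))) ⟩
          0ℚ + ∑ Z-1 (λ m → h (k ℕ.* suc m) * ∑ Z-1 (λ a → isUnit (suc a) * cutoff (ι (suc m) * ι (suc a) * p ^ i)))
            ≡⟨ +-identityˡ _ ⟩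
          ∑ Z-1 (λ m → h (k ℕ.* suc m) * ∑ Z-1 (λ a → isUnit (suc a) * cutoff (ι (suc m) * ι (suc a) * p ^ i))) ∎
          where
          open ≡-Reasoning
          inner : ∀ m → ∑ (suc Z-1) (λ a → isUnit a * window i (suc m ℕ.* a)) ≡
                        ∑ Z-1 (λ a → isUnit (suc a) * cutoff (ι (suc m) * ι (suc a) * p ^ i))
          inner m = trans
            (cong₂ _+_ (x≡0⇒xy≡0 (window i (suc m ℕ.* 0)) isUnit-0)
              (∑-cong′ Z-1 λ a → cong (λ x → isUnit (suc a) * cutoff (x * p ^ i)) (ι-* (suc m) (suc a))))
            (+-identityˡ _)

      scaleSum-bound : ∀ k i → i ℕ.≤ I → ∣ scaleSum k i ∣ ≤ scaleSumBound
      scaleSum-bound k i i≤I = subst (λ x → ∣ x ∣ ≤ scaleSumBound) (sym (scaleSum-from-1 k i))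
        (coprime-smoothed-sum-bound n Z-1 (p ^ i) (^>0 0<p i)
          (≤-trans Z-large (*-monoˡ (ι≥0 Z-1) (^-antimono 0<p p≤1 i≤I)))
          f C C≥0 sums-from-1 (series-bounded k Z-1))
        where
        f : ℕ → ℚ
        f m = h (k ℕ.* suc m)
        sums-from-1 : ∀ x → ∣ ∑ x f ∣ ≤ C
        sums-from-1 x = subst (λ s → ∣ s ∣ ≤ C) (trans (cong (_+ ∑ x f) (h-k0 k)) (+-identityˡ (∑ x f)))
          (sums-bounded k (suc x))

      correlation : ℚ
      correlation = ∑ n (λ k → ∑ (suc I) (λ i → scaleSum k i * scaleSum k (I ∸ i)))

      correlation-bound : ∣ correlation ∣ ≤ ι n * (ι (suc I) * (scaleSumBound * scaleSumBound))
      correlation-bound = ∣∑∣≤const n λ k _ → ∣∑∣≤const (suc I) λ { i (s≤s i≤I) →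
        ∣x*y∣≤ (scaleSum-bound k i i≤I) (scaleSum-bound k (I ∸ i) (ℕ.m∸n≤m I i)) }

      private
        correlation-coupled : correlation ≡ ∑₄ Z (λ m a m′ b → weight m a m′ b * coupled I (m ℕ.* a) (m′ ℕ.* b))
        correlation-coupled = begin
          correlation
            ≡⟨ ∑-cong′ n (λ k → ∑-cong′ (suc I) λ i → ∑₂-*-∑₂ Z (term k i) (term k (I ∸ i))) ⟩
          ∑ n (λ k → ∑ (suc I) (λ i → ∑₄ Z (λ m a m′ b → term k i m a * term k (I ∸ i) m′ b)))
            ≡⟨ ∑-cong′ n (λ k → ∑-∑₄-swap (suc I) Z (λ i m a m′ b → term k i m a * term k (I ∸ i) m′ b)) ⟩
          ∑ n (λ k → ∑₄ Z (λ m a m′ b → ∑ (suc I) (λ i → term k i m a * term k (I ∸ i) m′ b)))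
            ≡⟨ ∑-∑₄-swap n Z _ ⟩
          ∑₄ Z (λ m a m′ b → ∑ n (λ k → ∑ (suc I) (λ i → term k i m a * term k (I ∸ i) m′ b)))
            ≡⟨ ∑₄-cong′ Z collect ⟩
          ∑₄ Z (λ m a m′ b → weight m a m′ b * coupled I (m ℕ.* a) (m′ ℕ.* b)) ∎
          where
          open ≡-Reasoning
          term : (k i m a : ℕ) → ℚ
          term k i m a = h (k ℕ.* m) * (isUnit a * window i (m ℕ.* a))
          regroup : ∀ x c u y d v → x * (c * u) * (y * (d * v)) ≡ x * y * (c * d) * (u * v)
          regroup = solve-∀ ringℚ
          collect : ∀ m a m′ b → ∑ n (λ k → ∑ (suc I) (λ i → term k i m a * term k (I ∸ i) m′ b)) ≡
                                 weight m a m′ b * coupled I (m ℕ.* a) (m′ ℕ.* b)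
          collect m a m′ b = begin
            ∑ n (λ k → ∑ (suc I) (λ i → term k i m a * term k (I ∸ i) m′ b))
              ≡⟨ ∑-cong′ n (λ k → ∑-cong′ (suc I) λ i → regroup (h (k ℕ.* m)) (isUnit a) (window i (m ℕ.* a))
                   (h (k ℕ.* m′)) (isUnit b) (window (I ∸ i) (m′ ℕ.* b))) ⟩
            ∑ n (λ k → ∑ (suc I) (λ i → hh k * χχ * (window i (m ℕ.* a) * window (I ∸ i) (m′ ℕ.* b))))
              ≡⟨ ∑-cong′ n (λ k → ∑-*ˡ (suc I) (hh k * χχ) (λ i → window i (m ℕ.* a) * window (I ∸ i) (m′ ℕ.* b))) ⟨
            ∑ n (λ k → hh k * χχ * coupled I (m ℕ.* a) (m′ ℕ.* b))
              ≡⟨ ∑-*ʳ n (coupled I (m ℕ.* a) (m′ ℕ.* b)) (λ k → hh k * χχ) ⟨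
            ∑ n (λ k → hh k * χχ) * coupled I (m ℕ.* a) (m′ ℕ.* b)
              ≡⟨ cong (_* coupled I (m ℕ.* a) (m′ ℕ.* b)) (∑-*ʳ n χχ hh) ⟨
            weight m a m′ b * coupled I (m ℕ.* a) (m′ ℕ.* b) ∎
            where
            hh : ℕ → ℚ
            hh k = h (k ℕ.* m) * h (k ℕ.* m′)
            χχ : ℚ
            χχ = isUnit a * isUnit b

      mergedCorrelation : ℚ
      mergedCorrelation = ∑₄ Z (λ m a m′ b → weight m a m′ b * merged I (m ℕ.* a ℕ.* (m′ ℕ.* b)))

      private
        terms-close : ∀ m a m′ b →
          ∣ weight m a m′ b * coupled I (m ℕ.* a) (m′ ℕ.* b) - weight m a m′ b * merged I (m ℕ.* a ℕ.* (m′ ℕ.* b)) ∣ ≤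
          gramBound * (ι (suc I) * (η + η))
        terms-close m a m′ b = subst (λ x → ∣ x ∣ ≤ gramBound * (ι (suc I) * (η + η))) (factor (weight m a m′ b) _ _)
          (by-product (m ℕ.* a ℕ.* (m′ ℕ.* b) ℕ.≟ 0))
          where
          factor : ∀ x u v → x * (u - v) ≡ x * u - x * v
          factor = solve-∀ ringℚ
          Δ : ℚ
          Δ = coupled I (m ℕ.* a) (m′ ℕ.* b) - merged I (m ℕ.* a ℕ.* (m′ ℕ.* b))
          by-product : Dec (m ℕ.* a ℕ.* (m′ ℕ.* b) ≡ 0) → ∣ weight m a m′ b * Δ ∣ ≤ gramBound * (ι (suc I) * (η + η))
          by-product (yes N≡0) = subst (λ x → ∣ x ∣ ≤ gramBound * (ι (suc I) * (η + η)))
            (sym (x≡0⇒xy≡0 Δ (weight-zero m a m′ b λ N⊥n → 0-not-coprime (subst (λ N → Coprime N n) N≡0 N⊥n))))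
            (*≥0 gramBound≥0 (*≥0 (ι≥0 (suc I)) (+≥0 (<⇒≤ 0<η) (<⇒≤ 0<η))))
          by-product (no N≢0)  = ∣x*y∣≤ (∣weight∣≤gramBound m a m′ b) (coupled≈merged I (m ℕ.* a) (m′ ℕ.* b)
            {{ℕ.≢-nonZero λ ma≡0 → N≢0 (cong (ℕ._* (m′ ℕ.* b)) ma≡0)}}
            {{ℕ.≢-nonZero λ m′b≡0 → N≢0 (trans (cong (m ℕ.* a ℕ.*_) m′b≡0) (ℕ.*-zeroʳ (m ℕ.* a)))}})

      correlation≈merged : ∣ correlation - mergedCorrelation ∣ ≤ ι Z ^ 4 * (gramBound * (ι (suc I) * (η + η)))
      correlation≈merged = subst (λ x → ∣ x ∣ ≤ ι Z ^ 4 * (gramBound * (ι (suc I) * (η + η))))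
        (trans (∑₄-sub Z _ _) (cong (_- mergedCorrelation) (sym correlation-coupled))) (∣∑₄∣≤const Z terms-close)

      coefficient : ℕ → ℚ
      coefficient N = ∑₄ Z (λ m a m′ b → ⟦ N ℕ.≟ m ℕ.* a ℕ.* (m′ ℕ.* b) ⟧ * weight m a m′ b)

      private
        merged-beyond-Z : ∀ N → Z ℕ.≤ N → merged I N ≡ 0ℚ
        merged-beyond-Z N Z≤N = merged-zero I N (≤-trans Z-large (*-monoʳ (^≥0 0<p I)
          (ι-mono (ℕ.≤-trans (ℕ.n≤1+n Z-1) (subst (ℕ._≤ N) Z≡ Z≤N)))))

      mergedCorrelation-coefficients : mergedCorrelation ≡ ∑ Z (λ N → merged I N * coefficient N)
      mergedCorrelation-coefficients = begin
        mergedCorrelation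
          ≡⟨ ∑₄-cong′ Z select ⟨
        ∑₄ Z (λ m a m′ b → ∑ Z (λ N → merged I N * (⟦ N ℕ.≟ m ℕ.* a ℕ.* (m′ ℕ.* b) ⟧ * weight m a m′ b)))
          ≡⟨ ∑-∑₄-swap Z Z _ ⟨
        ∑ Z (λ N → ∑₄ Z (λ m a m′ b → merged I N * (⟦ N ℕ.≟ m ℕ.* a ℕ.* (m′ ℕ.* b) ⟧ * weight m a m′ b)))
          ≡⟨ ∑-cong′ Z (λ N → ∑₄-*ˡ Z (merged I N) λ m a m′ b → ⟦ N ℕ.≟ m ℕ.* a ℕ.* (m′ ℕ.* b) ⟧ * weight m a m′ b) ⟨
        ∑ Z (λ N → merged I N * coefficient N) ∎
        where
        open ≡-Reasoning
        regroup : ∀ o d r → o * (d * r) ≡ r * (d * o)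
        regroup = solve-∀ ringℚ
        select : ∀ m a m′ b → let P = m ℕ.* a ℕ.* (m′ ℕ.* b) in
          ∑ Z (λ N → merged I N * (⟦ N ℕ.≟ P ⟧ * weight m a m′ b)) ≡ weight m a m′ b * merged I P
        select m a m′ b = trans (∑-cong′ Z λ N → regroup (merged I N) ⟦ N ℕ.≟ P ⟧ (weight m a m′ b))
          (trans (sym (∑-*ˡ Z (weight m a m′ b) λ N → ⟦ N ℕ.≟ P ⟧ * merged I N))
                 (cong (weight m a m′ b *_) (∑-select Z (merged I) P (merged-beyond-Z P))))
          where
          P : ℕ
          P = m ℕ.* a ℕ.* (m′ ℕ.* b)

      private
        reorder : ∀ m a m′ b → m ℕ.* a ℕ.* (m′ ℕ.* b) ≡ b ℕ.* (m ℕ.* m′ ℕ.* a)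
        reorder = ℕ-Solver.solve-∀

        cofactors : ∀ N {{_ : ℕ.NonZero N}} → N ℕ.< Z → Coprime N n → ∀ m m′ a →
          ∑ Z (λ b → ⟦ N ℕ.≟ m ℕ.* a ℕ.* (m′ ℕ.* b) ⟧ * (isUnit a * isUnit b)) ≡ ⟦ m ℕ.* m′ ℕ.* a ∣? N ⟧
        cofactors N N<Z N⊥n m m′ a with m ℕ.* m′ ℕ.* a ∣? N
        ... | no ∤N = ∑-zero Z λ b _ → ⟦⟧-no* (N ℕ.≟ m ℕ.* a ℕ.* (m′ ℕ.* b)) (isUnit a * isUnit b) λ N≡ →
                ∤N (divides b (trans N≡ (reorder m a m′ b)))
        ... | yes mm′a∣N@(divides b₀ N≡b₀mm′a) = trans
          (∑-single Z b₀ (ℕ.≤-<-trans (∣⇒≤ b₀∣N) N<Z) λ b _ b≢b₀ →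
            ⟦⟧-no* (N ℕ.≟ m ℕ.* a ℕ.* (m′ ℕ.* b)) (isUnit a * isUnit b) λ N≡ →
              b≢b₀ (ℕ.*-cancelʳ-≡ b b₀ (m ℕ.* m′ ℕ.* a) {{mm′a≢0}}
                (trans (sym (trans N≡ (reorder m a m′ b))) N≡b₀mm′a)))
          (trans (⟦⟧-yes* (N ℕ.≟ m ℕ.* a ℕ.* (m′ ℕ.* b₀)) _ (trans N≡b₀mm′a (sym (reorder m a m′ b₀))))
            (cong₂ _*_ (⟦⟧-yes (coprime? a n) (∣-coprime (m*n∣⇒n∣ (m ℕ.* m′) a mm′a∣N) N⊥n))
                       (⟦⟧-yes (coprime? b₀ n) (∣-coprime b₀∣N N⊥n))))
          where
          b₀∣N : b₀ ∣ N
          b₀∣N = divides (m ℕ.* m′ ℕ.* a) (trans N≡b₀mm′a (ℕ.*-comm b₀ (m ℕ.* m′ ℕ.* a)))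
          mm′a≢0 : ℕ.NonZero (m ℕ.* m′ ℕ.* a)
          mm′a≢0 = ℕ.≢-nonZero λ mm′a≡0 →
            ℕ.≢-nonZero⁻¹ N (trans N≡b₀mm′a (trans (cong (b₀ ℕ.*_) mm′a≡0) (ℕ.*-zeroʳ b₀)))

      coefficient≡inghamSum : ∀ N {{_ : ℕ.NonZero N}} (N<Z : N ℕ.< Z) (N⊥n : Coprime N n) →
                              coefficient N ≡ inghamSum Z N N<Z N⊥n
      coefficient≡inghamSum N N<Z N⊥n = ∑-cong′ Z λ m → trans (∑-swap Z Z _) (∑-cong′ Z λ m′ → begin
        ∑₂ Z (λ a b → ⟦ N ℕ.≟ m ℕ.* a ℕ.* (m′ ℕ.* b) ⟧ * (gram m m′ * (isUnit a * isUnit b)))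
          ≡⟨ ∑₂-cong′ Z (λ a b → regroup ⟦ N ℕ.≟ m ℕ.* a ℕ.* (m′ ℕ.* b) ⟧ (gram m m′) (isUnit a * isUnit b)) ⟩
        ∑₂ Z (λ a b → ⟦ N ℕ.≟ m ℕ.* a ℕ.* (m′ ℕ.* b) ⟧ * (isUnit a * isUnit b) * gram m m′)
          ≡⟨ ∑₂-*ʳ Z (gram m m′) (λ a b → ⟦ N ℕ.≟ m ℕ.* a ℕ.* (m′ ℕ.* b) ⟧ * (isUnit a * isUnit b)) ⟨
        ∑₂ Z (λ a b → ⟦ N ℕ.≟ m ℕ.* a ℕ.* (m′ ℕ.* b) ⟧ * (isUnit a * isUnit b)) * gram m m′
          ≡⟨ cong (_* gram m m′) (∑-cong′ Z (cofactors N N<Z N⊥n m m′)) ⟩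
        ∑ Z (λ a → ⟦ m ℕ.* m′ ℕ.* a ∣? N ⟧) * gram m m′ ∎)
        where
        open ≡-Reasoning
        regroup : ∀ d r c → d * (r * c) ≡ d * c * r
        regroup = solve-∀ ringℚ

      coefficient-zero : ∀ N → ¬ Coprime N n → coefficient N ≡ 0ℚ
      coefficient-zero N N⊥̸n = ∑₄-zero Z λ m a m′ b → trans
        (⟦⟧*-cong (N ℕ.≟ m ℕ.* a ℕ.* (m′ ℕ.* b)) λ N≡ →
          weight-zero m a m′ b (N⊥̸n ∘ subst (λ P → Coprime P n) (sym N≡)))
        (*-zeroʳ ⟦ N ℕ.≟ m ℕ.* a ℕ.* (m′ ℕ.* b) ⟧)

      coefficient≥0 : ∀ N → N ℕ.< Z → 0ℚ ≤ coefficient N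
      coefficient≥0 zero      _   = ≤-reflexive (sym (coefficient-zero 0 0-not-coprime))
      coefficient≥0 N@(suc _) N<Z with coprime? N n
      ... | yes N⊥n = subst (0ℚ ≤_) (sym (coefficient≡inghamSum N N<Z N⊥n)) (inghamSum≥0 Z N N<Z N⊥n)
      ... | no  N⊥̸n = ≤-reflexive (sym (coefficient-zero N N⊥̸n))

      -- The squares of 1 + nj are coprime to n.
      root : ℕ → ℕ
      root j = 1 ℕ.+ n ℕ.* j

      root-coprime : ∀ j → Coprime (root j) n
      root-coprime j {d} (d∣root , d∣n) = ∣1⇒≡1
        (∣m+n∣m⇒∣n (subst (d ∣_) (ℕ.+-comm 1 (n ℕ.* j)) d∣root) (∣m⇒∣m*n j d∣n))

      gram≤coefficient-square : ∀ j → root j ℕ.* root j ℕ.< Z → gram 1 1 ≤ coefficient (root j ℕ.* root j)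
      gram≤coefficient-square j D²<Z = subst (gram 1 1 ≤_) (sym (coefficient≡inghamSum (root j ℕ.* root j) D²<Z D²⊥n))
        (inghamSum-square Z (root j ℕ.* root j) D²<Z D²⊥n (root j) refl)
        where
        D²⊥n : Coprime (root j ℕ.* root j) n
        D²⊥n = coprime-* {root j} {root j} (root-coprime j) (root-coprime j)

      mergedCorrelation-lower-bound : ∀ W c → 0ℚ ≤ c → (∀ j → j ℕ.< W → root j ℕ.* root j ℕ.< Z) →
        (∀ j → j ℕ.< W → c ≤ merged I (root j ℕ.* root j)) → ι W * (c * gram 1 1) ≤ mergedCorrelation
      mergedCorrelation-lower-bound W c 0≤c D²<Z c≤merged = begin
        ι W * (c * gram 1 1)
          ≡⟨ ∑-const W (c * gram 1 1) ⟨
        ∑ W (λ _ → c * gram 1 1)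
          ≤⟨ ∑-mono W (λ j j<W → *-mono 0≤c (c≤merged j j<W) gram-diagonal≥0
            (gram≤coefficient-square j (D²<Z j j<W))) ⟩
        ∑ W (λ j → merged I (root j ℕ.* root j) * coefficient (root j ℕ.* root j))
          ≤⟨ ∑-increasing≤∑ Z (λ N → merged I N * coefficient N) (λ j → root j ℕ.* root j) W
               (λ N N<Z → *≥0 (merged≥0 I N) (coefficient≥0 N N<Z))
               (λ i<j → ℕ.*-mono-< (s≤s (ℕ.*-monoʳ-< n i<j)) (s≤s (ℕ.*-monoʳ-< n i<j))) D²<Z ⟩
        ∑ Z (λ N → merged I N * coefficient N)
          ≡⟨ mergedCorrelation-coefficients ⟨
        mergedCorrelation ∎
        where open ≤-Reasoning

module NonVanishing where

  open import Data.Nat.DivMod using (m%n<n)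
  open OrderedRationals
  open RationalSums
  open Congruences
  open InghamIdentity
  open SmoothedSums
  open CoprimeSmoothing
  open GeometricScales
  open InghamMeans

  bernoulli : ∀ η → 0ℚ ≤ η → ∀ i → 1ℚ + ι i * η ≤ (1ℚ + η) ^ i
  bernoulli η 0≤η zero    = ≤-reflexive (trans (cong (λ x → 1ℚ + x) (ι-0* η)) (+-identityʳ 1ℚ))
  bernoulli η 0≤η (suc i) = begin
    1ℚ + ι (suc i) * η         ≡⟨ cong (λ x → 1ℚ + x) (ι-suc* i η) ⟩
    1ℚ + (ι i * η + η)         ≤⟨ ≤-slack (ι i * (η * η)) (*≥0 (ι≥0 i) (sq≥0 η)) (expand (ι i) η) ⟩
    (1ℚ + η) * (1ℚ + ι i * η)  ≤⟨ *-monoˡ (+≥0 0≤1 0≤η) (bernoulli η 0≤η i) ⟩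
    (1ℚ + η) * (1ℚ + η) ^ i    ∎
    where
    open ≤-Reasoning
    expand : ∀ i e → 1ℚ + (i * e + e) + i * (e * e) ≡ (1ℚ + e) * (1ℚ + i * e)
    expand = solve-∀ ringℚ

  harmonic-+ : ∀ N M → harmonic (N ℕ.+ M) ≤ harmonic N + ι M * inv (ι (suc N))
  harmonic-+ N M = begin
    harmonic (N ℕ.+ M)                                ≡⟨ ∑-split N M _ ⟩
    harmonic N + ∑ M (λ i → inv (ι (suc (N ℕ.+ i))))
      ≤⟨ +-monoʳ-≤ (harmonic N) (∑-mono M λ i _ → inv-antimono (ι>0 (suc N)) (ι-mono (s≤s (ℕ.m≤m+n N i)))) ⟩
    harmonic N + ∑ M (λ i → inv (ι (suc N)))          ≡⟨ cong (λ x → harmonic N + x) (∑-const M (inv (ι (suc N)))) ⟩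
    harmonic N + ι M * inv (ι (suc N))                ∎
    where open ≤-Reasoning

  private
    harmonic-block : ∀ B N → ι (B ℕ.* N) * inv (ι (suc N)) ≤ ι B
    harmonic-block B N = begin
      ι (B ℕ.* N) * inv (ι (suc N))        ≤⟨ *-monoʳ (inv≥0 (ι>0 (suc N))) (ι-mono (ℕ.*-monoʳ-≤ B (ℕ.n≤1+n N))) ⟩
      ι (B ℕ.* suc N) * inv (ι (suc N))    ≡⟨ cong (_* inv (ι (suc N))) (ι-* B (suc N)) ⟩
      ι B * ι (suc N) * inv (ι (suc N))    ≡⟨ *-assoc (ι B) (ι (suc N)) (inv (ι (suc N))) ⟩
      ι B * (ι (suc N) * inv (ι (suc N)))  ≡⟨ *-inv-cancelʳ (ι>0 (suc N)) (ι B) ⟩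
      ι B                                  ∎
      where open ≤-Reasoning

  harmonic-^ : ∀ B k → harmonic (suc B ℕ.^ k) ≤ ι (1 ℕ.+ k ℕ.* B)
  harmonic-^ B zero    = ≤-reflexive (trans (cong (_+ 0ℚ) (trans (cong inv ι-1) inv-1))
    (trans (+-identityʳ 1ℚ) (sym ι-1)))
  harmonic-^ B (suc k) = begin
    harmonic (N ℕ.+ B ℕ.* N)                    ≤⟨ harmonic-+ N (B ℕ.* N) ⟩
    harmonic N + ι (B ℕ.* N) * inv (ι (suc N))  ≤⟨ +-mono-≤ (harmonic-^ B k) (harmonic-block B N) ⟩
    ι (1 ℕ.+ k ℕ.* B) + ι B                     ≡⟨ ι-+ (1 ℕ.+ k ℕ.* B) B ⟨
    ι (1 ℕ.+ k ℕ.* B ℕ.+ B)                     ≡⟨ cong ι (cong suc (ℕ.+-comm (k ℕ.* B) B)) ⟩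
    ι (1 ℕ.+ suc k ℕ.* B)                       ∎
    where
    open ≤-Reasoning
    N : ℕ
    N = suc B ℕ.^ k

  smoothingLoss-^ : ∀ B .{{_ : ℕ.NonZero B}} k → smoothingLoss (B ℕ.^ k) ≤ ι (8 ℕ.+ 2 ℕ.* (k ℕ.* B))
  smoothingLoss-^ B@(suc B-1) k = begin
    4ℚ + 2ℚ * harmonic (suc N)                ≡⟨ cong (λ x → 4ℚ + 2ℚ * x) (∑-last N λ i → inv (ι (suc i))) ⟩
    4ℚ + 2ℚ * (harmonic N + inv (ι (suc N)))
      ≤⟨ +-monoʳ-≤ 4ℚ (*-monoˡ 0≤2 (+-mono-≤ harmonic≤ (1≤x⇒inv≤1 (ι≥1 (suc N))))) ⟩
    4ℚ + 2ℚ * (ι M + 1ℚ)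
      ≡⟨ cong (λ x → 4ℚ + 2ℚ * x) (trans (+-comm (ι M) 1ℚ) (sym (ι-suc M))) ⟩
    4ℚ + 2ℚ * ι (2 ℕ.+ k ℕ.* B)               ≡⟨ cong₂ (λ x y → x + y * ι (2 ℕ.+ k ℕ.* B)) ι-4 ι-2 ⟨
    ι 4 + ι 2 * ι (2 ℕ.+ k ℕ.* B)             ≡⟨ trans (ι-+ 4 _) (cong (λ x → ι 4 + x) (ι-* 2 (2 ℕ.+ k ℕ.* B))) ⟨
    ι (4 ℕ.+ 2 ℕ.* (2 ℕ.+ k ℕ.* B))           ≡⟨ cong ι (distribute (k ℕ.* B)) ⟩
    ι (8 ℕ.+ 2 ℕ.* (k ℕ.* B))                 ∎
    where
    open ≤-Reasoning
    N M : ℕ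
    N = B ℕ.^ k
    M = 1 ℕ.+ k ℕ.* B
    harmonic≤ : harmonic N ≤ ι M
    harmonic≤ = ≤-trans (harmonic-^ B-1 k) (ι-mono (s≤s (ℕ.*-monoʳ-≤ k (ℕ.n≤1+n B-1))))
    distribute : ∀ x → 4 ℕ.+ 2 ℕ.* (2 ℕ.+ x) ≡ 8 ℕ.+ 2 ℕ.* x
    distribute = ℕ-Solver.solve-∀

  first-power-above : ∀ q X → 1ℚ < X → ∀ i → X ≤ q ^ i → ∃ λ J → X ≤ q ^ suc J × q ^ J < X
  first-power-above q X 1<X zero    X≤1 = ⊥-elim (<⇒≱ 1<X X≤1)
  first-power-above q X 1<X (suc i) X≤q^1+i with X ≤? q ^ i
  ... | yes X≤q^i = first-power-above q X 1<X i X≤q^i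
  ... | no  X≰q^i = i , X≤q^1+i , ≰⇒> X≰q^i

  module _ (n : ℕ) {{_ : ℕ.NonZero n}} (1<n : 1 ℕ.< n) (h : ℕ → ℚ) (h-units : SupportedOnUnits n h)
    (C : ℚ) (series : VanishingSeries h C) where

    open Gram n 1<n h h-units using (gram; gram-diagonal≥0)
    open VanishingSeries series using (C≥0)

    private
      G κ : ℚ
      G = gramBound n 1<n h h-units C series
      κ = möbiusNorm n * (C * ι (8 ℕ.+ 64 ℕ.* n))

      2G≥0 : 0ℚ ≤ 2ℚ * G
      2G≥0 = *≥0 0≤2 (gramBound≥0 n 1<n h h-units C series)

    gramMultipleBound : ℚ
    gramMultipleBound = ι 9 * 4ℚ * (ι n * (κ * κ) + 2ℚ * G)

    private
      gramMultipleBound≥0 : 0ℚ ≤ gramMultipleBound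
      gramMultipleBound≥0 = *≥0 (*≥0 (ι≥0 9) (+≥0 0≤2 0≤2)) (+≥0 (*≥0 (ι≥0 n) (sq≥0 κ)) 2G≥0)

      -- The sums run over N < Z = B⁸ + 1 and over scales p⁰, …, p^I with p^J ≈ 1/X, I = 8J.  The squares of
      -- 1 + nj with j < V³ are below X⁶/2, so each of them is seen by J of the 8J + 1 scales.
      module Choice (V : ℕ) {{_ : ℕ.NonZero V}} where

        X B Z-1 Z W : ℕ
        X   = 2 ℕ.* (n ℕ.* V)
        B   = 2 ℕ.* X
        Z-1 = B ℕ.^ 8
        Z   = suc Z-1
        W   = V ℕ.* V ℕ.* V

        instance
          nV≢0 : ℕ.NonZero (n ℕ.* V)
          nV≢0 = ℕ.m*n≢0 n V

          B≢0 : ℕ.NonZero B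
          B≢0 = ℕ.m*n≢0 2 X {{_}} {{ℕ.m*n≢0 2 (n ℕ.* V)}}

        2≤X : 2 ℕ.≤ X
        2≤X = ℕ.m≤m*n 2 (n ℕ.* V)

        1<X : 1ℚ < ι X
        1<X = <-≤-trans (subst (1ℚ <_) (sym ι-2) (<-slack 1ℚ 0<1 refl)) (ι-mono 2≤X)

        0<X : 0ℚ < ι X
        0<X = <-trans 0<1 1<X

        Z⁴>0 : 0ℚ < ι Z ^ 4
        Z⁴>0 = ^>0 (ι>0 Z) 4

        η : ℚ
        η = inv (ι Z ^ 4)

        0<η : 0ℚ < η
        0<η = inv>0 Z⁴>0

        open Scales η 0<η

        q≤2 : q ≤ 2ℚ
        q≤2 = +-monoʳ-≤ 1ℚ {η} {1ℚ} (1≤x⇒inv≤1 (^≥1 (ι≥1 Z) 4))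

        power : ∃ λ J → ι X ≤ q ^ suc J × q ^ J < ι X
        power = first-power-above q (ι X) 1<X i (begin
          ι X           ≤⟨ ≤-slack 1ℚ 0≤1 (+-comm (ι X) 1ℚ) ⟩
          1ℚ + ι X      ≡⟨ cong (λ x → 1ℚ + x) iη≡X ⟨
          1ℚ + ι i * η  ≤⟨ bernoulli η (<⇒≤ 0<η) i ⟩
          q ^ i         ∎)
          where
          open ≤-Reasoning
          i : ℕ
          i = X ℕ.* Z ℕ.^ 4
          iη≡X : ι i * η ≡ ι X
          iη≡X = begin-equality
            ι i * η              ≡⟨ cong (_* η) (trans (ι-* X (Z ℕ.^ 4)) (cong (ι X *_) (ι-^ Z 4))) ⟩
            ι X * ι Z ^ 4 * η    ≡⟨ *-assoc (ι X) (ι Z ^ 4) η ⟩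
            ι X * (ι Z ^ 4 * η)  ≡⟨ *-inv-cancelʳ Z⁴>0 (ι X) ⟩
            ι X                  ∎

        J I : ℕ
        J = suc (proj₁ power)
        I = 8 ℕ.* J

        u : ℚ
        u = p ^ J

        0<u : 0ℚ < u
        0<u = ^>0 0<p J

        uq^J≡1 : u * q ^ J ≡ 1ℚ
        uq^J≡1 = trans (sym (^-distrib-* p q J)) (trans (cong (_^ J) pq≡1) (1^ J))

        Xu≤1 : ι X * u ≤ 1ℚ
        Xu≤1 = begin
          ι X * u    ≡⟨ *-comm (ι X) u ⟩
          u * ι X    ≤⟨ *-monoˡ (<⇒≤ 0<u) (proj₁ (proj₂ power)) ⟩
          u * q ^ J  ≡⟨ uq^J≡1 ⟩
          1ℚ         ∎
          where open ≤-Reasoning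

        1≤Bu : 1ℚ ≤ ι B * u
        1≤Bu = begin
          1ℚ         ≡⟨ uq^J≡1 ⟨
          u * q ^ J  ≡⟨ *-comm u (q ^ J) ⟩
          q ^ J * u
            ≤⟨ *-monoʳ (<⇒≤ 0<u) (*-mono (<⇒≤ 0<q) q≤2 (^≥0 0<q (proj₁ power)) (<⇒≤ (proj₂ (proj₂ power)))) ⟩
          2ℚ * ι X * u ≡⟨ cong (_* u) (trans (ι-* 2 X) (cong (_* ι X) ι-2)) ⟨
          ι B * u    ∎
          where open ≤-Reasoning

        p^[k*J] : ∀ k → p ^ (k ℕ.* J) ≡ u ^ k
        p^[k*J] k = trans (cong (p ^_) (ℕ.*-comm k J)) (sym (^-assocʳ p J k))

        Z-large : 1ℚ ≤ ι Z-1 * p ^ I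
        Z-large = begin
          1ℚ               ≤⟨ ^≥1 1≤Bu 8 ⟩
          (ι B * u) ^ 8    ≡⟨ ^-distrib-* (ι B) u 8 ⟩
          ι B ^ 8 * u ^ 8  ≡⟨ cong₂ _*_ (ι-^ B 8) (p^[k*J] 8) ⟨
          ι Z-1 * p ^ I    ∎
          where open ≤-Reasoning

        open Means n 1<n h h-units C series η 0<η Z Z-1 I refl Z-large

        u≤½ : u ≤ ½
        u≤½ = *-cancelˡ-≤ 0<X (begin
          ι X * u  ≤⟨ Xu≤1 ⟩
          1ℚ       ≡⟨ cong (_* ½) ι-2 ⟨
          ι 2 * ½  ≤⟨ *-monoʳ 0≤½ (ι-mono 2≤X) ⟩
          ι X * ½  ∎)
          where open ≤-Reasoning

        2root²≤X⁶ : ∀ j → j ℕ.< W → 2 ℕ.* (root j ℕ.* root j) ℕ.≤ X ℕ.^ 6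
        2root²≤X⁶ j j<W = begin
          2 ℕ.* (root j ℕ.* root j)                           ≤⟨ ℕ.*-monoʳ-≤ 2 (ℕ.*-mono-≤ root≤nW root≤nW) ⟩
          2 ℕ.* (n ℕ.* W ℕ.* (n ℕ.* W))                       ≤⟨ ℕ.m≤m*n _ (32 ℕ.* n ℕ.^ 4) {{32n⁴≢0}} ⟩
          2 ℕ.* (n ℕ.* W ℕ.* (n ℕ.* W)) ℕ.* (32 ℕ.* n ℕ.^ 4)  ≡⟨ regroup n V ⟩
          X ℕ.^ 6                                             ∎
          where
          open ℕ.≤-Reasoning
          root≤nW : root j ℕ.≤ n ℕ.* W
          root≤nW = begin
            1 ℕ.+ n ℕ.* j  ≤⟨ ℕ.+-monoˡ-≤ (n ℕ.* j) (ℕ.>-nonZero⁻¹ n) ⟩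
            n ℕ.+ n ℕ.* j  ≡⟨ ℕ.*-suc n j ⟨
            n ℕ.* suc j    ≤⟨ ℕ.*-monoʳ-≤ n j<W ⟩
            n ℕ.* W        ∎
          32n⁴≢0 : ℕ.NonZero (32 ℕ.* n ℕ.^ 4)
          32n⁴≢0 = ℕ.m*n≢0 32 (n ℕ.^ 4) {{_}} {{ℕ.m^n≢0 n 4}}
          regroup : ∀ n V → let W = V ℕ.* V ℕ.* V in
            2 ℕ.* (n ℕ.* W ℕ.* (n ℕ.* W)) ℕ.* (32 ℕ.* (n ℕ.* (n ℕ.* (n ℕ.* (n ℕ.* 1))))) ≡ let X = 2 ℕ.* (n ℕ.* V) in
            X ℕ.* (X ℕ.* (X ℕ.* (X ℕ.* (X ℕ.* (X ℕ.* 1)))))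
          regroup = ℕ-Solver.solve-∀

        root²<Z : ∀ j → j ℕ.< W → root j ℕ.* root j ℕ.< Z
        root²<Z j j<W = s≤s (begin
          root j ℕ.* root j          ≤⟨ ℕ.m≤n*m (root j ℕ.* root j) 2 ⟩
          2 ℕ.* (root j ℕ.* root j)  ≤⟨ 2root²≤X⁶ j j<W ⟩
          X ℕ.^ 6                    ≤⟨ ℕ.^-monoˡ-≤ 6 (ℕ.m≤n*m X 2) ⟩
          B ℕ.^ 6                    ≤⟨ ℕ.^-monoʳ-≤ B (ℕ.m≤m+n 6 2) ⟩
          B ℕ.^ 8                    ∎)
          where open ℕ.≤-Reasoning

        root²u⁶≤½ : ∀ j → j ℕ.< W → ι (root j ℕ.* root j) * u ^ 6 ≤ ½
        root²u⁶≤½ j j<W = *-cancelˡ-≤ 0<2 (begin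
          2ℚ * (ι D² * u ^ 6)   ≡⟨ *-assoc 2ℚ (ι D²) (u ^ 6) ⟨
          2ℚ * ι D² * u ^ 6     ≡⟨ cong (_* u ^ 6) (trans (ι-* 2 D²) (cong (_* ι D²) ι-2)) ⟨
          ι (2 ℕ.* D²) * u ^ 6  ≤⟨ *-monoʳ (^≥0 0<u 6) (ι-mono (2root²≤X⁶ j j<W)) ⟩
          ι (X ℕ.^ 6) * u ^ 6   ≡⟨ trans (cong (_* u ^ 6) (ι-^ X 6)) (sym (^-distrib-* (ι X) u 6)) ⟩
          (ι X * u) ^ 6         ≤⟨ ^≤1 (*>0 0<X 0<u) Xu≤1 6 ⟩
          1ℚ                    ∎)
          where
          open ≤-Reasoning
          D² : ℕ
          D² = root j ℕ.* root j

        merged-root² : ∀ j → j ℕ.< W → ι J * (½ * ½) ≤ merged I (root j ℕ.* root j)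
        merged-root² j j<W = merged-lower-bound J (6 ℕ.* J) (root j ℕ.* root j) u≤½
          (subst (λ x → ι (root j ℕ.* root j) * x ≤ ½) (sym (p^[k*J] 6)) (root²u⁶≤½ j j<W))

        scaleSumBound≥0 : 0ℚ ≤ scaleSumBound
        scaleSumBound≥0 = *≥0 (möbiusNorm≥0 n) (*≥0 C≥0 (smoothingLoss≥0 Z-1))

        scaleSumBound≤ : scaleSumBound ≤ ι V * κ
        scaleSumBound≤ = begin
          möbiusNorm n * (C * smoothingLoss Z-1)
            ≤⟨ *-monoˡ (möbiusNorm≥0 n) (*-monoˡ C≥0 (smoothingLoss-^ B 8)) ⟩
          möbiusNorm n * (C * ι (8 ℕ.+ 2 ℕ.* (8 ℕ.* B)))
            ≤⟨ *-monoˡ (möbiusNorm≥0 n) (*-monoˡ C≥0 (ι-mono linear-in-V)) ⟩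
          möbiusNorm n * (C * ι (V ℕ.* (8 ℕ.+ 64 ℕ.* n)))
            ≡⟨ cong (λ x → möbiusNorm n * (C * x)) (ι-* V (8 ℕ.+ 64 ℕ.* n)) ⟩
          möbiusNorm n * (C * (ι V * ι (8 ℕ.+ 64 ℕ.* n)))  ≡⟨ regroup (möbiusNorm n) C (ι V) (ι (8 ℕ.+ 64 ℕ.* n)) ⟩
          ι V * κ                                          ∎
          where
          open ≤-Reasoning
          regroup : ∀ m c v x → m * (c * (v * x)) ≡ v * (m * (c * x))
          regroup = solve-∀ ringℚ
          expand : ∀ n V → V ℕ.* 8 ℕ.+ 2 ℕ.* (8 ℕ.* (2 ℕ.* (2 ℕ.* (n ℕ.* V)))) ≡ V ℕ.* (8 ℕ.+ 64 ℕ.* n)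
          expand = ℕ-Solver.solve-∀
          linear-in-V : 8 ℕ.+ 2 ℕ.* (8 ℕ.* B) ℕ.≤ V ℕ.* (8 ℕ.+ 64 ℕ.* n)
          linear-in-V = ℕ.≤-trans (ℕ.+-monoˡ-≤ (2 ℕ.* (8 ℕ.* B)) (ℕ.m≤n*m 8 V)) (ℕ.≤-reflexive (expand n V))

        mergedCorrelation≤ : mergedCorrelation ≤ ι (suc I) * (ι n * (scaleSumBound * scaleSumBound) + 2ℚ * G)
        mergedCorrelation≤ = begin
          mergedCorrelation
            ≡⟨ split mergedCorrelation correlation ⟩
          correlation - (correlation - mergedCorrelation)
            ≤⟨ ≤-trans (x≤∣x∣ _) (∣x-y∣≤ correlation-bound correlation≈merged) ⟩
          ι n * (s * (K * K)) + ι Z ^ 4 * (G * (s * (η + η)))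
            ≡⟨ regroup (ι n) s (K * K) (ι Z ^ 4) G η ⟩
          s * (ι n * (K * K) + 2ℚ * G * (ι Z ^ 4 * η))
            ≡⟨ cong (λ x → s * (ι n * (K * K) + x)) (*-inv-cancelʳ Z⁴>0 (2ℚ * G)) ⟩
          s * (ι n * (K * K) + 2ℚ * G) ∎
          where
          open ≤-Reasoning
          s K : ℚ
          s = ι (suc I)
          K = scaleSumBound
          split : ∀ x y → x ≡ y - (y - x)
          split = solve-∀ ringℚ
          regroup : ∀ n s k z g e → n * (s * k) + z * (g * (s * (e + e))) ≡ s * (n * k + 2ℚ * g * (z * e))
          regroup = solve-∀ ringℚ

        1+I≤9J : ι (suc I) ≤ ι 9 * ι J
        1+I≤9J = subst (ι (suc I) ≤_) (ι-* 9 J) (ι-mono (ℕ.+-monoˡ-≤ I (s≤s z≤n)))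

        mergedCorrelation≤JV² : mergedCorrelation ≤ ι 9 * ι J * (ι n * (ι V * κ * (ι V * κ)) + ι V * ι V * (2ℚ * G))
        mergedCorrelation≤JV² = ≤-trans mergedCorrelation≤ (*-mono (ι≥0 (suc I)) 1+I≤9J
          (+≥0 (*≥0 (ι≥0 n) (sq≥0 scaleSumBound)) 2G≥0)
          (+-mono-≤ (*-monoˡ (ι≥0 n) (*-mono scaleSumBound≥0 scaleSumBound≤ scaleSumBound≥0 scaleSumBound≤))
                    (1≤x⇒y≤x*y (*-mono 0≤1 (ι≥1 V) 0≤1 (ι≥1 V)) 2G≥0)))

        V*gram≤ : ι V * gram 1 1 ≤ gramMultipleBound
        V*gram≤ = *-cancelˡ-≤ (*>0 (*>0 (ι>0 J) (*>0 0<½ 0<½)) (*>0 (ι>0 V) (ι>0 V))) (begin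
          ι J * (½ * ½) * (ι V * ι V) * (ι V * gram 1 1)
            ≡⟨ regroup (ι J) (ι V) (gram 1 1) ⟩
          ι V * ι V * ι V * (ι J * (½ * ½) * gram 1 1)
            ≡⟨ cong (_* (ι J * (½ * ½) * gram 1 1)) (trans (ι-* (V ℕ.* V) V) (cong (_* ι V) (ι-* V V))) ⟨
          ι W * (ι J * (½ * ½) * gram 1 1)
            ≤⟨ mergedCorrelation-lower-bound W _ (*≥0 (ι≥0 J) (*≥0 0≤½ 0≤½)) root²<Z merged-root² ⟩
          mergedCorrelation
            ≤⟨ mergedCorrelation≤JV² ⟩
          ι 9 * ι J * (ι n * (ι V * κ * (ι V * κ)) + ι V * ι V * (2ℚ * G))
            ≡⟨ collect (ι 9) (ι J) (ι n) (ι V) κ G ⟩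
          ι J * (½ * ½) * (ι V * ι V) * gramMultipleBound ∎)
          where
          open ≤-Reasoning
          regroup : ∀ j v r → j * (½ * ½) * (v * v) * (v * r) ≡ v * v * v * (j * (½ * ½) * r)
          regroup = solve-∀ ringℚ
          collect : ∀ c j n v k g → c * j * (n * (v * k * (v * k)) + v * v * (2ℚ * g)) ≡
                                    j * (½ * ½) * (v * v) * (c * 4ℚ * (n * (k * k) + 2ℚ * g))
          collect = solve-∀ ringℚ

    gram-diagonal≡0 : gram 1 1 ≡ 0ℚ
    gram-diagonal≡0 = ≤-antisym (ι*-bounded⇒≤0 gramMultipleBound bounded) gram-diagonal≥0
      where
      bounded : ∀ V → ι V * gram 1 1 ≤ gramMultipleBound
      bounded zero      = subst (_≤ gramMultipleBound) (sym (ι-0* (gram 1 1))) gramMultipleBound≥0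
      bounded V@(suc _) = Choice.V*gram≤ V

    vanishing : ∀ m → h m ≡ 0ℚ
    vanishing m = begin
      h m              ≡⟨ periodic m (m % n ℕ.* 1) (sym (trans (cong (_% n) (ℕ.*-identityʳ (m % n))) (%-mod n m))) ⟩
      h (m % n ℕ.* 1)  ≡⟨ sq≡0⇒≡0 (≤-antisym h²≤0 (sq≥0 (h (m % n ℕ.* 1)))) ⟩
      0ℚ               ∎
      where
      open ≡-Reasoning
      open SupportedOnUnits h-units
      h²≤0 : h (m % n ℕ.* 1) * h (m % n ℕ.* 1) ≤ 0ℚ
      h²≤0 = subst (h (m % n ℕ.* 1) * h (m % n ℕ.* 1) ≤_) gram-diagonal≡0
        (term≤∑ n (m % n) (m%n<n m n) λ k _ → sq≥0 (h (k ℕ.* 1)))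
      sq≡0⇒≡0 : ∀ {x} → x * x ≡ 0ℚ → x ≡ 0ℚ
      sq≡0⇒≡0 {x} x²≡0 with x ≟ 0ℚ
      ... | yes x≡0 = x≡0
      ... | no  x≢0 = ⊥-elim (<-irrefl (sym ∣x∣²≡0) (*>0 ∣x∣>0 ∣x∣>0))
        where
        ∣x∣²≡0 : ∣ x ∣ * ∣ x ∣ ≡ 0ℚ
        ∣x∣²≡0 = trans (sym (∣p*q∣≡∣p∣*∣q∣ x x)) (cong ∣_∣ x²≡0)
        ∣x∣>0 : 0ℚ < ∣ x ∣
        ∣x∣>0 = ≰⇒> λ ∣x∣≤0 → x≢0 (∣p∣≡0⇒p≡0 x (≤-antisym ∣x∣≤0 (0≤∣p∣ x)))

module RootsOfUnity where

  open import Algebra.Bundles using (CommutativeRing)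
  open import Data.Nat.DivMod using (m%n<n; m<n⇒m%n≡m; m≡m%n+[m/n]*n)
  open RangeSums
  open Congruences

  module PowerSums {c ℓ} (S : CommutativeRing c ℓ) where
    open CommutativeRing S hiding (zero) renaming (refl to ≈-refl; sym to ≈-sym; trans to ≈-trans)
    open RangeSum commutativeSemiring
    open import Algebra.Properties.CommutativeSemiring.Exp commutativeSemiring
    open import Algebra.Properties.Ring ring using (+-cancelʳ)
    open import Algebra.Properties.Semiring.Mult semiring renaming (_×_ to _·_)
    open import Algebra.Solver.Ring.NaturalCoefficients.Default commutativeSemiring using (solve; _:+_; _:*_; _:=_; con)
    open import Relation.Binary.Reasoning.Setoid setoid

    nat : ℕ → Carrier
    nat n = n · 1#

    nat-∑ : ∀ N (f : ℕ → ℕ) → nat (∑ℕ N f) ≈ ∑ N (nat ∘ f)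
    nat-∑ zero    f = ≈-refl
    nat-∑ (suc N) f = ≈-trans (×-homo-+ 1# (f 0) _) (+-congˡ (nat-∑ N (f ∘ suc)))

    ∑-const : ∀ N x → ∑ N (λ _ → x) ≈ nat N * x
    ∑-const zero    x = ≈-sym (zeroˡ x)
    ∑-const (suc N) x = ≈-trans (+-cong (≈-sym (*-identityˡ x)) (∑-const N x)) (≈-sym (distribʳ x 1# (nat N)))

    1^ : ∀ k → 1# ^ k ≈ 1#
    1^ zero    = ≈-refl
    1^ (suc k) = ≈-trans (*-identityˡ _) (1^ k)

    x≈1+[x-1] : ∀ x → x ≈ 1# + (x - 1#)
    x≈1+[x-1] x = begin
      x              ≈⟨ +-identityʳ x ⟨
      x + 0#         ≈⟨ +-congˡ (-‿inverseˡ 1#) ⟨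
      x + (- 1# + 1#) ≈⟨ +-assoc _ _ _ ⟨
      x - 1# + 1#    ≈⟨ +-comm _ _ ⟩
      1# + (x - 1#)  ∎

    module _ {X e : Carrier} (X≈1+e : X ≈ 1# + e) where

      geometric : ∀ N → e * ∑ N (X ^_) + 1# ≈ X ^ N
      geometric zero    = ≈-trans (+-congʳ (zeroʳ e)) (+-identityˡ 1#)
      geometric (suc N) = begin
        e * ∑ (suc N) (X ^_) + 1#
          ≈⟨ +-congʳ (*-congˡ (∑-last N (X ^_))) ⟩
        e * (∑ N (X ^_) + X ^ N) + 1#
          ≈⟨ solve 3 (λ e s p → e :* (s :+ p) :+ con 1 := e :* s :+ con 1 :+ e :* p) ≈-refl e (∑ N (X ^_)) (X ^ N) ⟩
        e * ∑ N (X ^_) + 1# + e * X ^ N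
          ≈⟨ +-congʳ (geometric N) ⟩
        X ^ N + e * X ^ N
          ≈⟨ solve 2 (λ e p → p :+ e :* p := (con 1 :+ e) :* p) ≈-refl e (X ^ N) ⟩
        (1# + e) * X ^ N
          ≈⟨ *-congʳ X≈1+e ⟨
        X * X ^ N ∎

      arithmetico-geometric : ∀ N → e * ∑ N (λ j → nat j * X ^ j) + X * ∑ N (X ^_) ≈ nat N * X ^ N
      arithmetico-geometric zero    =
        ≈-trans (+-cong (zeroʳ e) (zeroʳ X)) (≈-trans (+-identityˡ 0#) (≈-sym (zeroˡ _)))
      arithmetico-geometric (suc N) = begin
        e * ∑ (suc N) f + X * ∑ (suc N) (X ^_)
          ≈⟨ +-cong (*-congˡ (∑-last N f)) (*-congˡ (∑-last N (X ^_))) ⟩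
        e * (∑ N f + nat N * P) + X * (∑ N (X ^_) + P)
          ≈⟨ solve 6 (λ e s n p x g → e :* (s :+ n :* p) :+ x :* (g :+ p) :=
                                      e :* s :+ x :* g :+ (e :* (n :* p) :+ x :* p))
               ≈-refl e (∑ N f) (nat N) P X (∑ N (X ^_)) ⟩
        e * ∑ N f + X * ∑ N (X ^_) + (e * (nat N * P) + X * P)
          ≈⟨ +-congʳ (arithmetico-geometric N) ⟩
        nat N * P + (e * (nat N * P) + X * P)
          ≈⟨ solve 4 (λ e n p x → n :* p :+ (e :* (n :* p) :+ x :* p) := x :* p :+ n :* ((con 1 :+ e) :* p))
               ≈-refl e (nat N) P X ⟩
        X * P + nat N * ((1# + e) * P)
          ≈⟨ +-congˡ (*-congˡ (*-congʳ X≈1+e)) ⟨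
        X * P + nat N * (X * P)
          ≈⟨ solve 2 (λ n y → y :+ n :* y := (con 1 :+ n) :* y) ≈-refl (nat N) (X * P) ⟩
        (1# + nat N) * (X * P) ∎
        where
        f : ℕ → Carrier
        f j = nat j * X ^ j
        P : Carrier
        P = X ^ N

      module _ {e⁻¹ : Carrier} (e⁻¹e≈1 : e⁻¹ * e ≈ 1#) (N : ℕ) (X^N≈1 : X ^ N ≈ 1#) where

        private
          cancel-e : ∀ {x y} → e * x ≈ e * y → x ≈ y
          cancel-e {x} {y} ex≈ey = ≈-trans (≈-sym (absorb x)) (≈-trans (*-congˡ ex≈ey) (absorb y))
            where
            absorb : ∀ z → e⁻¹ * (e * z) ≈ z
            absorb z = ≈-trans (≈-sym (*-assoc e⁻¹ e z)) (≈-trans (*-congʳ e⁻¹e≈1) (*-identityˡ z))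

        geometric≈0 : ∑ N (X ^_) ≈ 0#
        geometric≈0 = cancel-e (≈-trans
          (+-cancelʳ 1# _ _ (≈-trans (≈-trans (geometric N) X^N≈1) (≈-sym (+-identityˡ 1#)))) (≈-sym (zeroʳ e)))

        -- With X = exp 2iα this expands c = cot α in powers of X.
        cotangent-expansion : ∀ {c I} → c * e ≈ I * (X + 1#) →
          nat N * c ≈ I * (nat N + (∑ N (λ j → nat j * X ^ j) + ∑ N (λ j → nat j * X ^ j)))
        cotangent-expansion {c} {I} ce≈I[X+1] = cancel-e (begin
          e * (nat N * c)
            ≈⟨ solve 3 (λ e n c → e :* (n :* c) := n :* (c :* e)) ≈-refl e (nat N) c ⟩
          nat N * (c * e)
            ≈⟨ *-congˡ (≈-trans ce≈I[X+1] (*-congˡ (+-congʳ X≈1+e))) ⟩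
          nat N * (I * (1# + e + 1#))
            ≈⟨ solve 3 (λ n i e → n :* (i :* (con 1 :+ e :+ con 1)) := i :* (n :* e :+ (n :+ n))) ≈-refl (nat N) I e ⟩
          I * (nat N * e + (nat N + nat N))
            ≈⟨ *-congˡ (+-congˡ (+-cong eJ≈N eJ≈N)) ⟨
          I * (nat N * e + (e * J + e * J))
            ≈⟨ solve 4 (λ n i e j → i :* (n :* e :+ (e :* j :+ e :* j)) := e :* (i :* (n :+ (j :+ j))))
                 ≈-refl (nat N) I e J ⟩
          e * (I * (nat N + (J + J))) ∎)
          where
          J : Carrier
          J = ∑ N (λ j → nat j * X ^ j)
          eJ≈N : e * J ≈ nat N
          eJ≈N = begin
            e * J                   ≈⟨ +-identityʳ _ ⟨
            e * J + 0#              ≈⟨ +-congˡ (≈-trans (*-congˡ geometric≈0) (zeroʳ X)) ⟨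
            e * J + X * ∑ N (X ^_)  ≈⟨ arithmetico-geometric N ⟩
            nat N * X ^ N           ≈⟨ ≈-trans (*-congˡ X^N≈1) (*-identityʳ (nat N)) ⟩
            nat N                   ∎

  module _ {a ℓ} (S : CommutativeRing a ℓ) (M : ℕ) where
    open CommutativeRing S using (Carrier; _≈_; _+_; _*_; _-_; 1#; commutativeSemiring)
    open import Algebra.Properties.CommutativeSemiring.Exp commutativeSemiring using (_^_)

    -- ζ = exp(2πi/M) and c m = cot(πm/M), I being the imaginary unit up to a real factor; κ m inverts ζᵐ - 1.
    record Cotangents : Set (a Level.⊔ ℓ) where
      field
        ζ I     : Carrier
        c κ     : ℕ → Carrier
        ζ^M≈1   : ζ ^ M ≈ 1#
        c-eq    : ∀ m → 0 ℕ.< m → m ℕ.< M → c m * (ζ ^ m - 1#) ≈ I * (ζ ^ m + 1#)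
        κ-eq    : ∀ m → 0 ℕ.< m → m ℕ.< M → κ m * (ζ ^ m - 1#) ≈ 1#

  module RootOfUnity {a ℓ} (S : CommutativeRing a ℓ) (n L : ℕ) {{_ : ℕ.NonZero n}} {{_ : ℕ.NonZero L}}
    (cotangents : Cotangents S (n ℕ.* L)) where

    open CommutativeRing S hiding (zero) renaming (refl to ≈-refl; sym to ≈-sym; trans to ≈-trans)
    open RangeSum commutativeSemiring
    open PowerSums S
    open Cotangents cotangents
    open import Algebra.Properties.CommutativeSemigroup *-commutativeSemigroup using (x∙yz≈xz∙y)
    open import Algebra.Properties.CommutativeSemiring.Exp commutativeSemiring
    open import Algebra.Properties.Semiring.Mult semiring using (×1-homo-*)
    open import Relation.Binary.Reasoning.Setoid setoid

    private
      M : ℕ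
      M = n ℕ.* L

      ζ^-cong : ∀ {a b} → a ≡ b → ζ ^ a ≈ ζ ^ b
      ζ^-cong = ^-congʳ ζ

      ζ^[M*k]≈1 : ∀ k → ζ ^ (M ℕ.* k) ≈ 1#
      ζ^[M*k]≈1 k = ≈-trans (≈-sym (^-assocʳ ζ M k)) (≈-trans (^-congˡ k ζ^M≈1) (1^ k))

      ζ^-drop : ∀ k j → ζ ^ (M ℕ.* k ℕ.+ j) ≈ ζ ^ j
      ζ^-drop k j = ≈-trans (^-homo-* ζ (M ℕ.* k) j) (≈-trans (*-congʳ (ζ^[M*k]≈1 k)) (*-identityˡ _))

      ζ^[*L]-mod : ∀ {a b} → a ≡ b mod n → ζ ^ (a ℕ.* L) ≈ ζ ^ (b ℕ.* L)
      ζ^[*L]-mod {a} {b} a≡b = ≈-trans (reduce a) (≈-trans (ζ^-cong (cong (ℕ._* L) a≡b)) (≈-sym (reduce b)))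
        where
        regroup : ∀ r q n L → (r ℕ.+ q ℕ.* n) ℕ.* L ≡ n ℕ.* L ℕ.* q ℕ.+ r ℕ.* L
        regroup = ℕ-Solver.solve-∀
        reduce : ∀ a → ζ ^ (a ℕ.* L) ≈ ζ ^ (a % n ℕ.* L)
        reduce a = ≈-trans
          (ζ^-cong (trans (cong (ℕ._* L) (m≡m%n+[m/n]*n a n)) (regroup (a % n) (a ℕ./ n) n L))) (ζ^-drop (a ℕ./ n) _)

      blockSum : ℕ → Carrier
      blockSum j = ∑ L (λ l → ζ ^ (l ℕ.* n ℕ.* j))

      blockSum-multiple : ∀ j → blockSum (j ℕ.* L ℕ.+ 0) ≈ nat L
      blockSum-multiple j = ≈-trans (∑-cong′ L λ l → ≈-trans (ζ^-cong (regroup l n j L)) (ζ^[M*k]≈1 (l ℕ.* j)))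
        (≈-trans (∑-const L 1#) (*-identityʳ _))
        where
        regroup : ∀ l n j L → l ℕ.* n ℕ.* (j ℕ.* L ℕ.+ 0) ≡ n ℕ.* L ℕ.* (l ℕ.* j)
        regroup = ℕ-Solver.solve-∀

      blockSum-nonmultiple : ∀ j ρ → ρ ℕ.< L → ρ ≢ 0 → blockSum (j ℕ.* L ℕ.+ ρ) ≈ 0#
      blockSum-nonmultiple j ρ ρ<L ρ≢0 = ≈-trans
        (∑-cong′ L λ l → ≈-trans (ζ^-cong (regroup l n j L ρ))
          (≈-trans (ζ^-drop (l ℕ.* j) _) (≈-sym (^-assocʳ ζ (n ℕ.* ρ) l))))
        (geometric≈0 (x≈1+[x-1] (ζ ^ (n ℕ.* ρ))) (κ-eq (n ℕ.* ρ) 0<nρ (ℕ.*-monoʳ-< n ρ<L)) L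
          (≈-trans (^-assocʳ ζ (n ℕ.* ρ) L) (≈-trans (ζ^-cong (commute n ρ L)) (ζ^[M*k]≈1 ρ))))
        where
        regroup : ∀ l n j L ρ → l ℕ.* n ℕ.* (j ℕ.* L ℕ.+ ρ) ≡ n ℕ.* L ℕ.* (l ℕ.* j) ℕ.+ n ℕ.* ρ ℕ.* l
        regroup = ℕ-Solver.solve-∀
        commute : ∀ n ρ L → n ℕ.* ρ ℕ.* L ≡ n ℕ.* L ℕ.* ρ
        commute = ℕ-Solver.solve-∀
        0<nρ : 0 ℕ.< n ℕ.* ρ
        0<nρ = ℕ.*-mono-< (ℕ.>-nonZero⁻¹ n) (ℕ.n≢0⇒n>0 ρ≢0)

    cotangent-sum : ∀ m → 0 ℕ.< m → m ℕ.< M →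
      nat M * c m ≈ I * (nat M + (∑ M (λ j → nat j * ζ ^ (m ℕ.* j)) + ∑ M (λ j → nat j * ζ ^ (m ℕ.* j))))
    cotangent-sum m 0<m m<M = ≈-trans
      (cotangent-expansion (x≈1+[x-1] (ζ ^ m)) (κ-eq m 0<m m<M) M
        (≈-trans (^-assocʳ ζ m M) (≈-trans (ζ^-cong (ℕ.*-comm m M)) (ζ^[M*k]≈1 m))) (c-eq m 0<m m<M))
      (*-congˡ (+-congˡ (+-cong powers powers)))
      where
      powers : ∑ M (λ j → nat j * (ζ ^ m) ^ j) ≈ ∑ M (λ j → nat j * ζ ^ (m ℕ.* j))
      powers = ∑-cong′ M λ j → *-congˡ (^-assocʳ ζ m j)

    residueTransform : ℕ → Carrier
    residueTransform a = nat L * nat L * ∑ n (λ r → nat (r ℕ.* a % n) * ζ ^ (r ℕ.* L))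

    private
      only-multiples-of-L : ∀ m₀ →
        ∑ L (λ l → ∑ M (λ j → nat j * ζ ^ ((l ℕ.* n ℕ.+ m₀) ℕ.* j))) ≈
          nat L * nat L * ∑ n (λ j → nat j * ζ ^ (j ℕ.* m₀ ℕ.* L))
      only-multiples-of-L m₀ = begin
        ∑ L (λ l → ∑ M (λ j → nat j * ζ ^ ((l ℕ.* n ℕ.+ m₀) ℕ.* j)))
          ≈⟨ ∑-swap L M _ ⟩
        ∑ M (λ j → ∑ L (λ l → nat j * ζ ^ ((l ℕ.* n ℕ.+ m₀) ℕ.* j)))
          ≈⟨ ∑-cong′ M (λ j → ≈-trans (∑-cong′ L λ l → separate j l) (≈-sym (∑-*ˡ L (nat j * ζ ^ (m₀ ℕ.* j)) _))) ⟩
        ∑ M (λ j → nat j * ζ ^ (m₀ ℕ.* j) * blockSum j)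
          ≈⟨ ∑-blocks n L _ ⟩
        ∑ n (λ j → ∑ L (λ ρ → nat (j ℕ.* L ℕ.+ ρ) * ζ ^ (m₀ ℕ.* (j ℕ.* L ℕ.+ ρ)) * blockSum (j ℕ.* L ℕ.+ ρ)))
          ≈⟨ ∑-cong′ n (λ j → ∑-single L 0 (ℕ.>-nonZero⁻¹ L) λ ρ ρ<L ρ≢0 →
               ≈-trans (*-congˡ (blockSum-nonmultiple j ρ ρ<L ρ≢0)) (zeroʳ _)) ⟩
        ∑ n (λ j → nat (j ℕ.* L ℕ.+ 0) * ζ ^ (m₀ ℕ.* (j ℕ.* L ℕ.+ 0)) * blockSum (j ℕ.* L ℕ.+ 0))
          ≈⟨ ∑-cong′ n multiple ⟩
        ∑ n (λ j → nat L * nat L * (nat j * ζ ^ (j ℕ.* m₀ ℕ.* L)))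
          ≈⟨ ∑-*ˡ n (nat L * nat L) _ ⟨
        nat L * nat L * ∑ n (λ j → nat j * ζ ^ (j ℕ.* m₀ ℕ.* L)) ∎
        where
        open import Algebra.Solver.Ring.NaturalCoefficients.Default commutativeSemiring using (solve; _:*_; _:=_)
        separate : ∀ j l → nat j * ζ ^ ((l ℕ.* n ℕ.+ m₀) ℕ.* j) ≈ nat j * ζ ^ (m₀ ℕ.* j) * ζ ^ (l ℕ.* n ℕ.* j)
        separate j l = ≈-trans
          (*-congˡ (≈-trans (ζ^-cong (ℕ.*-distribʳ-+ j (l ℕ.* n) m₀)) (^-homo-* ζ (l ℕ.* n ℕ.* j) (m₀ ℕ.* j))))
          (x∙yz≈xz∙y (nat j) _ _)
        regroup : ∀ m j L → m ℕ.* (j ℕ.* L ℕ.+ 0) ≡ j ℕ.* m ℕ.* L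
        regroup = ℕ-Solver.solve-∀
        multiple : ∀ j → nat (j ℕ.* L ℕ.+ 0) * ζ ^ (m₀ ℕ.* (j ℕ.* L ℕ.+ 0)) * blockSum (j ℕ.* L ℕ.+ 0) ≈
                         nat L * nat L * (nat j * ζ ^ (j ℕ.* m₀ ℕ.* L))
        multiple j = ≈-trans
          (*-cong (*-cong (≈-trans (reflexive (cong nat (ℕ.+-identityʳ (j ℕ.* L)))) (×1-homo-* j L))
                          (ζ^-cong (regroup m₀ j L))) (blockSum-multiple j))
          (solve 3 (λ j l z → j :* l :* z :* l := l :* l :* (j :* z)) ≈-refl (nat j) (nat L) (ζ ^ (j ℕ.* m₀ ℕ.* L)))

    -- Summing over the progression m₀ + nℤ kills all frequencies except the multiples of L;
    -- then j = ra mod n turns the inverse m₀ of a into a itself.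
    progression-transform : ∀ a m₀ → a ℕ.* m₀ ≡ 1 mod n →
      ∑ L (λ l → ∑ M (λ j → nat j * ζ ^ ((l ℕ.* n ℕ.+ m₀) ℕ.* j))) ≈ residueTransform a
    progression-transform a m₀ am₀≡1 = ≈-trans (only-multiples-of-L m₀) (*-congˡ (begin
      ∑ n (λ j → nat j * ζ ^ (j ℕ.* m₀ ℕ.* L))
        ≈⟨ ∑-permute n _ (λ r → r ℕ.* a % n) (λ j → j ℕ.* m₀ % n)
             (λ r _ → m%n<n (r ℕ.* a) n) (λ j _ → m%n<n (j ℕ.* m₀) n)
             (inverse-scale n {m₀} {a} (inverse-comm n a m₀ am₀≡1)) (inverse-scale n am₀≡1) ⟩
      ∑ n (λ r → nat (r ℕ.* a % n) * ζ ^ (r ℕ.* a % n ℕ.* m₀ ℕ.* L))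
        ≈⟨ ∑-cong n (λ r r<n → *-congˡ (ζ^[*L]-mod (trans (inverse-scale n am₀≡1 r r<n) (sym (m<n⇒m%n≡m r<n))))) ⟩
      ∑ n (λ r → nat (r ℕ.* a % n) * ζ ^ (r ℕ.* L)) ∎))

    progression-range : ∀ {a α} → Inverses n a α → ∀ i {l} → l ℕ.< L → 0 ℕ.< l ℕ.* n ℕ.+ α i × l ℕ.* n ℕ.+ α i ℕ.< M
    progression-range {α = α} inverses i {l} l<L =
      ℕ.<-≤-trans (0<a⁻¹ i) (ℕ.m≤n+m (α i) (l ℕ.* n)) ,
      ℕ.<-≤-trans (ℕ.+-monoʳ-< (l ℕ.* n) (a⁻¹<n i))
        (ℕ.≤-trans (ℕ.≤-reflexive (ℕ.+-comm (l ℕ.* n) n))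
          (ℕ.≤-trans (ℕ.*-monoˡ-≤ n l<L) (ℕ.≤-reflexive (ℕ.*-comm L n))))
      where open Inverses inverses

    module _ (N : ℕ) where

      progressionSum : (ℕ → ℕ) → Carrier
      progressionSum α = ∑ N (λ i → ∑ L (λ l → c (l ℕ.* n ℕ.+ α i)))

      private
        transformSum : (ℕ → ℕ) → Carrier
        transformSum a = ∑ N (residueTransform ∘ a)

        progressionSum-transform : ∀ {a α} → Inverses n a α →
          nat M * progressionSum α ≈ I * (∑ N (λ _ → nat L * nat M) + (transformSum a + transformSum a))
        progressionSum-transform {a} {α} inverses = begin
          nat M * progressionSum α
            ≈⟨ ≈-trans (∑-*ˡ N (nat M) _) (∑-cong′ N λ i → ∑-*ˡ L (nat M) _) ⟩
          ∑ N (λ i → ∑ L (λ l → nat M * c (l ℕ.* n ℕ.+ α i)))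
            ≈⟨ ∑-cong′ N (λ i → ∑-cong L λ l l<L →
                 let 0<m , m<M = progression-range inverses i l<L in cotangent-sum (l ℕ.* n ℕ.+ α i) 0<m m<M) ⟩
          ∑ N (λ i → ∑ L (λ l → I * (nat M + (J i l + J i l))))
            ≈⟨ ∑-cong′ N (λ i → ≈-trans (≈-sym (∑-*ˡ L I _)) (*-congˡ (sum-over-l i))) ⟩
          ∑ N (λ i → I * (nat L * nat M + (residueTransform (a i) + residueTransform (a i))))
            ≈⟨ ≈-trans (≈-sym (∑-*ˡ N I _)) (*-congˡ (≈-trans (∑-+ N _ _) (+-congˡ (∑-+ N _ _)))) ⟩
          I * (∑ N (λ _ → nat L * nat M) + (transformSum a + transformSum a)) ∎
          where
          open Inverses inverses
          J : ℕ → ℕ → Carrier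
          J i l = ∑ M (λ j → nat j * ζ ^ ((l ℕ.* n ℕ.+ α i) ℕ.* j))
          sum-over-l : ∀ i → ∑ L (λ l → nat M + (J i l + J i l)) ≈
                             nat L * nat M + (residueTransform (a i) + residueTransform (a i))
          sum-over-l i = ≈-trans (∑-+ L _ _) (+-cong (∑-const L (nat M))
            (≈-trans (∑-+ L (J i) (J i)) (+-cong transform transform)))
            where transform = progression-transform (a i) (α i) (inverse i)

        transformSum-residues : ∀ a → transformSum a ≈
          nat L * nat L * ∑ n (λ r → nat (residueSum n N a r) * ζ ^ (r ℕ.* L))
        transformSum-residues a = ≈-trans (≈-sym (∑-*ˡ N (nat L * nat L) _)) (*-congˡ (≈-trans (∑-swap N n _)
          (∑-cong′ n λ r → ≈-trans (≈-sym (∑-*ʳ N (ζ ^ (r ℕ.* L)) _))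
            (*-congʳ (≈-sym (nat-∑ N λ i → r ℕ.* a i % n))))))

      equal-progressionSums : ∀ {a α b β} → Inverses n a α → Inverses n b β →
        (∀ r → residueSum n N a r ≡ residueSum n N b r) → nat M * progressionSum α ≈ nat M * progressionSum β
      equal-progressionSums {a} {α} {b} {β} a-inverses b-inverses sums≡ = begin
        nat M * progressionSum α
          ≈⟨ progressionSum-transform a-inverses ⟩
        I * (∑ N (λ _ → nat L * nat M) + (transformSum a + transformSum a))
          ≈⟨ *-congˡ (+-congˡ (+-cong same same)) ⟩
        I * (∑ N (λ _ → nat L * nat M) + (transformSum b + transformSum b))
          ≈⟨ progressionSum-transform b-inverses ⟨
        nat M * progressionSum β                                             ∎
        where
        same : transformSum a ≈ transformSum b
        same = ≈-trans (transformSum-residues a) (≈-trans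
          (*-congˡ (∑-cong′ n λ r → *-congʳ (reflexive (cong nat (sums≡ r))))) (≈-sym (transformSum-residues b)))

    antisymmetry : ∀ m m′ → 0 ℕ.< m → m ℕ.< M → 0 ℕ.< m′ → m′ ℕ.< M → m ℕ.+ m′ ≡ M → c m + c m′ ≈ 0#
    antisymmetry m m′ 0<m m<M 0<m′ m′<M m+m′≡M = begin
      c m + c m′                          ≈⟨ *-identityˡ _ ⟨
      1# * (c m + c m′)                   ≈⟨ *-congʳ (κ-eq m 0<m m<M) ⟨
      κ m * E * (c m + c m′)              ≈⟨ solve 4 (λ k e c d → k :* e :* (c :+ d) := k :* (c :* e :+ d :* e))
                                               ≈-refl (κ m) E (c m) (c m′) ⟩
      κ m * (c m * E + c m′ * E)          ≈⟨ *-congˡ (+-congʳ reflect) ⟩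
      κ m * (c m′ * (X * E′) + c m′ * E)  ≈⟨ *-congˡ (distribˡ (c m′) (X * E′) E) ⟨
      κ m * (c m′ * (X * E′ + E))         ≈⟨ *-congˡ (≈-trans (*-congˡ XE′+E≈0) (zeroʳ (c m′))) ⟩
      κ m * 0#                            ≈⟨ zeroʳ (κ m) ⟩
      0#                                  ∎
      where
      open import Algebra.Solver.Ring.NaturalCoefficients.Default commutativeSemiring using (solve; _:+_; _:*_; _:=_; con)
      X X′ E E′ : Carrier
      X  = ζ ^ m
      X′ = ζ ^ m′
      E  = X - 1#
      E′ = X′ - 1#
      XX′≈1 : X * X′ ≈ 1#
      XX′≈1 = ≈-trans (≈-sym (^-homo-* ζ m m′)) (≈-trans (ζ^-cong m+m′≡M) ζ^M≈1)
      XE′+E≈0 : X * E′ + E ≈ 0#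
      XE′+E≈0 = begin
        X * E′ + E          ≈⟨ +-assoc (X * E′) X (- 1#) ⟨
        X * E′ + X - 1#     ≈⟨ +-congʳ (solve 2 (λ x e → x :* e :+ x := x :* (con 1 :+ e)) ≈-refl X E′) ⟩
        X * (1# + E′) - 1#  ≈⟨ +-congʳ (≈-trans (*-congˡ (≈-sym (x≈1+[x-1] X′))) XX′≈1) ⟩
        1# - 1#             ≈⟨ -‿inverseʳ 1# ⟩
        0#                  ∎
      reflect : c m * E ≈ c m′ * (X * E′)
      reflect = begin
        c m * E              ≈⟨ c-eq m 0<m m<M ⟩
        I * (X + 1#)         ≈⟨ *-congˡ (+-congˡ XX′≈1) ⟨
        I * (X + X * X′)     ≈⟨ solve 3 (λ i x y → i :* (x :+ x :* y) := x :* (i :* (y :+ con 1))) ≈-refl I X X′ ⟩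
        X * (I * (X′ + 1#))  ≈⟨ *-congˡ (c-eq m′ 0<m′ m′<M) ⟨
        X * (c m′ * E′)      ≈⟨ solve 3 (λ x c e → x :* (c :* e) := c :* (x :* e)) ≈-refl X (c m′) E′ ⟩
        c m′ * (X * E′)      ∎

  module Rotation {c ℓ} (S : CommutativeRing c ℓ) where
    open CommutativeRing S hiding (zero) renaming (refl to ≈-refl; sym to ≈-sym; trans to ≈-trans)
    open PowerSums S using (1^)
    open import Algebra.Properties.CommutativeSemiring.Exp commutativeSemiring
    open import Algebra.Solver.Ring.NaturalCoefficients.Default commutativeSemiring using (solve; _:+_; _:*_; _:=_; con)
    open import Relation.Binary.Reasoning.Setoid setoid

    -- rotation = w/w̄, with e = 1/(w w̄).
    module _ (w w̄ e : Carrier) (ww̄e≈1 : w * w̄ * e ≈ 1#) where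

      rotation : Carrier
      rotation = w * w * e

      private
        rotation-^ : ∀ m → rotation ^ m ≈ w ^ m * w ^ m * e ^ m
        rotation-^ m = ≈-trans (^-distrib-* (w * w) e m) (*-congʳ (^-distrib-* w w m))

        norm-^ : ∀ m → w ^ m * w̄ ^ m * e ^ m ≈ 1#
        norm-^ m = begin
          w ^ m * w̄ ^ m * e ^ m  ≈⟨ *-congʳ (^-distrib-* w w̄ m) ⟨
          (w * w̄) ^ m * e ^ m    ≈⟨ ^-distrib-* (w * w̄) e m ⟨
          (w * w̄ * e) ^ m        ≈⟨ ^-congˡ m ww̄e≈1 ⟩
          1# ^ m                  ≈⟨ 1^ m ⟩
          1#                      ∎

      module _ (m : ℕ) {B : Carrier} (w^m≈w̄^m+B : w ^ m ≈ w̄ ^ m + B) where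

        private
          A Ā E : Carrier
          A = w ^ m
          Ā = w̄ ^ m
          E = e ^ m

          rotation-^≈1+ : rotation ^ m ≈ 1# + A * E * B
          rotation-^≈1+ = begin
            rotation ^ m           ≈⟨ rotation-^ m ⟩
            A * A * E              ≈⟨ *-congʳ (*-congˡ w^m≈w̄^m+B) ⟩
            A * (Ā + B) * E
              ≈⟨ solve 4 (λ a b e d → a :* (b :+ d) :* e := a :* b :* e :+ a :* e :* d) ≈-refl A Ā E B ⟩
            A * Ā * E + A * E * B  ≈⟨ +-congʳ (norm-^ m) ⟩
            1# + A * E * B         ∎

          rotation-^-1 : rotation ^ m - 1# ≈ A * E * B
          rotation-^-1 = begin
            rotation ^ m - 1#      ≈⟨ +-congʳ (≈-trans rotation-^≈1+ (+-comm 1# (A * E * B))) ⟩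
            A * E * B + 1# - 1#    ≈⟨ +-assoc (A * E * B) 1# (- 1#) ⟩
            A * E * B + (1# - 1#)  ≈⟨ ≈-trans (+-congˡ (-‿inverseʳ 1#)) (+-identityʳ _) ⟩
            A * E * B              ∎

        rotation-cotangent : ∀ {c I} → c * B ≈ I * (A + Ā) → c * (rotation ^ m - 1#) ≈ I * (rotation ^ m + 1#)
        rotation-cotangent {c} {I} cB≈I[A+Ā] = begin
          c * (rotation ^ m - 1#)      ≈⟨ *-congˡ rotation-^-1 ⟩
          c * (A * E * B)
            ≈⟨ solve 4 (λ c a e b → c :* (a :* e :* b) := a :* e :* (c :* b)) ≈-refl c A E B ⟩
          A * E * (c * B)              ≈⟨ *-congˡ cB≈I[A+Ā] ⟩
          A * E * (I * (A + Ā))        ≈⟨ solve 4 (λ a e i b → a :* e :* (i :* (a :+ b)) :=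
                                                       i :* (a :* a :* e :+ a :* b :* e)) ≈-refl A E I Ā ⟩
          I * (A * A * E + A * Ā * E)  ≈⟨ *-congˡ (+-cong (≈-sym (rotation-^ m)) (norm-^ m)) ⟩
          I * (rotation ^ m + 1#)      ∎

        rotation-inverse : ∀ {B⁻¹} → B⁻¹ * B ≈ 1# → Ā * B⁻¹ * (rotation ^ m - 1#) ≈ 1#
        rotation-inverse {B⁻¹} B⁻¹B≈1 = begin
          Ā * B⁻¹ * (rotation ^ m - 1#)  ≈⟨ *-congˡ rotation-^-1 ⟩
          Ā * B⁻¹ * (A * E * B)
            ≈⟨ solve 5 (λ b g a e d → b :* g :* (a :* e :* d) := a :* b :* e :* (g :* d))
                                                ≈-refl Ā B⁻¹ A E B ⟩
          A * Ā * E * (B⁻¹ * B)          ≈⟨ *-cong (norm-^ m) B⁻¹B≈1 ⟩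
          1# * 1#                        ≈⟨ *-identityˡ 1# ⟩
          1#                             ∎

        rotation-period : B ≈ 0# → rotation ^ m ≈ 1#
        rotation-period B≈0 =
          ≈-trans rotation-^≈1+ (≈-trans (+-congˡ (≈-trans (*-congˡ B≈0) (zeroʳ _))) (+-identityʳ 1#))

module QuadraticPowers where

  open OrderedRationals

  -- (1 + √-y)ᵐ = Re y m + Im y m √-y.  With y = tan² α this is (cos mα + i sin mα)/cosᵐ α.
  Re Im : ℚ → ℕ → ℚ
  Re y zero    = 1ℚ
  Re y (suc m) = Re y m - y * Im y m
  Im y zero    = 0ℚ
  Im y (suc m) = Im y m + Re y m

  private
    0≤4^ : ∀ m → 0ℚ ≤ 4ℚ ^ m
    0≤4^ = ^≥0 (positive⁻¹ 4ℚ)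

    quadruple : ∀ x → x + x + (x + x) ≡ 4ℚ * x
    quadruple = expand
      where
      expand : ∀ x → x + x + (x + x) ≡ (1ℚ + 1ℚ + (1ℚ + 1ℚ)) * x
      expand = solve-∀ ringℚ

  powers-bounded : ∀ {y} → 0ℚ ≤ y → y ≤ 2ℚ → ∀ m → ∣ Re y m ∣ ≤ 4ℚ ^ m × ∣ Im y m ∣ ≤ 4ℚ ^ m
  powers-bounded 0≤y y≤2 zero    = ≤-refl , 0≤1
  powers-bounded {y} 0≤y y≤2 (suc m) with powers-bounded 0≤y y≤2 m
  ... | ∣Re∣≤B , ∣Im∣≤B =
    ≤-trans (∣x-y∣≤ ∣Re∣≤B (∣x*y∣≤ (0≤x⇒∣x∣≤ 0≤y y≤2) ∣Im∣≤B)) (≤-slack B 0≤B (collect B)) ,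
    ≤-trans (∣x+y∣≤ ∣Im∣≤B ∣Re∣≤B) (≤-slack (B + B) (+≥0 0≤B 0≤B) (quadruple B))
    where
    B : ℚ
    B = 4ℚ ^ m
    0≤B : 0ℚ ≤ B
    0≤B = 0≤4^ m
    collect : ∀ b → b + (1ℚ + 1ℚ) * b + b ≡ (1ℚ + 1ℚ + (1ℚ + 1ℚ)) * b
    collect = solve-∀ ringℚ

  powers-Lipschitz : ∀ {y δ} → 0ℚ ≤ y → y ≤ 2ℚ → 0ℚ ≤ δ → y + δ ≤ 2ℚ → ∀ m →
                     ∣ Re (y + δ) m - Re y m ∣ ≤ 4ℚ ^ m * δ × ∣ Im (y + δ) m - Im y m ∣ ≤ 4ℚ ^ m * δ
  powers-Lipschitz 0≤y y≤2 0≤δ y+δ≤2 zero = *≥0 0≤1 0≤δ , *≥0 0≤1 0≤δ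
  powers-Lipschitz {y} {δ} 0≤y y≤2 0≤δ y+δ≤2 (suc m) with powers-Lipschitz 0≤y y≤2 0≤δ y+δ≤2 m
  ... | Re-close , Im-close = Re-step , Im-step
    where
    open ≤-Reasoning
    B p′ p q′ q : ℚ
    B  = 4ℚ ^ m
    p′ = Re (y + δ) m
    p  = Re y m
    q′ = Im (y + δ) m
    q  = Im y m
    Re-difference : ∀ p′ p y d q′ q → (p′ - (y + d) * q′) - (p - y * q) ≡ (p′ - p) - (y * (q′ - q) + d * q′)
    Re-difference = solve-∀ ringℚ
    Im-difference : ∀ p′ p q′ q → (q′ + p′) - (q + p) ≡ (q′ - q) + (p′ - p)
    Im-difference = solve-∀ ringℚ
    collect : ∀ b d → b * d + ((1ℚ + 1ℚ) * (b * d) + d * b) ≡ (1ℚ + 1ℚ + (1ℚ + 1ℚ)) * b * d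
    collect = solve-∀ ringℚ
    0≤Bδ : 0ℚ ≤ B * δ
    0≤Bδ = *≥0 (0≤4^ m) 0≤δ
    ∣q′∣≤B : ∣ q′ ∣ ≤ B
    ∣q′∣≤B = proj₂ (powers-bounded (+≥0 0≤y 0≤δ) y+δ≤2 m)
    Re-step : ∣ (p′ - (y + δ) * q′) - (p - y * q) ∣ ≤ 4ℚ * B * δ
    Re-step = begin
      ∣ (p′ - (y + δ) * q′) - (p - y * q) ∣   ≡⟨ cong ∣_∣ (Re-difference p′ p y δ q′ q) ⟩
      ∣ (p′ - p) - (y * (q′ - q) + δ * q′) ∣  ≤⟨ ∣x-y∣≤ Re-close (∣x+y∣≤ (∣x*y∣≤ (0≤x⇒∣x∣≤ 0≤y y≤2) Im-close)
                                                                             (∣x*y∣≤ (0≤x⇒∣x∣≤ 0≤δ ≤-refl) ∣q′∣≤B)) ⟩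
      B * δ + (2ℚ * (B * δ) + δ * B)          ≡⟨ collect B δ ⟩
      4ℚ * B * δ                              ∎
    Im-step : ∣ (q′ + p′) - (q + p) ∣ ≤ 4ℚ * B * δ
    Im-step = begin
      ∣ (q′ + p′) - (q + p) ∣  ≡⟨ cong ∣_∣ (Im-difference p′ p q′ q) ⟩
      ∣ (q′ - q) + (p′ - p) ∣  ≤⟨ ∣x+y∣≤ Im-close Re-close ⟩
      B * δ + B * δ            ≤⟨ ≤-slack _ (+≥0 0≤Bδ 0≤Bδ) (quadruple (B * δ)) ⟩
      4ℚ * (B * δ)             ≡⟨ *-assoc 4ℚ B δ ⟨
      4ℚ * B * δ               ∎

  record SmallAngle (y : ℚ) (x m : ℕ) : Set where
    field
      Re≤1 : Re y m ≤ 1ℚ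
      Re≥  : 1ℚ - ι m * (ι x * y) ≤ Re y m
      Im≥0 : 0ℚ ≤ Im y m
      Im≤m : Im y m ≤ ι m

  module _ {y : ℚ} (x : ℕ) (0≤y : 0ℚ ≤ y) (x²y≤1 : ι x * (ι x * y) ≤ 1ℚ) where

    private
      0≤1-mxy : ∀ {m} → m ℕ.≤ x → 0ℚ ≤ 1ℚ - ι m * (ι x * y)
      0≤1-mxy m≤x = x≤y⇒0≤y-x (≤-trans (*-monoʳ (*≥0 (ι≥0 x) 0≤y) (ι-mono m≤x)) x²y≤1)

    small-angle : ∀ m → m ℕ.≤ x → SmallAngle y x m
    small-angle zero    _   = record
      { Re≤1 = ≤-refl
      ; Re≥  = ≤-reflexive (cong (λ z → 1ℚ - z) (ι-0* (ι x * y)))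
      ; Im≥0 = ≤-refl
      ; Im≤m = ≤-reflexive (sym ι-0) }
    small-angle (suc m) m<x = record
      { Re≤1 = ≤-trans (≤-slack (y * Im y m) (*≥0 0≤y Im≥0) (cancel (Re y m) (y * Im y m))) Re≤1
      ; Re≥  = ≤-trans (≤-slack (y * (ι x - Im y m)) (*≥0 0≤y (x≤y⇒0≤y-x (≤-trans Im≤m (ι-mono m≤x)))) lower)
                       (+-monoˡ-≤ (- (y * Im y m)) Re≥)
      ; Im≥0 = +≥0 Im≥0 (≤-trans (0≤1-mxy m≤x) Re≥)
      ; Im≤m = subst (Im y m + Re y m ≤_) (trans (+-comm (ι m) 1ℚ) (sym (ι-suc m))) (+-mono-≤ Im≤m Re≤1) }
      where
      m≤x : m ℕ.≤ x
      m≤x = ℕ.<⇒≤ m<x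
      open SmallAngle (small-angle m m≤x)
      cancel : ∀ p z → p - z + z ≡ p
      cancel = solve-∀ ringℚ
      lower : 1ℚ - ι (suc m) * (ι x * y) + y * (ι x - Im y m) ≡ (1ℚ - ι m * (ι x * y)) - y * Im y m
      lower = trans (cong (λ z → 1ℚ - z * (ι x * y) + y * (ι x - Im y m)) (ι-suc m)) (regroup (ι m) (ι x) y (Im y m))
        where
        regroup : ∀ m x y q → 1ℚ - (1ℚ + m) * (x * y) + y * (x - q) ≡ (1ℚ - m * (x * y)) - y * q
        regroup = solve-∀ ringℚ

    Re≥0 : ∀ m → m ℕ.≤ x → 0ℚ ≤ Re y m
    Re≥0 m m≤x = ≤-trans (0≤1-mxy m≤x) (SmallAngle.Re≥ (small-angle m m≤x))

    Im≥1 : ∀ m → suc m ℕ.≤ x → 1ℚ ≤ Im y (suc m)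
    Im≥1 zero    _  = ≤-refl
    Im≥1 (suc m) m<x = ≤-trans (Im≥1 m (ℕ.<⇒≤ m<x)) (≤-slack (Re y (suc m)) (Re≥0 (suc m) (ℕ.<⇒≤ m<x)) refl)

  ImPositive : ℚ → ℕ → Set
  ImPositive y M = ∀ m → 1 ℕ.≤ m → m ℕ.≤ M → 0ℚ < Im y m

  NonpositiveIm : ℚ → ℕ → Set
  NonpositiveIm y M = ∃ λ m → 1 ℕ.≤ m × m ℕ.≤ M × Im y m ≤ 0ℚ

  private
    sign-of-Im : ∀ y M → ImPositive y M ⊎ NonpositiveIm y M
    sign-of-Im y zero = inj₁ λ m 1≤m m≤0 → ⊥-elim (ℕ.<-irrefl refl (ℕ.≤-trans 1≤m m≤0))
    sign-of-Im y (suc M) with sign-of-Im y M | 0ℚ <? Im y (suc M)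
    ... | inj₂ (m , 1≤m , m≤M , Im≤0) | _       = inj₂ (m , 1≤m , ℕ.m≤n⇒m≤1+n m≤M , Im≤0)
    ... | inj₁ _                      | no Im≯0 = inj₂ (suc M , s≤s z≤n , ℕ.≤-refl , ≮⇒≥ Im≯0)
    ... | inj₁ positive               | yes 0<Im = inj₁ extended
      where
      extended : ImPositive y (suc M)
      extended m 1≤m m≤1+M with ℕ.m≤n⇒m<n∨m≡n m≤1+M
      ... | inj₁ (s≤s m≤M) = positive m 1≤m m≤M
      ... | inj₂ refl      = 0<Im

  sign-change : ∀ y δ M → ImPositive y M → ∀ k → ¬ ImPositive (y + ι k * δ) M →
                ∃ λ j → ImPositive (y + ι j * δ) M × NonpositiveIm (y + ι j * δ + δ) M
  sign-change y δ M positive zero ¬positive =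
    ⊥-elim (¬positive (subst (λ z → ImPositive z M)
      (sym (trans (cong (λ z → y + z) (ι-0* δ)) (+-identityʳ y))) positive))
  sign-change y δ M positive (suc k) ¬positive with sign-of-Im (y + ι k * δ) M
  ... | inj₂ (m , 1≤m , m≤M , Im≤0) =
    sign-change y δ M positive k λ positive′ → <⇒≱ (positive′ m 1≤m m≤M) Im≤0
  ... | inj₁ positiveₖ with sign-of-Im (y + ι k * δ + δ) M
  ...   | inj₂ nonpositive = k , positiveₖ , nonpositive
  ...   | inj₁ positive₁₊ₖ = ⊥-elim (¬positive (subst (λ z → ImPositive z M) next positive₁₊ₖ))
    where
    next : y + ι k * δ + δ ≡ y + ι (suc k) * δ
    next = trans (+-assoc y (ι k * δ) δ) (cong (λ z → y + z) (sym (ι-suc* k δ)))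

  module _ {y : ℚ} {M : ℕ} (positive : ImPositive y M) where

    ImPositive⇒Im≥0 : ∀ m → m ℕ.≤ M → 0ℚ ≤ Im y m
    ImPositive⇒Im≥0 zero    _   = ≤-refl
    ImPositive⇒Im≥0 (suc m) m<M = <⇒≤ (positive (suc m) (s≤s z≤n) m<M)

    -- Im y 4 = 4 (1 - y).
    ImPositive⇒<1 : 4 ℕ.≤ M → y < 1ℚ
    ImPositive⇒<1 4≤M with y <? 1ℚ
    ... | yes y<1 = y<1
    ... | no  y≮1 = ⊥-elim (<⇒≱ (positive 4 (s≤s z≤n) 4≤M)
      (≤-slack (4ℚ * (y - 1ℚ)) (*≥0 (0≤4^ 1) (x≤y⇒0≤y-x (≮⇒≥ y≮1))) (expand y)))
      where
      expand : ∀ y → (((0ℚ + 1ℚ) + (1ℚ - y * 0ℚ)) + ((1ℚ - y * 0ℚ) - y * (0ℚ + 1ℚ)))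
                     + (((1ℚ - y * 0ℚ) - y * (0ℚ + 1ℚ)) - y * ((0ℚ + 1ℚ) + (1ℚ - y * 0ℚ)))
                     + ((1ℚ + 1ℚ) + (1ℚ + 1ℚ)) * (y - 1ℚ) ≡ 0ℚ
      expand = solve-∀ ringℚ

    module _ (0≤y : 0ℚ ≤ y) where

      half-Im≤Im : ∀ m → suc (suc m) ℕ.≤ M → ½ * Im y m ≤ Im y (suc m)
      half-Im≤Im m m+2≤M = ≤-slack (½ * (y * Im y m) + ½ * Im y (suc (suc m)))
        (+≥0 (*≥0 0≤½ (*≥0 0≤y (ImPositive⇒Im≥0 m (ℕ.≤-trans (ℕ.m≤n+m m 2) m+2≤M))))
             (*≥0 0≤½ (ImPositive⇒Im≥0 (suc (suc m)) m+2≤M)))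
        (recurrence y (Im y m) (Re y m))
        where
        recurrence : ∀ y q p → ½ * q + (½ * (y * q) + ½ * ((q + p) + (p - y * q))) ≡ q + p
        recurrence = solve-∀ ringℚ

      Im≥½^ : ∀ m → suc m ℕ.< M → ½ ^ suc m ≤ Im y (suc m)
      Im≥½^ zero    _   = ≤-slack ½ 0≤½ refl
      Im≥½^ (suc m) m<M = ≤-trans (*-monoˡ 0≤½ (Im≥½^ m (ℕ.<⇒≤ m<M))) (half-Im≤Im (suc m) m<M)

  8ℚ : ℚ
  8ℚ = 2ℚ * 4ℚ

  private
    1≤8 : 1ℚ ≤ 8ℚ
    1≤8 = *-mono 0≤1 1≤2 0≤1 (≤-trans 1≤2 (≤-slack 2ℚ 0≤2 refl))

  Im-nearly-zero : ∀ {y δ} → 0ℚ ≤ y → y ≤ 2ℚ → 0ℚ ≤ δ → y + δ ≤ 2ℚ → ∀ m → Im (y + δ) m ≤ 0ℚ → Im y m ≤ 4ℚ ^ m * δ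
  Im-nearly-zero {y} {δ} 0≤y y≤2 0≤δ y+δ≤2 m Im≤0 = begin
    Im y m                     ≤⟨ ≤-slack (- Im (y + δ) m) (neg-antimono-≤ Im≤0) (flip (Im y m) (Im (y + δ) m)) ⟩
    - (Im (y + δ) m - Im y m)  ≤⟨ -x≤∣x∣ (Im (y + δ) m - Im y m) ⟩
    ∣ Im (y + δ) m - Im y m ∣  ≤⟨ proj₂ (powers-Lipschitz 0≤y y≤2 0≤δ y+δ≤2 m) ⟩
    4ℚ ^ m * δ                 ∎
    where
    open ≤-Reasoning
    flip : ∀ a b → a + - b ≡ - (b - a)
    flip = solve-∀ ringℚ

  -- A small value before the end forces t to be bounded, because Im y m ≥ ½ᵐ for m < M.
  small-Im-at-end : ∀ {y M t} → 0ℚ ≤ y → y ≤ 2ℚ → ImPositive y M → 0ℚ ≤ t → ∀ m → 1 ℕ.≤ m → m ℕ.≤ M →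
                    t * Im y m ≤ 4ℚ ^ m → t * Im y M ≤ 8ℚ ^ M * 4ℚ ^ M
  small-Im-at-end {y} {M} {t} 0≤y y≤2 positive 0≤t (suc m) _ m≤M t*Im≤ with ℕ.m≤n⇒m<n∨m≡n m≤M
  ... | inj₂ refl = ≤-trans t*Im≤ (1≤x⇒y≤x*y (^≥1 1≤8 M) (0≤4^ M))
  ... | inj₁ m<M  = *-mono 0≤t t≤8^M (ImPositive⇒Im≥0 positive M ℕ.≤-refl)
    (≤-trans (x≤∣x∣ (Im y M)) (proj₂ (powers-bounded 0≤y y≤2 M)))
    where
    open ≤-Reasoning
    m⁺ : ℕ
    m⁺ = suc m
    0≤2^ : 0ℚ ≤ 2ℚ ^ m⁺
    0≤2^ = ^≥0 0<2 m⁺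
    t≤8^M : t ≤ 8ℚ ^ M
    t≤8^M = begin
      t                        ≡⟨ trans (cong (t *_) (trans (sym (^-distrib-* 2ℚ ½ m⁺)) (1^ m⁺))) (*-identityʳ t) ⟨
      t * (2ℚ ^ m⁺ * ½ ^ m⁺)   ≡⟨ x∙yz≈y∙xz t (2ℚ ^ m⁺) (½ ^ m⁺) ⟩
      2ℚ ^ m⁺ * (t * ½ ^ m⁺)   ≤⟨ *-monoˡ 0≤2^ (*-monoˡ 0≤t (Im≥½^ positive 0≤y m m<M)) ⟩
      2ℚ ^ m⁺ * (t * Im y m⁺)  ≤⟨ *-monoˡ 0≤2^ t*Im≤ ⟩
      2ℚ ^ m⁺ * 4ℚ ^ m⁺        ≡⟨ ^-distrib-* 2ℚ 4ℚ m⁺ ⟨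
      8ℚ ^ m⁺                  ≤⟨ ^-mono 1≤8 m≤M ⟩
      8ℚ ^ M                   ∎

  -- y approximates tan²(π/M) from below.
  record Approximation (M T : ℕ) : Set where
    field
      y           : ℚ
      y≥          : inv (ι M * ι M) ≤ y
      y≤1         : y ≤ 1ℚ
      Im-positive : ImPositive y M
      Im-small    : ι (suc T) * Im y M ≤ 8ℚ ^ M * 4ℚ ^ M

  approximation : ∀ M T → 4 ℕ.≤ M → Approximation M T
  approximation M@(suc _) T 4≤M = result (sign-change y₀ δ M positive₀ (suc T) not-positive)
    where
    y₀ δ : ℚ
    y₀ = inv (ι M * ι M)
    δ  = inv (ι (suc T))
    0<M² : 0ℚ < ι M * ι M
    0<M² = *>0 (ι>0 M) (ι>0 M)
    0≤y₀ : 0ℚ ≤ y₀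
    0≤y₀ = inv≥0 0<M²
    0≤δ : 0ℚ ≤ δ
    0≤δ = inv≥0 (ι>0 (suc T))
    positive₀ : ImPositive y₀ M
    positive₀ (suc m) _ m<M = <-≤-trans 0<1
      (Im≥1 M 0≤y₀ (≤-reflexive (trans (sym (*-assoc (ι M) (ι M) y₀)) (*-inv⁺ 0<M²))) m m<M)
    not-positive : ¬ ImPositive (y₀ + ι (suc T) * δ) M
    not-positive positive = <⇒≱ (ImPositive⇒<1 positive 4≤M)
      (≤-slack y₀ 0≤y₀ (trans (+-comm 1ℚ y₀) (cong (λ z → y₀ + z) (sym (*-inv⁺ (ι>0 (suc T)))))))
    result : (∃ λ j → ImPositive (y₀ + ι j * δ) M × NonpositiveIm (y₀ + ι j * δ + δ) M) → Approximation M T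
    result (j , positive , m , 1≤m , m≤M , Im≤0) = record
      { y = y ; y≥ = ≤-slack (ι j * δ) 0≤jδ refl ; y≤1 = y≤1 ; Im-positive = positive
      ; Im-small = small-Im-at-end 0≤y y≤2 positive (ι≥0 (suc T)) m 1≤m m≤M scaled }
      where
      y : ℚ
      y = y₀ + ι j * δ
      0≤jδ : 0ℚ ≤ ι j * δ
      0≤jδ = *≥0 (ι≥0 j) 0≤δ
      0≤y : 0ℚ ≤ y
      0≤y = +≥0 0≤y₀ 0≤jδ
      y≤1 : y ≤ 1ℚ
      y≤1 = <⇒≤ (ImPositive⇒<1 positive 4≤M)
      y≤2 : y ≤ 2ℚ
      y≤2 = ≤-trans y≤1 1≤2
      scaled : ι (suc T) * Im y m ≤ 4ℚ ^ m
      scaled = subst (ι (suc T) * Im y m ≤_)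
        (trans (x∙yz≈y∙xz (ι (suc T)) (4ℚ ^ m) δ) (*-inv-cancelʳ (ι>0 (suc T)) (4ℚ ^ m)))
        (*-monoˡ (ι≥0 (suc T)) (Im-nearly-zero 0≤y y≤2 0≤δ (+-mono-≤ y≤1 (1≤x⇒inv≤1 (ι≥1 (suc T)))) m Im≤0))

module BoundedSequences where

  open import Algebra.Bundles using (CommutativeRing)
  open import Algebra.Structures using (IsCommutativeRing)
  open import Relation.Binary.Bundles using (Setoid)
  open import Relation.Binary.Structures using (IsEquivalence)
  open OrderedRationals

  infix 4 _≋_

  -- f T - g T = O(1/T).
  record _≋_ (f g : ℕ → ℚ) : Set where
    constructor within
    field
      constant : ℚ
      bounded  : ∀ T → ι (suc T) * ∣ f T - g T ∣ ≤ constant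

  ≗⇒≋ : ∀ {f g} → (∀ T → f T ≡ g T) → f ≋ g
  ≗⇒≋ {f} {g} f≗g = within 0ℚ λ T →
    ≤-reflexive (y≡0⇒xy≡0 (ι (suc T)) (cong ∣_∣ (trans (cong (λ x → x - g T) (f≗g T)) (+-inverseʳ (g T)))))

  ≋-sym : ∀ {f g} → f ≋ g → g ≋ f
  ≋-sym {f} {g} (within C f≋g) = within C λ T → subst (λ x → ι (suc T) * x ≤ C) (∣x-y∣≡∣y-x∣ (f T) (g T)) (f≋g T)

  private
    scaled-sum : ∀ T {x y z a b} → z ≡ x + y → ι (suc T) * ∣ x ∣ ≤ a → ι (suc T) * ∣ y ∣ ≤ b →
      ι (suc T) * ∣ z ∣ ≤ a + b
    scaled-sum T {x} {y} refl x≤a y≤b = ≤-trans (*-monoˡ (ι≥0 (suc T)) (∣p+q∣≤∣p∣+∣q∣ x y))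
      (≤-trans (≤-reflexive (*-distribˡ-+ (ι (suc T)) ∣ x ∣ ∣ y ∣)) (+-mono-≤ x≤a y≤b))

  ≋-trans : ∀ {f g h} → f ≋ g → g ≋ h → f ≋ h
  ≋-trans {f} {g} {h} (within C f≋g) (within D g≋h) = within (C + D) λ T →
    scaled-sum T (insert (f T) (g T) (h T)) (f≋g T) (g≋h T)
    where
    insert : ∀ a b c → a - c ≡ (a - b) + (b - c)
    insert = solve-∀ ringℚ

  ≋-+ : ∀ {f f′ g g′} → f ≋ f′ → g ≋ g′ → (λ T → f T + g T) ≋ (λ T → f′ T + g′ T)
  ≋-+ {f} {f′} {g} {g′} (within C f≋f′) (within D g≋g′) = within (C + D) λ T →
    scaled-sum T (regroup (f T) (f′ T) (g T) (g′ T)) (f≋f′ T) (g≋g′ T)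
    where
    regroup : ∀ a b c d → (a + c) - (b + d) ≡ (a - b) + (c - d)
    regroup = solve-∀ ringℚ

  ≋-neg : ∀ {f g} → f ≋ g → (λ T → - f T) ≋ (λ T → - g T)
  ≋-neg {f} {g} (within C f≋g) = within C λ T →
    subst (λ x → ι (suc T) * x ≤ C) (trans (∣x-y∣≡∣y-x∣ (f T) (g T)) (cong ∣_∣ (flip (f T) (g T)))) (f≋g T)
    where
    flip : ∀ a b → b - a ≡ (- a) - (- b)
    flip = solve-∀ ringℚ

  ≋-*ˡ : ∀ (g : ℕ → ℚ) {f f′ b} → (∀ T → ∣ g T ∣ ≤ b) → f ≋ f′ → (λ T → g T * f T) ≋ (λ T → g T * f′ T)
  ≋-*ˡ g {f} {f′} {b} ∣g∣≤b (within C f≋f′) = within (b * C) λ T → begin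
    ι (suc T) * ∣ g T * f T - g T * f′ T ∣  ≡⟨ cong (λ x → ι (suc T) * ∣ x ∣) (factor (g T) (f T) (f′ T)) ⟩
    ι (suc T) * ∣ g T * (f T - f′ T) ∣      ≡⟨ cong (ι (suc T) *_) (∣p*q∣≡∣p∣*∣q∣ (g T) (f T - f′ T)) ⟩
    ι (suc T) * (∣ g T ∣ * ∣ f T - f′ T ∣)  ≡⟨ x∙yz≈y∙xz (ι (suc T)) ∣ g T ∣ ∣ f T - f′ T ∣ ⟩
    ∣ g T ∣ * (ι (suc T) * ∣ f T - f′ T ∣)
      ≤⟨ *-mono (0≤∣p∣ (g T)) (∣g∣≤b T) (*≥0 (ι≥0 (suc T)) (0≤∣p∣ (f T - f′ T))) (f≋f′ T) ⟩
    b * C                                   ∎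
    where
    open ≤-Reasoning
    factor : ∀ g a b → g * a - g * b ≡ g * (a - b)
    factor = solve-∀ ringℚ

  ≋-* : ∀ {f f′ g g′ b b′} → (∀ T → ∣ f T ∣ ≤ b) → (∀ T → ∣ g′ T ∣ ≤ b′) → f ≋ f′ → g ≋ g′ →
        (λ T → f T * g T) ≋ (λ T → f′ T * g′ T)
  ≋-* {f} {f′} {g} {g′} ∣f∣≤b ∣g′∣≤b′ f≋f′ g≋g′ = ≋-trans (≋-*ˡ f ∣f∣≤b g≋g′)
    (≋-trans (≗⇒≋ λ T → *-comm (f T) (g′ T)) (≋-trans (≋-*ˡ g′ ∣g′∣≤b′ f≋f′) (≗⇒≋ λ T → *-comm (g′ T) (f′ T))))

  simultaneously-close : ∀ K (f g : ℕ → ℕ → ℚ) → (∀ j → j ℕ.< K → f j ≋ g j) → ∀ {ε} → 0ℚ < ε →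
                         ∃ λ T → ∀ j → j ℕ.< K → ∣ f j T - g j T ∣ ≤ ε
  simultaneously-close K f g f≋g {ε} 0<ε = T , λ j j<K → *-cancelˡ-≤ (ι>0 (suc T)) (begin
    ι (suc T) * ∣ f j T - g j T ∣  ≤⟨ proj₂ (common K f≋g) j j<K T ⟩
    C                              ≡⟨ *-inv-*-cancel 0<ε C ⟨
    C * inv ε * ε
      ≤⟨ *-monoʳ (<⇒≤ 0<ε) (≤-trans (proj₂ (archimedean (C * inv ε))) (ι-mono (ℕ.n≤1+n T))) ⟩
    ι (suc T) * ε                  ∎)
    where
    open ≤-Reasoning
    common : ∀ K → (∀ j → j ℕ.< K → f j ≋ g j) → ∃ λ C → ∀ j → j ℕ.< K → ∀ T → ι (suc T) * ∣ f j T - g j T ∣ ≤ C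
    common zero    _    = 0ℚ , λ _ ()
    common (suc K) f≋g with common K (λ j j<K → f≋g j (ℕ.m<n⇒m<1+n j<K)) | f≋g K ℕ.≤-refl
    ... | D , D-bounds | within C C-bounds = D ⊔ C , extended
      where
      extended : ∀ j → j ℕ.< suc K → ∀ T → ι (suc T) * ∣ f j T - g j T ∣ ≤ D ⊔ C
      extended j (s≤s j≤K) T with ℕ.m≤n⇒m<n∨m≡n j≤K
      ... | inj₁ j<K  = ≤-trans (D-bounds j j<K T) (p≤p⊔q D C)
      ... | inj₂ refl = ≤-trans (C-bounds T) (p≤q⊔p D C)
    C : ℚ
    C = proj₁ (common K f≋g)
    T : ℕ
    T = proj₁ (archimedean (C * inv ε))

  -- Bounded sequences over ℚ[√-Y T], where a sequence that is O(1/T) counts as zero: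
  -- identities that hold exactly for the irrational limit of Y can be derived in this ring.
  module Sequences (Y : ℕ → ℚ) (Y≥0 : ∀ T → 0ℚ ≤ Y T) (Y≤1 : ∀ T → Y T ≤ 1ℚ) where

    record Seq : Set where
      no-eta-equality
      constructor seq
      field
        re im : ℕ → ℚ
        bound : ℚ
        re≤   : ∀ T → ∣ re T ∣ ≤ bound
        im≤   : ∀ T → ∣ im T ∣ ≤ bound

    open Seq public

    infix 4 _≈_

    record _≈_ (x y : Seq) : Set where
      constructor parts
      field
        re≋ : re x ≋ re y
        im≋ : im x ≋ im y

    open _≈_ public

    exact : ∀ {x y} → (∀ T → re x T ≡ re y T) → (∀ T → im x T ≡ im y T) → x ≈ y
    exact re≗ im≗ = parts (≗⇒≋ re≗) (≗⇒≋ im≗)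

    private
      ∣Y∣≤1 : ∀ T → ∣ Y T ∣ ≤ 1ℚ
      ∣Y∣≤1 T = 0≤x⇒∣x∣≤ (Y≥0 T) (Y≤1 T)

      isEquivalence : IsEquivalence _≈_
      isEquivalence = record
        { refl  = exact (λ _ → refl) (λ _ → refl)
        ; sym   = λ (parts p q) → parts (≋-sym p) (≋-sym q)
        ; trans = λ (parts p q) (parts r s) → parts (≋-trans p r) (≋-trans q s) }

      setoid : Setoid 0ℓ 0ℓ
      setoid = record { isEquivalence = isEquivalence }

      open import Algebra.Consequences.Setoid setoid using (comm∧idˡ⇒id; comm∧distrˡ⇒distr)

    real : (f : ℕ → ℚ) (b : ℚ) → (∀ T → ∣ f T ∣ ≤ b) → Seq
    real f b ∣f∣≤b = seq f (λ _ → 0ℚ) b ∣f∣≤b (λ T → ≤-trans (0≤∣p∣ (f T)) (∣f∣≤b T))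

    imaginary : (f : ℕ → ℚ) (b : ℚ) → (∀ T → ∣ f T ∣ ≤ b) → Seq
    imaginary f b ∣f∣≤b = seq (λ _ → 0ℚ) f b (λ T → ≤-trans (0≤∣p∣ (f T)) (∣f∣≤b T)) ∣f∣≤b

    Value : Seq → ℕ → ℚ → ℚ → Set
    Value x T a b = re x T ≡ a × im x T ≡ b

    value-≡ : ∀ x {T a b a′ b′} → a ≡ a′ → b ≡ b′ → Value x T a b → Value x T a′ b′
    value-≡ x refl refl v = v

    equal-values : ∀ x y {a b : ℕ → ℚ} → (∀ T → Value x T (a T) (b T)) → (∀ T → Value y T (a T) (b T)) → x ≈ y
    equal-values x y vx vy = exact (λ T → trans (proj₁ (vx T)) (sym (proj₁ (vy T))))
      (λ T → trans (proj₂ (vx T)) (sym (proj₂ (vy T))))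

    infixl 6 _+ₛ_
    infixl 7 _*ₛ_

    -- Sealed, so that the type checker never compares the boundedness proofs.
    abstract
      _+ₛ_ _*ₛ_ : Seq → Seq → Seq
      x +ₛ y = seq (λ T → re x T + re y T) (λ T → im x T + im y T) (bound x + bound y)
        (λ T → ∣x+y∣≤ (re≤ x T) (re≤ y T)) (λ T → ∣x+y∣≤ (im≤ x T) (im≤ y T))
      x *ₛ y = seq (λ T → re x T * re y T - Y T * (im x T * im y T)) (λ T → re x T * im y T + im x T * re y T) (b + b)
        (λ T → ∣x-y∣≤ (∣x*y∣≤ (re≤ x T) (re≤ y T))
                      (subst (∣ Y T * (im x T * im y T) ∣ ≤_) (*-identityˡ b)
                        (∣x*y∣≤ (∣Y∣≤1 T) (∣x*y∣≤ (im≤ x T) (im≤ y T)))))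
        (λ T → ∣x+y∣≤ (∣x*y∣≤ (re≤ x T) (im≤ y T)) (∣x*y∣≤ (im≤ x T) (re≤ y T)))
        where
        b : ℚ
        b = bound x * bound y

      -ₛ_ : Seq → Seq
      -ₛ x = seq (λ T → - re x T) (λ T → - im x T) (bound x)
        (λ T → subst (_≤ bound x) (sym (∣-p∣≡∣p∣ (re x T))) (re≤ x T))
        (λ T → subst (_≤ bound x) (sym (∣-p∣≡∣p∣ (im x T))) (im≤ x T))

      0ₛ 1ₛ : Seq
      0ₛ = real (λ _ → 0ℚ) 0ℚ (λ _ → ≤-refl)
      1ₛ = real (λ _ → 1ℚ) 1ℚ (λ _ → ≤-refl)

      value-+ : ∀ x y {T a b c d} → Value x T a b → Value y T c d → Value (x +ₛ y) T (a + c) (b + d)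
      value-+ x y (refl , refl) (refl , refl) = refl , refl

      value-* : ∀ x y {T a b c d} → Value x T a b → Value y T c d →
        Value (x *ₛ y) T (a * c - Y T * (b * d)) (a * d + b * c)
      value-* x y (refl , refl) (refl , refl) = refl , refl

      value-0 : ∀ T → Value 0ₛ T 0ℚ 0ℚ
      value-0 T = refl , refl

      value-1 : ∀ T → Value 1ₛ T 1ℚ 0ℚ
      value-1 T = refl , refl

      +ₛ-cong : ∀ {x y u v} → x ≈ y → u ≈ v → x +ₛ u ≈ y +ₛ v
      +ₛ-cong (parts p q) (parts r s) = parts (≋-+ p r) (≋-+ q s)

      *ₛ-cong : ∀ {x y u v} → x ≈ y → u ≈ v → x *ₛ u ≈ y *ₛ v
      *ₛ-cong {x} {y} {u} {v} (parts p q) (parts r s) = parts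
        (≋-+ (≋-* (re≤ x) (re≤ v) p r) (≋-neg (≋-*ˡ Y ∣Y∣≤1 (≋-* (im≤ x) (im≤ v) q s))))
        (≋-+ (≋-* (re≤ x) (im≤ v) p s) (≋-* (im≤ x) (re≤ v) q r))

      *ₛ-comm : ∀ x y → x *ₛ y ≈ y *ₛ x
      *ₛ-comm x y = exact (λ T → re-comm (Y T) (re x T) (im x T) (re y T) (im y T))
                          (λ T → im-comm (re x T) (im x T) (re y T) (im y T))
        where
        re-comm : ∀ y a b c d → a * c - y * (b * d) ≡ c * a - y * (d * b)
        re-comm = solve-∀ ringℚ
        im-comm : ∀ a b c d → a * d + b * c ≡ c * b + d * a
        im-comm = solve-∀ ringℚ

      *ₛ-identityˡ : ∀ x → 1ₛ *ₛ x ≈ x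
      *ₛ-identityˡ x = exact (λ T → re-identity (Y T) (re x T) (im x T)) (λ T → im-identity (re x T) (im x T))
        where
        re-identity : ∀ y a b → 1ℚ * a - y * (0ℚ * b) ≡ a
        re-identity = solve-∀ ringℚ
        im-identity : ∀ a b → 1ℚ * b + 0ℚ * a ≡ b
        im-identity = solve-∀ ringℚ

      *ₛ-assoc : ∀ x y z → (x *ₛ y) *ₛ z ≈ x *ₛ (y *ₛ z)
      *ₛ-assoc x y z = exact (λ T → re-assoc (Y T) (re x T) (im x T) (re y T) (im y T) (re z T) (im z T))
                             (λ T → im-assoc (Y T) (re x T) (im x T) (re y T) (im y T) (re z T) (im z T))
        where
        re-assoc : ∀ y a b c d e f → (a * c - y * (b * d)) * e - y * ((a * d + b * c) * f) ≡
                                     a * (c * e - y * (d * f)) - y * (b * (c * f + d * e))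
        re-assoc = solve-∀ ringℚ
        im-assoc : ∀ y a b c d e f → (a * c - y * (b * d)) * f + (a * d + b * c) * e ≡
                                     a * (c * f + d * e) + b * (c * e - y * (d * f))
        im-assoc = solve-∀ ringℚ

      *ₛ-distribˡ-+ₛ : ∀ x y z → x *ₛ (y +ₛ z) ≈ x *ₛ y +ₛ x *ₛ z
      *ₛ-distribˡ-+ₛ x y z = exact (λ T → re-distrib (Y T) (re x T) (im x T) (re y T) (im y T) (re z T) (im z T))
                                   (λ T → im-distrib (re x T) (im x T) (re y T) (im y T) (re z T) (im z T))
        where
        re-distrib : ∀ y a b c d e f → a * (c + e) - y * (b * (d + f)) ≡ (a * c - y * (b * d)) + (a * e - y * (b * f))
        re-distrib = solve-∀ ringℚ
        im-distrib : ∀ a b c d e f → a * (d + f) + b * (c + e) ≡ (a * d + b * c) + (a * f + b * e)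
        im-distrib = solve-∀ ringℚ

      isCommutativeRing : IsCommutativeRing _≈_ _+ₛ_ _*ₛ_ -ₛ_ 0ₛ 1ₛ
      isCommutativeRing = record
        { isRing = record
          { +-isAbelianGroup = record
            { isGroup = record
              { isMonoid = record
                { isSemigroup = record
                  { isMagma = record { isEquivalence = isEquivalence ; ∙-cong = +ₛ-cong }
                  ; assoc = λ x y z → exact (λ T → +-assoc (re x T) (re y T) (re z T))
                    (λ T → +-assoc (im x T) (im y T) (im z T)) }
                ; identity = (λ x → exact (λ T → +-identityˡ (re x T)) (λ T → +-identityˡ (im x T))) ,
                             (λ x → exact (λ T → +-identityʳ (re x T)) (λ T → +-identityʳ (im x T))) }
              ; inverse = (λ x → exact (λ T → +-inverseˡ (re x T)) (λ T → +-inverseˡ (im x T))) ,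
                          (λ x → exact (λ T → +-inverseʳ (re x T)) (λ T → +-inverseʳ (im x T)))
              ; ⁻¹-cong = λ (parts p q) → parts (≋-neg p) (≋-neg q) }
            ; comm = λ x y → exact (λ T → +-comm (re x T) (re y T)) (λ T → +-comm (im x T) (im y T)) }
          ; *-cong = *ₛ-cong
          ; *-assoc = *ₛ-assoc
          ; *-identity = comm∧idˡ⇒id {_∙_ = _*ₛ_} *ₛ-comm {1ₛ} *ₛ-identityˡ
          ; distrib = comm∧distrˡ⇒distr {_∙_ = _*ₛ_} {_◦_ = _+ₛ_} +ₛ-cong *ₛ-comm *ₛ-distribˡ-+ₛ }
        ; *-comm = *ₛ-comm }

    commutativeRing : CommutativeRing 0ℓ 0ℓ
    commutativeRing = record { isCommutativeRing = isCommutativeRing }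

module ApproximateCotangents where

  open import Algebra.Bundles using (CommutativeRing)
  open import Relation.Nullary.Decidable using (_×-dec_)
  open OrderedRationals
  open RationalSums
  open RangeSums using (module RangeSum)
  open QuadraticPowers
  open BoundedSequences
  open Congruences using (Inverses; residueSum)
  open RootsOfUnity

  -- √y cot(mα) when y = tan² α.
  cot : ℚ → ℕ → ℚ
  cot y m = Re y m * inv (Im y m)

  module Tangents (n L : ℕ) {{_ : ℕ.NonZero n}} {{_ : ℕ.NonZero L}} (4≤M : 4 ℕ.≤ n ℕ.* L) where

    M : ℕ
    M = n ℕ.* L

    private
      module Approx (T : ℕ) = Approximation (approximation M T 4≤M)

    tan² : ℕ → ℚ
    tan² = Approx.y

    tan²-positive : ∀ T → ImPositive (tan² T) M
    tan²-positive = Approx.Im-positive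

    private
      instance
        M-nonZero : ℕ.NonZero M
        M-nonZero = ℕ.m*n≢0 n L

      0<M⁻² : 0ℚ < inv (ι M * ι M)
      0<M⁻² = inv>0 (*>0 (ι>0 M) (ι>0 M))

      tan²>0 : ∀ T → 0ℚ < tan² T
      tan²>0 T = <-≤-trans 0<M⁻² (Approx.y≥ T)

    tan²≥0 : ∀ T → 0ℚ ≤ tan² T
    tan²≥0 T = <⇒≤ (tan²>0 T)

    open Sequences tan² tan²≥0 Approx.y≤1 public

    private
      open CommutativeRing commutativeRing using (commutativeSemiring)
      open import Algebra.Properties.CommutativeSemiring.Exp commutativeSemiring using () renaming (_^_ to _^ₛ_)

      InRange : ℕ → Set
      InRange m = 0 ℕ.< m × m ℕ.< M

      inRange? : ∀ m → Dec (InRange m)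
      inRange? m = 0 ℕ.<? m ×-dec m ℕ.<? M

      guarded-bound : ∀ {p} {P : Set p} (P? : Dec P) {x B} → 0ℚ ≤ B → (P → ∣ x ∣ ≤ B) → ∣ ⟦ P? ⟧ * x ∣ ≤ B
      guarded-bound P?@(yes p) {x} {B} 0≤B ∣x∣≤B = subst (λ z → ∣ z ∣ ≤ B) (sym (⟦⟧-yes* P? x p)) (∣x∣≤B p)
      guarded-bound P?@(no ¬p) {x} {B} 0≤B ∣x∣≤B = subst (λ z → ∣ z ∣ ≤ B) (sym (⟦⟧-no* P? x ¬p)) 0≤B

      powers≤ : ∀ T m → ∣ Re (tan² T) m ∣ ≤ 4ℚ ^ m × ∣ Im (tan² T) m ∣ ≤ 4ℚ ^ m
      powers≤ T = powers-bounded (tan²≥0 T) (≤-trans (Approx.y≤1 T) 1≤2)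

      Im>0 : ∀ T {m} → InRange m → 0ℚ < Im (tan² T) m
      Im>0 T {m} (0<m , m<M) = tan²-positive T m 0<m (ℕ.<⇒≤ m<M)

      inv½^≥0 : ∀ m → 0ℚ ≤ inv (½ ^ m)
      inv½^≥0 m = inv≥0 (^>0 0<½ m)

      inv-Im≤ : ∀ T {m} → InRange m → ∣ inv (Im (tan² T) m) ∣ ≤ inv (½ ^ m)
      inv-Im≤ T {suc m} range@(_ , m<M) = 0≤x⇒∣x∣≤ (inv≥0 (Im>0 T range))
        (inv-antimono (^>0 0<½ (suc m)) (Im≥½^ (tan²-positive T) (tan²≥0 T) m m<M))

      -- 1 ± √-Y.
      root : (s : ℚ) → ∣ s ∣ ≤ 1ℚ → Seq
      root s ∣s∣≤1 = seq (λ _ → 1ℚ) (λ _ → s) 1ℚ (λ _ → ≤-refl) (λ _ → ∣s∣≤1)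

      value-root^ : ∀ s (∣s∣≤1 : ∣ s ∣ ≤ 1ℚ) → s * s ≡ 1ℚ → ∀ m T →
                    Value (root s ∣s∣≤1 ^ₛ m) T (Re (tan² T) m) (s * Im (tan² T) m)
      value-root^ s ∣s∣≤1 s²≡1 zero    T = value-≡ 1ₛ refl (sym (*-zeroʳ s)) (value-1 T)
      value-root^ s ∣s∣≤1 s²≡1 (suc m) T = value-≡ (w *ₛ w ^ₛ m) re-step (im-step p s q)
        (value-* w (w ^ₛ m) (refl , refl) (value-root^ s ∣s∣≤1 s²≡1 m T))
        where
        w : Seq
        w = root s ∣s∣≤1
        y p q : ℚ
        y = tan² T
        p = Re y m
        q = Im y m
        regroup : ∀ y p s q → 1ℚ * p - y * (s * (s * q)) ≡ p - y * (s * s * q)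
        regroup = solve-∀ ringℚ
        re-step : 1ℚ * p - y * (s * (s * q)) ≡ p - y * q
        re-step = trans (regroup y p s q) (cong (λ z → p - y * z) (trans (cong (_* q) s²≡1) (*-identityˡ q)))
        im-step : ∀ p s q → 1ℚ * (s * q) + s * p ≡ s * (q + p)
        im-step = solve-∀ ringℚ

      w w̄ e I : Seq
      w = root 1ℚ ≤-refl
      w̄ = root (- 1ℚ) ≤-refl
      e = real (λ T → inv (1ℚ + tan² T)) 1ℚ λ T → 0≤x⇒∣x∣≤ (inv≥0 (<-≤-trans 0<1 (1≤1+y T))) (1≤x⇒inv≤1 (1≤1+y T))
        where
        1≤1+y : ∀ T → 1ℚ ≤ 1ℚ + tan² T
        1≤1+y T = ≤-slack (tan² T) (tan²≥0 T) refl
      I = imaginary (λ _ → 1ℚ) 1ℚ (λ _ → ≤-refl)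

      value-w^ : ∀ m T → Value (w ^ₛ m) T (Re (tan² T) m) (1ℚ * Im (tan² T) m)
      value-w^ = value-root^ 1ℚ ≤-refl refl

      value-w̄^ : ∀ m T → Value (w̄ ^ₛ m) T (Re (tan² T) m) (- 1ℚ * Im (tan² T) m)
      value-w̄^ = value-root^ (- 1ℚ) ≤-refl refl

      ww̄e≈1 : w *ₛ w̄ *ₛ e ≈ 1ₛ
      ww̄e≈1 = equal-values (w *ₛ w̄ *ₛ e) 1ₛ
        (λ T → value-* (w *ₛ w̄) e (value-* w w̄ (refl , refl) (refl , refl)) (refl , refl))
        (λ T → value-≡ 1ₛ
          (sym (trans (norm (tan² T) (inv (1ℚ + tan² T))) (*-inv⁺ (<-≤-trans 0<1 (≤-slack _ (tan²≥0 T) refl)))))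
          (sym (cancel (tan² T) (inv (1ℚ + tan² T)))) (value-1 T))
        where
        norm : ∀ y i → (1ℚ * 1ℚ - y * (1ℚ * (- 1ℚ))) * i - y * ((1ℚ * (- 1ℚ) + 1ℚ * 1ℚ) * 0ℚ) ≡ (1ℚ + y) * i
        norm = solve-∀ ringℚ
        cancel : ∀ y i → (1ℚ * 1ℚ - y * (1ℚ * (- 1ℚ))) * 0ℚ + (1ℚ * (- 1ℚ) + 1ℚ * 1ℚ) * i ≡ 0ℚ
        cancel = solve-∀ ringℚ

      2√-y-Im : ℕ → Seq
      2√-y-Im m = imaginary (λ T → 2ℚ * Im (tan² T) m) (2ℚ * 4ℚ ^ m)
        (λ T → ∣x*y∣≤ {2ℚ} {Im (tan² T) m} {2ℚ} ≤-refl (proj₂ (powers≤ T m)))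

      w^≈w̄^+ : ∀ m → w ^ₛ m ≈ w̄ ^ₛ m +ₛ 2√-y-Im m
      w^≈w̄^+ m = equal-values (w ^ₛ m) (w̄ ^ₛ m +ₛ 2√-y-Im m) (value-w^ m) λ T →
        value-≡ (w̄ ^ₛ m +ₛ 2√-y-Im m) (+-identityʳ (Re (tan² T) m)) (conjugate (Im (tan² T) m))
          (value-+ (w̄ ^ₛ m) (2√-y-Im m) (value-w̄^ m T) (refl , refl))
        where
        conjugate : ∀ q → - 1ℚ * q + (1ℚ + 1ℚ) * q ≡ 1ℚ * q
        conjugate = solve-∀ ringℚ

      c : ℕ → Seq
      c m = real (λ T → ⟦ inRange? m ⟧ * cot (tan² T) m) (4ℚ ^ m * inv (½ ^ m)) λ T →
        guarded-bound (inRange? m) (*≥0 (^≥0 (positive⁻¹ 4ℚ) m) (inv½^≥0 m)) λ range →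
          ∣x*y∣≤ (proj₁ (powers≤ T m)) (inv-Im≤ T range)

      value-c : ∀ {m} → InRange m → ∀ T → Value (c m) T (cot (tan² T) m) 0ℚ
      value-c {m} range T = ⟦⟧-yes* (inRange? m) (cot (tan² T) m) range , refl

      inverse-2√-y-Im : ℕ → Seq
      inverse-2√-y-Im m = imaginary (λ T → ⟦ inRange? m ⟧ * - (½ * (inv (Im (tan² T) m) * inv (tan² T))))
        (½ * (inv (½ ^ m) * inv (inv (ι M * ι M)))) λ T →
        guarded-bound (inRange? m) (*≥0 0≤½ (*≥0 (inv½^≥0 m) (inv≥0 0<M⁻²))) λ range →
          subst (_≤ ½ * (inv (½ ^ m) * inv (inv (ι M * ι M))))
            (sym (∣-p∣≡∣p∣ (½ * (inv (Im (tan² T) m) * inv (tan² T)))))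
            (∣x*y∣≤ {½} {inv (Im (tan² T) m) * inv (tan² T)} {½} ≤-refl
              (∣x*y∣≤ (inv-Im≤ T range) (0≤x⇒∣x∣≤ (inv≥0 (tan²>0 T)) (inv-antimono 0<M⁻² (Approx.y≥ T)))))

      c-difference : ∀ m → InRange m → c m *ₛ 2√-y-Im m ≈ I *ₛ (w ^ₛ m +ₛ w̄ ^ₛ m)
      c-difference m range = equal-values (c m *ₛ 2√-y-Im m) (I *ₛ (w ^ₛ m +ₛ w̄ ^ₛ m))
        (λ T → value-* (c m) (2√-y-Im m) (value-c range T) (refl , refl))
        (λ T → value-≡ (I *ₛ (w ^ₛ m +ₛ w̄ ^ₛ m))
          (re-parts (tan² T) (Re (tan² T) m) (Im (tan² T) m) (inv (Im (tan² T) m)))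
          (trans
            (cong (λ z → 0ℚ * (1ℚ * Im (tan² T) m + - 1ℚ * Im (tan² T) m) + 1ℚ * z)
              (double (Re (tan² T) m) (*-inv⁺ (Im>0 T range))))
            (im-parts (Re (tan² T) m) (Im (tan² T) m) (inv (Im (tan² T) m))))
          (value-* I (w ^ₛ m +ₛ w̄ ^ₛ m) (refl , refl) (value-+ (w ^ₛ m) (w̄ ^ₛ m) (value-w^ m T) (value-w̄^ m T))))
        where
        re-parts : ∀ y p q i → 0ℚ * (p + p) - y * (1ℚ * (1ℚ * q + - 1ℚ * q)) ≡ p * i * 0ℚ - y * (0ℚ * ((1ℚ + 1ℚ) * q))
        re-parts = solve-∀ ringℚ
        double : ∀ p {o} → o ≡ 1ℚ → p + p ≡ o * (p + p)
        double p refl = sym (*-identityˡ (p + p))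
        im-parts : ∀ p q i → 0ℚ * (1ℚ * q + - 1ℚ * q) + 1ℚ * (q * i * (p + p)) ≡ p * i * ((1ℚ + 1ℚ) * q) + 0ℚ * 0ℚ
        im-parts = solve-∀ ringℚ

      2√-y-Im-inverse : ∀ m → InRange m → inverse-2√-y-Im m *ₛ 2√-y-Im m ≈ 1ₛ
      2√-y-Im-inverse m range = equal-values (inverse-2√-y-Im m *ₛ 2√-y-Im m) 1ₛ
        (λ T → value-≡ (inverse-2√-y-Im m *ₛ 2√-y-Im m)
          (trans (re-product (tan² T) (Im (tan² T) m) (inv (Im (tan² T) m)) (inv (tan² T)))
            (cong₂ _*_ (*-inv⁺ (Im>0 T range)) (*-inv⁺ (tan²>0 T))))
          (im-product (- (½ * (inv (Im (tan² T) m) * inv (tan² T)))) (Im (tan² T) m))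
          (value-* (inverse-2√-y-Im m) (2√-y-Im m) (refl , ⟦⟧-yes* (inRange? m) _ range) (refl , refl)))
        value-1
        where
        re-product : ∀ y q i j → 0ℚ * 0ℚ - y * (- (½ * (i * j)) * ((1ℚ + 1ℚ) * q)) ≡ (q * i) * (y * j)
        re-product = solve-∀ ringℚ
        im-product : ∀ i q → 0ℚ * ((1ℚ + 1ℚ) * q) + i * 0ℚ ≡ 0ℚ
        im-product = solve-∀ ringℚ

      2√-y-Im-M≈0 : 2√-y-Im M ≈ 0ₛ
      2√-y-Im-M≈0 = parts (≗⇒≋ λ T → sym (proj₁ (value-0 T))) (within (2ℚ * (8ℚ ^ M * 4ℚ ^ M)) λ T → begin
        ι (suc T) * ∣ 2ℚ * Im (tan² T) M - im 0ₛ T ∣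
          ≡⟨ cong (λ z → ι (suc T) * ∣ z ∣) (trans (cong (λ z → 2ℚ * Im (tan² T) M - z) (proj₂ (value-0 T)))
            (+-identityʳ _)) ⟩
        ι (suc T) * ∣ 2ℚ * Im (tan² T) M ∣
          ≡⟨ cong (ι (suc T) *_) (0≤p⇒∣p∣≡p (*≥0 0≤2 (ImPositive⇒Im≥0 (tan²-positive T) M ℕ.≤-refl))) ⟩
        ι (suc T) * (2ℚ * Im (tan² T) M)
          ≡⟨ x∙yz≈y∙xz (ι (suc T)) 2ℚ (Im (tan² T) M) ⟩
        2ℚ * (ι (suc T) * Im (tan² T) M)
          ≤⟨ *-monoˡ 0≤2 (Approx.Im-small T) ⟩
        2ℚ * (8ℚ ^ M * 4ℚ ^ M) ∎)
        where
        open ≤-Reasoning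

      open Rotation commutativeRing

      cotangents : Cotangents commutativeRing M
      cotangents = record
        { ζ     = rotation w w̄ e ww̄e≈1
        ; I     = I
        ; c     = c
        ; κ     = λ m → w̄ ^ₛ m *ₛ inverse-2√-y-Im m
        ; ζ^M≈1 = rotation-period w w̄ e ww̄e≈1 M (w^≈w̄^+ M) 2√-y-Im-M≈0
        ; c-eq  = λ m 0<m m<M → rotation-cotangent w w̄ e ww̄e≈1 m (w^≈w̄^+ m) (c-difference m (0<m , m<M))
        ; κ-eq  = λ m 0<m m<M → rotation-inverse w w̄ e ww̄e≈1 m (w^≈w̄^+ m) (2√-y-Im-inverse m (0<m , m<M)) }

    private
      module S = CommutativeRing commutativeRing
      open PowerSums commutativeRing using (nat)
      open RangeSum S.commutativeSemiring using () renaming (∑ to ∑ₛ)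

      re-∑ : ∀ N (f : ℕ → Seq) T → re (∑ₛ N f) T ≡ ∑ N (λ i → re (f i) T)
      re-∑ zero    f T = proj₁ (value-0 T)
      re-∑ (suc N) f T = trans (proj₁ (value-+ (f 0) (∑ₛ N (f ∘ suc)) (refl , refl) (refl , refl)))
        (cong (λ z → re (f 0) T + z) (re-∑ N (f ∘ suc) T))

      value-nat : ∀ k T → Value (nat k) T (ι k) 0ℚ
      value-nat zero    T = value-≡ 0ₛ (sym ι-0) refl (value-0 T)
      value-nat (suc k) T = value-≡ (1ₛ +ₛ nat k) (sym (ι-suc k)) refl
        (value-+ 1ₛ (nat k) (value-1 T) (value-nat k T))

      re-nat* : ∀ k x T → re (nat k *ₛ x) T ≡ ι k * re x T
      re-nat* k x T = trans (proj₁ (value-* (nat k) x (value-nat k T) (refl , refl)))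
        (drop (ι k) (re x T) (tan² T) (im x T))
        where
        drop : ∀ k a y b → k * a - y * (0ℚ * b) ≡ k * a
        drop = solve-∀ ringℚ

      open RootOfUnity commutativeRing n L cotangents

    cot-antisymmetric : ∀ m → 0 ℕ.< m → m ℕ.< M → (λ T → cot (tan² T) m + cot (tan² T) (M ∸ m)) ≋ (λ _ → 0ℚ)
    cot-antisymmetric m 0<m m<M = ≋-trans
      (≗⇒≋ λ T → sym (proj₁ (value-+ (c m) (c m′) (value-c (0<m , m<M) T) (value-c (0<m′ , m′<M) T))))
      (≋-trans (re≋ (antisymmetry m m′ 0<m m<M 0<m′ m′<M (ℕ.m+[n∸m]≡n (ℕ.<⇒≤ m<M)))) (≗⇒≋ (proj₁ ∘ value-0)))
      where
      m′ : ℕ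
      m′ = M ∸ m
      0<m′ : 0 ℕ.< m′
      0<m′ = ℕ.m<n⇒0<n∸m m<M
      m′<M : m′ ℕ.< M
      m′<M = ℕ.∸-monoʳ-< 0<m (ℕ.<⇒≤ m<M)

    cotSum : ℕ → (ℕ → ℕ) → ℕ → ℚ
    cotSum N α T = ∑ N (λ i → ∑ L (λ l → cot (tan² T) (l ℕ.* n ℕ.+ α i)))

    equal-cotSums : ∀ N {a α b β} → Inverses n a α → Inverses n b β →
      (∀ r → residueSum n N a r ≡ residueSum n N b r) →
      (λ T → ι M * cotSum N α T) ≋ (λ T → ι M * cotSum N β T)
    equal-cotSums N a-inverses b-inverses sums≡ = ≋-trans (≗⇒≋ λ T → sym (re-progressionSum a-inverses T))
      (≋-trans (re≋ (equal-progressionSums N a-inverses b-inverses sums≡)) (≗⇒≋ (re-progressionSum b-inverses)))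
      where
      re-progressionSum : ∀ {a α} → Inverses n a α → ∀ T → re (nat M *ₛ progressionSum N α) T ≡ ι M * cotSum N α T
      re-progressionSum {α = α} inverses T = trans (re-nat* M (progressionSum N α) T) (cong (ι M *_)
        (trans (re-∑ N _ T) (∑-cong′ N λ i → trans (re-∑ L _ T) (∑-cong L λ l l<L →
          proj₁ (value-c (progression-range inverses i l<L) T)))))

module CotangentBounds where

  open OrderedRationals
  open QuadraticPowers
  open ApproximateCotangents using (cot)

  module _ {y : ℚ} {M : ℕ} (0≤y : 0ℚ ≤ y) (positive : ImPositive y M) where

    private
      Im>0 : ∀ m → suc m ℕ.≤ M → 0ℚ < Im y (suc m)
      Im>0 m = positive (suc m) (s≤s z≤n)

      Im⁻¹ : ℕ → ℚ
      Im⁻¹ m = inv (Im y m)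

      Im⁻¹≥0 : ∀ m → suc m ℕ.≤ M → 0ℚ ≤ Im⁻¹ (suc m)
      Im⁻¹≥0 m m<M = inv≥0 (Im>0 m m<M)

      Im*Im⁻¹ : ∀ m → suc m ℕ.≤ M → Im y (suc m) * Im⁻¹ (suc m) ≡ 1ℚ
      Im*Im⁻¹ m m<M = *-inv⁺ (Im>0 m m<M)

      squareTerm : ℕ → ℚ
      squareTerm m = Im⁻¹ m * Im⁻¹ (suc m) * (Re y m * Re y m)

      squareTerm≥0 : ∀ m → suc (suc m) ℕ.≤ M → 0ℚ ≤ squareTerm (suc m)
      squareTerm≥0 m m+2≤M = *≥0 (*≥0 (Im⁻¹≥0 m (ℕ.<⇒≤ m+2≤M)) (Im⁻¹≥0 (suc m) m+2≤M)) (sq≥0 (Re y (suc m)))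

      expand-units : ∀ a b {u v} → u ≡ 1ℚ → v ≡ 1ℚ → a - b ≡ a * u - b * v
      expand-units a b refl refl = sym (cong₂ _-_ (*-identityʳ a) (*-identityʳ b))

      cot-step : ∀ m → suc (suc m) ℕ.≤ M →
        cot y (suc m) - cot y (suc (suc m)) ≡ squareTerm (suc m) + y * (Im⁻¹ (suc (suc m)) * Im y (suc m))
      cot-step m m+2≤M = begin
        p * j - (p - y * q) * j′
          ≡⟨ expand-units (p * j) ((p - y * q) * j′) (Im*Im⁻¹ (suc m) m+2≤M) (Im*Im⁻¹ m (ℕ.<⇒≤ m+2≤M)) ⟩
        p * j * ((q + p) * j′) - (p - y * q) * j′ * (q * j)
          ≡⟨ collect p q j j′ y ⟩
        j * j′ * (p * p) + y * (j′ * q) * (q * j)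
          ≡⟨ cong (λ z → j * j′ * (p * p) + z) (*-inv-cancelʳ (Im>0 m (ℕ.<⇒≤ m+2≤M)) (y * (j′ * q))) ⟩
        j * j′ * (p * p) + y * (j′ * q) ∎
        where
        open ≡-Reasoning
        p q j j′ : ℚ
        p  = Re y (suc m)
        q  = Im y (suc m)
        j  = Im⁻¹ (suc m)
        j′ = Im⁻¹ (suc (suc m))
        collect : ∀ p q j k y → p * j * ((q + p) * k) - (p - y * q) * k * (q * j) ≡
          j * k * (p * p) + y * (k * q) * (q * j)
        collect = solve-∀ ringℚ

      cancel : ∀ a b → a + (b - a) ≡ b
      cancel = solve-∀ ringℚ

    cot-1 : cot y 1 ≡ 1ℚ
    cot-1 = begin
      (1ℚ - y * 0ℚ) * inv 1ℚ  ≡⟨ cong₂ _*_ (drop y) inv-1 ⟩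
      1ℚ * 1ℚ                 ≡⟨ *-identityˡ 1ℚ ⟩
      1ℚ                      ∎
      where
      open ≡-Reasoning
      drop : ∀ y → 1ℚ - y * 0ℚ ≡ 1ℚ
      drop = solve-∀ ringℚ

    cot-decreasing : ∀ m → suc (suc m) ℕ.≤ M → cot y (suc (suc m)) ≤ cot y (suc m)
    cot-decreasing m m+2≤M = ≤-slack _
      (+≥0 (squareTerm≥0 m m+2≤M) (*≥0 0≤y (*≥0 (Im⁻¹≥0 (suc m) m+2≤M) (<⇒≤ (Im>0 m (ℕ.<⇒≤ m+2≤M))))))
      (trans (cong (λ z → cot y (suc (suc m)) + z) (sym (cot-step m m+2≤M)))
        (cancel (cot y (suc (suc m))) (cot y (suc m))))

    cot≤1 : ∀ m → suc m ℕ.≤ M → cot y (suc m) ≤ 1ℚ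
    cot≤1 zero    _     = ≤-reflexive cot-1
    cot≤1 (suc m) m+2≤M = ≤-trans (cot-decreasing m m+2≤M) (cot≤1 m (ℕ.<⇒≤ m+2≤M))

    private
      Re≤Im : ∀ m → suc m ℕ.≤ M → Re y (suc m) ≤ Im y (suc m)
      Re≤Im m m<M = subst₂ _≤_ (cot*Im (Re y (suc m)) (Im⁻¹ (suc m)) (Im*Im⁻¹ m m<M)) (*-identityˡ (Im y (suc m)))
        (*-monoʳ (<⇒≤ (Im>0 m m<M)) (cot≤1 m m<M))
        where
        cot*Im : ∀ p j {q} → q * j ≡ 1ℚ → p * j * q ≡ p
        cot*Im p j {q} qj≡1 = trans (regroup p j q) (trans (cong (p *_) qj≡1) (*-identityʳ p))
          where
          regroup : ∀ p j q → p * j * q ≡ p * (q * j)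
          regroup = solve-∀ ringℚ

      cot-drop : ∀ m → suc (suc m) ℕ.≤ M → ½ * y ≤ cot y (suc m) - cot y (suc (suc m))
      cot-drop m m+2≤M = ≤-slack (squareTerm (suc m) + y * (½ * (j * (q - p))))
        (+≥0 (squareTerm≥0 m m+2≤M) (*≥0 0≤y (*≥0 0≤½
          (*≥0 (Im⁻¹≥0 (suc m) m+2≤M) (x≤y⇒0≤y-x (Re≤Im m (ℕ.<⇒≤ m+2≤M)))))))
        (begin
          ½ * y + (s + y * (½ * (j * (q - p))))
            ≡⟨ cong (_+ (s + y * (½ * (j * (q - p))))) (*-inv-cancelʳ (Im>0 (suc m) m+2≤M) (½ * y)) ⟨
          ½ * y * ((q + p) * j) + (s + y * (½ * (j * (q - p))))
            ≡⟨ collect y q p j s ⟩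
          s + y * (j * q)
            ≡⟨ cot-step m m+2≤M ⟨
          cot y (suc m) - cot y (suc (suc m)) ∎)
        where
        open ≡-Reasoning
        p q j s : ℚ
        p = Re y (suc m)
        q = Im y (suc m)
        j = Im⁻¹ (suc (suc m))
        s = squareTerm (suc m)
        collect : ∀ y q p j s → ½ * y * ((q + p) * j) + (s + y * (½ * (j * (q - p)))) ≡ s + y * (j * q)
        collect = solve-∀ ringℚ

    cot≤1-ky/2 : ∀ k → suc k ℕ.≤ M → cot y (suc k) ≤ 1ℚ - ι k * (½ * y)
    cot≤1-ky/2 zero    _   = ≤-reflexive (trans cot-1 (cong (λ z → 1ℚ - z) (sym (ι-0* (½ * y)))))
    cot≤1-ky/2 (suc k) k+2≤M = begin
      c′                            ≡⟨ shift c′ c ⟩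
      c - (c - c′)                  ≤⟨ +-mono-≤ (cot≤1-ky/2 k (ℕ.<⇒≤ k+2≤M)) (neg-antimono-≤ (cot-drop k k+2≤M)) ⟩
      1ℚ - ι k * (½ * y) - ½ * y    ≡⟨ regroup (ι k * (½ * y)) (½ * y) ⟩
      1ℚ - (ι k * (½ * y) + ½ * y)  ≡⟨ cong (λ z → 1ℚ - z) (ι-suc* k (½ * y)) ⟨
      1ℚ - ι (suc k) * (½ * y)      ∎
      where
      open ≤-Reasoning
      c c′ : ℚ
      c  = cot y (suc k)
      c′ = cot y (suc (suc k))
      shift : ∀ a b → a ≡ b - (b - a)
      shift = solve-∀ ringℚ
      regroup : ∀ a b → 1ℚ - a - b ≡ 1ℚ - (a + b)
      regroup = solve-∀ ringℚ

    ky≤4 : ∀ k → M ≡ suc (suc k) → ι k * y ≤ 4ℚ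
    ky≤4 k refl = ≤-slack (2ℚ * (1ℚ - ι k * (½ * y) - cot y (suc k)) + 2ℚ * (1ℚ + cot y (suc k)))
      (+≥0 (*≥0 0≤2 (x≤y⇒0≤y-x (cot≤1-ky/2 k k<M))) (*≥0 0≤2 -1≤cot)) (collect (ι k) y (cot y (suc k)))
      where
      k<M : suc k ℕ.≤ suc (suc k)
      k<M = ℕ.n≤1+n (suc k)
      collect : ∀ k y c → k * y + ((1ℚ + 1ℚ) * (1ℚ - k * (½ * y) - c) + (1ℚ + 1ℚ) * (1ℚ + c)) ≡ (1ℚ + 1ℚ) + (1ℚ + 1ℚ)
      collect = solve-∀ ringℚ
      -1≤cot : 0ℚ ≤ 1ℚ + cot y (suc k)
      -1≤cot = subst (0ℚ ≤_)
        (trans (*-distribʳ-+ (Im⁻¹ (suc k)) (Im y (suc k)) (Re y (suc k))) (cong (_+ cot y (suc k)) (Im*Im⁻¹ k k<M)))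
        (*≥0 (<⇒≤ (Im>0 (suc k) ℕ.≤-refl)) (Im⁻¹≥0 k k<M))

    private
      defect : ℕ → ℚ
      defect m = Im y m - ι m * Re y m

      defect-0 : defect 0 ≡ 0ℚ
      defect-0 = cong (λ z → 0ℚ - z) (ι-0* 1ℚ)

      defect-suc : ∀ m → defect (suc m) ≡ defect m + (1ℚ + ι m) * (y * Im y m)
      defect-suc m = trans (cong (λ z → Im y m + Re y m - z * (Re y m - y * Im y m)) (ι-suc m))
        (collect (Im y m) (Re y m) (ι m) y)
        where
        collect : ∀ q p m y → q + p - (1ℚ + m) * (p - y * q) ≡ q - m * p + (1ℚ + m) * (y * q)
        collect = solve-∀ ringℚ

      defect≥0 : ∀ m → m ℕ.≤ M → 0ℚ ≤ defect m
      defect≥0 zero    _   = ≤-reflexive (sym defect-0)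
      defect≥0 (suc m) m<M = subst (0ℚ ≤_) (sym (defect-suc m)) (+≥0 (defect≥0 m (ℕ.<⇒≤ m<M))
        (*≥0 (+≥0 0≤1 (ι≥0 m)) (*≥0 0≤y (ImPositive⇒Im≥0 positive m (ℕ.<⇒≤ m<M)))))

      inv-cot≡ : ∀ m → suc m ℕ.≤ M → inv (ι (suc m)) - cot y (suc m) ≡ inv (ι (suc m)) * Im⁻¹ (suc m) * defect (suc m)
      inv-cot≡ m m<M = begin
        i - p * j                      ≡⟨ expand-units i (p * j) (Im*Im⁻¹ m m<M) (*-inv⁺ (ι>0 (suc m))) ⟩
        i * (q * j) - p * j * (μ * i)  ≡⟨ factor i q j p μ ⟩
        i * j * (q - μ * p)            ∎
        where
        open ≡-Reasoning
        i p q j μ : ℚ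
        i = inv (ι (suc m))
        p = Re y (suc m)
        q = Im y (suc m)
        j = Im⁻¹ (suc m)
        μ = ι (suc m)
        factor : ∀ i q j p μ → i * (q * j) - p * j * (μ * i) ≡ i * j * (q - μ * p)
        factor = solve-∀ ringℚ

    cot≤inv : ∀ m → suc m ℕ.≤ M → cot y (suc m) ≤ inv (ι (suc m))
    cot≤inv m m<M = ≤-slack (inv (ι (suc m)) - cot y (suc m))
      (subst (0ℚ ≤_) (sym (inv-cot≡ m m<M)) (*≥0 (*≥0 (inv≥0 (ι>0 (suc m))) (Im⁻¹≥0 m m<M)) (defect≥0 (suc m) m<M)))
      (cancel (cot y (suc m)) (inv (ι (suc m))))

    module _ (x : ℕ) (x≤M : x ℕ.≤ M) (x²y≤1 : ι x * (ι x * y) ≤ 1ℚ) where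

      cot≥0 : ∀ m → suc m ℕ.≤ x → 0ℚ ≤ cot y (suc m)
      cot≥0 m m<x = *≥0 (Re≥0 x 0≤y x²y≤1 (suc m) m<x) (Im⁻¹≥0 m (ℕ.≤-trans m<x x≤M))

      private
        x²y : ℚ
        x²y = ι x * (ι x * y)

        defect≤ : ∀ m → m ℕ.≤ x → defect m ≤ ι m * x²y
        defect≤ zero    _   = ≤-reflexive (trans defect-0 (sym (ι-0* x²y)))
        defect≤ (suc m) m<x = begin
          defect (suc m)   ≡⟨ defect-suc m ⟩
          defect m + (1ℚ + ι m) * (y * Im y m)
            ≤⟨ +-mono-≤ (defect≤ m m≤x) (*-mono (+≥0 0≤1 (ι≥0 m)) 1+m≤x (*≥0 0≤y Im≥0) yIm≤xy) ⟩
          ι m * x²y + x²y  ≡⟨ ι-suc* m x²y ⟨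
          ι (suc m) * x²y  ∎
          where
          open ≤-Reasoning
          m≤x : m ℕ.≤ x
          m≤x = ℕ.<⇒≤ m<x
          open SmallAngle (small-angle x 0≤y x²y≤1 m m≤x)
          1+m≤x : 1ℚ + ι m ≤ ι x
          1+m≤x = subst (_≤ ι x) (ι-suc m) (ι-mono m<x)
          yIm≤xy : y * Im y m ≤ ι x * y
          yIm≤xy = ≤-trans (*-monoˡ 0≤y (≤-trans Im≤m (ι-mono m≤x))) (≤-reflexive (*-comm y (ι x)))

      inv-cot≤ : ∀ m → suc m ℕ.≤ x → inv (ι (suc m)) - cot y (suc m) ≤ x²y
      inv-cot≤ m m<x = subst (_≤ x²y) (sym (inv-cot≡ m m<M)) (begin
        i * j * defect (suc m)     ≤⟨ *-monoˡ (*≥0 0≤i (Im⁻¹≥0 m m<M)) (defect≤ (suc m) m<x) ⟩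
        i * j * (ι (suc m) * x²y)  ≡⟨ regroup i j (ι (suc m)) x²y ⟩
        j * (x²y * (ι (suc m) * i)) ≡⟨ cong (j *_) (*-inv-cancelʳ (ι>0 (suc m)) x²y) ⟩
        j * x²y
          ≤⟨ x≤1⇒x*y≤y (1≤x⇒inv≤1 (Im≥1 x 0≤y x²y≤1 m m<x)) (*≥0 (ι≥0 x) (*≥0 (ι≥0 x) 0≤y)) ⟩
        x²y                        ∎)
        where
        open ≤-Reasoning
        i j : ℚ
        i = inv (ι (suc m))
        j = Im⁻¹ (suc m)
        0≤i : 0ℚ ≤ i
        0≤i = inv≥0 (ι>0 (suc m))
        m<M : suc m ℕ.≤ M
        m<M = ℕ.≤-trans m<x x≤M
        regroup : ∀ i j μ z → i * j * (μ * z) ≡ j * (z * (μ * i))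
        regroup = solve-∀ ringℚ

module ResidueCharges where

  open import Data.Nat.Coprimality using (Coprime)
  open import Data.Nat.DivMod using (m%n≤n; m≡m%n+[m/n]*n; m<n⇒m%n≡m; [m+kn]%n≡m%n)
  open OrderedRationals
  open RationalSums
  open Congruences
  open InghamIdentity using (SupportedOnUnits)
  open ≡-Reasoning

  module _ (n : ℕ) {{_ : ℕ.NonZero n}} where

    charge : ℕ → ℕ → ℚ
    charge x m = ⟦ m % n ℕ.≟ x ⟧ - ⟦ (m ℕ.+ x) % n ℕ.≟ 0 ⟧

    private
      flip : ∀ a b → a - b ≡ - (b - a)
      flip = solve-∀ ringℚ

    ∣charge∣≤1 : ∀ x m → ∣ charge x m ∣ ≤ 1ℚ
    ∣charge∣≤1 x m = ∣x∣≤ (difference≤1 (⟦⟧≤1 (m % n ℕ.≟ x)) (⟦⟧≥0 ((m ℕ.+ x) % n ℕ.≟ 0)))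
      (subst (_≤ 1ℚ) (flip ⟦ (m ℕ.+ x) % n ℕ.≟ 0 ⟧ ⟦ m % n ℕ.≟ x ⟧)
        (difference≤1 (⟦⟧≤1 ((m ℕ.+ x) % n ℕ.≟ 0)) (⟦⟧≥0 (m % n ℕ.≟ x))))
      where
      difference≤1 : ∀ {a b} → a ≤ 1ℚ → 0ℚ ≤ b → a - b ≤ 1ℚ
      difference≤1 a≤1 0≤b = +-mono-≤ a≤1 (neg-antimono-≤ 0≤b)

    charge-cong : ∀ x {m m′} → m ≡ m′ mod n → charge x m ≡ charge x m′
    charge-cong x {m} {m′} m≡m′ = cong₂ _-_
      (⟦⟧-cong (m % n ℕ.≟ x) (m′ % n ℕ.≟ x) (trans (sym m≡m′)) (trans m≡m′))
      (⟦⟧-cong ((m ℕ.+ x) % n ℕ.≟ 0) ((m′ ℕ.+ x) % n ℕ.≟ 0) (trans (sym m+x≡m′+x)) (trans m+x≡m′+x))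
      where
      m+x≡m′+x : m ℕ.+ x ≡ m′ ℕ.+ x mod n
      m+x≡m′+x = +-modʳ n x {m} {m′} m≡m′

    charge-complement : ∀ {x} → 0 ℕ.< x → x ℕ.< n → ∀ m → charge x m ≡ ⟦ m % n ℕ.≟ x ⟧ - ⟦ m % n ℕ.≟ n ∸ x ⟧
    charge-complement {x} 0<x x<n m = cong (λ z → ⟦ m % n ℕ.≟ x ⟧ - z)
      (⟦⟧-cong ((m ℕ.+ x) % n ℕ.≟ 0) (m % n ℕ.≟ n ∸ x) (complement⇒ n m 0<x x<n) (complement⇐ n m x<n))

    charge-odd : ∀ {x} → x ℕ.< n → ∀ m m′ → (m ℕ.+ m′) % n ≡ 0 → charge x m′ ≡ - charge x m
    charge-odd {x} x<n m m′ m+m′≡0 = begin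
      ⟦ m′ % n ℕ.≟ x ⟧ - ⟦ (m′ ℕ.+ x) % n ℕ.≟ 0 ⟧
        ≡⟨ cong₂ _-_ (opposite m m′ m+m′≡0) (sym (opposite m′ m m′+m≡0)) ⟩
      ⟦ (m ℕ.+ x) % n ℕ.≟ 0 ⟧ - ⟦ m % n ℕ.≟ x ⟧    ≡⟨ flip ⟦ (m ℕ.+ x) % n ℕ.≟ 0 ⟧ ⟦ m % n ℕ.≟ x ⟧ ⟩
      - charge x m                                 ∎
      where
      m′+m≡0 : (m′ ℕ.+ m) % n ≡ 0
      m′+m≡0 = trans (cong (_% n) (ℕ.+-comm m′ m)) m+m′≡0
      opposite : ∀ m m′ → (m ℕ.+ m′) % n ≡ 0 → ⟦ m′ % n ℕ.≟ x ⟧ ≡ ⟦ (m ℕ.+ x) % n ℕ.≟ 0 ⟧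
      opposite m m′ m+m′≡0 = ⟦⟧-cong (m′ % n ℕ.≟ x) ((m ℕ.+ x) % n ℕ.≟ 0)
        (λ m′≡x → trans (cong (λ z → (m ℕ.+ z) % n) (sym m′≡x)) (trans (+-modˡ n m (%-mod n m′)) m+m′≡0))
        (opposites-unique n m x m′ x<n m+m′≡0)

    charge-0 : ∀ {x} → 0 ℕ.< x → x ℕ.< n → charge x 0 ≡ 0ℚ
    charge-0 {x} 0<x x<n = cong₂ _-_
      (⟦⟧-no (0 % n ℕ.≟ x) λ 0≡x → ℕ.<⇒≢ 0<x (trans (sym (0%n≡0 n)) 0≡x))
      (⟦⟧-no (x % n ℕ.≟ 0) λ x≡0 → ℕ.<⇒≢ 0<x (trans (sym x≡0) (m<n⇒m%n≡m x<n)))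

    ∑-charge : ∀ {x} → 0 ℕ.< x → x ℕ.< n → ∑ n (charge x) ≡ 0ℚ
    ∑-charge {x} 0<x x<n = begin
      ∑ n (charge x)
        ≡⟨ ∑-cong′ n (charge-complement 0<x x<n) ⟩
      ∑ n (λ m → ⟦ m % n ℕ.≟ x ⟧ - ⟦ m % n ℕ.≟ n ∸ x ⟧)
        ≡⟨ ∑-sub n (λ m → ⟦ m % n ℕ.≟ x ⟧) (λ m → ⟦ m % n ℕ.≟ n ∸ x ⟧) ⟩
      ∑ n (λ m → ⟦ m % n ℕ.≟ x ⟧) - ∑ n (λ m → ⟦ m % n ℕ.≟ n ∸ x ⟧)
        ≡⟨ cong₂ _-_ (hits x<n) (hits (ℕ.∸-monoʳ-< 0<x (ℕ.<⇒≤ x<n))) ⟩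
      1ℚ - 1ℚ
        ≡⟨ +-inverseʳ 1ℚ ⟩
      0ℚ ∎
      where
      hits : ∀ {y} → y ℕ.< n → ∑ n (λ m → ⟦ m % n ℕ.≟ y ⟧) ≡ 1ℚ
      hits {y} y<n = trans
        (∑-single n y y<n λ m m<n m≢y → ⟦⟧-no (m % n ℕ.≟ y) λ m≡y → m≢y (trans (sym (m<n⇒m%n≡m m<n)) m≡y))
        (⟦⟧-yes (y % n ℕ.≟ y) (m<n⇒m%n≡m y<n))

    charge-opposite : ∀ {x y} → 0 ℕ.< x → x ℕ.< n → 0 ℕ.< y → y ℕ.< n → (x ℕ.+ y) % n ≡ 0 →
                      ∀ m → charge x m + charge y m ≡ 0ℚ
    charge-opposite {x} {y} 0<x x<n 0<y y<n x+y≡0 m = begin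
      charge x m + charge y m
        ≡⟨ cong₂ _+_ (charge-complement 0<x x<n m) (charge-complement 0<y y<n m) ⟩
      ⟦ m % n ℕ.≟ x ⟧ - ⟦ m % n ℕ.≟ n ∸ x ⟧ + (⟦ m % n ℕ.≟ y ⟧ - ⟦ m % n ℕ.≟ n ∸ y ⟧)
        ≡⟨ cong₂ (λ a b → ⟦ m % n ℕ.≟ x ⟧ - ⟦ m % n ℕ.≟ a ⟧ + (⟦ m % n ℕ.≟ y ⟧ - ⟦ m % n ℕ.≟ b ⟧)) n∸x≡y n∸y≡x ⟩
      ⟦ m % n ℕ.≟ x ⟧ - ⟦ m % n ℕ.≟ y ⟧ + (⟦ m % n ℕ.≟ y ⟧ - ⟦ m % n ℕ.≟ x ⟧)
        ≡⟨ cancel ⟦ m % n ℕ.≟ x ⟧ ⟦ m % n ℕ.≟ y ⟧ ⟩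
      0ℚ ∎
      where
      cancel : ∀ a b → a - b + (b - a) ≡ 0ℚ
      cancel = solve-∀ ringℚ
      n∸x≡y : n ∸ x ≡ y
      n∸x≡y = trans (sym (complement⇒ n y 0<x x<n (trans (cong (_% n) (ℕ.+-comm y x)) x+y≡0))) (m<n⇒m%n≡m y<n)
      n∸y≡x : n ∸ y ≡ x
      n∸y≡x = trans (sym (complement⇒ n x 0<y y<n x+y≡0)) (m<n⇒m%n≡m x<n)

    charge-support : ∀ {x g} → 0 ℕ.< x → x ℕ.< n → g ℕ.* x ≡ 1 mod n → ∀ m → ¬ Coprime m n → charge x m ≡ 0ℚ
    charge-support {x} {g} 0<x x<n gx≡1 m m⊥̸n = trans (charge-complement 0<x x<n m) (cong₂ _-_
      (⟦⟧-no (m % n ℕ.≟ x) λ m≡x → not-inverse g x x<n gx≡1 m≡x)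
      (⟦⟧-no (m % n ℕ.≟ n ∸ x) λ m≡n∸x → not-inverse (ℕ.pred n ℕ.* g) (n ∸ x) (ℕ.∸-monoʳ-< 0<x (ℕ.<⇒≤ x<n))
        (neg-inverse n g x (ℕ.<⇒≤ x<n) gx≡1) m≡n∸x))
      where
      not-inverse : ∀ g x → x ℕ.< n → g ℕ.* x ≡ 1 mod n → m % n ≢ x
      not-inverse g x x<n gx≡1 m≡x = m⊥̸n (invertible⇒coprime n {m} {g} (inverse-comm n g m
        (trans (*-modˡ n g {m} {x} (trans m≡x (sym (m<n⇒m%n≡m x<n)))) gx≡1)))

    charge-scale : ∀ {k k⁻¹ x x′} → k ℕ.* k⁻¹ ≡ 1 mod n → x ℕ.< n → x′ ℕ.< n → k ℕ.* x′ ≡ x mod n →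
                   ∀ m → charge x (k ℕ.* m) ≡ charge x′ m
    charge-scale {k} {k⁻¹} {x} {x′} kk⁻¹≡1 x<n x′<n kx′≡x m = cong₂ _-_
      (⟦⟧-cong ((k ℕ.* m) % n ℕ.≟ x) (m % n ℕ.≟ x′)
        (λ km≡x → trans (unscale (trans km≡x (sym (trans kx′≡x x≡x)))) (m<n⇒m%n≡m x′<n))
        (λ m≡x′ → trans (*-modˡ n k {m} {x′} (trans m≡x′ (sym (m<n⇒m%n≡m x′<n)))) (trans kx′≡x x≡x)))
      (⟦⟧-cong ((k ℕ.* m ℕ.+ x) % n ℕ.≟ 0) ((m ℕ.+ x′) % n ℕ.≟ 0)
        (λ km+x≡0 → trans (unscale {m ℕ.+ x′} {0}
          (trans k[m+x′]≡ (trans km+x≡0 (sym (*-zero-mod n k (0%n≡0 n)))))) (0%n≡0 n))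
        (λ m+x′≡0 → trans (sym k[m+x′]≡) (*-zero-mod n k m+x′≡0)))
      where
      x≡x : x % n ≡ x
      x≡x = m<n⇒m%n≡m x<n
      k[m+x′]≡ : k ℕ.* (m ℕ.+ x′) ≡ k ℕ.* m ℕ.+ x mod n
      k[m+x′]≡ = trans (cong (_% n) (ℕ.*-distribˡ-+ k m x′)) (+-modˡ n (k ℕ.* m) {k ℕ.* x′} {x} kx′≡x)
      unscale : ∀ {a b} → k ℕ.* a ≡ k ℕ.* b mod n → a ≡ b mod n
      unscale {a} {b} ka≡kb = begin
        a % n                    ≡⟨ inverse-cancelˡ n {k⁻¹} {k} a (inverse-comm n k k⁻¹ kk⁻¹≡1) ⟨
        (k⁻¹ ℕ.* (k ℕ.* a)) % n  ≡⟨ *-modˡ n k⁻¹ {k ℕ.* a} {k ℕ.* b} ka≡kb ⟩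
        (k⁻¹ ℕ.* (k ℕ.* b)) % n  ≡⟨ inverse-cancelˡ n {k⁻¹} {k} b (inverse-comm n k k⁻¹ kk⁻¹≡1) ⟩
        b % n                    ∎

    totalCharge : ℕ → (ℕ → ℕ) → ℕ → ℚ
    totalCharge N α m = ∑ N (λ i → charge (α i) m)

    module TotalCharge (N : ℕ) {a α : ℕ → ℕ} (inverses : Inverses n a α) where
      open Inverses inverses

      private
        h : ℕ → ℚ
        h = totalCharge N α

      ∣totalCharge∣≤ : ∀ m → ∣ h m ∣ ≤ ι N
      ∣totalCharge∣≤ m = subst (∣ h m ∣ ≤_) (*-identityʳ (ι N)) (∣∑∣≤const N λ i _ → ∣charge∣≤1 (α i) m)

      totalCharge-odd : ∀ m m′ → (m ℕ.+ m′) % n ≡ 0 → h m′ ≡ - h m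
      totalCharge-odd m m′ m+m′≡0 = trans (∑-cong′ N λ i → charge-odd (a⁻¹<n i) m m′ m+m′≡0) (∑-neg N _)

      totalCharge-0 : h 0 ≡ 0ℚ
      totalCharge-0 = ∑-zero N λ i _ → charge-0 (0<a⁻¹ i) (a⁻¹<n i)

      totalCharge-units : SupportedOnUnits n h
      totalCharge-units = record
        { periodic = λ m m′ m≡m′ → ∑-cong′ N λ i → charge-cong (α i) m≡m′
        ; support  = λ m m⊥̸n → ∑-zero N λ i _ → charge-support {g = a i} (0<a⁻¹ i) (a⁻¹<n i) (inverse i) m m⊥̸n }

      private
        ∑-block : ∀ l → ∑ n (λ r → h (l ℕ.* n ℕ.+ r)) ≡ 0ℚ
        ∑-block l = begin
          ∑ n (λ r → h (l ℕ.* n ℕ.+ r))   ≡⟨ ∑-cong′ n (λ r → periodic (l ℕ.* n ℕ.+ r) r (drop-block r)) ⟩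
          ∑ n h                           ≡⟨ ∑-swap n N (λ m i → charge (α i) m) ⟩
          ∑ N (λ i → ∑ n (charge (α i)))  ≡⟨ ∑-zero N (λ i _ → ∑-charge (0<a⁻¹ i) (a⁻¹<n i)) ⟩
          0ℚ                              ∎
          where
          open SupportedOnUnits totalCharge-units
          drop-block : ∀ r → l ℕ.* n ℕ.+ r ≡ r mod n
          drop-block r = trans (cong (_% n) (ℕ.+-comm (l ℕ.* n) r)) ([m+kn]%n≡m%n r l n)

      ∣∑-totalCharge∣≤ : ∀ x → ∣ ∑ x h ∣ ≤ ι n * ι N
      ∣∑-totalCharge∣≤ x = subst (λ z → ∣ z ∣ ≤ ι n * ι N) (sym last-block) (≤-trans
        (∣∑∣≤const (x % n) λ j _ → ∣totalCharge∣≤ (q ℕ.* n ℕ.+ j)) (*-monoʳ (ι≥0 N) (ι-mono (m%n≤n x n))))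
        where
        q : ℕ
        q = x ℕ./ n
        last-block : ∑ x h ≡ ∑ (x % n) (λ j → h (q ℕ.* n ℕ.+ j))
        last-block = begin
          ∑ x h                    ≡⟨ cong (λ z → ∑ z h) (trans (m≡m%n+[m/n]*n x n) (ℕ.+-comm (x % n) (q ℕ.* n))) ⟩
          ∑ (q ℕ.* n ℕ.+ x % n) h  ≡⟨ ∑-split (q ℕ.* n) (x % n) h ⟩
          ∑ (q ℕ.* n) h + last     ≡⟨ cong (_+ last) (trans (∑-blocks q n h) (∑-zero q λ l _ → ∑-block l)) ⟩
          0ℚ + last                ≡⟨ +-identityˡ last ⟩
          last                     ∎
          where
          last : ℚ
          last = ∑ (x % n) (λ j → h (q ℕ.* n ℕ.+ j))

      totalCharge-complement : ∀ m → h m ≡ ∑ N (λ i → ⟦ m % n ℕ.≟ α i ⟧ - ⟦ m % n ℕ.≟ n ∸ α i ⟧)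
      totalCharge-complement m = ∑-cong′ N λ i → charge-complement (0<a⁻¹ i) (a⁻¹<n i) m

module HarmonicSeries where

  open import Data.Nat.DivMod using (m*n%n≡0)
  open OrderedRationals
  open RationalSums
  open Congruences
  open ResidueSums using (∑-residue)
  open QuadraticPowers
  open BoundedSequences
  open ApproximateCotangents
  open CotangentBounds
  open ResidueCharges

  module SeriesEstimate (M : ℕ) (h : ℕ → ℚ) {H C : ℚ} (∣h∣≤H : ∀ m → ∣ h m ∣ ≤ H) (sums≤C : ∀ x → ∣ ∑ x h ∣ ≤ C)
    (h0≡0 : h 0 ≡ 0ℚ) (h-odd : ∀ m → m ℕ.≤ M → h (M ∸ m) ≡ - h m)
    {y ε : ℚ} (0≤y : 0ℚ ≤ y) (positive : ImPositive y M) (x : ℕ) (2x₁<M : 2 ℕ.* suc x ℕ.< M)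
    (x₁²y≤1 : ι (suc x) * (ι (suc x) * y) ≤ 1ℚ)
    (antisymmetric : ∀ j → j ℕ.< suc x → ∣ cot y (suc j) + cot y (M ∸ suc j) ∣ ≤ ε)
    (total≤ε : ∣ ∑ M (λ m → h m * cot y m) ∣ ≤ ε) where

    private
      x₁ R′ R : ℕ
      x₁ = suc x
      R′ = M ∸ 2 ℕ.* x₁
      R  = suc R′

      M≡ : x₁ ℕ.+ (R ℕ.+ x) ≡ M
      M≡ = trans (regroup x R′) (ℕ.m+[n∸m]≡n (ℕ.<⇒≤ 2x₁<M))
        where
        regroup : ∀ x r → suc x ℕ.+ (suc r ℕ.+ x) ≡ 2 ℕ.* suc x ℕ.+ r
        regroup = ℕ-Solver.solve-∀

      x₁≤M : x₁ ℕ.≤ M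
      x₁≤M = ℕ.≤-trans (ℕ.m≤n*m x₁ 2) (ℕ.<⇒≤ 2x₁<M)

      c term : ℕ → ℚ
      c = cot y
      term m = h m * c m

      head middle reflectionError series x₁²y : ℚ
      head            = ∑ x (λ j → term (suc j))
      middle          = ∑ R (λ j → term (x₁ ℕ.+ j))
      reflectionError = ∑ x (λ j → h (suc j) * (c (suc j) + c (M ∸ suc j)))
      series          = ∑ x (λ j → h (suc j) * inv (ι (suc j)))
      x₁²y            = ι x₁ * (ι x₁ * y)

      0≤C : 0ℚ ≤ C
      0≤C = ≤-trans (0≤∣p∣ (∑ 0 h)) (sums≤C 0)

      0≤H : 0ℚ ≤ H
      0≤H = ≤-trans (0≤∣p∣ (h 0)) (∣h∣≤H 0)

      reflected : ∑ x (λ j → term (M ∸ suc j)) ≡ head - reflectionError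
      reflected = trans (∑-cong x λ j j<x →
          trans (cong (_* c (M ∸ suc j)) (h-odd (suc j) (ℕ.≤-trans j<x (ℕ.≤-trans (ℕ.n≤1+n x) x₁≤M))))
                (insert (h (suc j)) (c (suc j)) (c (M ∸ suc j))))
        (∑-sub x _ _)
        where
        insert : ∀ h c d → - h * d ≡ h * c - h * (c + d)
        insert = solve-∀ ringℚ

      total≡ : ∑ M term ≡ head + (middle + (head - reflectionError))
      total≡ = begin
        ∑ M term
          ≡⟨ cong (λ N → ∑ N term) M≡ ⟨
        ∑ (x₁ ℕ.+ (R ℕ.+ x)) term
          ≡⟨ ∑-ends x R term ⟩
        ∑ x₁ term + (middle + ∑ x (λ j → term (x₁ ℕ.+ (R ℕ.+ x) ∸ suc j)))
          ≡⟨ cong (λ N → ∑ x₁ term + (middle + ∑ x (λ j → term (N ∸ suc j)))) M≡ ⟩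
        term 0 + head + (middle + ∑ x (λ j → term (M ∸ suc j)))
          ≡⟨ cong₂ (λ u v → u + head + (middle + v)) (x≡0⇒xy≡0 (c 0) h0≡0) reflected ⟩
        0ℚ + head + (middle + (head - reflectionError))
          ≡⟨ cong (_+ (middle + (head - reflectionError))) (+-identityˡ head) ⟩
        head + (middle + (head - reflectionError)) ∎
        where open ≡-Reasoning

      cancel : ∀ a b → a + b - a ≡ b
      cancel = solve-∀ ringℚ

      0≤c[x₁] : 0ℚ ≤ c x₁
      0≤c[x₁] = cot≥0 0≤y positive x₁ x₁≤M x₁²y≤1 x ℕ.≤-refl

      ∣c[M∸x₁]∣≤ : ∣ c (M ∸ x₁) ∣ ≤ c x₁ + ε
      ∣c[M∸x₁]∣≤ = subst (λ z → ∣ z ∣ ≤ c x₁ + ε) (cancel (c x₁) (c (M ∸ x₁)))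
        (≤-trans (∣x-y∣≤ (antisymmetric x ℕ.≤-refl) (0≤x⇒∣x∣≤ 0≤c[x₁] ≤-refl)) (≤-reflexive (+-comm ε (c x₁))))

      middleCot : ℕ → ℚ
      middleCot j = c (x₁ ℕ.+ j)

      middleCot-decreasing : ∀ i → i ℕ.< R′ → ∣ middleCot i - middleCot (suc i) ∣ ≤ middleCot i - middleCot (suc i)
      middleCot-decreasing i i<R′ = ≤-reflexive (0≤p⇒∣p∣≡p (x≤y⇒0≤y-x
        (subst (λ z → c z ≤ middleCot i) (sym (ℕ.+-suc x₁ i)) (cot-decreasing 0≤y positive (x ℕ.+ i) in-range))))
        where
        regroup : ∀ x r → suc (suc (x ℕ.+ r)) ℕ.+ x ≡ suc x ℕ.+ (suc r ℕ.+ x)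
        regroup = ℕ-Solver.solve-∀
        in-range : suc (suc (x ℕ.+ i)) ℕ.≤ M
        in-range = ℕ.≤-trans (s≤s (s≤s (ℕ.+-monoʳ-≤ x (ℕ.<⇒≤ i<R′))))
          (ℕ.≤-trans (ℕ.m≤m+n (suc (suc (x ℕ.+ R′))) x) (ℕ.≤-reflexive (trans (regroup x R′) M≡)))

      middle≤ : ∣ middle ∣ ≤ (C + C) * ((c x₁ + ε) + (c x₁ + (c x₁ + ε)))
      middle≤ = begin
        ∣ middle ∣
          ≤⟨ ∣∑∣≤-by-parts R′ (λ j → h (x₁ ℕ.+ j)) middleCot _ (C + C)
            (+≥0 0≤C 0≤C) shifted-sums middleCot-decreasing ⟩
        (C + C) * (∣ middleCot R′ ∣ + ∑ R′ (λ i → middleCot i - middleCot (suc i)))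
          ≡⟨ cong₂ (λ m s → (C + C) * (∣ c m ∣ + s)) x₁+R′≡ (∑-telescope R′ middleCot) ⟩
        (C + C) * (∣ c (M ∸ x₁) ∣ + (middleCot 0 - middleCot R′))
          ≡⟨ cong₂ (λ l m → (C + C) * (∣ c (M ∸ x₁) ∣ + (c l - c m))) (ℕ.+-identityʳ x₁) x₁+R′≡ ⟩
        (C + C) * (∣ c (M ∸ x₁) ∣ + (c x₁ - c (M ∸ x₁)))
          ≤⟨ *-monoˡ (+≥0 0≤C 0≤C) (+-mono-≤ ∣c[M∸x₁]∣≤
            (+-monoʳ-≤ (c x₁) (≤-trans (-x≤∣x∣ (c (M ∸ x₁))) ∣c[M∸x₁]∣≤))) ⟩
        (C + C) * ((c x₁ + ε) + (c x₁ + (c x₁ + ε))) ∎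
        where
        open ≤-Reasoning
        x₁+R′≡ : x₁ ℕ.+ R′ ≡ M ∸ x₁
        x₁+R′≡ = trans (sym (ℕ.m+n∸n≡m (x₁ ℕ.+ R′) x₁)) (cong (_∸ x₁) (trans (regroup x R′) M≡))
          where
          regroup : ∀ x r → suc x ℕ.+ r ℕ.+ suc x ≡ suc x ℕ.+ (suc r ℕ.+ x)
          regroup = ℕ-Solver.solve-∀
        shifted-sums : ∀ i → ∣ ∑ i (λ j → h (x₁ ℕ.+ j)) ∣ ≤ C + C
        shifted-sums i = subst (λ z → ∣ z ∣ ≤ C + C)
          (trans (cong (_- ∑ x₁ h) (∑-split x₁ i h)) (cancel (∑ x₁ h) (∑ i (λ j → h (x₁ ℕ.+ j)))))
          (∣x-y∣≤ (sums≤C (x₁ ℕ.+ i)) (sums≤C x₁))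

      head≤ : ∣ head ∣ ≤ ε + (C + C) * ((c x₁ + ε) + (c x₁ + (c x₁ + ε))) + ι x * (H * ε)
      head≤ = begin
        ∣ head ∣       ≤⟨ ∣x∣≤∣c*x∣ head 1≤2 ⟩
        ∣ 2ℚ * head ∣  ≡⟨ cong ∣_∣ (solve-for-head head middle reflectionError) ⟩
        ∣ head + (middle + (head - reflectionError)) - middle + reflectionError ∣
          ≡⟨ cong (λ z → ∣ z - middle + reflectionError ∣) total≡ ⟨
        ∣ ∑ M term - middle + reflectionError ∣
          ≤⟨ ∣x+y∣≤ (∣x-y∣≤ total≤ε middle≤) (∣∑∣≤const x λ j j<x →
            ∣x*y∣≤ (∣h∣≤H (suc j)) (antisymmetric j (ℕ.m<n⇒m<1+n j<x))) ⟩
        ε + (C + C) * ((c x₁ + ε) + (c x₁ + (c x₁ + ε))) + ι x * (H * ε) ∎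
        where
        open ≤-Reasoning
        solve-for-head : ∀ u s e → (1ℚ + 1ℚ) * u ≡ u + (s + (u - e)) - s + e
        solve-for-head = solve-∀ ringℚ

      series≤ : ∣ series ∣ ≤ ∣ head ∣ + ι x * (H * x₁²y)
      series≤ = subst (λ z → ∣ z ∣ ≤ ∣ head ∣ + ι x * (H * x₁²y)) head+difference≡series
        (∣x+y∣≤ {head} ≤-refl (∣∑∣≤const x λ j j<x → ∣x*y∣≤ (∣h∣≤H (suc j)) (difference≤ j (ℕ.m<n⇒m<1+n j<x))))
        where
        difference≤ : ∀ j → j ℕ.< x₁ → ∣ inv (ι (suc j)) - c (suc j) ∣ ≤ x₁²y
        difference≤ j j<x₁ = 0≤x⇒∣x∣≤ (x≤y⇒0≤y-x (cot≤inv 0≤y positive j (ℕ.≤-trans j<x₁ x₁≤M)))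
          (inv-cot≤ 0≤y positive x₁ x₁≤M x₁²y≤1 j j<x₁)
        add : ∀ h c i → h * c + h * (i - c) ≡ h * i
        add = solve-∀ ringℚ
        head+difference≡series : head + ∑ x (λ j → h (suc j) * (inv (ι (suc j)) - c (suc j))) ≡ series
        head+difference≡series = trans (sym (∑-+ x (λ j → term (suc j)) _))
          (∑-cong′ x λ j → add (h (suc j)) (c (suc j)) (inv (ι (suc j))))

    errorWeight : ℚ
    errorWeight = ι x + 4ℚ * C * ι x + ι x * (ι x * H)

    estimate : ε * errorWeight ≤ 1ℚ → ι x * (ι x * (ι x₁ * (ι x₁ * y))) ≤ 1ℚ →
      ι x * ∣ series ∣ ≤ 1ℚ + (4ℚ + 2ℚ) * C + H
    estimate ε-small y-small = begin
      ι x * ∣ series ∣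
        ≤⟨ *-monoˡ (ι≥0 x) (≤-trans series≤ (+-monoˡ-≤ (ι x * (H * x₁²y)) head≤)) ⟩
      ι x * (ε + (C + C) * ((c x₁ + ε) + (c x₁ + (c x₁ + ε))) + ι x * (H * ε) + ι x * (H * x₁²y))
        ≡⟨ collect (ι x) ε C (c x₁) H x₁²y ⟩
      ε * errorWeight + (4ℚ + 2ℚ) * C * (ι x * c x₁) + H * (ι x * (ι x * x₁²y))
        ≤⟨ +-mono-≤ (+-mono-≤ ε-small (*-monoˡ (*≥0 (nonNegative⁻¹ (4ℚ + 2ℚ)) 0≤C) x*cot≤1)) (*-monoˡ 0≤H y-small) ⟩
      1ℚ + (4ℚ + 2ℚ) * C * 1ℚ + H * 1ℚ
        ≡⟨ cong₂ (λ a b → 1ℚ + a + b) (*-identityʳ ((4ℚ + 2ℚ) * C)) (*-identityʳ H) ⟩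
      1ℚ + (4ℚ + 2ℚ) * C + H ∎
      where
      open ≤-Reasoning
      x*cot≤1 : ι x * c x₁ ≤ 1ℚ
      x*cot≤1 = ≤-trans (*-mono (ι≥0 x) (ι-mono (ℕ.n≤1+n x)) 0≤c[x₁] (cot≤inv 0≤y positive x x₁≤M))
        (≤-reflexive (*-inv⁺ (ι>0 x₁)))
      collect : ∀ x e C g H X →
        x * (e + (C + C) * ((g + e) + (g + (g + e))) + x * (H * e) + x * (H * X)) ≡
        e * (x + ((1ℚ + 1ℚ) + (1ℚ + 1ℚ)) * C * x + x * (x * H)) +
          ((1ℚ + 1ℚ) + (1ℚ + 1ℚ) + (1ℚ + 1ℚ)) * C * (x * g) + H * (x * (x * X))
      collect = solve-∀ ringℚ

  private
    x⁴y≤1 : ∀ {y M} x {{_ : ℕ.NonZero x}} → 0ℚ ≤ y → ImPositive y M → 4 ℕ.* x ℕ.^ 4 ℕ.+ 2 ℕ.≤ M →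
            ι x * (ι x * (ι x * (ι x * y))) ≤ 1ℚ
    x⁴y≤1 {y} {M} x 0≤y positive 4x⁴+2≤M = *-cancelˡ-≤ (positive⁻¹ 4ℚ) (begin
      4ℚ * (ι x * (ι x * (ι x * (ι x * y))))  ≡⟨ regroup 4ℚ (ι x) y ⟩
      4ℚ * ι x ^ 4 * y                        ≡⟨ cong₂ (λ a b → a * b * y) ι-4 (ι-^ x 4) ⟨
      ι 4 * ι (x ℕ.^ 4) * y                   ≡⟨ cong (_* y) (ι-* 4 (x ℕ.^ 4)) ⟨
      ι (4 ℕ.* x ℕ.^ 4) * y                   ≤⟨ *-monoʳ 0≤y (ι-mono 4x⁴≤k) ⟩
      ι k * y                                 ≤⟨ ky≤4 0≤y positive k M≡k+2 ⟩
      4ℚ * 1ℚ                                 ∎)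
      where
      open ≤-Reasoning
      k : ℕ
      k = M ∸ 2
      M≡k+2 : M ≡ suc (suc k)
      M≡k+2 = sym (ℕ.m+[n∸m]≡n (ℕ.≤-trans (ℕ.m≤n+m 2 _) 4x⁴+2≤M))
      4x⁴≤k : 4 ℕ.* x ℕ.^ 4 ℕ.≤ k
      4x⁴≤k = ℕ.≤-trans (ℕ.≤-reflexive (sym (ℕ.m+n∸n≡m _ 2))) (ℕ.∸-monoˡ-≤ 2 4x⁴+2≤M)
      regroup : ∀ f x y → f * (x * (x * (x * (x * y)))) ≡ f * (x * (x * (x * (x * 1ℚ)))) * y
      regroup = solve-∀ ringℚ

  -- Σ h(m)/m over m ≤ x is O(1/x) for the odd function h, if h annihilates the sawtooth.
  module BalancedCharges (n : ℕ) {{_ : ℕ.NonZero n}} (N : ℕ) {a α : ℕ → ℕ} (inverses : Inverses n a α)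
    (balance : ∀ r → residueSum n N a r ≡ residueSum n N (negate n a) r) where

    open TotalCharge n N inverses
    open Inverses inverses

    private
      h : ℕ → ℚ
      h = totalCharge n N α

      n-α : ℕ → ℕ
      n-α i = n ∸ α i

      C : ℚ
      C = ι n * ι N

    seriesBound : ℚ
    seriesBound = 1ℚ + (4ℚ + 2ℚ) * C + ι N

    private
      module Cutoff (x : ℕ) where
        x₁ L : ℕ
        x₁ = suc x
        L  = 4 ℕ.* x₁ ℕ.^ 4 ℕ.+ 4 ℕ.* x₁

        instance
          L-nonZero : ℕ.NonZero L
          L-nonZero = ℕ.>-nonZero (ℕ.<-≤-trans (s≤s z≤n) (ℕ.m≤n+m (4 ℕ.* x₁) (4 ℕ.* x₁ ℕ.^ 4)))

        4x₁≤M : 4 ℕ.* x₁ ℕ.≤ n ℕ.* L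
        4x₁≤M = ℕ.≤-trans (ℕ.m≤n+m (4 ℕ.* x₁) (4 ℕ.* x₁ ℕ.^ 4)) (ℕ.m≤n*m L n)

        4≤M : 4 ℕ.≤ n ℕ.* L
        4≤M = ℕ.≤-trans (ℕ.m≤m*n 4 x₁) 4x₁≤M

        open Tangents n L 4≤M

        2x₁<M : 2 ℕ.* x₁ ℕ.< M
        2x₁<M = ℕ.<-≤-trans (ℕ.*-monoˡ-< x₁ {2} {4} (s≤s (s≤s (s≤s z≤n)))) 4x₁≤M

        4x₁⁴+2≤M : 4 ℕ.* x₁ ℕ.^ 4 ℕ.+ 2 ℕ.≤ M
        4x₁⁴+2≤M = ℕ.≤-trans (ℕ.+-monoʳ-≤ (4 ℕ.* x₁ ℕ.^ 4) (ℕ.≤-trans (s≤s (s≤s z≤n)) (ℕ.m≤m*n 4 x₁))) (ℕ.m≤n*m L n)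

        ∑-charge*cot : ∀ T → ∑ M (λ m → h m * cot (tan² T) m) ≡ cotSum N α T - cotSum N n-α T
        ∑-charge*cot T = begin
          ∑ M (λ m → h m * c m)
            ≡⟨ ∑-cong′ M (λ m → trans (cong (_* c m) (totalCharge-complement m)) (trans (∑-*ʳ N (c m) _)
                 (∑-cong′ N λ i → distribute ⟦ m % n ℕ.≟ α i ⟧ ⟦ m % n ℕ.≟ n-α i ⟧ (c m)))) ⟩
          ∑ M (λ m → ∑ N (λ i → ⟦ m % n ℕ.≟ α i ⟧ * c m - ⟦ m % n ℕ.≟ n-α i ⟧ * c m))
            ≡⟨ ∑-swap M N _ ⟩
          ∑ N (λ i → ∑ M (λ m → ⟦ m % n ℕ.≟ α i ⟧ * c m - ⟦ m % n ℕ.≟ n-α i ⟧ * c m))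
            ≡⟨ ∑-cong′ N (λ i → trans (∑-sub M _ _) (cong₂ _-_
                 (∑-residue n L (α i) c (a⁻¹<n i)) (∑-residue n L (n-α i) c
                   (ℕ.∸-monoʳ-< (0<a⁻¹ i) (ℕ.<⇒≤ (a⁻¹<n i)))))) ⟩
          ∑ N (λ i → ∑ L (λ l → c (l ℕ.* n ℕ.+ α i)) - ∑ L (λ l → c (l ℕ.* n ℕ.+ n-α i)))
            ≡⟨ ∑-sub N _ _ ⟩
          cotSum N α T - cotSum N n-α T ∎
          where
          open ≡-Reasoning
          c : ℕ → ℚ
          c = cot (tan² T)
          distribute : ∀ a b c → (a - b) * c ≡ a * c - b * c
          distribute = solve-∀ ringℚ

        G ε : ℚ
        G = ι x + 4ℚ * C * ι x + ι x * (ι x * ι N)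
        ε = inv (1ℚ + G)

        0≤G : 0ℚ ≤ G
        0≤G = +≥0 (+≥0 (ι≥0 x) (*≥0 (*≥0 (nonNegative⁻¹ 4ℚ) (*≥0 (ι≥0 n) (ι≥0 N))) (ι≥0 x)))
          (*≥0 (ι≥0 x) (*≥0 (ι≥0 x) (ι≥0 N)))

        0<1+G : 0ℚ < 1ℚ + G
        0<1+G = <-≤-trans 0<1 (≤-slack G 0≤G refl)

        εG≤1 : ε * G ≤ 1ℚ
        εG≤1 = ≤-trans (*-monoˡ (inv≥0 0<1+G) (≤-slack 1ℚ 0≤1 (+-comm G 1ℚ)))
          (≤-reflexive (trans (*-comm ε (1ℚ + G)) (*-inv⁺ 0<1+G)))

        lhs rhs : ℕ → ℕ → ℚ
        lhs zero    T = ι M * cotSum N α T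
        lhs (suc j) T = cot (tan² T) (suc j) + cot (tan² T) (M ∸ suc j)
        rhs zero    T = ι M * cotSum N n-α T
        rhs (suc j) T = 0ℚ

        lhs≋rhs : ∀ j → j ℕ.< suc x₁ → lhs j ≋ rhs j
        lhs≋rhs zero    _         = equal-cotSums N inverses (negate-inverses n inverses) balance
        lhs≋rhs (suc j) (s≤s j<x₁) = cot-antisymmetric (suc j) (s≤s z≤n)
          (ℕ.≤-<-trans j<x₁ (ℕ.≤-<-trans (ℕ.m≤n*m x₁ 2) 2x₁<M))

        T : ℕ
        T = proj₁ (simultaneously-close (suc x₁) lhs rhs lhs≋rhs (inv>0 0<1+G))

        close : ∀ j → j ℕ.< suc x₁ → ∣ lhs j T - rhs j T ∣ ≤ ε
        close = proj₂ (simultaneously-close (suc x₁) lhs rhs lhs≋rhs (inv>0 0<1+G))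

        y : ℚ
        y = tan² T

        antisymmetric : ∀ j → j ℕ.< x₁ → ∣ cot y (suc j) + cot y (M ∸ suc j) ∣ ≤ ε
        antisymmetric j j<x₁ = subst (λ z → ∣ z ∣ ≤ ε) (+-identityʳ (cot y (suc j) + cot y (M ∸ suc j)))
          (close (suc j) (s≤s j<x₁))

        total≤ε : ∣ ∑ M (λ m → h m * cot y m) ∣ ≤ ε
        total≤ε = begin
          ∣ ∑ M (λ m → h m * cot y m) ∣              ≡⟨ cong ∣_∣ (∑-charge*cot T) ⟩
          ∣ cotSum N α T - cotSum N n-α T ∣
            ≤⟨ ∣x∣≤∣c*x∣ (cotSum N α T - cotSum N n-α T) (ι≥1 M {{ℕ.m*n≢0 n L}}) ⟩
          ∣ ι M * (cotSum N α T - cotSum N n-α T) ∣  ≡⟨ cong ∣_∣ (expand (ι M) (cotSum N α T) (cotSum N n-α T)) ⟩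
          ∣ lhs 0 T - rhs 0 T ∣                      ≤⟨ close 0 (s≤s z≤n) ⟩
          ε                                          ∎
          where
          open ≤-Reasoning
          expand : ∀ m a b → m * (a - b) ≡ m * a - m * b
          expand = solve-∀ ringℚ

        0≤y : 0ℚ ≤ y
        0≤y = tan²≥0 T

        0≤x₁²y : 0ℚ ≤ ι x₁ * (ι x₁ * y)
        0≤x₁²y = *≥0 (ι≥0 x₁) (*≥0 (ι≥0 x₁) 0≤y)

        x₁⁴y≤1 : ι x₁ * (ι x₁ * (ι x₁ * (ι x₁ * y))) ≤ 1ℚ
        x₁⁴y≤1 = x⁴y≤1 x₁ 0≤y (tan²-positive T) 4x₁⁴+2≤M

        x₁²y≤1 : ι x₁ * (ι x₁ * y) ≤ 1ℚ
        x₁²y≤1 = ≤-trans (≤-trans (1≤x⇒y≤x*y (ι≥1 x₁) 0≤x₁²y) (1≤x⇒y≤x*y (ι≥1 x₁) (*≥0 (ι≥0 x₁) 0≤x₁²y))) x₁⁴y≤1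

        x²x₁²y≤1 : ι x * (ι x * (ι x₁ * (ι x₁ * y))) ≤ 1ℚ
        x²x₁²y≤1 = ≤-trans (*-mono (ι≥0 x) x≤x₁ (*≥0 (ι≥0 x) 0≤x₁²y) (*-monoʳ 0≤x₁²y x≤x₁)) x₁⁴y≤1
          where
          x≤x₁ : ι x ≤ ι x₁
          x≤x₁ = ι-mono (ℕ.n≤1+n x)

        reflected-charge : ∀ m → m ℕ.≤ M → h (M ∸ m) ≡ - h m
        reflected-charge m m≤M = totalCharge-odd m (M ∸ m)
          (trans (cong (_% n) (trans (ℕ.m+[n∸m]≡n m≤M) (ℕ.*-comm n L))) (m*n%n≡0 L n))

        open SeriesEstimate M h ∣totalCharge∣≤ ∣∑-totalCharge∣≤ totalCharge-0 reflected-charge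
          0≤y (tan²-positive T) x 2x₁<M x₁²y≤1 antisymmetric total≤ε public using (estimate)

    charge-series-bound : ∀ x → ι x * ∣ ∑ x (λ m → h (suc m) * inv (ι (suc m))) ∣ ≤ seriesBound
    charge-series-bound x = estimate εG≤1 x²x₁²y≤1
      where open Cutoff x

module OddVanishing where

  open import Data.Nat.Coprimality using (Coprime; coprime?)
  open import Data.Nat.DivMod using (m%n<n; m<n⇒m%n≡m)
  open import Data.Nat.Divisibility using (m∣m*n)
  open OrderedRationals
  open RationalSums
  open RangeSums using (∑ℕ-cong)
  open Congruences
  open InghamIdentity using (SupportedOnUnits)
  open InghamMeans using (VanishingSeries)
  open NonVanishing using (vanishing)
  open ResidueCharges
  open HarmonicSeries using (module BalancedCharges)
  open ≡-Reasoning

  module _ (n : ℕ) {{_ : ℕ.NonZero n}} where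

    Balanced : ℕ → (ℕ → ℕ) → Set
    Balanced N a = ∀ r → residueSum n N a r ≡ residueSum n N (negate n a) r

    balanced-scale : ∀ k N a → Balanced N a → Balanced N (λ i → k ℕ.* a i)
    balanced-scale k N a balance r = begin
      residueSum n N (λ i → k ℕ.* a i) r             ≡⟨ ∑ℕ-cong N (λ i → cong (_% n) (ℕ.*-assoc r k (a i))) ⟨
      residueSum n N a (r ℕ.* k)                     ≡⟨ balance (r ℕ.* k) ⟩
      residueSum n N (negate n a) (r ℕ.* k)
        ≡⟨ ∑ℕ-cong N (λ i → cong (_% n) (regroup r k (ℕ.pred n) (a i))) ⟩
      residueSum n N (negate n (λ i → k ℕ.* a i)) r  ∎
      where
      regroup : ∀ r k p a → r ℕ.* k ℕ.* (p ℕ.* a) ≡ r ℕ.* (p ℕ.* (k ℕ.* a))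
      regroup = ℕ-Solver.solve-∀

    module _ (k k⁻¹ : ℕ) (kk⁻¹≡1 : k ℕ.* k⁻¹ ≡ 1 mod n) {a α : ℕ → ℕ} (inverses : Inverses n a α) where
      open Inverses inverses

      private
        α′ : ℕ → ℕ
        α′ i = k⁻¹ ℕ.* α i % n

        kα′≡α : ∀ i → k ℕ.* α′ i ≡ α i mod n
        kα′≡α i = trans (*-modˡ n k {α′ i} {k⁻¹ ℕ.* α i} (%-mod n (k⁻¹ ℕ.* α i)))
          (inverse-cancelˡ n {k} {k⁻¹} (α i) kk⁻¹≡1)

      inverses-scale : Inverses n (λ i → k ℕ.* a i) α′
      inverses-scale = record { inverse = inverse′ ; 0<a⁻¹ = 0<α′ ; a⁻¹<n = λ i → m%n<n (k⁻¹ ℕ.* α i) n }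
        where
        regroup : ∀ k a b → k ℕ.* a ℕ.* b ≡ a ℕ.* (k ℕ.* b)
        regroup = ℕ-Solver.solve-∀
        inverse′ : ∀ i → k ℕ.* a i ℕ.* α′ i ≡ 1 mod n
        inverse′ i = begin
          (k ℕ.* a i ℕ.* α′ i) % n    ≡⟨ cong (_% n) (regroup k (a i) (α′ i)) ⟩
          (a i ℕ.* (k ℕ.* α′ i)) % n  ≡⟨ *-modˡ n (a i) {k ℕ.* α′ i} {α i} (kα′≡α i) ⟩
          (a i ℕ.* α i) % n           ≡⟨ inverse i ⟩
          1 % n                       ∎
        0<α′ : ∀ i → 0 ℕ.< α′ i
        0<α′ i = ℕ.n≢0⇒n>0 λ α′≡0 → ℕ.<⇒≢ (0<a⁻¹ i) (sym (begin
          α i               ≡⟨ m<n⇒m%n≡m (a⁻¹<n i) ⟨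
          α i % n           ≡⟨ kα′≡α i ⟨
          (k ℕ.* α′ i) % n  ≡⟨ *-zero-mod n k (trans (cong (_% n) α′≡0) (0%n≡0 n)) ⟩
          0                 ∎))

      totalCharge-scale : ∀ N m → totalCharge n N α (k ℕ.* m) ≡ totalCharge n N α′ m
      totalCharge-scale N m = ∑-cong′ N λ i → charge-scale n {k} {k⁻¹} kk⁻¹≡1 (a⁻¹<n i) (m%n<n (k⁻¹ ℕ.* α i) n)
        (kα′≡α i) m

    module _ (1<n : 1 ℕ.< n) (N : ℕ) {a α : ℕ → ℕ} (inverses : Inverses n a α) (balance : Balanced N a) where
      open TotalCharge n N inverses using (totalCharge-units)
      open BalancedCharges n N inverses balance using (seriesBound)
      open SupportedOnUnits totalCharge-units

      private
        h : ℕ → ℚ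
        h = totalCharge n N α

        C : ℚ
        C = ι n * ι N + seriesBound

        0≤seriesBound : 0ℚ ≤ seriesBound
        0≤seriesBound = +≥0 (+≥0 0≤1 (*≥0 (nonNegative⁻¹ (4ℚ + 2ℚ)) (*≥0 (ι≥0 n) (ι≥0 N)))) (ι≥0 N)

        0≤C : 0ℚ ≤ C
        0≤C = +≥0 (*≥0 (ι≥0 n) (ι≥0 N)) 0≤seriesBound

        h[k*]≡0 : ∀ {k} → ¬ Coprime k n → ∀ m → h (k ℕ.* m) ≡ 0ℚ
        h[k*]≡0 {k} k⊥̸n m = support (k ℕ.* m) λ km⊥n → k⊥̸n (∣-coprime (m∣m*n m) km⊥n)

        sums-bounded : ∀ k x → ∣ ∑ x (λ m → h (k ℕ.* m)) ∣ ≤ C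
        sums-bounded k x with coprime? k n
        ... | no  k⊥̸n = subst (λ z → ∣ z ∣ ≤ C) (sym (∑-zero x λ m _ → h[k*]≡0 k⊥̸n m)) 0≤C
        ... | yes k⊥n with coprime⇒invertible n k⊥n
        ...   | k⁻¹ , kk⁻¹≡1 = subst (λ z → ∣ z ∣ ≤ C) (sym (∑-cong′ x (totalCharge-scale k k⁻¹ kk⁻¹≡1 inverses N)))
          (≤-trans (TotalCharge.∣∑-totalCharge∣≤ n N (inverses-scale k k⁻¹ kk⁻¹≡1 inverses) x)
            (≤-slack seriesBound 0≤seriesBound refl))

        series-bounded : ∀ k x → ι x * ∣ ∑ x (λ m → h (k ℕ.* suc m) * inv (ι (suc m))) ∣ ≤ C
        series-bounded k x with coprime? k n
        ... | no  k⊥̸n = subst (_≤ C) (sym (y≡0⇒xy≡0 (ι x) (cong ∣_∣ (∑-zero x λ m _ →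
          x≡0⇒xy≡0 (inv (ι (suc m))) (h[k*]≡0 k⊥̸n (suc m)))))) 0≤C
        ... | yes k⊥n with coprime⇒invertible n k⊥n
        ...   | k⁻¹ , kk⁻¹≡1 = subst (λ z → ι x * ∣ z ∣ ≤ C)
          (sym (∑-cong′ x λ m → cong (_* inv (ι (suc m))) (totalCharge-scale k k⁻¹ kk⁻¹≡1 inverses N (suc m))))
          (≤-trans (BalancedCharges.charge-series-bound n N
              (inverses-scale k k⁻¹ kk⁻¹≡1 inverses) (balanced-scale k N a balance) x)
            (≤-slack (ι n * ι N) (*≥0 (ι≥0 n) (ι≥0 N)) (+-comm seriesBound (ι n * ι N))))

        series : VanishingSeries h C
        series = record { C≥0 = 0≤C ; sums-bounded = sums-bounded ; series-bounded = series-bounded }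

      balanced⇒totalCharge≡0 : ∀ m → h m ≡ 0ℚ
      balanced⇒totalCharge≡0 = vanishing n 1<n h totalCharge-units C series

module Matching where

  open import Data.Fin.Base using (Fin; zero; suc; toℕ; punchIn; punchOut)
  open import Data.Fin.Properties using (_≟_; punchIn-punchOut; punchOut-punchIn; punchInᵢ≢i)
  import Data.Sum as Sum

  record Pairing {N : ℕ} (d : ℕ) (R : Fin N → Fin N → Set) : Set where
    field
      left right : Fin d → Fin N
      side       : Fin N → Fin d ⊎ Fin d
      side-left  : ∀ i → side (left i) ≡ inj₁ i
      side-right : ∀ i → side (right i) ≡ inj₂ i
      at-side    : ∀ k → [ left , right ]′ (side k) ≡ k
      related    : ∀ i → R (left i) (right i)
      left-zero  : ∀ i → toℕ i ≡ 0 → toℕ (left i) ≡ 0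

  map-pairing : ∀ {N d} {R S : Fin N → Fin N → Set} → (∀ i j → R i j → S i j) → Pairing d R → Pairing d S
  map-pairing R⇒S P = record { Pairing P hiding (related) ; related = λ i → R⇒S _ _ (Pairing.related P i) }

  module _ {N d : ℕ} {R : Fin (suc (suc N)) → Fin (suc (suc N)) → Set} (j : Fin (suc N)) (0Rj : R zero (suc j))
    (P : Pairing d (λ i k → R (suc (punchIn j i)) (suc (punchIn j k)))) where

    private
      module P = Pairing P

      old : Fin N → Fin (suc (suc N))
      old i = suc (punchIn j i)

      left right : Fin (suc d) → Fin (suc (suc N))
      left zero     = zero
      left (suc i)  = old (P.left i)
      right zero    = suc j
      right (suc i) = old (P.right i)

      locate : ∀ k → Dec (j ≡ k) → Fin (suc d) ⊎ Fin (suc d)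
      locate k (yes _)  = inj₂ zero
      locate k (no j≢k) = Sum.map suc suc (P.side (punchOut j≢k))

      side : Fin (suc (suc N)) → Fin (suc d) ⊎ Fin (suc d)
      side zero    = inj₁ zero
      side (suc k) = locate k (j ≟ k)

      locate-new : (j≟j : Dec (j ≡ j)) → locate j j≟j ≡ inj₂ zero
      locate-new (yes _)  = refl
      locate-new (no j≢j) = ⊥-elim (j≢j refl)

      locate-old : ∀ i {x} (j≟ : Dec (j ≡ punchIn j i)) → P.side i ≡ x → locate (punchIn j i) j≟ ≡ Sum.map suc suc x
      locate-old i (yes j≡) _    = ⊥-elim (punchInᵢ≢i j i (sym j≡))
      locate-old i (no j≢k) refl = cong (Sum.map suc suc ∘ P.side) (punchOut-punchIn j)

      at-old : ∀ x → [ left , right ]′ (Sum.map suc suc x) ≡ old ([ P.left , P.right ]′ x)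
      at-old (inj₁ _) = refl
      at-old (inj₂ _) = refl

      at-locate : ∀ k (j≟k : Dec (j ≡ k)) → [ left , right ]′ (locate k j≟k) ≡ suc k
      at-locate k (yes refl) = refl
      at-locate k (no j≢k)   = trans (at-old (P.side (punchOut j≢k)))
        (cong suc (trans (cong (punchIn j) (P.at-side (punchOut j≢k))) (punchIn-punchOut j≢k)))

    extend-pairing : Pairing (suc d) R
    extend-pairing = record
      { left       = left
      ; right      = right
      ; side       = side
      ; side-left  = λ { zero → refl ; (suc i) → locate-old (P.left i) (j ≟ _) (P.side-left i) }
      ; side-right = λ { zero → locate-new (j ≟ j) ; (suc i) → locate-old (P.right i) (j ≟ _) (P.side-right i) }
      ; at-side    = λ { zero → refl ; (suc k) → at-locate k (j ≟ k) }
      ; related    = λ { zero → 0Rj ; (suc i) → P.related i }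
      ; left-zero  = λ { zero _ → refl ; (suc i) () } }

  module _ {X : Set} (R : X → X → Set) (Matchable : ∀ {N} → (Fin N → X) → Set)
    (partner : ∀ {N} (f : Fin (suc (suc N)) → X) → Matchable f → ∃ λ j → R (f zero) (f (suc j)))
    (remove : ∀ {N} (f : Fin (suc (suc N)) → X) j → Matchable f → R (f zero) (f (suc j)) →
              Matchable (λ i → f (suc (punchIn j i)))) where

    match : ∀ d {N} → N ≡ d ℕ.+ d → (f : Fin N → X) → Matchable f → Pairing d (λ i j → R (f i) (f j))
    match zero    {zero}        N≡2d f matchable = record
      { left = λ () ; right = λ () ; side = λ () ; side-left = λ () ; side-right = λ () ; at-side = λ ()
      ; related = λ () ; left-zero = λ () }
    match (suc d) {suc zero}    N≡2d f matchable =
      ⊥-elim (ℕ.1+n≢0 (sym (trans (ℕ.suc-injective N≡2d) (ℕ.+-suc d d))))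
    match (suc d) {suc (suc N)} N≡2d f matchable with partner f matchable
    ... | j , 0Rj = extend-pairing j 0Rj
      (match d (ℕ.suc-injective (trans (ℕ.suc-injective N≡2d) (ℕ.+-suc d d))) _ (remove f j matchable 0Rj))

module UnitPairing where

  open import Data.Fin.Base using (Fin; zero; suc; toℕ; punchIn)
  open import Data.Fin.Properties using (any?)
  open import Data.Nat.Coprimality using (Coprime; coprime-divisor) renaming (sym to coprime-sym)
  open import Data.Nat.DivMod using (m%n<n; m<n⇒m%n≡m; n%1≡0)
  open import Data.Nat.Divisibility using (_∣_; _∣0; ∣⇒≤; m%n≡0⇒n∣m; ∣-refl)
  open import Data.Unit.Base using (⊤; tt)
  open OrderedRationals
  open import Algebra.Properties.CommutativeMonoid.Sum +-0-commutativeMonoid using (sum; sum-remove; sum-cong-≗)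
  open RationalSums using (∑; ∑≡sum; ⟦⟧-yes; ⟦⟧-no; ⟦⟧≥0)
  open Congruences
  open ResidueCharges
  open OddVanishing
  open Matching
  open ≡-Reasoning

  module _ (n : ℕ) {{_ : ℕ.NonZero n}} where

    Opposite : ℕ → ℕ → Set
    Opposite x y = (x ℕ.+ y) % n ≡ 0

    opposite-inverses : ∀ {a α b β} → a ℕ.* α ≡ 1 mod n → b ℕ.* β ≡ 1 mod n → Opposite α β → Opposite a b
    opposite-inverses {a} {α} {b} {β} aα≡1 bβ≡1 α+β≡0 = begin
      (a ℕ.+ b) % n
        ≡⟨ cong (_% n) (sym (trans (ℕ.+-comm (b ℕ.* 1) (a ℕ.* 1))
          (cong₂ ℕ._+_ (ℕ.*-identityʳ a) (ℕ.*-identityʳ b)))) ⟩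
      (b ℕ.* 1 ℕ.+ a ℕ.* 1) % n
        ≡⟨ +-mod n (*-modˡ n b {a ℕ.* α} {1} aα≡1) (*-modˡ n a {b ℕ.* β} {1} bβ≡1) ⟨
      (b ℕ.* (a ℕ.* α) ℕ.+ a ℕ.* (b ℕ.* β)) % n  ≡⟨ cong (_% n) (factor a b α β) ⟩
      (a ℕ.* b ℕ.* (α ℕ.+ β)) % n                ≡⟨ *-zero-mod n (a ℕ.* b) α+β≡0 ⟩
      0                                          ∎
      where
      factor : ∀ a b x y → b ℕ.* (a ℕ.* x) ℕ.+ a ℕ.* (b ℕ.* y) ≡ a ℕ.* b ℕ.* (x ℕ.+ y)
      factor = ℕ-Solver.solve-∀

    Unit : ℕ → Set
    Unit x = x ℕ.< n × Coprime x n

    Neutral : ∀ {N} → (Fin N → ℕ) → Set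
    Neutral f = (∀ m → sum (λ i → charge n (f i) m) ≡ 0ℚ) × (∀ i → Unit (f i))

    module _ (2<n : 2 ℕ.< n) where

      private
        instance
          n-nonTrivial : ℕ.NonTrivial n
          n-nonTrivial = ℕ.n>1⇒nonTrivial (ℕ.<-trans (s≤s (s≤s z≤n)) 2<n)

        unit>0 : ∀ {x} → Unit x → 0 ℕ.< x
        unit>0 {zero}  (_ , 0⊥n) = ⊥-elim (ℕ.<⇒≢ (ℕ.<-trans (s≤s (s≤s z≤n)) 2<n) (sym (0⊥n (n ∣0 , ∣-refl))))
        unit>0 {suc x} _         = s≤s z≤n

        not-self-opposite : ∀ {x} → Unit x → ¬ Opposite x x
        not-self-opposite {x} (_ , x⊥n) x+x≡0 =
          ℕ.<⇒≱ 2<n (∣⇒≤ (coprime-divisor (coprime-sym x⊥n) (subst (n ∣_) (double x) (m%n≡0⇒n∣m (x ℕ.+ x) n x+x≡0))))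
          where
          double : ∀ x → x ℕ.+ x ≡ x ℕ.* 2
          double = ℕ-Solver.solve-∀

        sum-nonNeg : ∀ {N} (f : Fin N → ℚ) → (∀ i → 0ℚ ≤ f i) → 0ℚ ≤ sum f
        sum-nonNeg {zero}  f f≥0 = ≤-refl
        sum-nonNeg {suc N} f f≥0 = +≥0 (f≥0 zero) (sum-nonNeg (f ∘ suc) (f≥0 ∘ suc))

        -- Otherwise every other unit would contribute ≥ 0 to the total charge at x.
        partner : ∀ {N} (f : Fin (suc (suc N)) → ℕ) → Neutral f → ∃ λ j → Opposite (f zero) (f (suc j))
        partner f (neutral , units) with any? (λ j → (f zero ℕ.+ f (suc j)) % n ℕ.≟ 0)
        ... | yes found = found
        ... | no  none  = ⊥-elim (<⇒≱ 0<1 (≤-slack (sum rest) (sum-nonNeg rest rest≥0)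
          (trans (cong (_+ sum rest) (sym own)) (neutral x))))
          where
          x : ℕ
          x = f zero
          own : charge n x x ≡ 1ℚ
          own = cong₂ _-_ (⟦⟧-yes (x % n ℕ.≟ x) (m<n⇒m%n≡m (proj₁ (units zero))))
                          (⟦⟧-no ((x ℕ.+ x) % n ℕ.≟ 0) (not-self-opposite (units zero)))
          rest : Fin _ → ℚ
          rest j = charge n (f (suc j)) x
          rest≥0 : ∀ j → 0ℚ ≤ rest j
          rest≥0 j = subst (λ z → 0ℚ ≤ ⟦x≡fj⟧ - z)
            (sym (⟦⟧-no ((x ℕ.+ f (suc j)) % n ℕ.≟ 0) λ opposite → none (j , opposite)))
            (x≤y⇒0≤y-x (⟦⟧≥0 (x % n ℕ.≟ f (suc j))))
            where
            ⟦x≡fj⟧ : ℚ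
            ⟦x≡fj⟧ = RationalSums.⟦ x % n ℕ.≟ f (suc j) ⟧

        remove : ∀ {N} (f : Fin (suc (suc N)) → ℕ) j → Neutral f → Opposite (f zero) (f (suc j)) →
                 Neutral (λ i → f (suc (punchIn j i)))
        remove f j (neutral , units) opposite = (λ m → begin
          sum (rest m)                  ≡⟨ +-identityˡ (sum (rest m)) ⟨
          0ℚ + sum (rest m)             ≡⟨ cong (_+ sum (rest m)) (cancel m) ⟨
          charge n (f zero) m + charge n (f (suc j)) m + sum (rest m) ≡⟨ +-assoc (charge n (f zero) m) _ _ ⟩
          charge n (f zero) m + (charge n (f (suc j)) m + sum (rest m))
            ≡⟨ cong (charge n (f zero) m +_) (sum-remove {i = j} (λ i → charge n (f (suc i)) m)) ⟨
          sum (λ i → charge n (f i) m)  ≡⟨ neutral m ⟩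
          0ℚ                            ∎) , λ i → units (suc (punchIn j i))
          where
          rest : ℕ → Fin _ → ℚ
          rest m i = charge n (f (suc (punchIn j i))) m
          cancel : ∀ m → charge n (f zero) m + charge n (f (suc j)) m ≡ 0ℚ
          cancel = charge-opposite n (unit>0 (units zero)) (proj₁ (units zero))
            (unit>0 (units (suc j))) (proj₁ (units (suc j))) opposite

      neutral⇒pairing : ∀ d {N} → N ≡ d ℕ.+ d → (f : Fin N → ℕ) → Neutral f → Pairing d (λ i j → Opposite (f i) (f j))
      neutral⇒pairing = match Opposite Neutral partner remove

  -- Extends finite families to sequences.
  clamp : ∀ {N} → ℕ → Fin (suc N)
  clamp {zero}  _       = zero
  clamp {suc N} zero    = zero
  clamp {suc N} (suc i) = suc (clamp i)

  clamp-toℕ : ∀ {N} (i : Fin (suc N)) → clamp (toℕ i) ≡ i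
  clamp-toℕ {zero}  zero    = refl
  clamp-toℕ {suc N} zero    = refl
  clamp-toℕ {suc N} (suc i) = cong suc (clamp-toℕ i)

  private
    odd : ∀ {x} → Coprime x 2 → x % 2 ≡ 1
    odd {x} x⊥2 = remainder (x % 2) refl (m%n<n x 2)
      where
      remainder : ∀ y → x % 2 ≡ y → y ℕ.< 2 → y ≡ 1
      remainder zero          x≡0 _ = ⊥-elim (ℕ.1+n≢n (x⊥2 (m%n≡0⇒n∣m x 2 x≡0 , ∣-refl)))
      remainder 1             _   _ = refl
      remainder (suc (suc _)) _   (s≤s (s≤s ()))

  module _ {N : ℕ} (d : ℕ) (N≡2d : suc N ≡ d ℕ.+ d) (a : Fin (suc N) → ℕ) where

    pairing-mod-1 : Pairing d (λ i j → Opposite 1 (a i) (a j))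
    pairing-mod-1 = match (Opposite 1) (λ _ → ⊤) (λ f _ → zero , n%1≡0 (f zero ℕ.+ f (suc zero)))
      (λ _ _ _ _ → tt) d N≡2d a tt

    pairing-mod-2 : (∀ i → a i % 2 ≡ 1) → Pairing d (λ i j → Opposite 2 (a i) (a j))
    pairing-mod-2 = match (Opposite 2) (λ f → ∀ i → f i % 2 ≡ 1)
      (λ f f-odd → zero , +-mod 2 {f zero} {1} {f (suc zero)} {1} (f-odd zero) (f-odd (suc zero)))
      (λ f j f-odd _ i → f-odd (suc (punchIn j i))) d N≡2d a

    module _ (n : ℕ) {{_ : ℕ.NonZero n}} (2<n : 2 ℕ.< n) (a-coprime : ∀ i → Coprime (a i) n)
      (balance : Balanced n (suc N) (a ∘ clamp)) where

      private
        α : Fin (suc N) → ℕ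
        α i = proj₁ (coprime⇒invertible n (a-coprime i)) % n

        inverse : ∀ i → a i ℕ.* α i ≡ 1 mod n
        inverse i with coprime⇒invertible n (a-coprime i)
        ... | h , ah≡1 = trans (*-modˡ n (a i) {h % n} {h} (%-mod n h)) ah≡1

        1<n : 1 ℕ.< n
        1<n = ℕ.<-trans (s≤s (s≤s z≤n)) 2<n

        0<α : ∀ i → 0 ℕ.< α i
        0<α i = ℕ.n≢0⇒n>0 λ α≡0 → ℕ.1+n≢0 (begin
          1                  ≡⟨ m<n⇒m%n≡m 1<n ⟨
          1 % n              ≡⟨ inverse i ⟨
          (a i ℕ.* α i) % n  ≡⟨ *-zero-mod n (a i) (trans (cong (_% n) α≡0) (0%n≡0 n)) ⟩
          0                  ∎)

        α<n : ∀ i → α i ℕ.< n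
        α<n i = m%n<n _ n

        inverses : Inverses n (a ∘ clamp) (α ∘ clamp)
        inverses = record { inverse = inverse ∘ clamp ; 0<a⁻¹ = 0<α ∘ clamp ; a⁻¹<n = α<n ∘ clamp }

        neutral : Neutral n α
        neutral = (λ m → begin
          sum (λ i → charge n (α i) m)
            ≡⟨ sum-cong-≗ (λ i → cong (λ j → charge n (α j) m) (clamp-toℕ i)) ⟨
          sum {suc N} (λ i → charge n (α (clamp (toℕ i))) m) ≡⟨ ∑≡sum (suc N) (λ i → charge n (α (clamp i)) m) ⟨
          ∑ (suc N) (λ i → charge n (α (clamp i)) m)  ≡⟨ balanced⇒totalCharge≡0 n 1<n (suc N) inverses balance m ⟩
          0ℚ                                          ∎) ,
          λ i → α<n i , invertible⇒coprime n (inverse-comm n (a i) (α i) (inverse i))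

      balanced⇒pairing : Pairing d (λ i j → Opposite n (a i) (a j))
      balanced⇒pairing = map-pairing (λ i j → opposite-inverses n {a i} {α i} {a j} (inverse i) (inverse j))
        (neutral⇒pairing n 2<n d N≡2d α neutral)

  pairing : ∀ n {{_ : ℕ.NonZero n}} d {N} → suc N ≡ d ℕ.+ d → (a : Fin (suc N) → ℕ) → (∀ i → Coprime (a i) n) →
            Balanced n (suc N) (a ∘ clamp) → Pairing d (λ i j → Opposite n (a i) (a j))
  pairing 1                     d N≡2d a a-coprime balance = pairing-mod-1 d N≡2d a
  pairing 2                     d N≡2d a a-coprime balance = pairing-mod-2 d N≡2d a (odd ∘ a-coprime)
  pairing n@(suc (suc (suc _))) d N≡2d a a-coprime balance = balanced⇒pairing d N≡2d a n
    (s≤s (s≤s (s≤s z≤n))) a-coprime balance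

module FiniteSums where

  open import Algebra.Bundles using (CommutativeRing)
  open import Data.Fin.Base using (Fin; zero; suc; punchIn; inject₁; fromℕ; _↑ˡ_; _↑ʳ_)
  open import Data.Fin.Permutation using (Permutation; _⟨$⟩ʳ_)
  open import Data.Fin.Properties using (punchInᵢ≢i)
  import Data.Integer.Properties as ℤ
  import Data.Rational.Properties as ℚ
  open import Defs using (sumℤ; sumℚ)

  module _ (R : CommutativeRing 0ℓ 0ℓ) where
    open CommutativeRing R using (Carrier; 0#; _+_)

    -- Transfers the library's finite sums to the sums of the statement.
    module FiniteSum (S : ∀ {n} → (Fin n → Carrier) → Carrier) (S-empty : ∀ (f : Fin 0 → Carrier) → S f ≡ 0#)
      (S-suc : ∀ {n} (f : Fin (suc n) → Carrier) → S f ≡ f zero + S (f ∘ suc)) where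

      open CommutativeRing R hiding (zero; Carrier; 0#; _+_)
        renaming (refl to ≈-refl; sym to ≈-sym; trans to ≈-trans)
      open import Algebra.Properties.CommutativeMonoid.Sum +-commutativeMonoid
        using (sum; sum-cong-≋; ∑-distrib-+; ∑-comm; sum-remove; sum-permute; sum-init-last; sum-replicate-zero)
      open import Algebra.Properties.CommutativeSemigroup *-commutativeSemigroup using (x∙yz≈y∙xz)
      open import Algebra.Properties.Group +-group using (//-rightDividesˡ; //-rightDividesʳ)
      open import Algebra.Properties.Semiring.Sum semiring using (*-distribˡ-sum; *-distribʳ-sum)
      open import Relation.Binary.Reasoning.Setoid setoid

      private
        S≡sum : ∀ {n} (f : Fin n → Carrier) → S f ≡ sum f
        S≡sum {zero}  f = S-empty f
        S≡sum {suc n} f = trans (S-suc f) (cong (f zero +_) (S≡sum (f ∘ suc)))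

        S≈sum : ∀ {n} (f : Fin n → Carrier) → S f ≈ sum f
        S≈sum f = reflexive (S≡sum f)

      sum-cong : ∀ {n} {f g : Fin n → Carrier} → (∀ i → f i ≈ g i) → S f ≈ S g
      sum-cong {f = f} {g} f≈g = ≈-trans (S≈sum f) (≈-trans (sum-cong-≋ f≈g) (≈-sym (S≈sum g)))

      sum-+ : ∀ {n} (f g : Fin n → Carrier) → S (λ i → f i + g i) ≈ S f + S g
      sum-+ f g = ≈-trans (S≈sum _) (≈-trans (∑-distrib-+ f g) (≈-sym (+-cong (S≈sum f) (S≈sum g))))

      sum-sub : ∀ {n} (f g : Fin n → Carrier) → S (λ i → f i - g i) ≈ S f - S g
      sum-sub f g = begin
        S (λ i → f i - g i)              ≈⟨ //-rightDividesʳ (S g) _ ⟨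
        S (λ i → f i - g i) + S g - S g  ≈⟨ +-congʳ (sum-+ (λ i → f i - g i) g) ⟨
        S (λ i → f i - g i + g i) - S g  ≈⟨ +-congʳ (sum-cong λ i → //-rightDividesˡ (g i) (f i)) ⟩
        S f - S g                        ∎

      sum-*ˡ : ∀ {n} x (f : Fin n → Carrier) → x * S f ≈ S (λ i → x * f i)
      sum-*ˡ x f = ≈-trans (*-congˡ (S≈sum f)) (≈-trans (*-distribˡ-sum x f) (≈-sym (S≈sum _)))

      sum-*ʳ : ∀ {n} x (f : Fin n → Carrier) → S f * x ≈ S (λ i → f i * x)
      sum-*ʳ x f = ≈-trans (*-congʳ (S≈sum f)) (≈-trans (*-distribʳ-sum x f) (≈-sym (S≈sum _)))

      sum-comm : ∀ {m n} (f : Fin m → Fin n → Carrier) → S (λ i → S (λ j → f i j)) ≈ S (λ j → S (λ i → f i j))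
      sum-comm f = begin
        S (λ i → S (λ j → f i j))      ≈⟨ sum-cong (λ i → S≈sum _) ⟩
        S (λ i → sum (λ j → f i j))    ≈⟨ S≈sum _ ⟩
        sum (λ i → sum (λ j → f i j))  ≈⟨ ∑-comm f ⟩
        sum (λ j → sum (λ i → f i j))  ≈⟨ S≈sum _ ⟨
        S (λ j → sum (λ i → f i j))    ≈⟨ sum-cong (λ j → S≈sum _) ⟨
        S (λ j → S (λ i → f i j))      ∎

      sum-remove-at : ∀ {n} (j : Fin (suc n)) f → S f ≈ f j + S (f ∘ punchIn j)
      sum-remove-at j f = ≈-trans (S≈sum f) (≈-trans (sum-remove {i = j} f) (+-congˡ (≈-sym (S≈sum _))))

      sum-permutation : ∀ {m n} (f : Fin n → Carrier) (π : Permutation m n) → S f ≈ S (λ i → f (π ⟨$⟩ʳ i))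
      sum-permutation f π = ≈-trans (S≈sum f) (≈-trans (sum-permute f π) (≈-sym (S≈sum _)))

      sum-last : ∀ {n} (f : Fin (suc n) → Carrier) → S f ≈ S (f ∘ inject₁) + f (fromℕ n)
      sum-last f = ≈-trans (S≈sum f) (≈-trans (sum-init-last f) (+-congʳ (≈-sym (S≈sum _))))

      sum-zero : ∀ {n} {f : Fin n → Carrier} → (∀ i → f i ≈ 0#) → S f ≈ 0#
      sum-zero {n} f≈0 = ≈-trans (sum-cong f≈0) (≈-trans (S≈sum _) (sum-replicate-zero n))

      sum-single : ∀ {n} (j : Fin n) {f : Fin n → Carrier} → (∀ i → i ≢ j → f i ≈ 0#) → S f ≈ f j
      sum-single {suc n} j {f} f≈0 = ≈-trans (sum-remove-at j f)
        (≈-trans (+-congˡ (sum-zero λ i → f≈0 (punchIn j i) (punchInᵢ≢i j i))) (+-identityʳ (f j)))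

      sum-++ : ∀ m {n} (f : Fin (m ℕ.+ n) → Carrier) → S f ≈ S (λ i → f (i ↑ˡ n)) + S (λ j → f (m ↑ʳ j))
      sum-++ zero    f = ≈-trans (≈-sym (+-identityˡ (S f))) (+-congʳ (reflexive (sym (S-empty _))))
      sum-++ (suc m) {n} f = begin
        S f                                                                 ≡⟨ S-suc f ⟩
        f zero + S (f ∘ suc)                                                ≈⟨ +-congˡ (sum-++ m (f ∘ suc)) ⟩
        f zero + (S (λ i → f (suc (i ↑ˡ n))) + S (λ j → f (suc (m ↑ʳ j))))  ≈⟨ +-assoc _ _ _ ⟨
        f zero + S (λ i → f (suc (i ↑ˡ n))) + S (λ j → f (suc (m ↑ʳ j)))
          ≡⟨ cong (_+ S (λ j → f (suc m ↑ʳ j))) (S-suc (λ i → f (i ↑ˡ n))) ⟨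
        S (λ i → f (i ↑ˡ n)) + S (λ j → f (suc m ↑ʳ j))                     ∎

      sum-bilinear : ∀ {m n} (x : Fin m → Carrier) (y : Fin n → Carrier) (p : Fin m → Fin n → Carrier) →
                     S (λ i → x i * S (λ j → y j * p i j)) ≈ S (λ j → y j * S (λ i → x i * p i j))
      sum-bilinear x y p = begin
        S (λ i → x i * S (λ j → y j * p i j))    ≈⟨ sum-cong (λ i → sum-*ˡ (x i) _) ⟩
        S (λ i → S (λ j → x i * (y j * p i j)))  ≈⟨ sum-comm _ ⟩
        S (λ j → S (λ i → x i * (y j * p i j)))  ≈⟨ sum-cong (λ j → sum-cong λ i → x∙yz≈y∙xz (x i) (y j) (p i j)) ⟩
        S (λ j → S (λ i → y j * (x i * p i j)))  ≈⟨ sum-cong (λ j → sum-*ˡ (y j) _) ⟨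
        S (λ j → y j * S (λ i → x i * p i j))    ∎

      sum-affine : ∀ {m n} (c : Carrier) (y : Fin n → Carrier) (x t : Fin m → Carrier) (p : Fin m → Fin n → Carrier) →
                   S (λ i → x i * (c * t i + S (λ j → y j * p i j))) ≈
                   c * S (λ i → x i * t i) + S (λ j → y j * S (λ i → x i * p i j))
      sum-affine c y x t p = begin
        S (λ i → x i * (c * t i + S (λ j → y j * p i j)))
          ≈⟨ sum-cong (λ i → ≈-trans (distribˡ (x i) _ _) (+-congʳ (x∙yz≈y∙xz (x i) c (t i)))) ⟩
        S (λ i → c * (x i * t i) + x i * S (λ j → y j * p i j))
          ≈⟨ sum-+ _ _ ⟩
        S (λ i → c * (x i * t i)) + S (λ i → x i * S (λ j → y j * p i j))
          ≈⟨ +-cong (≈-sym (sum-*ˡ c _)) (sum-bilinear x y p) ⟩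
        c * S (λ i → x i * t i) + S (λ j → y j * S (λ i → x i * p i j)) ∎

  module Sumℤ = FiniteSum ℤ.+-*-commutativeRing sumℤ (λ _ → refl) (λ _ → refl)
  module Sumℚ = FiniteSum ℚ.+-*-commutativeRing sumℚ (λ _ → refl) (λ _ → refl)

module LatticePoints where

  open import Data.Fin.Base using (Fin; zero; suc)
  open import Data.Integer.Base as ℤ using (ℤ; +_)
  import Data.Integer.Properties as ℤ
  import Data.Integer.Tactic.RingSolver as ℤ-Solver
  open import Data.Rational
  open import Data.Rational.Properties
  open import Tactic.RingSolver using (solve-∀)
  open import Defs using (ℤ→ℚ; sumℤ; sumℚ; Pt; QPt; combℤ; AffIndep; _≋ℤ_)
  open IntegersInRationals
  open OrderedRationals using (ringℚ)
  open FiniteSums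

  length≤sum : ∀ {n} (f : Fin n → ℤ) → (∀ i → + 1 ℤ.≤ f i) → + n ℤ.≤ sumℤ f
  length≤sum {zero}  f 1≤f = ℤ.≤-refl
  length≤sum {suc n} f 1≤f = ℤ.+-mono-≤ (1≤f zero) (length≤sum (f ∘ suc) (1≤f ∘ suc))

  sumℤ-const : ∀ {n} x → sumℤ {n} (λ _ → x) ≡ + n ℤ.* x
  sumℤ-const {zero}  x = sym (ℤ.*-zeroˡ x)
  sumℤ-const {suc n} x = trans (cong (λ z → x ℤ.+ z) (sumℤ-const {n} x)) (sym (ℤ.suc-* (+ n) x))

  ℤ→ℚ-sum : ∀ {n} (f : Fin n → ℤ) → ℤ→ℚ (sumℤ f) ≡ sumℚ (ℤ→ℚ ∘ f)
  ℤ→ℚ-sum {zero}  f = refl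
  ℤ→ℚ-sum {suc n} f = trans (ℤ→ℚ-+ (f zero) (sumℤ (f ∘ suc))) (cong (λ z → ℤ→ℚ (f zero) + z) (ℤ→ℚ-sum (f ∘ suc)))

  ℤ→ℚ-dot : ∀ {n} (f g : Fin n → ℤ) → ℤ→ℚ (sumℤ λ i → f i ℤ.* g i) ≡ sumℚ (λ i → ℤ→ℚ (f i) * ℤ→ℚ (g i))
  ℤ→ℚ-dot f g = trans (ℤ→ℚ-sum λ i → f i ℤ.* g i) (Sumℚ.sum-cong λ i → ℤ→ℚ-* (f i) (g i))

  AffIndep⇒ℤ : ∀ {n m} {p : Fin n → Pt m} → AffIndep p → (c : Fin n → ℤ) → sumℤ c ≡ + 0 →
               (∀ s → combℤ c p s ≡ + 0) → ∀ i → c i ≡ + 0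
  AffIndep⇒ℤ {p = p} indep c sum≡0 comb≡0 i = ℤ→ℚ-injective (indep (ℤ→ℚ ∘ c)
    (trans (sym (ℤ→ℚ-sum c)) (cong ℤ→ℚ sum≡0))
    (λ s → trans (sym (ℤ→ℚ-dot c (λ i → p i s))) (cong ℤ→ℚ (comb≡0 s))) i)

  AffIndep⇒comb-injective : ∀ {n m} {p : Fin n → Pt m} → AffIndep p → (x y : Fin n → ℤ) → sumℤ x ≡ sumℤ y →
                            combℤ x p ≋ℤ combℤ y p → ∀ i → x i ≡ y i
  AffIndep⇒comb-injective {p = p} indep x y sum≡ comb≡ i = ℤ.i-j≡0⇒i≡j (x i) (y i) (AffIndep⇒ℤ indep
    (λ i → x i ℤ.- y i)
    (trans (Sumℤ.sum-sub x y) (ℤ.i≡j⇒i-j≡0 sum≡))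
    (λ s → trans (Sumℤ.sum-cong λ i → distribute (x i) (y i) (p i s))
      (trans (Sumℤ.sum-sub (λ i → x i ℤ.* p i s) (λ i → y i ℤ.* p i s)) (ℤ.i≡j⇒i-j≡0 (comb≡ s)))) i)
    where
    distribute : ∀ a b c → (a ℤ.- b) ℤ.* c ≡ a ℤ.* c ℤ.- b ℤ.* c
    distribute = ℤ-Solver.solve-∀

  record IntegralMultiple {m} (x : QPt m) : Set where
    field
      D-1       : ℕ
      multiple  : Pt m
      multiple≡ : ∀ s → ℤ→ℚ (+ suc D-1) * x s ≡ ℤ→ℚ (multiple s)

  integralMultiple : ∀ {m} (x : QPt m) → IntegralMultiple x
  integralMultiple {zero}  x = record { D-1 = 0 ; multiple = λ () ; multiple≡ = λ () }
  integralMultiple {suc m} x = record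
    { D-1       = ℕ.pred (suc d ℕ.* suc D-1)
    ; multiple  = λ { zero → + suc D-1 ℤ.* ↥ x zero ; (suc s) → + suc d ℤ.* multiple s }
    ; multiple≡ = λ
      { zero → begin
          ℤ→ℚ (+ suc d ℤ.* + suc D-1) * x zero           ≡⟨ cong (_* x zero) (ℤ→ℚ-* (+ suc d) (+ suc D-1)) ⟩
          ℤ→ℚ (+ suc d) * ℤ→ℚ (+ suc D-1) * x zero       ≡⟨ regroup (ℤ→ℚ (+ suc d)) (ℤ→ℚ (+ suc D-1)) (x zero) ⟩
          ℤ→ℚ (+ suc D-1) * (ℤ→ℚ (+ suc d) * x zero)     ≡⟨ cong (ℤ→ℚ (+ suc D-1) *_) (↧p*p≡↥p (x zero)) ⟩
          ℤ→ℚ (+ suc D-1) * ℤ→ℚ (↥ x zero)               ≡⟨ ℤ→ℚ-* (+ suc D-1) (↥ x zero) ⟨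
          ℤ→ℚ (+ suc D-1 ℤ.* ↥ x zero)                   ∎
      ; (suc s) → begin
          ℤ→ℚ (+ suc d ℤ.* + suc D-1) * x (suc s)        ≡⟨ cong (_* x (suc s)) (ℤ→ℚ-* (+ suc d) (+ suc D-1)) ⟩
          ℤ→ℚ (+ suc d) * ℤ→ℚ (+ suc D-1) * x (suc s)    ≡⟨ *-assoc (ℤ→ℚ (+ suc d)) (ℤ→ℚ (+ suc D-1)) (x (suc s)) ⟩
          ℤ→ℚ (+ suc d) * (ℤ→ℚ (+ suc D-1) * x (suc s))  ≡⟨ cong (ℤ→ℚ (+ suc d) *_) (multiple≡ s) ⟩
          ℤ→ℚ (+ suc d) * ℤ→ℚ (multiple s)               ≡⟨ ℤ→ℚ-* (+ suc d) (multiple s) ⟨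
          ℤ→ℚ (+ suc d ℤ.* multiple s)                   ∎ } }
    where
    open ≡-Reasoning
    open IntegralMultiple (integralMultiple (x ∘ suc))
    d : ℕ
    d = ℚ.denominator-1 (x zero)
    regroup : ∀ a b x → a * b * x ≡ b * (a * x)
    regroup = solve-∀ ringℚ

module UnitVectors where

  open import Data.Fin.Base using (Fin)
  open import Data.Fin.Properties using (_≟_)
  open import Data.Integer.Base using (ℤ; +_; _*_)
  open import Data.Integer.Properties using (*-comm; *-zeroʳ; *-identityˡ; *-identityʳ)
  open import Defs
  open FiniteSums
  open Sumℤ
  open LatticePoints using (AffIndep⇒comb-injective)
  open ≡-Reasoning

  unitVec-same : ∀ {r} (i : Fin r) → unitVec i i ≡ + 1
  unitVec-same i with i ≟ i
  ... | yes _  = refl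
  ... | no i≢i = ⊥-elim (i≢i refl)

  unitVec-other : ∀ {r} {i t : Fin r} → i ≢ t → unitVec i t ≡ + 0
  unitVec-other {i = i} {t} i≢t with i ≟ t
  ... | yes i≡t = ⊥-elim (i≢t i≡t)
  ... | no _    = refl

  unitVec-cong : ∀ {r s} (i t : Fin r) (i′ t′ : Fin s) → (i ≡ t → i′ ≡ t′) → (i′ ≡ t′ → i ≡ t) →
    unitVec i t ≡ unitVec i′ t′
  unitVec-cong i t i′ t′ to from with i ≟ t
  ... | yes i≡t = sym (trans (cong (unitVec i′) (sym (to i≡t))) (unitVec-same i′))
  ... | no i≢t  = sym (unitVec-other (i≢t ∘ from))

  sum-*-unitVec : ∀ {n} (f : Fin n → ℤ) j → sumℤ (λ i → f i * unitVec i j) ≡ f j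
  sum-*-unitVec f j = begin
    sumℤ (λ i → f i * unitVec i j)
      ≡⟨ sum-single j (λ i i≢j → trans (cong (f i *_) (unitVec-other i≢j)) (*-zeroʳ (f i))) ⟩
    f j * unitVec j j               ≡⟨ cong (f j *_) (unitVec-same j) ⟩
    f j * + 1                       ≡⟨ *-identityʳ (f j) ⟩
    f j                             ∎

  sum-unitVec : ∀ {n} (j : Fin n) → sumℤ (λ i → unitVec i j) ≡ + 1
  sum-unitVec j = trans (sum-cong λ i → sym (*-identityˡ (unitVec i j))) (sum-*-unitVec (λ _ → + 1) j)

  comb-unitVec : ∀ {n m} (p : Fin n → Pt m) j s → combℤ (λ i → unitVec i j) p s ≡ p j s
  comb-unitVec p j s = trans (sum-cong λ i → *-comm (unitVec i j) (p i s)) (sum-*-unitVec (λ i → p i s) j)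

  AffIndep⇒distinct : ∀ {n m} {p : Fin n → Pt m} → AffIndep p → ∀ {i j} → i ≢ j → ¬ p i ≋ℤ p j
  AffIndep⇒distinct {p = p} indep {i} {j} i≢j pᵢ≋pⱼ = 1≢0 (begin
    + 1          ≡⟨ unitVec-same i ⟨
    unitVec i i  ≡⟨ AffIndep⇒comb-injective indep (λ k → unitVec k i) (λ k → unitVec k j)
                          (trans (sum-unitVec i) (sym (sum-unitVec j)))
                          (λ s → trans (comb-unitVec p i s) (trans (pᵢ≋pⱼ s) (sym (comb-unitVec p j s)))) i ⟩
    unitVec i j  ≡⟨ unitVec-other i≢j ⟩
    + 0          ∎)
    where
    1≢0 : + 1 ≢ + 0
    1≢0 ()

module AffineFrames where

  open import Data.Fin.Base using (Fin; zero; suc; punchIn; punchOut; inject₁; fromℕ)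
  open import Data.Fin.Permutation using (Permutation; permutation; _⟨$⟩ʳ_)
  open import Data.Fin.Properties using (_≟_; any?; ¬∀⟶∃¬; injective⇒≤; punchIn-punchOut; punchOut-injective)
  open import Data.Fin.Relation.Unary.Top using (view; view-fromℕ; view-inject₁; ‵fromℕ; ‵inject₁)
  open import Data.Integer.Base using (ℤ; +_; _+_; _*_; _-_; -_; -1ℤ)
  open import Data.Integer.Properties
    using (+-identityʳ; +-identityˡ; +-inverseʳ; *-comm; *-zeroˡ; *-zeroʳ; *-identityˡ; *-identityʳ;
      i-j≡0⇒i≡j; -1*i≡-i)
  open import Data.Integer.Tactic.RingSolver using (solve-∀)
  open import Function.Definitions using (Injective)
  open import Defs
  open FiniteSums
  open Sumℤ
  open UnitVectors
  open ≡-Reasoning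

  injective⇒surjective : ∀ {k} (f : Fin k → Fin k) → Injective _≡_ _≡_ f → ∀ y → ∃ λ x → f x ≡ y
  injective⇒surjective {suc k} f f-injective y with any? (λ x → f x ≟ y)
  ... | yes found = found
  ... | no missed = ⊥-elim (ℕ.1+n≰n (injective⇒≤ {f = λ x → punchOut (y≢f x)} λ {x} {x′} eq →
    f-injective (punchOut-injective (y≢f x) (y≢f x′) eq)))
    where
    y≢f : ∀ x → y ≢ f x
    y≢f x y≡fx = missed (x , sym y≡fx)

  record MissedIndex {k} (ι : Fin k → Fin (suc k)) : Set where
    field
      missed    : Fin (suc k)
      avoids    : ∀ i → ι i ≢ missed
      sum-split : ∀ (f : Fin (suc k) → ℤ) → sumℤ f ≡ f missed + sumℤ (f ∘ ι)

  missedIndex : ∀ {k} (ι : Fin k → Fin (suc k)) → Injective _≡_ _≡_ ι → MissedIndex ι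
  missedIndex {k} ι ι-injective = record { missed = j ; avoids = λ i ιi≡j → j-missed (i , ιi≡j) ; sum-split = split }
    where
    not-surjective : ¬ (∀ j → ∃ λ i → ι i ≡ j)
    not-surjective preimage = ℕ.1+n≰n (injective⇒≤ {f = proj₁ ∘ preimage} λ {x} {y} eq →
      trans (sym (proj₂ (preimage x))) (trans (cong ι eq) (proj₂ (preimage y))))
    missing : ∃ λ j → ¬ (∃ λ i → ι i ≡ j)
    missing = ¬∀⟶∃¬ (suc k) _ (λ j → any? λ i → ι i ≟ j) not-surjective
    j : Fin (suc k)
    j = proj₁ missing
    j-missed : ¬ (∃ λ i → ι i ≡ j)
    j-missed = proj₂ missing
    j≢ι : ∀ i → j ≢ ι i
    j≢ι i j≡ιi = j-missed (i , sym j≡ιi)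
    f : Fin k → Fin k
    f i = punchOut (j≢ι i)
    f-injective : Injective _≡_ _≡_ f
    f-injective {x} {y} eq = ι-injective (punchOut-injective (j≢ι x) (j≢ι y) eq)
    f⁻¹ : ∀ y → ∃ λ x → f x ≡ y
    f⁻¹ = injective⇒surjective f f-injective
    π : Permutation k k
    π = permutation f (proj₁ ∘ f⁻¹) (proj₂ ∘ f⁻¹) (λ x → f-injective (proj₂ (f⁻¹ (f x))))
    split : ∀ (g : Fin (suc k) → ℤ) → sumℤ g ≡ g j + sumℤ (g ∘ ι)
    split g = begin
      sumℤ g                                       ≡⟨ sum-remove-at j g ⟩
      g j + sumℤ (g ∘ punchIn j)                   ≡⟨ cong (λ z → g j + z) (sum-permutation (g ∘ punchIn j) π) ⟩
      g j + sumℤ (λ i → g (punchIn j (π ⟨$⟩ʳ i)))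
        ≡⟨ cong (λ z → g j + z) (sum-cong λ i → cong g (punchIn-punchOut (j≢ι i))) ⟩
      g j + sumℤ (g ∘ ι)                           ∎

  -- The integral affine functional z ↦ c + Σ ℓ z, homogenised: it takes the value c t + Σ ℓ z at (z, t).
  record Functional (m : ℕ) : Set where
    constructor functional
    field
      const  : ℤ
      linear : Pt m

    _⟨_,_⟩ : Pt m → ℤ → ℤ
    _⟨_,_⟩ z t = const * t + sumℤ (λ s → linear s * z s)

  open Functional public

  combine : ∀ {m n} → (Fin n → ℤ) → (Fin n → Functional m) → Functional m
  combine x f = functional (sumℤ λ i → x i * const (f i)) (λ s → sumℤ λ i → x i * linear (f i) s)

  combine-value : ∀ {m n} (x : Fin n → ℤ) (f : Fin n → Functional m) z t →
                  combine x f ⟨ z , t ⟩ ≡ sumℤ (λ i → x i * (f i ⟨ z , t ⟩))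
  combine-value x f z t = sym (begin
    sumℤ (λ i → x i * (const (f i) * t + sumℤ (λ s → linear (f i) s * z s)))
      ≡⟨ sum-cong (λ i → cong (x i *_) (cong₂ _+_ (*-comm (const (f i)) t)
        (sum-cong λ s → *-comm (linear (f i) s) (z s)))) ⟩
    sumℤ (λ i → x i * (t * const (f i) + sumℤ (λ s → z s * linear (f i) s)))
      ≡⟨ sum-affine t z x (const ∘ f) (linear ∘ f) ⟩
    t * sumℤ (λ i → x i * const (f i)) + sumℤ (λ s → z s * sumℤ (λ i → x i * linear (f i) s))
      ≡⟨ cong₂ _+_ (*-comm t _) (sum-cong λ s → *-comm (z s) _) ⟩
    combine x f ⟨ z , t ⟩ ∎)

  value-scale : ∀ {m} (f : Functional m) c z t → f ⟨ (λ s → c * z s) , c * t ⟩ ≡ c * (f ⟨ z , t ⟩)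
  value-scale f c z t = begin
    const f * (c * t) + sumℤ (λ s → linear f s * (c * z s))
      ≡⟨ cong₂ _+_ (swap (const f) c t) (trans (sum-cong λ s → swap (linear f s) c (z s))
        (sym (sum-*ˡ c λ s → linear f s * z s))) ⟩
    c * (const f * t) + c * sumℤ (λ s → linear f s * z s)
      ≡⟨ factor c (const f * t) _ ⟩
    c * (f ⟨ z , t ⟩) ∎
    where
    swap : ∀ a b x → a * (b * x) ≡ b * (a * x)
    swap = solve-∀
    factor : ∀ c a b → c * a + c * b ≡ c * (a + b)
    factor = solve-∀

  module LatticeBasis {m} (b : Fin m → Pt m) (basis : IsLatticeBasis b) where

    dual : Fin m → Pt m
    dual x t = proj₁ (proj₁ basis (unitVec t)) x

    basisCoord : Fin m → Pt m → ℤ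
    basisCoord x z = sumℤ (λ t → dual x t * z t)

    basisCoord-expand : ∀ z s → sumℤ (λ x → basisCoord x z * b x s) ≡ z s
    basisCoord-expand z s = begin
      sumℤ (λ x → basisCoord x z * b x s)
        ≡⟨ sum-cong (λ x → trans (*-comm (basisCoord x z) (b x s))
          (cong (b x s *_) (sum-cong λ t → *-comm (dual x t) (z t)))) ⟩
      sumℤ (λ x → b x s * sumℤ (λ t → z t * dual x t))
        ≡⟨ sum-bilinear (λ x → b x s) z dual ⟩
      sumℤ (λ t → z t * sumℤ (λ x → b x s * dual x t))
        ≡⟨ sum-cong (λ t → cong (z t *_) (trans (sum-cong λ x → *-comm (b x s) (dual x t))
          (proj₂ (proj₁ basis (unitVec t)) s))) ⟩
      sumℤ (λ t → z t * unitVec t s)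
        ≡⟨ sum-*-unitVec z s ⟩
      z s ∎

    basisCoord-basis : ∀ x y → basisCoord x (b y) ≡ unitVec y x
    basisCoord-basis x y = i-j≡0⇒i≡j (basisCoord x (b y)) (unitVec y x)
      (proj₂ basis (λ x → basisCoord x (b y) - unitVec y x) (λ s → begin
        sumℤ (λ x → (basisCoord x (b y) - unitVec y x) * b x s)
          ≡⟨ sum-cong (λ x → distribute (basisCoord x (b y)) (unitVec y x) (b x s)) ⟩
        sumℤ (λ x → basisCoord x (b y) * b x s - b x s * unitVec y x)
          ≡⟨ sum-sub (λ x → basisCoord x (b y) * b x s) (λ x → b x s * unitVec y x) ⟩
        sumℤ (λ x → basisCoord x (b y) * b x s) - sumℤ (λ x → b x s * unitVec y x)
          ≡⟨ cong₂ _-_ (basisCoord-expand (b y) s)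
               (trans (sum-cong λ x → cong (b x s *_) (unitVec-cong y x x y sym sym))
                 (sum-*-unitVec (λ x → b x s) y)) ⟩
        b y s - b y s
          ≡⟨ +-inverseʳ (b y s) ⟩
        + 0 ∎) x)
      where
      distribute : ∀ a u c → (a - u) * c ≡ a * c - c * u
      distribute = solve-∀

    basisCoord-affine : ∀ {n} x (z : Pt m) (c : Fin n → ℤ) p y q → (∀ s → z s ≡ combℤ c p s + y * q s) →
                        basisCoord x z ≡ sumℤ (λ i → c i * basisCoord x (p i)) + y * basisCoord x q
    basisCoord-affine x z c p y q z≡ = begin
      sumℤ (λ t → dual x t * z t)
        ≡⟨ sum-cong (λ t → trans (cong (dual x t *_) (z≡ t)) (distribute (dual x t) (combℤ c p t) y (q t))) ⟩
      sumℤ (λ t → dual x t * combℤ c p t + y * (dual x t * q t))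
        ≡⟨ sum-+ (λ t → dual x t * combℤ c p t) (λ t → y * (dual x t * q t)) ⟩
      sumℤ (λ t → dual x t * combℤ c p t) + sumℤ (λ t → y * (dual x t * q t))
        ≡⟨ cong₂ _+_ (sym (sum-bilinear c (dual x) p)) (sym (sum-*ˡ y λ t → dual x t * q t)) ⟩
      sumℤ (λ i → c i * basisCoord x (p i)) + y * basisCoord x q ∎
      where
      distribute : ∀ b u y q → b * (u + y * q) ≡ b * u + y * (b * q)
      distribute = solve-∀

  record AffineFrame {k} (w : Fin (suc k) → Pt (suc k)) : Set where
    field
      normal    : Pt (suc k)
      coord     : Fin (suc k) → Functional (suc k)
      height    : Functional (suc k)
      coord-sum : ∀ z t → sumℤ (λ l → coord l ⟨ z , t ⟩) ≡ t
      expand    : ∀ z t s → combℤ (λ l → coord l ⟨ z , t ⟩) w s + (height ⟨ z , t ⟩) * normal s ≡ z s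
      unique    : ∀ z t x y → sumℤ x ≡ t → (∀ s → combℤ x w s + y * normal s ≡ z s) →
                  (∀ l → coord l ⟨ z , t ⟩ ≡ x l) × height ⟨ z , t ⟩ ≡ y

  private
    snoc : ∀ {A : Set} {k} → (Fin k → A) → A → Fin (suc k) → A
    snoc f x l with view l
    ... | ‵fromℕ     = x
    ... | ‵inject₁ i = f i

    snoc-inject₁ : ∀ {A : Set} {k} (f : Fin k → A) x i → snoc f x (inject₁ i) ≡ f i
    snoc-inject₁ f x i rewrite view-inject₁ i = refl

    snoc-fromℕ : ∀ {A : Set} {k} (f : Fin k → A) x → snoc f x (fromℕ k) ≡ x
    snoc-fromℕ {k = k} f x rewrite view-fromℕ k = refl

  -- The edge vectors wᵢ - p of a basic facet, p its last vertex, extend by one vector b j to a lattice basis.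
  module _ {k} (w : Fin (suc k) → Pt (suc k)) (basic : IsBasic w) where

    private
      m : ℕ
      m = suc k

      b : Fin m → Pt m
      b = proj₁ (proj₂ basic)

      ι : Fin k → Fin m
      ι = proj₁ (proj₂ (proj₂ basic))

      ι-injective : Injective _≡_ _≡_ ι
      ι-injective = proj₁ (proj₂ (proj₂ (proj₂ basic)))

      edge≡ : ∀ i → b (ι i) ≡ λ s → w (inject₁ i) s - w (fromℕ k) s
      edge≡ = proj₂ (proj₂ (proj₂ (proj₂ (proj₂ basic))))

      open LatticeBasis b (proj₁ (proj₂ (proj₂ (proj₂ (proj₂ basic)))))
      open MissedIndex (missedIndex ι ι-injective) renaming (missed to j)

      p : Pt m
      p = w (fromℕ k)

      shift : Pt m → ℤ → Pt m
      shift z t s = z s - t * p s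

      edgeComb : (Fin m → ℤ) → Pt m
      edgeComb x = combℤ (x ∘ inject₁) (b ∘ ι)

      centred : Fin m → Functional m
      centred x = functional (- basisCoord x p) (dual x)

      centred-value : ∀ x z t → centred x ⟨ z , t ⟩ ≡ basisCoord x (shift z t)
      centred-value x z t = sym (begin
        sumℤ (λ s → dual x s * (z s - t * p s))
          ≡⟨ sum-cong (λ s → distribute (dual x s) (z s) t (p s)) ⟩
        sumℤ (λ s → dual x s * z s - t * (dual x s * p s))
          ≡⟨ sum-sub (λ s → dual x s * z s) (λ s → t * (dual x s * p s)) ⟩
        basisCoord x z - sumℤ (λ s → t * (dual x s * p s))
          ≡⟨ cong (λ v → basisCoord x z - v) (sum-*ˡ t λ s → dual x s * p s) ⟨
        basisCoord x z - t * basisCoord x p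
          ≡⟨ swap (basisCoord x z) t (basisCoord x p) ⟩
        centred x ⟨ z , t ⟩ ∎)
        where
        distribute : ∀ d z t p → d * (z - t * p) ≡ d * z - t * (d * p)
        distribute = solve-∀
        swap : ∀ a t b → a - t * b ≡ - b * t + a
        swap = solve-∀

      edgeCoordSum : Pt m → ℤ → ℤ
      edgeCoordSum z t = sumℤ (λ i → centred (ι i) ⟨ z , t ⟩)

      sign : Fin (suc k) → ℤ
      sign zero    = + 1
      sign (suc _) = -1ℤ

      summand : Fin (suc k) → Functional m
      summand zero    = functional (+ 1) (λ _ → + 0)
      summand (suc i) = centred (ι i)

      lastCoord : Functional m
      lastCoord = combine sign summand

      lastCoord-value : ∀ z t → lastCoord ⟨ z , t ⟩ ≡ t - edgeCoordSum z t
      lastCoord-value z t = trans (combine-value sign summand z t) (cong₂ _+_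
        (trans (*-identityˡ _) (trans (cong₂ _+_ (*-identityˡ t) (sum-zero λ s → *-zeroˡ (z s))) (+-identityʳ t)))
        (trans (sym (sum-*ˡ -1ℤ λ i → centred (ι i) ⟨ z , t ⟩)) (-1*i≡-i (edgeCoordSum z t))))

      coord : Fin m → Functional m
      coord = snoc (centred ∘ ι) lastCoord

      coord-inject₁ : ∀ i z t → coord (inject₁ i) ⟨ z , t ⟩ ≡ centred (ι i) ⟨ z , t ⟩
      coord-inject₁ i z t = cong (_⟨ z , t ⟩) (snoc-inject₁ (centred ∘ ι) lastCoord i)

      coord-last : ∀ z t → coord (fromℕ k) ⟨ z , t ⟩ ≡ t - edgeCoordSum z t
      coord-last z t = trans (cong (_⟨ z , t ⟩) (snoc-fromℕ (centred ∘ ι) lastCoord)) (lastCoord-value z t)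

      coord-sum : ∀ z t → sumℤ (λ l → coord l ⟨ z , t ⟩) ≡ t
      coord-sum z t = begin
        sumℤ (λ l → coord l ⟨ z , t ⟩)
          ≡⟨ sum-last (λ l → coord l ⟨ z , t ⟩) ⟩
        sumℤ (λ i → coord (inject₁ i) ⟨ z , t ⟩) + coord (fromℕ k) ⟨ z , t ⟩
          ≡⟨ cong₂ _+_ (sum-cong λ i → coord-inject₁ i z t) (coord-last z t) ⟩
        edgeCoordSum z t + (t - edgeCoordSum z t)
          ≡⟨ cancel (edgeCoordSum z t) t ⟩
        t ∎
        where
        cancel : ∀ a t → a + (t - a) ≡ t
        cancel = solve-∀

      comb-edges : ∀ (x : Fin m → ℤ) s → combℤ x w s ≡ edgeComb x s + sumℤ x * p s
      comb-edges x s = begin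
        combℤ x w s
          ≡⟨ sum-last (λ l → x l * w l s) ⟩
        sumℤ (λ i → x (inject₁ i) * w (inject₁ i) s) + x (fromℕ k) * p s
          ≡⟨ cong (_+ x (fromℕ k) * p s) (trans (sum-cong λ i → split i)
               (trans (sum-+ (λ i → x (inject₁ i) * b (ι i) s) (λ i → x (inject₁ i) * p s))
                 (cong (λ v → edgeComb x s + v) (sym (sum-*ʳ (p s) (x ∘ inject₁)))))) ⟩
        edgeComb x s + sumℤ (x ∘ inject₁) * p s + x (fromℕ k) * p s
          ≡⟨ factor (edgeComb x s) (sumℤ (x ∘ inject₁)) (p s) (x (fromℕ k)) ⟩
        edgeComb x s + (sumℤ (x ∘ inject₁) + x (fromℕ k)) * p s
          ≡⟨ cong (λ v → edgeComb x s + v * p s) (sum-last x) ⟨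
        edgeComb x s + sumℤ x * p s ∎
        where
        factor : ∀ c a p l → c + a * p + l * p ≡ c + (a + l) * p
        factor = solve-∀
        insert : ∀ x w p → x * w ≡ x * (w - p) + x * p
        insert = solve-∀
        split : ∀ i → x (inject₁ i) * w (inject₁ i) s ≡ x (inject₁ i) * b (ι i) s + x (inject₁ i) * p s
        split i = trans (insert (x (inject₁ i)) (w (inject₁ i) s) (p s))
          (cong (λ u → x (inject₁ i) * u s + x (inject₁ i) * p s) (sym (edge≡ i)))

      expand : ∀ z t s → combℤ (λ l → coord l ⟨ z , t ⟩) w s + (centred j ⟨ z , t ⟩) * b j s ≡ z s
      expand z t s = begin
        combℤ (λ l → coord l ⟨ z , t ⟩) w s + (centred j ⟨ z , t ⟩) * b j s
          ≡⟨ cong₂ _+_ (comb-edges (λ l → coord l ⟨ z , t ⟩) s) (cong (_* b j s) (centred-value j z t)) ⟩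
        edgeComb (λ l → coord l ⟨ z , t ⟩) s + sumℤ (λ l → coord l ⟨ z , t ⟩) * p s + c j * b j s
          ≡⟨ cong₂ (λ u v → u + v * p s + c j * b j s)
               (sum-cong λ i → cong (_* b (ι i) s) (trans (coord-inject₁ i z t) (centred-value (ι i) z t)))
                 (coord-sum z t) ⟩
        sumℤ (λ i → c (ι i) * b (ι i) s) + t * p s + c j * b j s
          ≡⟨ rotate (sumℤ λ i → c (ι i) * b (ι i) s) (t * p s) (c j * b j s) ⟩
        c j * b j s + sumℤ (λ i → c (ι i) * b (ι i) s) + t * p s
          ≡⟨ cong (_+ t * p s) (trans (sym (sum-split λ x → c x * b x s)) (basisCoord-expand (shift z t) s)) ⟩
        z s - t * p s + t * p s
          ≡⟨ restore (z s) (t * p s) ⟩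
        z s ∎
        where
        c : Fin m → ℤ
        c x = basisCoord x (shift z t)
        rotate : ∀ a b c → a + b + c ≡ c + a + b
        rotate = solve-∀
        restore : ∀ a b → a - b + b ≡ a
        restore = solve-∀

      module Unique (z : Pt m) (t : ℤ) (x : Fin m → ℤ) (y : ℤ) (sum-x≡t : sumℤ x ≡ t)
        (z≡ : ∀ s → combℤ x w s + y * b j s ≡ z s) where

        shift≡ : ∀ s → shift z t s ≡ edgeComb x s + y * b j s
        shift≡ s = begin
          z s - t * p s                                      ≡⟨ cong (_- t * p s) (z≡ s) ⟨
          combℤ x w s + y * b j s - t * p s
            ≡⟨ cong (λ v → v + y * b j s - t * p s) (comb-edges x s) ⟩
          edgeComb x s + sumℤ x * p s + y * b j s - t * p s
            ≡⟨ cong (λ v → edgeComb x s + v * p s + y * b j s - t * p s) sum-x≡t ⟩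
          edgeComb x s + t * p s + y * b j s - t * p s       ≡⟨ cancel (edgeComb x s) (t * p s) (y * b j s) ⟩
          edgeComb x s + y * b j s                           ∎
          where
          cancel : ∀ c a b → c + a + b - a ≡ c + b
          cancel = solve-∀

        centred≡ : ∀ u → centred u ⟨ z , t ⟩ ≡ sumℤ (λ i → x (inject₁ i) * unitVec (ι i) u) + y * unitVec j u
        centred≡ u = begin
          centred u ⟨ z , t ⟩       ≡⟨ centred-value u z t ⟩
          basisCoord u (shift z t)  ≡⟨ basisCoord-affine u (shift z t) (x ∘ inject₁) (b ∘ ι) y (b j) shift≡ ⟩
          sumℤ (λ i → x (inject₁ i) * basisCoord u (b (ι i))) + y * basisCoord u (b j)
            ≡⟨ cong₂ (λ a c → a + y * c) (sum-cong λ i → cong (x (inject₁ i) *_) (basisCoord-basis u (ι i)))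
              (basisCoord-basis u j) ⟩
          sumℤ (λ i → x (inject₁ i) * unitVec (ι i) u) + y * unitVec j u ∎

        edge-coord : ∀ i → centred (ι i) ⟨ z , t ⟩ ≡ x (inject₁ i)
        edge-coord i = begin
          centred (ι i) ⟨ z , t ⟩
            ≡⟨ centred≡ (ι i) ⟩
          sumℤ (λ i′ → x (inject₁ i′) * unitVec (ι i′) (ι i)) + y * unitVec j (ι i)
            ≡⟨ cong₂ _+_ (trans
                 (sum-cong λ i′ → cong (x (inject₁ i′) *_) (unitVec-cong (ι i′) (ι i) i′ i ι-injective (cong ι)))
                 (sum-*-unitVec (x ∘ inject₁) i))
                 (trans (cong (y *_) (unitVec-other (avoids i ∘ sym))) (*-zeroʳ y)) ⟩
          x (inject₁ i) + + 0
            ≡⟨ +-identityʳ (x (inject₁ i)) ⟩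
          x (inject₁ i) ∎

        height-value : centred j ⟨ z , t ⟩ ≡ y
        height-value = begin
          centred j ⟨ z , t ⟩
            ≡⟨ centred≡ j ⟩
          sumℤ (λ i → x (inject₁ i) * unitVec (ι i) j) + y * unitVec j j
            ≡⟨ cong₂ _+_
                 (sum-zero λ i → trans (cong (x (inject₁ i) *_) (unitVec-other (avoids i))) (*-zeroʳ (x (inject₁ i))))
                 (trans (cong (y *_) (unitVec-same j)) (*-identityʳ y)) ⟩
          + 0 + y
            ≡⟨ +-identityˡ y ⟩
          y ∎

        coord-value : ∀ l → coord l ⟨ z , t ⟩ ≡ x l
        coord-value l with view l
        ... | ‵inject₁ i = edge-coord i
        ... | ‵fromℕ     = begin
          lastCoord ⟨ z , t ⟩                                    ≡⟨ lastCoord-value z t ⟩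
          t - edgeCoordSum z t
            ≡⟨ cong₂ _-_ (trans (sym sum-x≡t) (sum-last x)) (sum-cong edge-coord) ⟩
          sumℤ (x ∘ inject₁) + x (fromℕ k) - sumℤ (x ∘ inject₁)  ≡⟨ cancel (sumℤ (x ∘ inject₁)) (x (fromℕ k)) ⟩
          x (fromℕ k)                                            ∎
          where
          cancel : ∀ a b → a + b - a ≡ b
          cancel = solve-∀

    abstract
      affineFrame : AffineFrame w
      affineFrame = record
        { normal = b j ; coord = coord ; height = centred j ; coord-sum = coord-sum ; expand = expand
        ; unique = λ z t x y sum-x≡t z≡ → let open Unique z t x y sum-x≡t z≡ in coord-value , height-value }

module CyclicQuotients where

  open import Data.Fin.Base using (Fin; zero; suc; punchIn; punchOut)
  open import Data.Fin.Properties using (_≟_; punchIn-punchOut)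
  open import Data.Integer.Base using (ℤ; +_; -[1+_]; _+_; _*_; _-_; -_; -1ℤ)
  open import Data.Integer.Properties
    using (+-identityʳ; +-identityˡ; *-zeroˡ; *-identityˡ; *-identityʳ; *-assoc; -1*i≡-i)
  open import Data.Integer.Tactic.RingSolver using (solve-∀)
  open import Defs
  open FiniteSums
  open Sumℤ
  open LatticePoints using (AffIndep⇒ℤ)
  open AffineFrames
  open ≡-Reasoning

  -- ℤ^m is spanned by the vertices and Γ, and nΓ = Σ aᵢ vᵢ: modulo the vertex lattice, ℤ^m is cyclic of order n.
  record CyclicQuotient {m} (v : Fin (suc m) → Pt m) : Set where
    field
      n-1 : ℕ

    n : ℤ
    n = + suc n-1

    field
      a          : Fin (suc m) → ℤ
      a-zero     : a zero ≡ + 1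
      a-sum      : sumℤ a ≡ + 0
      Γ          : Pt m
      nΓ         : ∀ s → n * Γ s ≡ combℤ a v s
      coord      : Fin (suc m) → Functional m
      height     : Functional m
      coord-zero : ∀ z t → coord zero ⟨ z , t ⟩ ≡ + 0
      coord-sum  : ∀ z t → sumℤ (λ i → coord i ⟨ z , t ⟩) ≡ t
      expand     : ∀ z t s → combℤ (λ i → coord i ⟨ z , t ⟩) v s + (height ⟨ z , t ⟩) * Γ s ≡ z s
      unique     : ∀ z t x y → x zero ≡ + 0 → sumℤ x ≡ t → (∀ s → combℤ x v s + y * Γ s ≡ z s) →
                   (∀ i → coord i ⟨ z , t ⟩ ≡ x i) × height ⟨ z , t ⟩ ≡ y

  private
    nonzero-sign : ∀ h → h ≢ + 0 → ∃₂ λ n-1 ε → h ≡ + suc n-1 * ε × ε * ε ≡ + 1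
    nonzero-sign (+ zero)   h≢0 = ⊥-elim (h≢0 refl)
    nonzero-sign (+ suc n)  h≢0 = n , + 1 , sym (*-identityʳ (+ suc n)) , refl
    nonzero-sign (-[1+ n ]) h≢0 = n , -1ℤ , negate (+ suc n) , refl
      where
      negate : ∀ x → - x ≡ x * - (+ 1)
      negate = solve-∀

  module _ {k} (v : Fin (suc (suc k)) → Pt (suc k)) (indep : AffIndep v) (basic : IsBasic (v ∘ suc)) where

    private
      m : ℕ
      m = suc k

      module F = AffineFrame (affineFrame (v ∘ suc) basic)

      h : ℤ
      h = F.height ⟨ v zero , + 1 ⟩

      a : Fin (suc m) → ℤ
      a zero    = + 1
      a (suc i) = - (F.coord i ⟨ v zero , + 1 ⟩)

      a-sum : sumℤ a ≡ + 0
      a-sum = cong (λ z → + 1 + z) (begin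
        sumℤ (λ i → - (F.coord i ⟨ v zero , + 1 ⟩))    ≡⟨ sum-cong (λ i → -1*i≡-i (F.coord i ⟨ v zero , + 1 ⟩)) ⟨
        sumℤ (λ i → -1ℤ * (F.coord i ⟨ v zero , + 1 ⟩)) ≡⟨ sum-*ˡ -1ℤ (λ i → F.coord i ⟨ v zero , + 1 ⟩) ⟨
        -1ℤ * sumℤ (λ i → F.coord i ⟨ v zero , + 1 ⟩)  ≡⟨ cong (-1ℤ *_) (F.coord-sum (v zero) (+ 1)) ⟩
        -1ℤ                                            ∎)

      h-normal : ∀ s → combℤ a v s ≡ h * F.normal s
      h-normal s = begin
        + 1 * v zero s + sumℤ (λ i → - (F.coord i ⟨ v zero , + 1 ⟩) * v (suc i) s)
          ≡⟨ cong₂ _+_ (*-identityˡ (v zero s)) (trans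
               (sum-cong λ i → negate (F.coord i ⟨ v zero , + 1 ⟩) (v (suc i) s))
               (sym (sum-*ˡ -1ℤ λ i → (F.coord i ⟨ v zero , + 1 ⟩) * v (suc i) s))) ⟩
        v zero s + -1ℤ * base
          ≡⟨ cong (λ x → x + -1ℤ * base) (F.expand (v zero) (+ 1) s) ⟨
        base + h * F.normal s + -1ℤ * base
          ≡⟨ cancel base (h * F.normal s) ⟩
        h * F.normal s ∎
        where
        base : ℤ
        base = combℤ (λ i → F.coord i ⟨ v zero , + 1 ⟩) (v ∘ suc) s
        negate : ∀ x y → - x * y ≡ - (+ 1) * (x * y)
        negate = solve-∀
        cancel : ∀ c h → c + h + - (+ 1) * c ≡ h
        cancel = solve-∀

      h≢0 : h ≢ + 0
      h≢0 h≡0 = 1≢0 (AffIndep⇒ℤ {p = v} indep a a-sum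
        (λ s → trans (h-normal s) (trans (cong (_* F.normal s) h≡0) (*-zeroˡ (F.normal s)))) zero)
        where
        1≢0 : + 1 ≢ + 0
        1≢0 ()

      n-1 : ℕ
      n-1 = proj₁ (nonzero-sign h h≢0)

      ε : ℤ
      ε = proj₁ (proj₂ (nonzero-sign h h≢0))

      h≡nε : h ≡ + suc n-1 * ε
      h≡nε = proj₁ (proj₂ (proj₂ (nonzero-sign h h≢0)))

      ε²≡1 : ε * ε ≡ + 1
      ε²≡1 = proj₂ (proj₂ (proj₂ (nonzero-sign h h≢0)))

      ε*ε* : ∀ x → ε * (ε * x) ≡ x
      ε*ε* x = trans (sym (*-assoc ε ε x)) (trans (cong (_* x) ε²≡1) (*-identityˡ x))

      Γ : Pt m
      Γ s = ε * F.normal s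

      coord : Fin (suc m) → Functional m
      coord zero    = functional (+ 0) (λ _ → + 0)
      coord (suc i) = F.coord i

      height : Functional m
      height = combine {n = 1} (λ _ → ε) (λ _ → F.height)

      coord-zero : ∀ z t → coord zero ⟨ z , t ⟩ ≡ + 0
      coord-zero z t = cong₂ _+_ (*-zeroˡ t) (sum-zero λ s → *-zeroˡ (z s))

      height-value : ∀ z t → height ⟨ z , t ⟩ ≡ ε * (F.height ⟨ z , t ⟩)
      height-value z t = trans (combine-value {n = 1} (λ _ → ε) (λ _ → F.height) z t) (+-identityʳ _)

      height*Γ : ∀ z t s → (height ⟨ z , t ⟩) * Γ s ≡ (F.height ⟨ z , t ⟩) * F.normal s
      height*Γ z t s = trans (cong (_* Γ s) (height-value z t))
        (trans (regroup ε (F.height ⟨ z , t ⟩) (F.normal s)) (ε*ε* ((F.height ⟨ z , t ⟩) * F.normal s)))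
        where
        regroup : ∀ e x y → e * x * (e * y) ≡ e * (e * (x * y))
        regroup = solve-∀

      comb-tail : ∀ x → x zero ≡ + 0 → ∀ s → combℤ x v s ≡ combℤ (x ∘ suc) (v ∘ suc) s
      comb-tail x x₀≡0 s = trans (cong (λ u → u * v zero s + combℤ (x ∘ suc) (v ∘ suc) s) x₀≡0)
        (trans (cong (_+ combℤ (x ∘ suc) (v ∘ suc) s) (*-zeroˡ (v zero s))) (+-identityˡ _))

      unique : ∀ z t x y → x zero ≡ + 0 → sumℤ x ≡ t → (∀ s → combℤ x v s + y * Γ s ≡ z s) →
               (∀ i → coord i ⟨ z , t ⟩ ≡ x i) × height ⟨ z , t ⟩ ≡ y
      unique z t x y x₀≡0 sum-x≡t z≡ =
        (λ { zero → trans (coord-zero z t) (sym x₀≡0) ; (suc i) → proj₁ facet i }) ,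
        trans (height-value z t) (trans (cong (ε *_) (proj₂ facet)) (ε*ε* y))
        where
        regroup : ∀ y e b → e * y * b ≡ y * (e * b)
        regroup = solve-∀
        facet : (∀ i → F.coord i ⟨ z , t ⟩ ≡ x (suc i)) × F.height ⟨ z , t ⟩ ≡ ε * y
        facet = F.unique z t (x ∘ suc) (ε * y)
          (trans (sym (+-identityˡ (sumℤ (x ∘ suc)))) (trans (cong (_+ sumℤ (x ∘ suc)) (sym x₀≡0)) sum-x≡t))
          (λ s → trans (cong₂ _+_ (sym (comb-tail x x₀≡0 s)) (regroup y ε (F.normal s))) (z≡ s))

    cyclicQuotient : CyclicQuotient v
    cyclicQuotient = record
      { n-1 = n-1 ; a = a ; a-zero = refl ; a-sum = a-sum ; Γ = Γ
      ; nΓ = λ s → trans (sym (*-assoc (+ suc n-1) ε (F.normal s)))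
        (trans (cong (_* F.normal s) (sym h≡nε)) (sym (h-normal s)))
      ; coord = coord ; height = height ; coord-zero = coord-zero
      ; coord-sum = λ z t → trans (cong₂ _+_ (coord-zero z t) (F.coord-sum z t)) (+-identityˡ t)
      ; expand = λ z t s → trans (cong₂ _+_ (comb-tail (λ i → coord i ⟨ z , t ⟩) (coord-zero z t) s)
        (height*Γ z t s)) (F.expand z t s)
      ; unique = unique }

  module _ {k} (v : Fin (suc (suc k)) → Pt (suc k)) (basic : ∀ j → IsBasic (v ∘ punchIn j))
    (Q : CyclicQuotient v) where

    open CyclicQuotient Q

    private
      -- If r aⱼ = n c, the lattice vector rΓ - c vⱼ lies in the span of the basic facet j, so its
      -- coordinates r aᵢ / n are integers.
      module Facet (j : Fin (suc (suc k))) (r c : ℤ) (raⱼ≡nc : r * a j ≡ n * c) where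
        module F = AffineFrame (affineFrame (v ∘ punchIn j) (basic j))

        w : Fin (suc k) → Pt (suc k)
        w = v ∘ punchIn j

        z : Pt (suc k)
        z s = r * Γ s - c * v j s

        x : Fin (suc k) → ℤ
        x l = r * a (punchIn j l)

        remove-j : ∀ (f : Fin (suc (suc k)) → ℤ) → sumℤ (f ∘ punchIn j) ≡ sumℤ f - f j
        remove-j f = trans (isolate (f j) (sumℤ (f ∘ punchIn j))) (cong (_- f j) (sym (sum-remove-at j f)))
          where
          isolate : ∀ a b → b ≡ a + b - a
          isolate = solve-∀

        sum-x : sumℤ x ≡ n * - c
        sum-x = begin
          sumℤ (λ l → r * a (punchIn j l))  ≡⟨ remove-j (λ i → r * a i) ⟩
          sumℤ (λ i → r * a i) - r * a j    ≡⟨ cong₂ _-_ (trans (sym (sum-*ˡ r a)) (cong (r *_) a-sum)) raⱼ≡nc ⟩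
          r * + 0 - n * c                   ≡⟨ collect r n c ⟩
          n * - c                           ∎
          where
          collect : ∀ r n c → r * + 0 - n * c ≡ n * - c
          collect = solve-∀

        comb-x : ∀ s → combℤ x w s + + 0 * F.normal s ≡ n * z s
        comb-x s = begin
          combℤ x w s + + 0 * F.normal s                  ≡⟨ cong (λ u → combℤ x w s + u) (*-zeroˡ (F.normal s)) ⟩
          combℤ x w s + + 0                               ≡⟨ +-identityʳ (combℤ x w s) ⟩
          combℤ x w s                                     ≡⟨ remove-j (λ i → r * a i * v i s) ⟩
          sumℤ (λ i → r * a i * v i s) - r * a j * v j s
            ≡⟨ cong₂ _-_ (trans (sum-cong λ i → *-assoc r (a i) (v i s)) (sym (sum-*ˡ r λ i → a i * v i s)))
              (cong (_* v j s) raⱼ≡nc) ⟩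
          r * combℤ a v s - n * c * v j s                 ≡⟨ cong (λ u → r * u - n * c * v j s) (nΓ s) ⟨
          r * (n * Γ s) - n * c * v j s                   ≡⟨ factor r n (Γ s) c (v j s) ⟩
          n * z s                                         ∎
          where
          factor : ∀ r n g c v → r * (n * g) - n * c * v ≡ n * (r * g - c * v)
          factor = solve-∀

        quotient : ∀ l → r * a (punchIn j l) ≡ n * (F.coord l ⟨ z , - c ⟩)
        quotient l = trans (sym (proj₁ (F.unique (λ s → n * z s) (n * - c) x (+ 0) sum-x comb-x) l))
          (value-scale (F.coord l) n z (- c))

    divides-multiplier : ∀ j r c → r * a j ≡ n * c → ∃ λ c′ → r ≡ n * c′
    divides-multiplier j r c raⱼ≡nc with j ≟ zero
    ... | yes refl = c , trans r≡r*a₀ raⱼ≡nc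
      where
      r≡r*a₀ : r ≡ r * a zero
      r≡r*a₀ = trans (sym (*-identityʳ r)) (cong (r *_) (sym a-zero))
    ... | no j≢0   = F.coord l ⟨ z , - c ⟩ , (begin
      r                            ≡⟨ *-identityʳ r ⟨
      r * + 1                      ≡⟨ cong (r *_) a-zero ⟨
      r * a zero                   ≡⟨ cong (λ i → r * a i) (punchIn-punchOut j≢0) ⟨
      r * a (punchIn j l)          ≡⟨ quotient l ⟩
      n * (F.coord l ⟨ z , - c ⟩)  ∎)
      where
      open Facet j r c raⱼ≡nc
      l : Fin (suc k)
      l = punchOut j≢0

module BalancedResidues where

  open import Data.Fin.Base using (Fin; zero; suc; punchIn)
  open import Data.Integer.Base as ℤ using (ℤ; +_; -[1+_]; _+_; _*_; _-_; -_)
  open import Data.Integer.DivMod using (_/ℕ_; _%ℕ_; a≡a%ℕn+[a/ℕn]*n)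
  import Data.Integer.Properties as ℤ
  open import Data.Integer.Tactic.RingSolver using (solve-∀)
  open import Data.Nat.Coprimality using (Coprime)
  open import Data.Nat.Divisibility using (_∣_; divides; m%n≡0⇒n∣m)
  open import Data.Nat.DivMod using (m≡m%n+[m/n]*n; m*n%n≡0; m%n<n)
  import Data.Rational as ℚ
  import Data.Rational.Properties as ℚ
  import Tactic.RingSolver as ℚ-Solver
  open import Defs
  open IntegersInRationals
  open OrderedRationals using (ringℚ; inv; inv>0; *-inv⁺; *>0)
  open RangeSums using (∑ℕ; ∑ℕ-cong)
  open Congruences
  open OddVanishing using (Balanced)
  open UnitPairing using (clamp; Opposite)
  open FiniteSums
  open Sumℤ
  open LatticePoints
  open CyclicQuotients
  open ≡-Reasoning

  ∑ℕ-clamp : ∀ {N} (f : Fin (suc N) → ℕ) → + ∑ℕ (suc N) (f ∘ clamp) ≡ sumℤ (λ i → + f i)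
  ∑ℕ-clamp {zero}  f = refl
  ∑ℕ-clamp {suc N} f = cong (λ z → + f zero + z) (∑ℕ-clamp (f ∘ suc))

  positive-factor : ∀ {k n T} → + suc k ℤ.≤ + suc n * T → ∃ λ t → T ≡ + suc t
  positive-factor {k} {n} {+ zero}    1+k≤0 = ⊥-elim
    (ℕ.n≮0 (ℤ.drop‿+≤+ (subst (+ suc k ℤ.≤_) (ℤ.*-zeroʳ (+ suc n)) 1+k≤0)))
  positive-factor {T = + suc t}       _     = t , refl
  positive-factor {T = -[1+ t ]}      ()

  module _ {m} (v : Fin (suc m) → Pt m) (n-1 t : ℕ) (f : Fin (suc m) → ℕ) (0<f : ∀ i → 0 ℕ.< f i) (x : Pt m)
    (sum-f : sumℤ (λ i → + f i) ≡ + suc n-1 * + suc t)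
    (comb-f : ∀ s → combℤ (λ i → + f i) v s ≡ + suc n-1 * x s) where

    private
      n k D : ℚ.ℚ
      n = ℤ→ℚ (+ suc n-1)
      k = ℤ→ℚ (+ suc t)
      D = n ℚ.* k

      0<D : ℚ.0ℚ ℚ.< D
      0<D = *>0 (ℤ→ℚ>0 n-1) (ℤ→ℚ>0 t)

      weight : Fin (suc m) → ℚ.ℚ
      weight i = ℤ→ℚ (+ f i) ℚ.* inv D

      weight>0 : ∀ i → ℚ.0ℚ ℚ.< weight i
      weight>0 i = *>0 (ℤ→ℚ-positive (f i) (0<f i)) (inv>0 0<D)
        where
        ℤ→ℚ-positive : ∀ k → 0 ℕ.< k → ℚ.0ℚ ℚ.< ℤ→ℚ (+ k)
        ℤ→ℚ-positive (suc k) _ = ℤ→ℚ>0 k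

      sum-weight : sumℚ weight ≡ ℚ.1ℚ
      sum-weight = begin
        sumℚ weight                          ≡⟨ Sumℚ.sum-*ʳ (inv D) (λ i → ℤ→ℚ (+ f i)) ⟨
        sumℚ (λ i → ℤ→ℚ (+ f i)) ℚ.* inv D   ≡⟨ cong (ℚ._* inv D) (ℤ→ℚ-sum λ i → + f i) ⟨
        ℤ→ℚ (sumℤ λ i → + f i) ℚ.* inv D     ≡⟨ cong (λ z → ℤ→ℚ z ℚ.* inv D) sum-f ⟩
        ℤ→ℚ (+ suc n-1 * + suc t) ℚ.* inv D  ≡⟨ cong (ℚ._* inv D) (ℤ→ℚ-* (+ suc n-1) (+ suc t)) ⟩
        D ℚ.* inv D                          ≡⟨ *-inv⁺ 0<D ⟩
        ℚ.1ℚ                                 ∎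

      comb-weight : ∀ s → k ℚ.* combℚ weight (toQ ∘ v) s ≡ ℤ→ℚ (x s)
      comb-weight s = begin
        k ℚ.* sumℚ (λ i → ℤ→ℚ (+ f i) ℚ.* inv D ℚ.* V i)
          ≡⟨ cong (k ℚ.*_) (trans (Sumℚ.sum-cong λ i → swap (ℤ→ℚ (+ f i)) (inv D) (V i))
               (sym (Sumℚ.sum-*ʳ (inv D) λ i → ℤ→ℚ (+ f i) ℚ.* V i))) ⟩
        k ℚ.* (sumℚ (λ i → ℤ→ℚ (+ f i) ℚ.* V i) ℚ.* inv D)
          ≡⟨ cong (λ z → k ℚ.* (z ℚ.* inv D))
               (trans (sym (ℤ→ℚ-dot (λ i → + f i) (λ i → v i s)))
                 (trans (cong ℤ→ℚ (comb-f s)) (ℤ→ℚ-* (+ suc n-1) (x s)))) ⟩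
        k ℚ.* (n ℚ.* ℤ→ℚ (x s) ℚ.* inv D)
          ≡⟨ regroup k n (ℤ→ℚ (x s)) (inv D) ⟩
        D ℚ.* inv D ℚ.* ℤ→ℚ (x s)
          ≡⟨ trans (cong (ℚ._* ℤ→ℚ (x s)) (*-inv⁺ 0<D)) (ℚ.*-identityˡ (ℤ→ℚ (x s))) ⟩
        ℤ→ℚ (x s) ∎
        where
        V : Fin (suc m) → ℚ.ℚ
        V i = ℤ→ℚ (v i s)
        swap : ∀ f i v → f ℚ.* i ℚ.* v ≡ f ℚ.* v ℚ.* i
        swap = ℚ-Solver.solve-∀ ringℚ
        regroup : ∀ k n x i → k ℚ.* (n ℚ.* x ℚ.* i) ≡ n ℚ.* k ℚ.* i ℚ.* x
        regroup = ℚ-Solver.solve-∀ ringℚ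

    interior-point : InIntMultiple (suc t) v x
    interior-point = weight , weight>0 , sum-weight , comb-weight

  private
    halves : ∀ {d t t′} → d ℕ.≤ t → d ℕ.≤ t′ → t ℕ.+ t′ ≡ d ℕ.+ d → t ≡ d
    halves {d} {t} d≤t d≤t′ t+t′≡2d =
      ℕ.≤-antisym (ℕ.+-cancelʳ-≤ d t d (ℕ.≤-trans (ℕ.+-monoʳ-≤ t d≤t′) (ℕ.≤-reflexive t+t′≡2d))) d≤t

  module Residues (e : ℕ) (v : Fin (suc (suc (e ℕ.+ e))) → Pt (suc (e ℕ.+ e))) (basic : ∀ j → IsBasic (v ∘ punchIn j))
    (Q : CyclicQuotient v) (empty : NoInteriorPoints e v) where

    open CyclicQuotient Q

    modulus : ℕ
    modulus = suc n-1

    private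
      N : ℕ
      N = suc (suc (e ℕ.+ e))

      natural-multiple : ∀ {r c} → + r ≡ n * c → r ≡ modulus ℕ.* ℤ.∣ c ∣
      natural-multiple {c = c} r≡nc = trans (cong ℤ.∣_∣ r≡nc) (ℤ.abs-* n c)

    residue : Fin N → ℕ
    residue i = a i %ℕ modulus

    residue-division : ∀ i → a i ≡ + residue i + (a i /ℕ modulus) * n
    residue-division i = a≡a%ℕn+[a/ℕn]*n (a i) modulus

    opposite-residues : ∀ i j → Opposite modulus (residue i) (residue j) → ∃ λ s → a i + a j ≡ n * s
    opposite-residues i j opposite = multiple (m%n≡0⇒n∣m (residue i ℕ.+ residue j) modulus opposite)
      where
      p q : ℤ
      p = a i /ℕ modulus
      q = a j /ℕ modulus
      regroup : ∀ x y p q n → (x + p * n) + (y + q * n) ≡ (x + y) + (p + q) * n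
      regroup = solve-∀
      factor : ∀ k p q n → k * n + (p + q) * n ≡ n * (k + p + q)
      factor = solve-∀
      multiple : modulus ∣ residue i ℕ.+ residue j → ∃ λ s → a i + a j ≡ n * s
      multiple (divides k sum≡kn) = + k + p + q , (begin
        a i + a j                                      ≡⟨ cong₂ _+_ (residue-division i) (residue-division j) ⟩
        (+ residue i + p * n) + (+ residue j + q * n)  ≡⟨ regroup (+ residue i) (+ residue j) p q n ⟩
        + (residue i ℕ.+ residue j) + (p + q) * n
          ≡⟨ cong (_+ (p + q) * n) (trans (cong +_ sum≡kn) (ℤ.pos-* k modulus)) ⟩
        + k * n + (p + q) * n                          ≡⟨ factor (+ k) p q n ⟩
        n * (+ k + p + q)                              ∎)

    residue-coprime : ∀ i → Coprime (residue i) modulus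
    residue-coprime i {d} (divides w residue≡wd , divides u n≡ud) = d≡1
      (divides-multiplier v basic Q i (+ u) (+ w + + u * q) (begin
      + u * a i
        ≡⟨ cong (+ u *_) (trans (residue-division i)
          (cong (λ z → z + q * n) (trans (cong +_ residue≡wd) (ℤ.pos-* w d)))) ⟩
      + u * (+ w * + d + q * n)        ≡⟨ regroup (+ u) (+ w) (+ d) q n ⟩
      + w * (+ u * + d) + + u * q * n
        ≡⟨ cong (λ z → + w * z + + u * q * n) (trans (sym (ℤ.pos-* u d)) (cong +_ (sym n≡ud))) ⟩
      + w * n + + u * q * n            ≡⟨ factor (+ w) n (+ u * q) ⟩
      n * (+ w + + u * q)              ∎))
      where
      q : ℤ
      q = a i /ℕ modulus
      regroup : ∀ u w d q n → u * (w * d + q * n) ≡ w * (u * d) + u * q * n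
      regroup = solve-∀
      factor : ∀ w n x → w * n + x * n ≡ n * (w + x)
      factor = solve-∀
      u≢0 : u ≢ 0
      u≢0 refl = ℕ.1+n≢0 n≡ud
      d≡1 : (∃ λ c → + u ≡ n * c) → d ≡ 1
      d≡1 (c , u≡nc) = ℕ.m*n≡1⇒m≡1 d ℤ.∣ c ∣ (sym (ℕ.*-cancelˡ-≡ 1 (d ℕ.* ℤ.∣ c ∣) u {{ℕ.≢-nonZero u≢0}} (begin
        u ℕ.* 1                ≡⟨ ℕ.*-identityʳ u ⟩
        u                      ≡⟨ natural-multiple {u} {c} u≡nc ⟩
        modulus ℕ.* ℤ.∣ c ∣    ≡⟨ cong (ℕ._* ℤ.∣ c ∣) n≡ud ⟩
        u ℕ.* d ℕ.* ℤ.∣ c ∣    ≡⟨ ℕ.*-assoc u d ℤ.∣ c ∣ ⟩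
        u ℕ.* (d ℕ.* ℤ.∣ c ∣)  ∎)))

    private
      scaled : ℕ → Fin N → ℕ
      scaled r i = r ℕ.* residue i % modulus

      scaled<n : ∀ r i → scaled r i ℕ.< modulus
      scaled<n r i = m%n<n (r ℕ.* residue i) modulus

      quotient : ℕ → Fin N → ℤ
      quotient r i = + (r ℕ.* residue i ℕ./ modulus) + + r * (a i /ℕ modulus)

      scaled-division : ∀ r i → + r * a i ≡ + scaled r i + n * quotient r i
      scaled-division r i = begin
        + r * a i                          ≡⟨ cong (+ r *_) (residue-division i) ⟩
        + r * (+ residue i + q * n)        ≡⟨ distribute (+ r) (+ residue i) (q * n) ⟩
        + r * + residue i + + r * (q * n)
          ≡⟨ cong (_+ + r * (q * n)) (trans (sym (ℤ.pos-* r (residue i)))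
            (cong +_ (m≡m%n+[m/n]*n (r ℕ.* residue i) modulus))) ⟩
        + scaled r i + + (p ℕ.* modulus) + + r * (q * n)
          ≡⟨ cong (λ z → + scaled r i + z + + r * (q * n)) (ℤ.pos-* p modulus) ⟩
        + scaled r i + + p * n + + r * (q * n) ≡⟨ collect (+ scaled r i) (+ p) n (+ r) q ⟩
        + scaled r i + n * quotient r i    ∎
        where
        p : ℕ
        p = r ℕ.* residue i ℕ./ modulus
        q : ℤ
        q = a i /ℕ modulus
        distribute : ∀ r a b → r * (a + b) ≡ r * a + r * b
        distribute = solve-∀
        collect : ∀ f q n r k → f + q * n + r * (k * n) ≡ f + n * (q + r * k)
        collect = solve-∀

      scaled>0 : ∀ r → r % modulus ≢ 0 → ∀ i → 0 ℕ.< scaled r i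
      scaled>0 r r≢0 i = ℕ.n≢0⇒n>0 λ scaled≡0 →
        r≢0 (multiple (divides-multiplier v basic Q i (+ r) (quotient r i) (begin
        + r * a i                        ≡⟨ scaled-division r i ⟩
        + scaled r i + n * quotient r i  ≡⟨ cong (λ z → + z + n * quotient r i) scaled≡0 ⟩
        + 0 + n * quotient r i           ≡⟨ ℤ.+-identityˡ (n * quotient r i) ⟩
        n * quotient r i                 ∎)))
        where
        multiple : (∃ λ c → + r ≡ n * c) → r % modulus ≡ 0
        multiple (c , r≡nc) = trans
          (cong (_% modulus) (trans (natural-multiple {r} {c} r≡nc) (ℕ.*-comm modulus ℤ.∣ c ∣)))
          (m*n%n≡0 ℤ.∣ c ∣ modulus)

      module _ (r : ℕ) where

        latticePoint : Pt (suc (e ℕ.+ e))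
        latticePoint s = + r * Γ s - combℤ (quotient r) v s

        scaled≡ : ∀ i → + scaled r i ≡ + r * a i - n * quotient r i
        scaled≡ i = trans (isolate (+ scaled r i) (n * quotient r i))
          (cong (_- n * quotient r i) (sym (scaled-division r i)))
          where
          isolate : ∀ f x → f ≡ f + x - x
          isolate = solve-∀

        sum-scaled : sumℤ (λ i → + scaled r i) ≡ n * - sumℤ (quotient r)
        sum-scaled = begin
          sumℤ (λ i → + scaled r i)
            ≡⟨ trans (sum-cong scaled≡) (sum-sub (λ i → + r * a i) (λ i → n * quotient r i)) ⟩
          sumℤ (λ i → + r * a i) - sumℤ (λ i → n * quotient r i)
            ≡⟨ cong₂ _-_ (sum-*ˡ (+ r) a) (sum-*ˡ n (quotient r)) ⟨
          + r * sumℤ a - n * sumℤ (quotient r)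
            ≡⟨ cong (λ z → + r * z - n * sumℤ (quotient r)) a-sum ⟩
          + r * + 0 - n * sumℤ (quotient r)                       ≡⟨ collect (+ r) n (sumℤ (quotient r)) ⟩
          n * - sumℤ (quotient r)                                 ∎
          where
          collect : ∀ r n c → r * + 0 - n * c ≡ n * - c
          collect = solve-∀

        comb-scaled : ∀ s → combℤ (λ i → + scaled r i) v s ≡ n * latticePoint s
        comb-scaled s = begin
          sumℤ (λ i → + scaled r i * v i s)
            ≡⟨ sum-cong (λ i → trans (cong (_* v i s) (scaled≡ i))
              (distribute (+ r) (a i) n (quotient r i) (v i s))) ⟩
          sumℤ (λ i → + r * (a i * v i s) - n * (quotient r i * v i s))
            ≡⟨ sum-sub (λ i → + r * (a i * v i s)) (λ i → n * (quotient r i * v i s)) ⟩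
          sumℤ (λ i → + r * (a i * v i s)) - sumℤ (λ i → n * (quotient r i * v i s))
            ≡⟨ cong₂ _-_ (sum-*ˡ (+ r) λ i → a i * v i s) (sum-*ˡ n λ i → quotient r i * v i s) ⟨
          + r * combℤ a v s - n * combℤ (quotient r) v s
            ≡⟨ cong (λ z → + r * z - n * combℤ (quotient r) v s) (nΓ s) ⟨
          + r * (n * Γ s) - n * combℤ (quotient r) v s
            ≡⟨ factor (+ r) n (Γ s) (combℤ (quotient r) v s) ⟩
          n * latticePoint s ∎
          where
          distribute : ∀ r a n c v → (r * a - n * c) * v ≡ r * (a * v) - n * (c * v)
          distribute = solve-∀
          factor : ∀ r n g c → r * (n * g) - n * c ≡ n * (r * g - c)
          factor = solve-∀

        -- rΓ minus a vertex combination lies in Int(tΔ), where t = Σ (r aᵢ mod n) / n.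
        degree≥d : r % modulus ≢ 0 → ∃ λ t → sumℤ (λ i → + scaled r i) ≡ n * + t × suc e ℕ.≤ t
        degree≥d r≢0 = bound (positive-factor {n = n-1} { - sumℤ (quotient r)}
          (subst (+ N ℤ.≤_) sum-scaled (length≤sum (λ i → + scaled r i) λ i → ℤ.+≤+ (scaled>0 r r≢0 i))))
          where
          bound : (∃ λ t → - sumℤ (quotient r) ≡ + suc t) → ∃ λ t → sumℤ (λ i → + scaled r i) ≡ n * + t × suc e ℕ.≤ t
          bound (t , -sum≡1+t) = suc t , sum≡n[1+t] , ℕ.≰⇒> λ t<d →
            empty (suc t) (s≤s z≤n) t<d latticePoint
              (interior-point v n-1 t (scaled r) (scaled>0 r r≢0) latticePoint sum≡n[1+t] comb-scaled)
            where
            sum≡n[1+t] : sumℤ (λ i → + scaled r i) ≡ n * + suc t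
            sum≡n[1+t] = trans sum-scaled (cong (n *_) -sum≡1+t)

      -r : ℕ → ℕ
      -r r = ℕ.pred modulus ℕ.* r

      scaled-neg : ∀ r → r % modulus ≢ 0 → ∀ i → scaled (-r r) i ≡ modulus ∸ scaled r i
      scaled-neg r r≢0 i = complement⇒ modulus (-r r ℕ.* residue i) (scaled>0 r r≢0 i) (scaled<n r i) (begin
        (-r r ℕ.* residue i ℕ.+ scaled r i) % modulus
          ≡⟨ +-modˡ modulus (-r r ℕ.* residue i) {scaled r i} {r ℕ.* residue i} (%-mod modulus (r ℕ.* residue i)) ⟩
        (-r r ℕ.* residue i ℕ.+ r ℕ.* residue i) % modulus
          ≡⟨ cong (λ z → (z ℕ.+ r ℕ.* residue i) % modulus) (ℕ.*-assoc n-1 r (residue i)) ⟩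
        (n-1 ℕ.* (r ℕ.* residue i) ℕ.+ r ℕ.* residue i) % modulus ≡⟨ pred*+-mod modulus (r ℕ.* residue i) ⟩
        0                                                   ∎)

      neg≢0 : ∀ r → r % modulus ≢ 0 → -r r % modulus ≢ 0
      neg≢0 r r≢0 -r≡0 = r≢0 (trans (sym (+-modʳ modulus r { -r r} {0} -r≡0)) (pred*+-mod modulus r))

      scaled-pair : ∀ r → r % modulus ≢ 0 → sumℤ (λ i → + scaled r i) + sumℤ (λ i → + scaled (-r r) i) ≡ n * + N
      scaled-pair r r≢0 = begin
        sumℤ (λ i → + scaled r i) + sumℤ (λ i → + scaled (-r r) i)
          ≡⟨ sum-+ (λ i → + scaled r i) (λ i → + scaled (-r r) i) ⟨
        sumℤ (λ i → + (scaled r i ℕ.+ scaled (-r r) i))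
          ≡⟨ sum-cong (λ i → cong +_ (trans (cong (scaled r i ℕ.+_) (scaled-neg r r≢0 i))
            (ℕ.m+[n∸m]≡n (ℕ.<⇒≤ (scaled<n r i))))) ⟩
        sumℤ {N} (λ i → n)
          ≡⟨ sumℤ-const {N} n ⟩
        + N * n
          ≡⟨ ℤ.*-comm (+ N) n ⟩
        n * + N ∎

      sum-scaled≡nd : ∀ r → r % modulus ≢ 0 → sumℤ (λ i → + scaled r i) ≡ n * + suc e
      sum-scaled≡nd r r≢0 = pin (degree≥d r r≢0) (degree≥d (-r r) (neg≢0 r r≢0))
        where
        pin : (∃ λ t → sumℤ (λ i → + scaled r i) ≡ n * + t × suc e ℕ.≤ t) →
              (∃ λ t → sumℤ (λ i → + scaled (-r r) i) ≡ n * + t × suc e ℕ.≤ t) →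
                sumℤ (λ i → + scaled r i) ≡ n * + suc e
        pin (t , sum≡nt , d≤t) (t′ , sum≡nt′ , d≤t′) = trans sum≡nt
          (cong (λ z → n * + z) (halves d≤t d≤t′ (trans t+t′≡N (cong suc (sym (ℕ.+-suc e e))))))
          where
          t+t′≡N : t ℕ.+ t′ ≡ N
          t+t′≡N = ℤ.+-injective (ℤ.*-cancelˡ-≡ n (+ (t ℕ.+ t′)) (+ N) (begin
            n * (+ t + + t′)    ≡⟨ ℤ.*-distribˡ-+ n (+ t) (+ t′) ⟩
            n * + t + n * + t′  ≡⟨ cong₂ _+_ sum≡nt sum≡nt′ ⟨
            sumℤ (λ i → + scaled r i) + sumℤ (λ i → + scaled (-r r) i) ≡⟨ scaled-pair r r≢0 ⟩
            n * + N             ∎))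

      sum-scaled-neg : ∀ r → sumℤ (λ i → + scaled r i) ≡ sumℤ (λ i → + scaled (-r r) i)
      sum-scaled-neg r = cases (r % modulus ℕ.≟ 0)
        where
        vanish : ∀ i r → r % modulus ≡ 0 → scaled r i ≡ 0
        vanish i r r≡0 = trans (cong (_% modulus) (ℕ.*-comm r (residue i))) (*-zero-mod modulus (residue i) r≡0)
        cases : Dec (r % modulus ≡ 0) → sumℤ (λ i → + scaled r i) ≡ sumℤ (λ i → + scaled (-r r) i)
        cases (no  r≢0) = trans (sum-scaled≡nd r r≢0) (sym (sum-scaled≡nd (-r r) (neg≢0 r r≢0)))
        cases (yes r≡0) = sum-cong λ i → cong +_
          (trans (vanish i r r≡0) (sym (vanish i (-r r) (*-zero-mod modulus n-1 r≡0))))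

    residue-balanced : Balanced modulus N (residue ∘ clamp)
    residue-balanced r = ℤ.+-injective (begin
      + residueSum modulus N (residue ∘ clamp) r
        ≡⟨ ∑ℕ-clamp (scaled r) ⟩
      sumℤ (λ i → + scaled r i)
        ≡⟨ sum-scaled-neg r ⟩
      sumℤ (λ i → + scaled (-r r) i)
        ≡⟨ ∑ℕ-clamp (scaled (-r r)) ⟨
      + residueSum modulus N (residue ∘ clamp) (-r r)
        ≡⟨ cong +_ (∑ℕ-cong N λ i → cong (_% modulus) (regroup n-1 r (residue (clamp i)))) ⟩
      + residueSum modulus N (negate modulus (residue ∘ clamp)) r ∎)
      where
      regroup : ∀ p r x → p ℕ.* r ℕ.* x ≡ r ℕ.* (p ℕ.* x)
      regroup = ℕ-Solver.solve-∀

module AffineMaps where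

  open import Data.Fin.Base using (Fin; zero; suc; splitAt; join; _↑ˡ_; _↑ʳ_)
  open import Data.Fin.Permutation using (Permutation; _⟨$⟩ʳ_; _⟨$⟩ˡ_; inverseˡ)
  open import Data.Fin.Properties using (join-splitAt)
  open import Data.Integer.Base as ℤ using (ℤ; +_)
  import Data.Integer.Properties as ℤ
  open import Data.Rational
  open import Data.Rational.Properties
  open import Tactic.RingSolver using (solve-∀)
  open import Defs
  open IntegersInRationals
  open OrderedRationals using (ringℚ; inv; *-inv; x∙yz≈y∙xz)
  open FiniteSums
  open Sumℚ
  open LatticePoints
  open AffineFrames using (Functional; functional; _⟨_,_⟩)
  open ≡-Reasoning

  ↑-cases : ∀ m {n} (P : Fin (m ℕ.+ n) → Set) → (∀ i → P (i ↑ˡ n)) → (∀ j → P (m ↑ʳ j)) → ∀ k → P k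
  ↑-cases m {n} P left right k = subst P (join-splitAt m n k) (cases (splitAt m k))
    where
    cases : ∀ x → P (join m n x)
    cases (inj₁ i) = left i
    cases (inj₂ j) = right j

  AffIndep-seg : ∀ {d} {p q : Pt d} → ¬ p ≋ℤ q → AffIndep (seg p q)
  AffIndep-seg {p = p} {q} p≢q w sum≡0 comb≡0 = λ { zero → w₀≡0 ; (suc zero) → trans w₁≡-w₀ (cong -_ w₀≡0) }
    where
    w₀ w₁ : ℚ
    w₀ = w zero
    w₁ = w (suc zero)
    isolate : ∀ a b → b ≡ a + (b + 0ℚ) - a
    isolate = solve-∀ ringℚ
    w₁≡-w₀ : w₁ ≡ - w₀
    w₁≡-w₀ = trans (isolate w₀ w₁) (trans (cong (_- w₀) sum≡0) (+-identityˡ (- w₀)))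
    regroup : ∀ a b i x y → a * i * (x - y) + y ≡ i * (a * x + (b * y + 0ℚ)) - i * (a + (b + 0ℚ)) * y + y
    regroup = solve-∀ ringℚ
    p≡q : w₀ ≢ 0ℚ → ∀ t → ℤ→ℚ (p t) ≡ ℤ→ℚ (q t)
    p≡q w₀≢0 t = begin
      x                        ≡⟨ restore x y ⟩
      1ℚ * (x - y) + y         ≡⟨ cong (λ u → u * (x - y) + y) (*-inv w₀≢0) ⟨
      w₀ * i * (x - y) + y     ≡⟨ regroup w₀ w₁ i x y ⟩
      i * (w₀ * x + (w₁ * y + 0ℚ)) - i * (w₀ + (w₁ + 0ℚ)) * y + y
        ≡⟨ cong₂ (λ u s → i * u - i * s * y + y) (comb≡0 t) sum≡0 ⟩
      i * 0ℚ - i * 0ℚ * y + y  ≡⟨ vanish i y ⟩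
      y                        ∎
      where
      x y i : ℚ
      x = ℤ→ℚ (p t)
      y = ℤ→ℚ (q t)
      i = inv w₀
      restore : ∀ x y → x ≡ 1ℚ * (x - y) + y
      restore = solve-∀ ringℚ
      vanish : ∀ i y → i * 0ℚ - i * 0ℚ * y + y ≡ y
      vanish = solve-∀ ringℚ
    w₀≡0 : w₀ ≡ 0ℚ
    w₀≡0 with w₀ ≟ 0ℚ
    ... | yes w₀≡0 = w₀≡0
    ... | no  w₀≢0 = ⊥-elim (p≢q λ t → ℤ→ℚ-injective (p≡q w₀≢0 t))

  module _ {m M} (φ : AffMap m M) where
    open AffMap φ

    component : Fin M → Functional m
    component t = functional (c t) (A t)

    applyℤ-component : ∀ z t → applyℤ φ z t ≡ component t ⟨ z , + 1 ⟩
    applyℤ-component z t = cong (λ x → x ℤ.+ sumℤ (λ j → A t j ℤ.* z j)) (sym (ℤ.*-identityʳ (c t)))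

    applyℚ-toQ : ∀ z t → applyℚ φ (toQ z) t ≡ ℤ→ℚ (applyℤ φ z t)
    applyℚ-toQ z t = sym (trans (ℤ→ℚ-+ (c t) (sumℤ λ j → A t j ℤ.* z j))
      (cong (λ x → ℤ→ℚ (c t) + x) (ℤ→ℚ-dot (A t) z)))

    applyℚ-cong : ∀ {x y} → x ≋ℚ y → applyℚ φ x ≋ℚ applyℚ φ y
    applyℚ-cong x≋y t = cong (λ x → ℤ→ℚ (c t) + x) (sum-cong λ j → cong (ℤ→ℚ (A t j) *_) (x≋y j))

    applyℚ-multiple : ∀ D {x : QPt m} {z : Pt m} → (∀ s → ℤ→ℚ D * x s ≡ ℤ→ℚ (z s)) →
                      ∀ t → ℤ→ℚ D * applyℚ φ x t ≡ ℤ→ℚ (component t ⟨ z , D ⟩)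
    applyℚ-multiple D {x} {z} Dx≡z t = begin
      ℤ→ℚ D * (ℤ→ℚ (c t) + sumℚ (λ j → ℤ→ℚ (A t j) * x j))
        ≡⟨ *-distribˡ-+ (ℤ→ℚ D) (ℤ→ℚ (c t)) _ ⟩
      ℤ→ℚ D * ℤ→ℚ (c t) + ℤ→ℚ D * sumℚ (λ j → ℤ→ℚ (A t j) * x j)
        ≡⟨ cong₂ _+_ (*-comm (ℤ→ℚ D) (ℤ→ℚ (c t))) (trans (sum-*ˡ (ℤ→ℚ D) λ j → ℤ→ℚ (A t j) * x j)
             (sum-cong λ j → trans (x∙yz≈y∙xz (ℤ→ℚ D) (ℤ→ℚ (A t j)) (x j)) (cong (ℤ→ℚ (A t j) *_) (Dx≡z j)))) ⟩
      ℤ→ℚ (c t) * ℤ→ℚ D + sumℚ (λ j → ℤ→ℚ (A t j) * ℤ→ℚ (z j))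
        ≡⟨ cong₂ _+_ (ℤ→ℚ-* (c t) D) (ℤ→ℚ-dot (A t) z) ⟨
      ℤ→ℚ (c t ℤ.* D) + ℤ→ℚ (sumℤ λ j → A t j ℤ.* z j)
        ≡⟨ ℤ→ℚ-+ (c t ℤ.* D) (sumℤ λ j → A t j ℤ.* z j) ⟨
      ℤ→ℚ (component t ⟨ z , D ⟩) ∎

    applyℚ-comb : ∀ {n} (μ : Fin n → ℚ) (p : Fin n → QPt m) → sumℚ μ ≡ 1ℚ →
      applyℚ φ (combℚ μ p) ≋ℚ combℚ μ (applyℚ φ ∘ p)
    applyℚ-comb μ p sum-μ t = sym (begin
      sumℚ (λ i → μ i * (cₜ + sumℚ (λ j → Aₜ j * p i j)))
        ≡⟨ sum-cong (λ i → cong (λ x → μ i * (x + sumℚ (λ j → Aₜ j * p i j))) (sym (*-identityʳ cₜ))) ⟩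
      sumℚ (λ i → μ i * (cₜ * 1ℚ + sumℚ (λ j → Aₜ j * p i j)))
        ≡⟨ sum-affine cₜ Aₜ μ (λ _ → 1ℚ) p ⟩
      cₜ * sumℚ (λ i → μ i * 1ℚ) + rest
        ≡⟨ cong (λ x → cₜ * x + rest) (trans (sum-cong λ i → *-identityʳ (μ i)) sum-μ) ⟩
      cₜ * 1ℚ + rest
        ≡⟨ cong (_+ rest) (*-identityʳ cₜ) ⟩
      cₜ + rest ∎)
      where
      cₜ rest : ℚ
      cₜ = ℤ→ℚ (c t)
      Aₜ : Fin m → ℚ
      Aₜ j = ℤ→ℚ (A t j)
      rest = sumℚ (λ j → Aₜ j * sumℚ (λ i → μ i * p i j))

    module _ {N K} (v : Fin N → Pt m) (w : Fin K → Pt M) (π : Permutation K N)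
      (w≡φv : ∀ k → w k ≋ℤ applyℤ φ (v (π ⟨$⟩ʳ k))) where

      private
        image : ∀ (μ : Fin N → ℚ) → sumℚ μ ≡ 1ℚ → applyℚ φ (combℚ μ (toQ ∘ v)) ≋ℚ combℚ (λ k → μ (π ⟨$⟩ʳ k)) (toQ ∘ w)
        image μ sum-μ t = begin
          applyℚ φ (combℚ μ (toQ ∘ v)) t
            ≡⟨ applyℚ-comb μ (toQ ∘ v) sum-μ t ⟩
          sumℚ (λ i → μ i * applyℚ φ (toQ (v i)) t)
            ≡⟨ sum-permutation (λ i → μ i * applyℚ φ (toQ (v i)) t) π ⟩
          sumℚ (λ k → μ (π ⟨$⟩ʳ k) * applyℚ φ (toQ (v (π ⟨$⟩ʳ k))) t)
            ≡⟨ sum-cong (λ k → cong (μ (π ⟨$⟩ʳ k) *_)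
              (trans (applyℚ-toQ (v (π ⟨$⟩ʳ k)) t) (cong ℤ→ℚ (sym (w≡φv k t))))) ⟩
          combℚ (λ k → μ (π ⟨$⟩ʳ k)) (toQ ∘ w) t ∎

      mapsOnto-permuted : MapsOnto φ v w
      mapsOnto-permuted y = onto , into
        where
        into : (x : QPt m) → InConv (toQ ∘ v) x → applyℚ φ x ≋ℚ y → InConv (toQ ∘ w) y
        into x (μ , μ≥0 , sum-μ , comb-μ) φx≋y =
          (λ k → μ (π ⟨$⟩ʳ k)) , (λ k → μ≥0 (π ⟨$⟩ʳ k)) , trans (sym (sum-permutation μ π)) sum-μ ,
          λ t → trans (sym (image μ sum-μ t)) (trans (applyℚ-cong comb-μ t) (φx≋y t))
        onto : InConv (toQ ∘ w) y → ∃ λ (x : QPt m) → InConv (toQ ∘ v) x × applyℚ φ x ≋ℚ y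
        onto (ν , ν≥0 , sum-ν , comb-ν) =
          combℚ μ (toQ ∘ v) , (μ , (λ i → ν≥0 (π ⟨$⟩ˡ i)) , sum-μ , λ _ → refl) ,
          λ t → trans (image μ sum-μ t) (trans (sum-cong λ k → cong (_* ℤ→ℚ (w k t)) (μ-π k)) (comb-ν t))
          where
          μ : Fin N → ℚ
          μ i = ν (π ⟨$⟩ˡ i)
          μ-π : ∀ k → μ (π ⟨$⟩ʳ k) ≡ ν k
          μ-π k = cong ν (inverseˡ π)
          sum-μ : sumℚ μ ≡ 1ℚ
          sum-μ = trans (sum-permutation μ π) (trans (sum-cong μ-π) sum-ν)

module PairedIndices where

  open import Data.Fin.Base using (Fin; zero; splitAt; join; _↑ˡ_; _↑ʳ_)
  open import Data.Fin.Permutation using (Permutation; permutation; _⟨$⟩ʳ_)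
  open import Data.Fin.Properties using (splitAt-↑ˡ; splitAt-↑ʳ; join-splitAt; splitAt-join; toℕ-injective)
  open import Data.Integer.Base using (ℤ; _+_)
  open import Data.Sum.Properties using (inj₁-injective; inj₂-injective)
  open import Function.Definitions using (Injective)
  open import Defs
  open Matching
  open FiniteSums
  open Sumℤ
  open ≡-Reasoning

  module _ {N d : ℕ} {R : Fin N → Fin N → Set} (P : Pairing d R) where
    open Pairing P

    private
      to : Fin (d ℕ.+ d) → Fin N
      to k = [ left , right ]′ (splitAt d k)

      from : Fin N → Fin (d ℕ.+ d)
      from i = join d d (side i)

      to-from : ∀ i → to (from i) ≡ i
      to-from i = trans (cong [ left , right ]′ (splitAt-join d d (side i))) (at-side i)

      from-to : ∀ k → from (to k) ≡ k
      from-to k = trans (cong (join d d) (side-at (splitAt d k))) (join-splitAt d d k)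
        where
        side-at : ∀ x → side ([ left , right ]′ x) ≡ x
        side-at (inj₁ i) = side-left i
        side-at (inj₂ i) = side-right i

    arrangement : Permutation (d ℕ.+ d) N
    arrangement = permutation to from to-from from-to

    arrangement-left : ∀ i → arrangement ⟨$⟩ʳ (i ↑ˡ d) ≡ left i
    arrangement-left i = cong [ left , right ]′ (splitAt-↑ˡ d i d)

    arrangement-right : ∀ i → arrangement ⟨$⟩ʳ (d ↑ʳ i) ≡ right i
    arrangement-right i = cong [ left , right ]′ (splitAt-↑ʳ d d i)

    sum-pairs : ∀ (f : Fin N → ℤ) → sumℤ f ≡ sumℤ (λ i → f (left i) + f (right i))
    sum-pairs f = begin
      sumℤ f
        ≡⟨ trans (sum-permutation f arrangement) (sum-++ d (λ k → f (arrangement ⟨$⟩ʳ k))) ⟩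
      sumℤ (λ i → f (arrangement ⟨$⟩ʳ (i ↑ˡ d))) + sumℤ (λ i → f (arrangement ⟨$⟩ʳ (d ↑ʳ i)))
        ≡⟨ cong₂ _+_ (sum-cong λ i → cong f (arrangement-left i)) (sum-cong λ i → cong f (arrangement-right i)) ⟩
      sumℤ (f ∘ left) + sumℤ (f ∘ right)
        ≡⟨ sum-+ (f ∘ left) (f ∘ right) ⟨
      sumℤ (λ i → f (left i) + f (right i)) ∎

    pair-cases : ∀ (S : Fin N → Set) → (∀ i → S (left i)) → (∀ i → S (right i)) → ∀ k → S k
    pair-cases S on-left on-right k = subst S (at-side k) (cases (side k))
      where
      cases : ∀ x → S ([ left , right ]′ x)
      cases (inj₁ i) = on-left i
      cases (inj₂ i) = on-right i

    left-injective : Injective _≡_ _≡_ left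
    left-injective {i} {j} eq = inj₁-injective (trans (sym (side-left i)) (trans (cong side eq) (side-left j)))

    right-injective : Injective _≡_ _≡_ right
    right-injective {i} {j} eq = inj₂-injective (trans (sym (side-right i)) (trans (cong side eq) (side-right j)))

    left≢right : ∀ i j → left i ≢ right j
    left≢right i j eq = inj₁≢inj₂ (trans (sym (side-left i)) (trans (cong side eq) (side-right j)))
      where
      inj₁≢inj₂ : ∀ {x y : Fin d} → inj₁ x ≢ inj₂ y
      inj₁≢inj₂ ()

  left-first : ∀ {N d} {R : Fin (suc N) → Fin (suc N) → Set} (P : Pairing (suc d) R) → Pairing.left P zero ≡ zero
  left-first P = toℕ-injective (Pairing.left-zero P zero refl)

module CayleyConstruction where

  open import Data.Fin.Base using (Fin; zero; suc; _↑ˡ_; _↑ʳ_)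
  open import Data.Fin.Permutation using (_⟨$⟩ʳ_)
  open import Data.Integer.Base using (ℤ; +_; _+_; _*_; _-_; -_)
  import Data.Integer.Properties as ℤ
  open import Data.Integer.Tactic.RingSolver using (solve-∀)
  import Data.Rational as ℚ
  import Data.Rational.Properties as ℚ
  open import Data.Vec.Functional using (_++_; _∷_; [])
  open import Data.Vec.Functional.Properties using (lookup-++ˡ; lookup-++ʳ)
  open import Defs
  open IntegersInRationals
  open OrderedRationals using (*-cancelˡ-≡)
  open Matching
  open FiniteSums
  open Sumℤ
  open LatticePoints
  open UnitVectors
  open AffineFrames
  open CyclicQuotients
  open AffineMaps
  open PairedIndices
  open ≡-Reasoning

  module _ {e m : ℕ} (v : Fin (suc m) → Pt m) (indep : AffIndep v) (Q : CyclicQuotient v) where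
    open CyclicQuotient Q

    private
      d : ℕ
      d = suc e

    module Construction (P : Pairing d (λ i j → ∃ λ s → a i + a j ≡ n * s)) where
      open Pairing P

      private
        slope : Fin d → ℤ
        slope i = proj₁ (related i)

        n*slope : ∀ i → a (left i) + a (right i) ≡ n * slope i
        n*slope i = proj₂ (related i)

        slope-sum : sumℤ slope ≡ + 0
        slope-sum = ℤ.*-cancelˡ-≡ n (sumℤ slope) (+ 0) (begin
          n * sumℤ slope                         ≡⟨ sum-*ˡ n slope ⟩
          sumℤ (λ i → n * slope i)               ≡⟨ sum-cong n*slope ⟨
          sumℤ (λ i → a (left i) + a (right i))  ≡⟨ sum-pairs P a ⟨
          sumℤ a                                 ≡⟨ a-sum ⟩
          + 0                                    ≡⟨ ℤ.*-zeroʳ n ⟨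
          n * + 0                                ∎)

        first second : Fin d → Functional m
        first i = combine (+ 1 ∷ + 1 ∷ slope i ∷ []) (coord (left i) ∷ coord (right i) ∷ height ∷ [])
        second zero    = height
        second (suc i) = coord (left (suc i))

        Φ : Fin (d ℕ.+ d) → Functional m
        Φ = first ++ second

        Φ-first : ∀ i → Φ (i ↑ˡ d) ≡ first i
        Φ-first i = lookup-++ˡ first second i

        Φ-second : ∀ i → Φ (d ↑ʳ i) ≡ second i
        Φ-second i = lookup-++ʳ first second i

        first-value : ∀ i z t → first i ⟨ z , t ⟩ ≡
                      coord (left i) ⟨ z , t ⟩ + coord (right i) ⟨ z , t ⟩ + slope i * (height ⟨ z , t ⟩)
        first-value i z t = trans
          (combine-value (+ 1 ∷ + 1 ∷ slope i ∷ []) (coord (left i) ∷ coord (right i) ∷ height ∷ []) z t)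
          (expand-sum (coord (left i) ⟨ z , t ⟩) (coord (right i) ⟨ z , t ⟩) (slope i) (height ⟨ z , t ⟩))
          where
          expand-sum : ∀ a b s l → + 1 * a + (+ 1 * b + (s * l + + 0)) ≡ a + b + s * l
          expand-sum = solve-∀

        first-sum : ∀ z t → sumℤ (λ i → first i ⟨ z , t ⟩) ≡ t
        first-sum z t = begin
          sumℤ (λ i → first i ⟨ z , t ⟩)
            ≡⟨ sum-cong (λ i → first-value i z t) ⟩
          sumℤ (λ i → coord (left i) ⟨ z , t ⟩ + coord (right i) ⟨ z , t ⟩ + slope i * ℓ)
            ≡⟨ sum-+ (λ i → coord (left i) ⟨ z , t ⟩ + coord (right i) ⟨ z , t ⟩) (λ i → slope i * ℓ) ⟩
          sumℤ (λ i → coord (left i) ⟨ z , t ⟩ + coord (right i) ⟨ z , t ⟩) + sumℤ (λ i → slope i * ℓ)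
            ≡⟨ cong₂ _+_ (sum-pairs P λ i → coord i ⟨ z , t ⟩) (sum-*ʳ ℓ slope) ⟨
          sumℤ (λ i → coord i ⟨ z , t ⟩) + sumℤ slope * ℓ
            ≡⟨ cong₂ (λ u x → u + x * ℓ) (coord-sum z t) slope-sum ⟩
          t + + 0 * ℓ
            ≡⟨ trans (cong (λ u → t + u) (ℤ.*-zeroˡ ℓ)) (ℤ.+-identityʳ t) ⟩
          t ∎
          where
          ℓ : ℤ
          ℓ = height ⟨ z , t ⟩

      φ : AffMap m (d ℕ.+ d)
      φ = record { c = const ∘ Φ ; A = linear ∘ Φ }

      private
        first-component : ∀ z i → applyℤ φ z (i ↑ˡ d) ≡ first i ⟨ z , + 1 ⟩
        first-component z i = trans (applyℤ-component φ z (i ↑ˡ d)) (cong (_⟨ z , + 1 ⟩) (Φ-first i))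

        second-component : ∀ z i → applyℤ φ z (d ↑ʳ i) ≡ second i ⟨ z , + 1 ⟩
        second-component z i = trans (applyℤ-component φ z (d ↑ʳ i)) (cong (_⟨ z , + 1 ⟩) (Φ-second i))

        φ-into-H : (x : QPt m) → InH d (applyℚ φ x)
        φ-into-H x = *-cancelˡ-≡ (ℤ→ℚ>0 D-1) (begin
          D ℚ.* sumℚ (λ (i : Fin d) → applyℚ φ x (i ↑ˡ d))
            ≡⟨ Sumℚ.sum-*ˡ D (λ (i : Fin d) → applyℚ φ x (i ↑ˡ d)) ⟩
          sumℚ (λ (i : Fin d) → D ℚ.* applyℚ φ x (i ↑ˡ d))
            ≡⟨ Sumℚ.sum-cong (λ i → trans (applyℚ-multiple φ (+ suc D-1) multiple≡ (i ↑ˡ d))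
                 (cong (λ f → ℤ→ℚ (f ⟨ multiple , + suc D-1 ⟩)) (Φ-first i))) ⟩
          sumℚ (λ i → ℤ→ℚ (first i ⟨ multiple , + suc D-1 ⟩))
            ≡⟨ ℤ→ℚ-sum (λ i → first i ⟨ multiple , + suc D-1 ⟩) ⟨
          ℤ→ℚ (sumℤ λ i → first i ⟨ multiple , + suc D-1 ⟩)
            ≡⟨ cong ℤ→ℚ (first-sum multiple (+ suc D-1)) ⟩
          D
            ≡⟨ ℚ.*-identityʳ D ⟨
          D ℚ.* ℚ.1ℚ ∎)
          where
          open IntegralMultiple (integralMultiple x)
          D : ℚ.ℚ
          D = ℤ→ℚ (+ suc D-1)

        Φ-injective : ∀ z z′ t → (∀ k → Φ k ⟨ z , t ⟩ ≡ Φ k ⟨ z′ , t ⟩) → z ≋ℤ z′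
        Φ-injective z z′ t Φ≡ s = begin
          z s
            ≡⟨ expand z t s ⟨
          combℤ (λ i → coord i ⟨ z , t ⟩) v s + (height ⟨ z , t ⟩) * Γ s
            ≡⟨ cong₂ _+_ (sum-cong λ i → cong (_* v i s) (coord≡ i)) (cong (_* Γ s) height≡) ⟩
          combℤ (λ i → coord i ⟨ z′ , t ⟩) v s + (height ⟨ z′ , t ⟩) * Γ s
            ≡⟨ expand z′ t s ⟩
          z′ s ∎
          where
          Agree : Functional m → Set
          Agree f = f ⟨ z , t ⟩ ≡ f ⟨ z′ , t ⟩
          height≡ : Agree height
          height≡ = subst Agree (Φ-second zero) (Φ≡ (d ↑ʳ zero))
          left≡ : ∀ i → Agree (coord (left i))
          left≡ zero    = subst (Agree ∘ coord) (sym (left-first P)) (trans (coord-zero z t) (sym (coord-zero z′ t)))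
          left≡ (suc i) = subst Agree (Φ-second (suc i)) (Φ≡ (d ↑ʳ suc i))
          isolate : ∀ a b x → b ≡ a + b + x - a - x
          isolate = solve-∀
          right-value : ∀ i z → coord (right i) ⟨ z , t ⟩ ≡
            first i ⟨ z , t ⟩ - coord (left i) ⟨ z , t ⟩ - slope i * (height ⟨ z , t ⟩)
          right-value i z = trans
            (isolate (coord (left i) ⟨ z , t ⟩) (coord (right i) ⟨ z , t ⟩) (slope i * (height ⟨ z , t ⟩)))
            (cong (λ u → u - coord (left i) ⟨ z , t ⟩ - slope i * (height ⟨ z , t ⟩)) (sym (first-value i z t)))
          right≡ : ∀ i → Agree (coord (right i))
          right≡ i = trans (right-value i z) (trans
            (cong₂ _-_ (cong₂ _-_ (subst Agree (Φ-first i) (Φ≡ (i ↑ˡ d))) (left≡ i)) (cong (slope i *_) height≡))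
            (sym (right-value i z′)))
          coord≡ : ∀ i → Agree (coord i)
          coord≡ = pair-cases P (Agree ∘ coord) left≡ right≡

        φ-injective : (x y : QPt m) → applyℚ φ x ≋ℚ applyℚ φ y → x ≋ℚ y
        φ-injective x y φx≋φy s = *-cancelˡ-≡ (ℤ→ℚ>0 D-1) (begin
          D ℚ.* x s   ≡⟨ Dx≡ s ⟩
          ℤ→ℚ (z s)   ≡⟨ cong ℤ→ℚ (Φ-injective z z′ (+ suc D-1) Φ≡ s) ⟩
          ℤ→ℚ (z′ s)  ≡⟨ Dy≡ s ⟨
          D ℚ.* y s   ∎)
          where
          open IntegralMultiple (integralMultiple (x ++ y))
          D : ℚ.ℚ
          D = ℤ→ℚ (+ suc D-1)
          z z′ : Pt m
          z s  = multiple (s ↑ˡ m)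
          z′ s = multiple (m ↑ʳ s)
          Dx≡ : ∀ s → D ℚ.* x s ≡ ℤ→ℚ (z s)
          Dx≡ s = trans (cong (D ℚ.*_) (sym (lookup-++ˡ x y s))) (multiple≡ (s ↑ˡ m))
          Dy≡ : ∀ s → D ℚ.* y s ≡ ℤ→ℚ (z′ s)
          Dy≡ s = trans (cong (D ℚ.*_) (sym (lookup-++ʳ x y s))) (multiple≡ (m ↑ʳ s))
          Φ≡ : ∀ k → Φ k ⟨ z , + suc D-1 ⟩ ≡ Φ k ⟨ z′ , + suc D-1 ⟩
          Φ≡ k = ℤ→ℚ-injective (begin
            ℤ→ℚ (Φ k ⟨ z , + suc D-1 ⟩)   ≡⟨ applyℚ-multiple φ (+ suc D-1) Dx≡ k ⟨
            D ℚ.* applyℚ φ x k            ≡⟨ cong (D ℚ.*_) (φx≋φy k) ⟩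
            D ℚ.* applyℚ φ y k            ≡⟨ applyℚ-multiple φ (+ suc D-1) Dy≡ k ⟩
            ℤ→ℚ (Φ k ⟨ z′ , + suc D-1 ⟩)  ∎)

        module Preimage (y : Pt (d ℕ.+ d)) (y∈H : InH d (toQ y)) where
          ℓ : ℤ
          ℓ = y (d ↑ʳ zero)

          ξ ξ′ : Fin d → ℤ
          ξ zero    = + 0
          ξ (suc i) = y (d ↑ʳ suc i)
          ξ′ i = y (i ↑ˡ d) - ξ i - slope i * ℓ

          x : Fin (suc m) → ℤ
          x k = [ ξ , ξ′ ]′ (side k)

          x-left : ∀ i → x (left i) ≡ ξ i
          x-left i = cong [ ξ , ξ′ ]′ (side-left i)

          x-right : ∀ i → x (right i) ≡ ξ′ i
          x-right i = cong [ ξ , ξ′ ]′ (side-right i)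

          sum-x : sumℤ x ≡ + 1
          sum-x = begin
            sumℤ x
              ≡⟨ sum-pairs P x ⟩
            sumℤ (λ i → x (left i) + x (right i))
              ≡⟨ sum-cong (λ i → trans (cong₂ _+_ (x-left i) (x-right i)) (cancel (ξ i) (y (i ↑ˡ d)) (slope i * ℓ))) ⟩
            sumℤ (λ (i : Fin d) → y (i ↑ˡ d) - slope i * ℓ)
              ≡⟨ trans (sum-sub (λ (i : Fin d) → y (i ↑ˡ d)) (λ i → slope i * ℓ))
                (cong (λ u → sum-y - u) (sym (sum-*ʳ ℓ slope))) ⟩
            sum-y - sumℤ slope * ℓ
              ≡⟨ cong₂ (λ u s → u - s * ℓ) sum-y≡1 slope-sum ⟩
            + 1 - + 0 * ℓ
              ≡⟨ cong (λ z → + 1 - z) (ℤ.*-zeroˡ ℓ) ⟩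
            + 1 ∎
            where
            sum-y : ℤ
            sum-y = sumℤ (λ (i : Fin d) → y (i ↑ˡ d))
            sum-y≡1 : sum-y ≡ + 1
            sum-y≡1 = ℤ→ℚ-injective (trans (ℤ→ℚ-sum λ (i : Fin d) → y (i ↑ˡ d)) y∈H)
            cancel : ∀ x y s → x + (y - x - s) ≡ y - s
            cancel = solve-∀

          z : Pt m
          z s = combℤ x v s + ℓ * Γ s

          z-coords : (∀ i → coord i ⟨ z , + 1 ⟩ ≡ x i) × height ⟨ z , + 1 ⟩ ≡ ℓ
          z-coords = unique z (+ 1) x ℓ (trans (cong x (sym (left-first P))) (x-left zero)) sum-x (λ _ → refl)

          z-left : ∀ i → coord (left i) ⟨ z , + 1 ⟩ ≡ ξ i
          z-left i = trans (proj₁ z-coords (left i)) (x-left i)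

          image : applyℤ φ z ≋ℤ y
          image = ↑-cases d (λ t → applyℤ φ z t ≡ y t)
            (λ i → trans (first-component z i) (trans (first-value i z (+ 1)) (trans
              (cong₂ _+_ (cong₂ _+_ (z-left i) (trans (proj₁ z-coords (right i)) (x-right i)))
                (cong (slope i *_) (proj₂ z-coords)))
              (restore (ξ i) (y (i ↑ˡ d)) (slope i * ℓ)))))
            (λ { zero    → trans (second-component z zero) (proj₂ z-coords)
               ; (suc i) → trans (second-component z (suc i)) (z-left (suc i)) })
            where
            restore : ∀ x y s → x + (y - x - s) + s ≡ y
            restore = solve-∀

        -- n times the barycentric coordinates of vⱼ.
        barycentric : ∀ j k → n * (coord k ⟨ v j , + 1 ⟩) + (height ⟨ v j , + 1 ⟩) * a k ≡ n * unitVec k j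
        barycentric j = AffIndep⇒comb-injective {p = v} indep (λ k → n * c k + ℓ * a k) (λ k → n * unitVec k j)
          (trans sums (trans (sym (cong (n *_) (sum-unitVec j))) (sum-*ˡ n λ k → unitVec k j)))
          (λ s → trans (combs s) (trans (sym (cong (n *_) (comb-unitVec v j s)))
            (scaled-comb (λ k → unitVec k j) n s)))
          where
          ℓ : ℤ
          ℓ = height ⟨ v j , + 1 ⟩
          c : Fin (suc m) → ℤ
          c k = coord k ⟨ v j , + 1 ⟩
          scaled-comb : ∀ (f : Fin (suc m) → ℤ) x s → x * combℤ f v s ≡ combℤ (λ k → x * f k) v s
          scaled-comb f x s = trans (sum-*ˡ x λ k → f k * v k s) (sum-cong λ k → sym (ℤ.*-assoc x (f k) (v k s)))
          sums : sumℤ (λ k → n * c k + ℓ * a k) ≡ n * + 1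
          sums = begin
            sumℤ (λ k → n * c k + ℓ * a k)               ≡⟨ sum-+ (λ k → n * c k) (λ k → ℓ * a k) ⟩
            sumℤ (λ k → n * c k) + sumℤ (λ k → ℓ * a k)  ≡⟨ cong₂ _+_ (sum-*ˡ n c) (sum-*ˡ ℓ a) ⟨
            n * sumℤ c + ℓ * sumℤ a
              ≡⟨ cong₂ (λ u w → n * u + ℓ * w) (coord-sum (v j) (+ 1)) a-sum ⟩
            n * + 1 + ℓ * + 0
              ≡⟨ trans (cong (λ u → n * + 1 + u) (ℤ.*-zeroʳ ℓ)) (ℤ.+-identityʳ _) ⟩
            n * + 1                                      ∎
          combs : ∀ s → combℤ (λ k → n * c k + ℓ * a k) v s ≡ n * v j s
          combs s = begin
            combℤ (λ k → n * c k + ℓ * a k) v s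
              ≡⟨ trans (sum-cong λ k → ℤ.*-distribʳ-+ (v k s) (n * c k) (ℓ * a k))
                   (sum-+ (λ k → n * c k * v k s) (λ k → ℓ * a k * v k s)) ⟩
            combℤ (λ k → n * c k) v s + combℤ (λ k → ℓ * a k) v s
              ≡⟨ cong₂ _+_ (scaled-comb c n s) (scaled-comb a ℓ s) ⟨
            n * combℤ c v s + ℓ * combℤ a v s            ≡⟨ cong (λ u → n * combℤ c v s + ℓ * u) (nΓ s) ⟨
            n * combℤ c v s + ℓ * (n * Γ s)              ≡⟨ factor n (combℤ c v s) ℓ (Γ s) ⟩
            n * (combℤ c v s + ℓ * Γ s)                  ≡⟨ cong (n *_) (expand (v j) (+ 1) s) ⟩
            n * v j s                                    ∎
            where
            factor : ∀ n q l g → n * q + l * (n * g) ≡ n * (q + l * g)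
            factor = solve-∀

        first-vertex : ∀ i j → first i ⟨ v j , + 1 ⟩ ≡ unitVec (left i) j + unitVec (right i) j
        first-vertex i j = ℤ.*-cancelˡ-≡ n _ _ (begin
          n * (first i ⟨ v j , + 1 ⟩)                     ≡⟨ cong (n *_) (first-value i (v j) (+ 1)) ⟩
          n * (c + c′ + slope i * ℓ)                      ≡⟨ distribute n c c′ (slope i) ℓ ⟩
          n * c + n * c′ + n * slope i * ℓ                ≡⟨ cong (λ x → n * c + n * c′ + x * ℓ) (n*slope i) ⟨
          n * c + n * c′ + (a (left i) + a (right i)) * ℓ ≡⟨ regroup (n * c) (n * c′) (a (left i)) (a (right i)) ℓ ⟩
          n * c + ℓ * a (left i) + (n * c′ + ℓ * a (right i))
            ≡⟨ cong₂ _+_ (barycentric j (left i)) (barycentric j (right i)) ⟩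
          n * unitVec (left i) j + n * unitVec (right i) j
            ≡⟨ ℤ.*-distribˡ-+ n (unitVec (left i) j) (unitVec (right i) j) ⟨
          n * (unitVec (left i) j + unitVec (right i) j)  ∎)
          where
          ℓ c c′ : ℤ
          ℓ  = height ⟨ v j , + 1 ⟩
          c  = coord (left i) ⟨ v j , + 1 ⟩
          c′ = coord (right i) ⟨ v j , + 1 ⟩
          distribute : ∀ n a b s l → n * (a + b + s * l) ≡ n * a + n * b + n * s * l
          distribute = solve-∀
          regroup : ∀ x y a b l → x + y + (a + b) * l ≡ x + l * a + (y + l * b)
          regroup = solve-∀

        first-left : ∀ j i → applyℤ φ (v (left j)) (i ↑ˡ d) ≡ unitVec j i
        first-left j i = begin
          applyℤ φ (v (left j)) (i ↑ˡ d)  ≡⟨ trans (first-component (v (left j)) i) (first-vertex i (left j)) ⟩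
          unitVec (left i) (left j) + unitVec (right i) (left j) ≡⟨ cong₂ _+_
            (unitVec-cong (left i) (left j) j i (sym ∘ left-injective P) (cong left ∘ sym))
              (unitVec-other (left≢right P j i ∘ sym)) ⟩
          unitVec j i + + 0               ≡⟨ ℤ.+-identityʳ (unitVec j i) ⟩
          unitVec j i                     ∎

        first-right : ∀ j i → applyℤ φ (v (right j)) (i ↑ˡ d) ≡ unitVec j i
        first-right j i = begin
          applyℤ φ (v (right j)) (i ↑ˡ d)  ≡⟨ trans (first-component (v (right j)) i) (first-vertex i (right j)) ⟩
          unitVec (left i) (right j) + unitVec (right i) (right j) ≡⟨ cong₂ _+_ (unitVec-other (left≢right P i j))
            (unitVec-cong (right i) (right j) j i (sym ∘ right-injective P) (cong right ∘ sym)) ⟩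
          + 0 + unitVec j i                ≡⟨ ℤ.+-identityˡ (unitVec j i) ⟩
          unitVec j i                      ∎

      start end : Fin d → Pt d
      start i t = applyℤ φ (v (left i)) (d ↑ʳ t)
      end i t   = applyℤ φ (v (right i)) (d ↑ʳ t)

      private
        image-of-vertex : ∀ i k (p : Pt d) → (∀ j → applyℤ φ (v k) (j ↑ˡ d) ≡ unitVec i j) →
          (∀ j → applyℤ φ (v k) (d ↑ʳ j) ≡ p j) →
          (unitVec i ++ p) ≋ℤ applyℤ φ (v k)
        image-of-vertex i k p on-first on-second = ↑-cases d (λ t → (unitVec i ++ p) t ≡ applyℤ φ (v k) t)
          (λ j → trans (lookup-++ˡ (unitVec i) p j) (sym (on-first j)))
          (λ j → trans (lookup-++ʳ (unitVec i) p j) (sym (on-second j)))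

        vertices : ∀ k → cayleyVerts start end k ≋ℤ applyℤ φ (v (arrangement P ⟨$⟩ʳ k))
        vertices = ↑-cases d (λ k → cayleyVerts start end k ≋ℤ applyℤ φ (v (arrangement P ⟨$⟩ʳ k)))
          (λ i t → trans (cong (λ p → p t) (lookup-++ˡ (λ i → unitVec i ++ start i) (λ i → unitVec i ++ end i) i))
            (trans (image-of-vertex i (left i) (start i) (first-left i) (λ _ → refl) t)
              (cong (λ k → applyℤ φ (v k) t) (sym (arrangement-left P i)))))
          (λ i t → trans (cong (λ p → p t) (lookup-++ʳ (λ i → unitVec i ++ start i) (λ i → unitVec i ++ end i) i))
            (trans (image-of-vertex i (right i) (end i) (first-right i) (λ _ → refl) t)
              (cong (λ k → applyℤ φ (v k) t) (sym (arrangement-right P i)))))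

        start≢end : ∀ i → ¬ start i ≋ℤ end i
        start≢end i start≋end = AffIndep⇒distinct {p = v} indep (left≢right P i i) λ s → ℤ→ℚ-injective
          (φ-injective (toQ (v (left i))) (toQ (v (right i))) (λ t → trans (applyℚ-toQ φ (v (left i)) t)
            (trans (cong ℤ→ℚ (φv≡ t)) (sym (applyℚ-toQ φ (v (right i)) t)))) s)
          where
          φv≡ : applyℤ φ (v (left i)) ≋ℤ applyℤ φ (v (right i))
          φv≡ = ↑-cases d _ (λ j → trans (first-left i j) (sym (first-right i j))) start≋end

      cayleyOfSegments : IsCayleyOfSegments d v
      cayleyOfSegments = start , end , (λ i → AffIndep-seg (start≢end i)) , φ ,
        (φ-into-H , φ-injective , λ y y∈H → Preimage.z y y∈H , Preimage.image y y∈H) ,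
        mapsOnto-permuted φ v (cayleyVerts start end) (arrangement P) vertices

module InteriorMultiples where

  open import Data.Fin.Base using (Fin; zero; suc; punchIn; _↑ˡ_; _↑ʳ_)
  open import Data.Fin.Properties as Fin using (any?)
  open import Data.Integer.Base as ℤ using (ℤ; +_)
  import Data.Integer.Properties as ℤ
  open import Data.Rational
  open import Data.Rational.Properties
  open import Data.Vec.Functional using (_++_)
  open import Data.Vec.Functional.Properties using (lookup-++ˡ; lookup-++ʳ)
  open import Defs
  open IntegersInRationals
  open OrderedRationals using (≤-slack; +≥0; *≥0; *>0; 0<1; 0≤1)
  open FiniteSums
  open Sumℚ
  open LatticePoints
  open UnitVectors
  open AffineFrames using (_⟨_,_⟩)
  open AffineMaps
  open ≡-Reasoning

  sum≥0 : ∀ {n} (f : Fin n → ℚ) → (∀ i → 0ℚ ≤ f i) → 0ℚ ≤ sumℚ f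
  sum≥0 {zero}  f f≥0 = ≤-refl
  sum≥0 {suc n} f f≥0 = +≥0 (f≥0 zero) (sum≥0 (f ∘ suc) (f≥0 ∘ suc))

  sum>0 : ∀ {n} (f : Fin n → ℚ) → (∀ i → 0ℚ ≤ f i) → ∀ j → 0ℚ < f j → 0ℚ < sumℚ f
  sum>0 {suc n} f f≥0 j 0<fⱼ = <-≤-trans 0<fⱼ
    (≤-slack (sumℚ (f ∘ punchIn j)) (sum≥0 (f ∘ punchIn j) (f≥0 ∘ punchIn j)) (sym (sum-remove-at j f)))

  weighted-sum>0 : ∀ {n} (g ρ μ : Fin n → ℚ) → (∀ i → 0ℚ ≤ g i) → sumℚ (λ i → ρ i * g i) ≡ 1ℚ → (∀ i → 0ℚ < μ i) →
                   0ℚ < sumℚ (λ i → μ i * g i)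
  weighted-sum>0 g ρ μ g≥0 ρg≡1 μ>0 with any? (λ i → 0ℚ <? g i)
  ... | yes (j , 0<gⱼ) = sum>0 (λ i → μ i * g i) (λ i → *≥0 (<⇒≤ (μ>0 i)) (g≥0 i)) j (*>0 (μ>0 j) 0<gⱼ)
  ... | no  g≯0        = ⊥-elim (<-irrefl (trans (sym (sum-zero λ i →
    trans (cong (ρ i *_) (≤-antisym (≮⇒≥ λ 0<gᵢ → g≯0 (i , 0<gᵢ)) (g≥0 i))) (*-zeroʳ (ρ i)))) ρg≡1) 0<1)

  unitVec≥0 : ∀ {r} (i t : Fin r) → 0ℚ ≤ ℤ→ℚ (unitVec i t)
  unitVec≥0 i t with i Fin.≟ t
  ... | yes _ = 0≤1
  ... | no _  = ≤-refl

  vertex-InConv : ∀ {N M} (p : Fin N → Pt M) j → InConv (toQ ∘ p) (toQ (p j))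
  vertex-InConv p j = (λ i → ℤ→ℚ (unitVec i j)) , (λ i → unitVec≥0 i j) ,
    trans (sym (ℤ→ℚ-sum λ i → unitVec i j)) (cong ℤ→ℚ (sum-unitVec j)) ,
    λ t → trans (sym (ℤ→ℚ-dot (λ i → unitVec i j) (λ i → p i t))) (cong ℤ→ℚ (comb-unitVec p j t))

  module _ {m d} (v : Fin (suc m) → Pt m) (a b : Fin d → Pt d) (φ : AffMap m (d ℕ.+ d))
    (iso : IsLatticeIsoOntoH m d d φ)
    (maps : MapsOnto φ v (cayleyVerts a b)) where

    private
      w : Fin (d ℕ.+ d) → Pt (d ℕ.+ d)
      w = cayleyVerts a b

      w-left : ∀ i j → w (j ↑ˡ d) (i ↑ˡ d) ≡ unitVec j i
      w-left i j = trans (cong (λ p → p (i ↑ˡ d)) (lookup-++ˡ (λ i → unitVec i ++ a i) (λ i → unitVec i ++ b i) j))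
        (lookup-++ˡ (unitVec j) (a j) i)

      w-right : ∀ i j → w (d ↑ʳ j) (i ↑ˡ d) ≡ unitVec j i
      w-right i j = trans (cong (λ p → p (i ↑ˡ d)) (lookup-++ʳ (λ i → unitVec i ++ a i) (λ i → unitVec i ++ b i) j))
        (lookup-++ˡ (unitVec j) (b j) i)

      w≥0 : ∀ i k → 0ℚ ≤ ℤ→ℚ (w k (i ↑ˡ d))
      w≥0 i = ↑-cases d (λ k → 0ℚ ≤ ℤ→ℚ (w k (i ↑ˡ d)))
        (λ j → subst (λ z → 0ℚ ≤ ℤ→ℚ z) (sym (w-left i j)) (unitVec≥0 j i))
        (λ j → subst (λ z → 0ℚ ≤ ℤ→ℚ z) (sym (w-right i j)) (unitVec≥0 j i))

      level : Fin d → Fin (suc m) → ℚ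
      level i j = applyℚ φ (toQ (v j)) (i ↑ˡ d)

      level≥0 : ∀ i j → 0ℚ ≤ level i j
      level≥0 i j with proj₂ (maps (applyℚ φ (toQ (v j)))) (toQ (v j)) (vertex-InConv v j) (λ _ → refl)
      ... | μ , μ≥0 , _ , comb-μ = subst (0ℚ ≤_) (comb-μ (i ↑ˡ d))
        (sum≥0 (λ k → μ k * ℤ→ℚ (w k (i ↑ˡ d))) (λ k → *≥0 (μ≥0 k) (w≥0 i k)))

      level-attains-1 : ∀ i → ∃ λ (ρ : Fin (suc m) → ℚ) → sumℚ (λ j → ρ j * level i j) ≡ 1ℚ
      level-attains-1 i with proj₁ (maps (toQ (w (i ↑ˡ d)))) (vertex-InConv w (i ↑ˡ d))
      ... | x , (ρ , _ , sum-ρ , comb-ρ) , φx≡ = ρ , (begin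
        sumℚ (λ j → ρ j * level i j)           ≡⟨ applyℚ-comb φ ρ (toQ ∘ v) sum-ρ (i ↑ˡ d) ⟨
        applyℚ φ (combℚ ρ (toQ ∘ v)) (i ↑ˡ d)  ≡⟨ applyℚ-cong φ comb-ρ (i ↑ˡ d) ⟩
        applyℚ φ x (i ↑ˡ d)                    ≡⟨ φx≡ (i ↑ˡ d) ⟩
        ℤ→ℚ (w (i ↑ˡ d) (i ↑ˡ d))              ≡⟨ cong ℤ→ℚ (trans (w-left i i) (unitVec-same i)) ⟩
        1ℚ                                     ∎)

    -- Each of the d integral functionals k cᵢ + Aᵢ x is positive on Int(kΔ), and they add up to k.
    interior-multiple⇒d≤k : ∀ k x → 1 ℕ.≤ k → InIntMultiple k v x → d ℕ.≤ k
    interior-multiple⇒d≤k k@(suc k-1) x _ (μ , μ>0 , sum-μ , comb-μ) =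
      ℤ.drop‿+≤+ (subst (+ d ℤ.≤_) sum-value (length≤sum value λ i → ℤ→ℚ>0⇒≥1 (value>0 i)))
      where
      y : QPt m
      y = combℚ μ (toQ ∘ v)
      value : Fin d → ℤ
      value i = component φ (i ↑ˡ d) ⟨ x , + k ⟩
      k*φy≡value : ∀ i → ℕ→ℚ k * applyℚ φ y (i ↑ˡ d) ≡ ℤ→ℚ (value i)
      k*φy≡value i = applyℚ-multiple φ (+ k) comb-μ (i ↑ˡ d)
      value>0 : ∀ i → 0ℚ < ℤ→ℚ (value i)
      value>0 i = subst (0ℚ <_) (k*φy≡value i) (*>0 (ℤ→ℚ>0 k-1)
        (subst (0ℚ <_) (sym (applyℚ-comb φ μ (toQ ∘ v) sum-μ (i ↑ˡ d)))
          (weighted-sum>0 (level i) (proj₁ (level-attains-1 i)) μ (level≥0 i) (proj₂ (level-attains-1 i)) μ>0)))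
      sum-value : sumℤ value ≡ + k
      sum-value = ℤ→ℚ-injective (begin
        ℤ→ℚ (sumℤ value)                                    ≡⟨ ℤ→ℚ-sum value ⟩
        sumℚ (λ i → ℤ→ℚ (value i))                          ≡⟨ sum-cong k*φy≡value ⟨
        sumℚ (λ (i : Fin d) → ℕ→ℚ k * applyℚ φ y (i ↑ˡ d))
          ≡⟨ sum-*ˡ (ℕ→ℚ k) (λ (i : Fin d) → applyℚ φ y (i ↑ˡ d)) ⟨
        ℕ→ℚ k * sumℚ (λ (i : Fin d) → applyℚ φ y (i ↑ˡ d))  ≡⟨ cong (ℕ→ℚ k *_) (proj₁ iso y) ⟩
        ℕ→ℚ k * 1ℚ                                          ≡⟨ *-identityʳ (ℕ→ℚ k) ⟩
        ℕ→ℚ k                                               ∎)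

open import Defs
open import Data.Nat using (_+_)
open import Data.Fin using (Fin; zero; punchIn)
open import Function.Bundles using (_⇔_; mk⇔)
open Matching using (map-pairing)
open UnitPairing using (pairing)
open CyclicQuotients using (CyclicQuotient; cyclicQuotient)
open BalancedResidues using (module Residues)
open CayleyConstruction using (module Construction)
open InteriorMultiples using (interior-multiple⇒d≤k)

theorem1p6 : (e : ℕ) → (v : Fin (suc (suc (e + e))) → Pt (suc (e + e))) →
    AffIndep v →
    ((j : Fin (suc (suc (e + e)))) → IsBasic (λ i → v (punchIn j i))) →
    (NoInteriorPoints e v ⇔ IsCayleyOfSegments (suc e) v)
theorem1p6 e v indep basic = mk⇔ segments no-interior-points
  where
  segments : NoInteriorPoints e v → IsCayleyOfSegments (suc e) v
  segments empty = Construction.cayleyOfSegments v indep Q (map-pairing opposite-residues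
    (pairing modulus (suc e) (cong suc (sym (ℕ.+-suc e e))) residue residue-coprime residue-balanced))
    where
    Q : CyclicQuotient v
    Q = cyclicQuotient v indep (basic zero)
    open Residues e v basic Q empty

  no-interior-points : IsCayleyOfSegments (suc e) v → NoInteriorPoints e v
  no-interior-points (a , b , _ , φ , iso , maps) k 1≤k k≤e x interior =
    ℕ.<⇒≱ (interior-multiple⇒d≤k v a b φ iso maps k x 1≤k interior) k≤e
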